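{- Let $G$ be a connected graph. Then $G$ is claw-free and equimatchable if and only if one of the following holds: (i) $G$ is isomorphic to $C_4$; (ii) $G$ is isomorphic to $K_{2p}$ for some $p\ge 1$; (iii) $G$ is odd and $\alpha(G)\le 2$; (iv) $G\in\mathcal{G}_1$; (v) $G\in\mathcal{G}_{21}\cup\mathcal{G}_{22}\cup\mathcal{G}_{23}$ or $G$ is isomorphic to $C_7$; (vi) $G\in\mathcal{G}_3$.
   Context: All graphs are finite and simple. A graph is equimatchable if all its maximal matchings have the same cardinality; it is claw-free if it has no induced subgraph isomorphic to $K_{1,3}$. $G$ is odd (even) if $|V(G)|$ is odd (even). $\alpha(G)$ is the independence number. $K_p,C_p,P_p$ denote the complete graph, cycle and path on $p$ vertices. $N(v)$ is the neighborhood of $v$ and $N_X(v)=N(v)\cap X$. A set $S$ of vertices is independent if its vertices are pairwise non-adjacent. For a connected graph $G$, a cut set is a set $S$ of vertices with $G\setminus S$ disconnected; a 2-cut is a cut set of size 2. A vertex is complete to a vertex set $X$ if it is adjacent to every vertex of $X$. $\mathcal{G}_1$: graphs $G$ having a vertex $v$ such that $G-v$ has exactly two connected components $G_1,G_2$ and for each $i\in\{1,2\}$: $G_i$ is a complete graph on an even number of vertices or is isomorphic to $C_4$; if $G_i$ is a $C_4$ then $N_{V(G_i)}(v)$ consists of exactly two adjacent vertices of $G_i$; and if both $G_1,G_2$ are complete graphs then $v$ has at least one non-neighbor in $G_1$ and at least one non-neighbor in $G_2$. $\mathcal{G}_{21}$: graphs whose vertex set can be partitioned into $V_1,V_2$ such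 that $V_1$ induces $K_{2q+1}$ for some $q\ge1$; $V_2$ induces a 4-cycle $v_1v_2v_3v_4$ (edges $v_1v_2,v_2v_3,v_3v_4,v_4v_1$); $N_{V_1}(v_1)=N_{V_1}(v_2)$; $2\le |N_{V_1}(v_1)|<|V_1|$; and $N_{V_1}(v_3)=N_{V_1}(v_4)=\emptyset$. $\mathcal{G}_{22}$: graphs $G$ having two non-adjacent vertices $s_1,s_2$, $S=\{s_1,s_2\}$, such that $G\setminus S$ has exactly two connected components, $A$ of even order and $B$ of odd order, with $A$ isomorphic to $K_{2p}$ for some $p\ge1$, $B$ isomorphic to $K_{2q+1}$ for some $q\ge 0$, $s_1$ and $s_2$ complete to $B$, $N_A(s_1)\cup N_A(s_2)\subsetneq A$, and $N_A(s_1)\cap N_A(s_2)=\emptyset$. $\mathcal{G}_{23}$: graphs $G$ having two non-adjacent vertices $s_1,s_2$, $S=\{s_1,s_2\}$, such that $G\setminus S$ has exactly two connected components, $A$ of even order and $B$ of odd order, with $A$ isomorphic to $K_2$, $G[S\cup A]$ isomorphic to $P_4$, $B$ isomorphic to $K_{2q+1}$ for some $q\ge1$, and $N_B(s_1)\cup N_B(s_2)=B$. $\mathcal{G}_3$: graphs $G$ having an independent set $S=\{s_1,s_2,s_3\}$ such that $G\setminus S$ has exactly two connected components $A,A'$, each a complete graph on an odd number of at least three vertices, and there exist $a\in A$, $a'\in A'$ with $N(s_1)=A\cup\{a'\}$, $N(s_2)=A'\cup\{a\}$, $N(s_3)=(A\cup A')\setminus\{a,a'\}$. -}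

module Defs where

open import Data.Nat using (ℕ; zero; suc; _+_; _*_; _≤_; _<_; _≡ᵇ_)
open import Data.Fin using (Fin; toℕ; _≟_)
open import Data.Bool using (Bool; true; false; not; _∧_; _∨_; if_then_else_)
open import Data.List using (List; []; _∷_; length; foldr; map; allFin)
open import Data.Nat.ListAction using (sum)
open import Data.List.Membership.Propositional using (_∈_)
open import Data.List.Relation.Unary.All using (All)
open import Data.List.Relation.Unary.Unique.Propositional using (Unique)
open import Data.Product using (Σ; ∃; ∃-syntax; _×_; _,_; proj₁; proj₂)
open import Data.Sum using (_⊎_)
open import Relation.Nullary using (¬_)
open import Relation.Nullary.Decidable using (⌊_⌋)
open import Relation.Binary.PropositionalEquality using (_≡_; _≢_)
open import Function.Bundles using (_↔_; Inverse)
open import Function.Definitions using (Injective)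

Graph : ℕ → Set
Graph n = Fin n → Fin n → Bool

IsSimple : ∀ {n} → Graph n → Set
IsSimple {n} G = (∀ (u v : Fin n) → G u v ≡ G v u) × (∀ (u : Fin n) → G u u ≡ false)

VSet : ℕ → Set
VSet n = Fin n → Bool

full : ∀ {n} → VSet n
full _ = true

singleton : ∀ {n} → Fin n → VSet n
singleton v x = ⌊ x ≟ v ⌋

pair : ∀ {n} → Fin n → Fin n → VSet n
pair a b x = ⌊ x ≟ a ⌋ ∨ ⌊ x ≟ b ⌋

triple : ∀ {n} → Fin n → Fin n → Fin n → VSet n
triple a b c x = ⌊ x ≟ a ⌋ ∨ ⌊ x ≟ b ⌋ ∨ ⌊ x ≟ c ⌋

_∪ˢ_ : ∀ {n} → VSet n → VSet n → VSet n
(A ∪ˢ B) x = A x ∨ B x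

count : ∀ {n} → VSet n → ℕ
count {n} X = sum (map (λ x → if X x then 1 else 0) (allFin n))

Complete : (p : ℕ) → Graph p
Complete p i j = not (toℕ i ≡ᵇ toℕ j)

-- cycle 0 - 1 - ... - (p-1) - 0  (meant for p ≥ 3)
private
  next : (p : ℕ) → Fin p → Fin p → Bool
  next p i j = (suc (toℕ i) ≡ᵇ toℕ j) ∨ ((suc (toℕ i) ≡ᵇ p) ∧ (toℕ j ≡ᵇ 0))

Cycle : (p : ℕ) → Graph p
Cycle p i j = next p i j ∨ next p j i

PathGraph : (p : ℕ) → Graph p
PathGraph p i j = (suc (toℕ i) ≡ᵇ toℕ j) ∨ (suc (toℕ j) ≡ᵇ toℕ i)

Iso : ∀ {n m} → Graph n → Graph m → Set
Iso {n} {m} G H =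
  Σ (Fin n ↔ Fin m) λ f → ∀ u v → G u v ≡ H (Inverse.to f u) (Inverse.to f v)

InducedIso : ∀ {n k} → Graph n → VSet n → Graph k → Set
InducedIso {n} {k} G X H =
  Σ (Fin k → Fin n) λ f →
    Injective _≡_ _≡_ f
    × (∀ i → X (f i) ≡ true)
    × (∀ x → X x ≡ true → ∃[ i ] f i ≡ x)
    × (∀ i j → H i j ≡ G (f i) (f j))

data WalkIn {n} (G : Graph n) (X : VSet n) : Fin n → Fin n → Set where
  here : ∀ {u} → WalkIn G X u u
  step : ∀ {u w v} → G u w ≡ true → X w ≡ true → WalkIn G X w v → WalkIn G X u v

ConnectedIn : ∀ {n} → Graph n → VSet n → Set
ConnectedIn {n} G X =
  (∃[ x ] X x ≡ true) × (∀ u v → X u ≡ true → X v ≡ true → WalkIn G X u v)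

Connected : ∀ {n} → Graph n → Set
Connected G = ConnectedIn G full

TwoComponents : ∀ {n} → Graph n → VSet n → VSet n → VSet n → Set
TwoComponents {n} G S A B =
  (∀ x → (S x ∨ A x ∨ B x) ≡ true)
  × (∀ x → (S x ∧ A x) ≡ false)
  × (∀ x → (S x ∧ B x) ≡ false)
  × (∀ x → (A x ∧ B x) ≡ false)
  × ConnectedIn G A
  × ConnectedIn G B
  × (∀ a b → A a ≡ true → B b ≡ true → G a b ≡ false)

ends : ∀ {n} → List (Fin n × Fin n) → List (Fin n)
ends = foldr (λ e r → proj₁ e ∷ proj₂ e ∷ r) []

IsMatching : ∀ {n} → Graph n → List (Fin n × Fin n) → Set
IsMatching G M = All (λ e → G (proj₁ e) (proj₂ e) ≡ true) M × Unique (ends M)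

IsMaximalMatching : ∀ {n} → Graph n → List (Fin n × Fin n) → Set
IsMaximalMatching G M =
  IsMatching G M × (∀ u v → G u v ≡ true → u ∈ ends M ⊎ v ∈ ends M)

Equimatchable : ∀ {n} → Graph n → Set
Equimatchable G = ∀ M M' → IsMaximalMatching G M → IsMaximalMatching G M'
                          → length M ≡ length M'

IsClaw : ∀ {n} → Graph n → Fin n → Fin n → Fin n → Fin n → Set
IsClaw G c a b d =
  G c a ≡ true × G c b ≡ true × G c d ≡ true
  × a ≢ b × a ≢ d × b ≢ d
  × G a b ≡ false × G a d ≡ false × G b d ≡ false

ClawFree : ∀ {n} → Graph n → Set
ClawFree G = ∀ c a b d → ¬ IsClaw G c a b d

IsIndependent : ∀ {n} → Graph n → List (Fin n) → Set
IsIndependent G S = Unique S × (∀ x y → x ∈ S → y ∈ S → G x y ≡ false)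

IndepNumberAtMost : ∀ {n} → Graph n → ℕ → Set
IndepNumberAtMost G k = ∀ S → IsIndependent G S → length S ≤ k

OddNat : ℕ → Set
OddNat n = ∃[ k ] n ≡ suc (2 * k)

module _ {n : ℕ} (G : Graph n) where

  CompleteEven : VSet n → Set
  CompleteEven X = ∃[ p ] InducedIso G X (Complete (2 * p))

  NbrsTwoAdjacent : Fin n → VSet n → Set
  NbrsTwoAdjacent v X =
    Σ (Fin n) λ a → Σ (Fin n) λ b →
      a ≢ b × X a ≡ true × X b ≡ true × G a b ≡ true
      × (∀ x → X x ≡ true → G v x ≡ true → x ≡ a ⊎ x ≡ b)
      × G v a ≡ true × G v b ≡ true

  HasNonNbr : Fin n → VSet n → Set
  HasNonNbr v X = ∃[ x ] (X x ≡ true × G v x ≡ false)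

  G1Part : Fin n → VSet n → Set
  G1Part v X = CompleteEven X ⊎ (InducedIso G X (Cycle 4) × NbrsTwoAdjacent v X)

  InG1 : Set
  InG1 = Σ (Fin n) λ v → Σ (VSet n) λ G₁ → Σ (VSet n) λ G₂ →
    TwoComponents G (singleton v) G₁ G₂
    × G1Part v G₁ × G1Part v G₂
    × (CompleteEven G₁ → CompleteEven G₂ → HasNonNbr v G₁ × HasNonNbr v G₂)

  InG21 : Set
  InG21 = Σ (VSet n) λ V₁ → Σ (VSet n) λ V₂ →
    (∀ x → V₁ x ≡ not (V₂ x))
    × (∃[ q ] (1 ≤ q × InducedIso G V₁ (Complete (suc (2 * q)))))
    × (Σ (InducedIso G V₂ (Cycle 4)) λ iso →
        let f = proj₁ iso
            v₁ = f (Data.Fin.zero)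
            v₂ = f (Data.Fin.suc Data.Fin.zero)
            v₃ = f (Data.Fin.suc (Data.Fin.suc Data.Fin.zero))
            v₄ = f (Data.Fin.suc (Data.Fin.suc (Data.Fin.suc Data.Fin.zero)))
            N₁ = λ x → V₁ x ∧ G v₁ x
        in (∀ x → V₁ x ≡ true → G v₁ x ≡ G v₂ x)
           × 2 ≤ count N₁ × count N₁ < count V₁
           × (∀ x → V₁ x ≡ true → G v₃ x ≡ false)
           × (∀ x → V₁ x ≡ true → G v₄ x ≡ false))

  InG22 : Set
  InG22 = Σ (Fin n) λ s₁ → Σ (Fin n) λ s₂ → Σ (VSet n) λ A → Σ (VSet n) λ B →
    s₁ ≢ s₂ × G s₁ s₂ ≡ false
    × TwoComponents G (pair s₁ s₂) A B
    × (∃[ p ] (1 ≤ p × InducedIso G A (Complete (2 * p))))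
    × (∃[ q ] InducedIso G B (Complete (suc (2 * q))))
    × (∀ x → B x ≡ true → G s₁ x ≡ true × G s₂ x ≡ true)
    × (∃[ x ] (A x ≡ true × G s₁ x ≡ false × G s₂ x ≡ false))
    × (∀ x → A x ≡ true → (G s₁ x ∧ G s₂ x) ≡ false)

  InG23 : Set
  InG23 = Σ (Fin n) λ s₁ → Σ (Fin n) λ s₂ → Σ (VSet n) λ A → Σ (VSet n) λ B →
    s₁ ≢ s₂ × G s₁ s₂ ≡ false
    × TwoComponents G (pair s₁ s₂) A B
    × InducedIso G A (Complete 2)
    × InducedIso G (pair s₁ s₂ ∪ˢ A) (PathGraph 4)
    × (∃[ q ] (1 ≤ q × InducedIso G B (Complete (suc (2 * q)))))
    × (∀ x → B x ≡ true → (G s₁ x ∨ G s₂ x) ≡ true)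

  InG3 : Set
  InG3 = Σ (Fin n) λ s₁ → Σ (Fin n) λ s₂ → Σ (Fin n) λ s₃ →
         Σ (VSet n) λ A → Σ (VSet n) λ A' →
    s₁ ≢ s₂ × s₁ ≢ s₃ × s₂ ≢ s₃
    × G s₁ s₂ ≡ false × G s₁ s₃ ≡ false × G s₂ s₃ ≡ false
    × TwoComponents G (triple s₁ s₂ s₃) A A'
    × (∃[ q ] (1 ≤ q × InducedIso G A (Complete (suc (2 * q)))))
    × (∃[ r ] (1 ≤ r × InducedIso G A' (Complete (suc (2 * r)))))
    × (Σ (Fin n) λ a → Σ (Fin n) λ a' →
        A a ≡ true × A' a' ≡ true
        × (∀ x → G s₁ x ≡ (A x ∨ ⌊ x ≟ a' ⌋))
        × (∀ x → G s₂ x ≡ (A' x ∨ ⌊ x ≟ a ⌋))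
        × (∀ x → G s₃ x ≡ ((A x ∨ A' x) ∧ not (⌊ x ≟ a ⌋ ∨ ⌊ x ≟ a' ⌋))))

{-# OPTIONS --safe #-}

-- By an augmenting-walk argument, in which claw-freeness supplies the exchange step,
-- a connected claw-free graph is equimatchable only if no matching leaves two or more
-- vertices that are pairwise non-adjacent uncovered.  For even n this forces C₄ or K₂ₚ.
-- For odd n with α(G) ≥ 3, removing matching edges leaves five vertices inducing
-- 2K₂ + K₁, C₄ + K₁, K₂ + P₃ or P₅, and the other vertices are still perfectly matched.
-- Adjoining one or two further matching edges, the claws and the matchings leaving an
-- independent pair uncovered decide, by a finite refutation, how these edges attach; this
-- gives 𝒢₁ for 2K₂ + K₁, one of 𝒢₁, 𝒢₂₁, 𝒢₃ for C₄ + K₁, and 𝒢₂₂, 𝒢₂₃ or C₇ for P₅.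
-- Conversely, apart from C₄ and K₂ₚ, n is odd in each class, so it suffices that no matching
-- leaves an independent triple uncovered; parities of closed vertex sets exclude this.

module Submission where

open import Defs
open import Data.Bool using (Bool; true; false; not; _∧_; _∨_; if_then_else_; T; T?)
open import Data.Bool.ListAction using (any; all)
import Data.Bool.Properties as Bool
open import Data.Empty using (⊥; ⊥-elim)
open import Data.Fin using (Fin; zero; suc; toℕ; _≟_)
open import Data.Fin.Permutation using (↔⇒≡)
import Data.Fin.Properties as Fin
open import Data.List using (List; []; _∷_; _++_; length; map; allFin; upTo; filterᵇ; concatMap)
import Data.List as List
import Data.List.Properties as List
open import Data.List.Membership.Propositional using (_∈_; _∉_; find; lose)
open import Data.List.Membership.Propositional.Properties using (∈-∃++; ∈-++⁺ˡ; ∈-++⁺ʳ; ∈-++⁻; ∈-allFin; ∈-filter⁺; ∈-filter⁻; ∈-concatMap⁺; ∈-map⁺)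
open import Data.List.Relation.Binary.Permutation.Propositional using (_↭_; ↭-refl; ↭-sym; ↭-trans; prep; swap; ↭-reflexive; ↭⇒↭ₛ)
open import Data.List.Relation.Binary.Permutation.Propositional.Properties using (∈-resp-↭; All-resp-↭; drop-∷; map⁺; shift; ++⁺; ++⁺ˡ; ++⁺ʳ; ++-comm; ↭-length)
open import Data.List.Relation.Binary.Pointwise using (Pointwise; []; _∷_)
open import Data.List.Relation.Unary.All as All using (All; []; _∷_)
import Data.List.Relation.Unary.All.Properties as All
import Data.List.Relation.Unary.Any.Properties as Any
open import Data.List.Relation.Unary.AllPairs as AllPairs using (AllPairs; []; _∷_)
open import Data.List.Relation.Unary.Any as Any using (Any; here; there)
open import Data.List.Relation.Unary.Unique.Propositional using (Unique)
import Data.List.Relation.Unary.Unique.Propositional.Properties as Unique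
open import Data.List.Relation.Unary.Unique.Propositional.Properties using (allFin⁺; filter⁺; Unique[x∷xs]⇒x∉xs)
open import Data.Maybe as Maybe using (Maybe; just; nothing)
open import Data.Nat using (ℕ; zero; suc; _+_; _*_; _≤_; _<_; z≤n; s≤s; s≤s⁻¹; _≡ᵇ_; _<ᵇ_; _≤ᵇ_)
open import Data.Nat.ListAction using (sum)
open import Data.Nat.ListAction.Properties using (sum-++; sum-↭)
open import Data.Nat.Induction using (<-rec)
import Data.Nat.Properties as ℕ
open import Data.Product using (∃-syntax; _×_; _,_; proj₁; proj₂)
open import Data.Sum using (_⊎_; inj₁; inj₂; [_,_]′)
open import Data.Unit using (⊤; tt)
open import Function using (_∘_; id; case_of_)
open import Function.Bundles using (_⇔_; mk⇔; Inverse; mk↔ₛ′)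
open import Relation.Binary.Definitions using (tri<; tri≈; tri>)
open import Relation.Binary.PropositionalEquality using (_≡_; _≢_; refl; sym; trans; cong; cong₂; subst; setoid)
open import Relation.Nullary.Decidable using (toWitness; ⌊_⌋)
open import Relation.Nullary using (¬_; yes; no; Dec; contradiction; _×-dec_; _⊎-dec_; ¬?)
import Relation.Nullary.Decidable as Dec
import Data.List.Relation.Binary.Permutation.Setoid.Properties as ↭ₛ

-- What makes finite refutations possible in a graph of unbounded size is `Rest xs`: once the
-- vertices outside `xs` are perfectly matched, every matching inside `xs` extends to the whole
-- graph, so the bound on uncovered independent vertices becomes a condition on the adjacencies
-- within `xs` alone. An arbitrary outside vertex joins such a list together with its partner, and a
-- relation between two or three outside vertices costs at most as many partner edges; lists of at
-- most thirteen vertices suffice. The recurring obstacle is that vertices brought in may be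
-- partners of one another, so a single relation often needs one table for each way in which their
-- matching edges can coincide. The order of the patterns matters as well: once 2K₂ + K₁, and then
-- C₄ + K₁, is known not to occur, its absence is itself a constraint, because a matching inside
-- `xs` that leaves five vertices in that pattern is forbidden. All case splits are on decidable
-- properties of the given graph, including the existence of a pattern with perfectly matched
-- complement, so the argument stays constructive.

∧-true : ∀ {a b} → a ∧ b ≡ true → a ≡ true × b ≡ true
∧-true {true} {true} _ = refl , refl

eqᵇ : Bool → Bool → Bool
eqᵇ a b = if a then b else not b

eqᵇ-sound : ∀ a b → eqᵇ a b ≡ true → a ≡ b
eqᵇ-sound true  true  _ = refl
eqᵇ-sound false false _ = refl

≡ᵇ-sound : ∀ {m k} → (m ≡ᵇ k) ≡ true → m ≡ k
≡ᵇ-sound {m} {k} e = ℕ.≡ᵇ⇒≡ m k (subst T (sym e) _)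

true≢false : ∀ {b} → b ≡ true → b ≡ false → ⊥
true≢false refl ()

Unique-resp-↭ : ∀ {A : Set} {xs ys : List A} → xs ↭ ys → Unique xs → Unique ys
Unique-resp-↭ {A} p = ↭ₛ.Unique-resp-↭ (setoid A) (↭⇒↭ₛ p)

Unique-++ˡ : ∀ {A : Set} (xs : List A) {ys} → Unique (xs ++ ys) → Unique xs
Unique-++ˡ []       _         = []
Unique-++ˡ (x ∷ xs) (px ∷ u) = All.++⁻ˡ xs px ∷ Unique-++ˡ xs u

Unique-apart : ∀ {A : Set} (xs : List A) {ys} → Unique (xs ++ ys) → ∀ {x} → x ∈ xs → x ∉ ys
Unique-apart (x ∷ xs) (px ∷ u) (here refl) x∈ys = All.lookup (All.++⁻ʳ xs px) x∈ys refl
Unique-apart (x ∷ xs) (px ∷ u) (there x∈)  x∈ys = Unique-apart xs u x∈ x∈ys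

∈⇒↭ : ∀ {A : Set} {x : A} {xs} → x ∈ xs → ∃[ ys ] xs ↭ x ∷ ys
∈⇒↭ {x = x} x∈ with ∈-∃++ x∈
... | as , bs , refl = as ++ bs , shift x as bs

module _ {A : Set} where

  -- The flattening `ends`, but over any type: matchings are also written over `ℕ`, as pairs of
  -- positions in a list of vertices.
  pairs : List (A × A) → List A
  pairs []            = []
  pairs ((x , y) ∷ m) = x ∷ y ∷ pairs m

  pairs-resp-↭ : ∀ {m m'} → m ↭ m' → pairs m ↭ pairs m'
  pairs-resp-↭ _↭_.refl          = ↭-refl
  pairs-resp-↭ (prep e p)        = prep _ (prep _ (pairs-resp-↭ p))
  pairs-resp-↭ (swap (a , b) (c , d) p) =
    ↭-trans (shift c (a ∷ b ∷ []) _) (prep c (↭-trans (shift d (a ∷ b ∷ []) _)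
      (prep d (prep a (prep b (pairs-resp-↭ p))))))
  pairs-resp-↭ (_↭_.trans p q)   = ↭-trans (pairs-resp-↭ p) (pairs-resp-↭ q)

  pairs-++ : ∀ m m' → pairs (m ++ m') ≡ pairs m ++ pairs m'
  pairs-++ []            m' = refl
  pairs-++ ((x , y) ∷ m) m' = cong (λ z → x ∷ y ∷ z) (pairs-++ m m')

pairs≡ends : ∀ {n} (m : List (Fin n × Fin n)) → pairs m ≡ ends m
pairs≡ends []            = refl
pairs≡ends ((x , y) ∷ m) = cong (λ z → x ∷ y ∷ z) (pairs≡ends m)

-- A small refutation procedure: a list of forbidden conjunctions of literals
-- (i , j , b), read as "the adjacency of the i-th and j-th vertex is b", is
-- shown to exclude every graph by unit propagation and case splitting.

record Lit : Set where
  constructor lit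
  field
    left right : ℕ
    value : Bool

infix 20 _~_ _≁_

_~_ _≁_ : ℕ → ℕ → Lit
i ~ j = lit i j true
i ≁ j = lit i j false

Conj : Set
Conj = List Lit

data Status : Set where
  conflict stuck : Status
  unit guess   : Lit → Status

status : List Conj → Status
status []             = stuck
status ([] ∷ _)       = conflict
status ((l ∷ []) ∷ _) = unit l
status ((l ∷ _ ∷ _) ∷ cs) with status cs
... | conflict   = conflict
... | unit l'  = unit l'
... | stuck    = guess l
... | guess _  = guess l

-- `nothing` marks a conjunction that the literal falsifies; it forbids nothing any more and is
-- dropped by `assign`.
without : Lit → Conj → Maybe Conj
without l [] = just []
without l@(lit i j b) (l'@(lit i' j' b') ∷ c) =
  if (i ≡ᵇ i') ∧ (j ≡ᵇ j')
  then (if eqᵇ b b' then without l c else nothing)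
  else Maybe.map (l' ∷_) (without l c)

assign : Lit → List Conj → List Conj
assign l []       = []
assign l (c ∷ cs) with without l c
... | just c' = c' ∷ assign l cs
... | nothing = assign l cs

negate : Lit → Lit
negate (lit i j b) = lit i j (not b)

-- Only the answer `true` carries information. Being stuck and running out of fuel both give
-- `false`, so neither the fuel nor the choice of split can harm soundness.
refute : ℕ → List Conj → Bool
refute zero       _  = false
refute (suc fuel) cs with status cs
... | conflict  = true
... | stuck   = false
... | unit l  = refute fuel (assign (negate l) cs)
... | guess l = refute fuel (assign l cs) ∧ refute fuel (assign (negate l) cs)

module _ (ρ : ℕ → ℕ → Bool) where

  True : Lit → Set
  True (lit i j b) = ρ i j ≡ b

  Sat : Conj → Set
  Sat []      = ⊤
  Sat (l ∷ c) = True l × Sat c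

  Sat? : ∀ c → Dec (Sat c)
  Sat? []              = yes tt
  Sat? (lit i j b ∷ c) = (ρ i j Bool.≟ b) ×-dec Sat? c

  -- Out-of-range positions give the trivial type.
  NthTrue : Conj → ℕ → Set
  NthTrue []      _       = ⊤
  NthTrue (l ∷ _) zero    = True l
  NthTrue (_ ∷ c) (suc i) = NthTrue c i

  Sat-nth : ∀ c → Sat c → ∀ i → NthTrue c i
  Sat-nth []      _       _       = tt
  Sat-nth (l ∷ c) (t , s) zero    = t
  Sat-nth (l ∷ c) (t , s) (suc i) = Sat-nth c s i

  Sat-++⁻ : ∀ c {c'} → Sat (c ++ c') → Sat c × Sat c'
  Sat-++⁻ []      s       = tt , s
  Sat-++⁻ (l ∷ c) (t , s) with Sat-++⁻ c s
  ... | s₁ , s₂ = (t , s₁) , s₂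

  Sat-++⁺ : ∀ c {c'} → Sat c → Sat c' → Sat (c ++ c')
  Sat-++⁺ []      _       s' = s'
  Sat-++⁺ (l ∷ c) (t , s) s' = t , Sat-++⁺ c s s'

  without-sound : ∀ l c {c'} → True l → without l c ≡ just c' → Sat c' → Sat c
  without-sound l [] t refl s = s
  without-sound l@(lit i j b) (lit i' j' b' ∷ c) t eq s
    with (i ≡ᵇ i') ∧ (j ≡ᵇ j') in vars
  ... | true with eqᵇ b b' in vals
  ...   | true with ∧-true {i ≡ᵇ i'} vars
  ...     | e , e' with ≡ᵇ-sound {i} e | ≡ᵇ-sound {j} e' | eqᵇ-sound b b' vals
  ...       | refl | refl | refl = t , without-sound _ c t eq s
  without-sound l (_ ∷ c) t eq s | false with without l c in eq'
  without-sound l (_ ∷ c) t refl (p , s) | false | just _ = p , without-sound l c t eq' s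

  Excluded : List Conj → Set
  Excluded = All (λ c → ¬ Sat c)

  assign-sound : ∀ l cs → True l → Excluded cs → Excluded (assign l cs)
  assign-sound l []       t []       = []
  assign-sound l (c ∷ cs) t (¬c ∷ e) with without l c in eq
  ... | just c' = (λ s → ¬c (without-sound l c t eq s)) ∷ assign-sound l cs t e
  ... | nothing = assign-sound l cs t e

  status-conflict : ∀ cs → status cs ≡ conflict → Excluded cs → ⊥
  status-conflict ([] ∷ cs) eq (¬c ∷ e) = ¬c tt
  status-conflict ((l ∷ l' ∷ c) ∷ cs) eq (¬c ∷ e) with status cs in eq'
  ... | conflict = status-conflict cs eq' e

  status-unit : ∀ cs {l} → status cs ≡ unit l → Excluded cs → ¬ True l
  status-unit ((l ∷ []) ∷ cs) refl (¬c ∷ e) t = ¬c (t , tt)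
  status-unit ((l ∷ l' ∷ c) ∷ cs) eq (¬c ∷ e) with status cs in eq'
  status-unit ((l ∷ l' ∷ c) ∷ cs) refl (¬c ∷ e) | unit _ = status-unit cs eq' e

  negate-true : ∀ l → ¬ True l → True (negate l)
  negate-true (lit i j b) ¬t = Bool.¬-not ¬t

  -- Known facts enter the solver in its only format: a true literal is the same as its negation
  -- being forbidden.
  units-excluded : ∀ c → Sat c → Excluded (map (λ l → negate l ∷ []) c)
  units-excluded []              _       = []
  units-excluded (lit i j b ∷ c) (t , s) = (λ { (q , _) → Bool.not-¬ t q }) ∷ units-excluded c s

  refute-sound : ∀ fuel cs → refute fuel cs ≡ true → Excluded cs → ⊥
  refute-sound (suc fuel) cs eq e with status cs in st
  ... | conflict = status-conflict cs st e
  ... | unit l = refute-sound fuel (assign (negate l) cs) eq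
                   (assign-sound (negate l) cs (negate-true l (status-unit cs st e)) e)
  ... | guess l@(lit i j b) with ∧-true {refute fuel (assign l cs)} eq | ρ i j Bool.≟ b
  ...   | eq₁ , _ | yes t = refute-sound fuel (assign l cs) eq₁ (assign-sound l cs t e)
  ...   | _ , eq₂ | no ¬t = refute-sound fuel (assign (negate l) cs) eq₂
                              (assign-sound (negate l) cs (negate-true l ¬t) e)


-- Permutations of positions, verified by computation.

remove : ℕ → List ℕ → Maybe (List ℕ)
remove x []       = nothing
remove x (y ∷ ys) = if x ≡ᵇ y then just ys else Maybe.map (y ∷_) (remove x ys)

permᵇ : List ℕ → List ℕ → Bool
permᵇ []       []       = true
permᵇ []       (_ ∷ _)  = false
permᵇ (x ∷ xs) ys with remove x ys
... | just ys' = permᵇ xs ys'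
... | nothing  = false

remove-sound : ∀ x ys {ys'} → remove x ys ≡ just ys' → x ∷ ys' ↭ ys
remove-sound x (y ∷ ys) eq with x ≡ᵇ y in e
remove-sound x (y ∷ ys) refl | true with ≡ᵇ-sound {x} e
... | refl = ↭-refl
remove-sound x (y ∷ ys) eq | false with remove x ys in r
remove-sound x (y ∷ ys) refl | false | just _ = ↭-trans (swap x y ↭-refl) (prep y (remove-sound x ys r))

permᵇ-sound : ∀ xs ys → permᵇ xs ys ≡ true → xs ↭ ys
permᵇ-sound []       []  _  = ↭-refl
permᵇ-sound (x ∷ xs) ys eq with remove x ys in r
... | just ys' = ↭-trans (prep x (permᵇ-sound xs ys' eq)) (remove-sound x ys r)

module _ {A : Set} where

  -- Indices past the end give the default o.
  at : A → List A → ℕ → A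
  at o []       _       = o
  at o (x ∷ _)  zero    = x
  at o (_ ∷ xs) (suc i) = at o xs i

  map-at-upTo : ∀ o xs → map (at o xs) (upTo (length xs)) ≡ xs
  map-at-upTo o xs = trans (List.map-upTo (at o xs) (length xs)) (go xs)
    where
    go : ∀ xs → List.applyUpTo (at o xs) (length xs) ≡ xs
    go []       = refl
    go (x ∷ xs) = cong (x ∷_) (go xs)

  at-∈ : ∀ o xs {i} → i < length xs → at o xs i ∈ xs
  at-∈ o (x ∷ xs) {zero}  _ = here refl
  at-∈ o (x ∷ xs) {suc i} h = there (at-∈ o xs (s≤s⁻¹ h))

  at-injective : ∀ o {xs} → Unique xs → ∀ {i j} → i < length xs → j < length xs →
                 at o xs i ≡ at o xs j → i ≡ j
  at-injective o (_ ∷ _)       {zero}  {zero}  _ _ _ = refl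
  at-injective o {x ∷ xs} u    {zero}  {suc j} _ h e =
    contradiction (subst (_∈ xs) (sym e) (at-∈ o xs (s≤s⁻¹ h))) (Unique[x∷xs]⇒x∉xs u)
  at-injective o {x ∷ xs} u    {suc i} {zero}  h _ e =
    contradiction (subst (_∈ xs) e (at-∈ o xs (s≤s⁻¹ h))) (Unique[x∷xs]⇒x∉xs u)
  at-injective o (_ ∷ u)       {suc i} {suc j} h h' e = cong suc (at-injective o u (s≤s⁻¹ h) (s≤s⁻¹ h') e)

  -- Rearranges a prefix of known length by naming the target order; the proof that it is an order
  -- of all positions is `refl`, in place of a chain of swaps.
  shuffle : ∀ xs is {zs} → permᵇ is (upTo (length xs)) ≡ true → ∀ o → map (at o xs) is ++ zs ↭ xs ++ zs
  shuffle xs is {zs} ok o = ++⁺ʳ zs (↭-trans (map⁺ (at o xs) (permᵇ-sound is (upTo (length xs)) ok))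
                                             (↭-reflexive (map-at-upTo o xs)))

-- Matchings, and lists of vertices with perfectly matched complement.

module Matchings {n : ℕ} (G : Graph n) (simple : IsSimple G) where

  G-sym : ∀ {u v b} → G u v ≡ b → G v u ≡ b
  G-sym {u} {v} = trans (proj₁ simple v u)

  G-irr : ∀ {u v} → G u v ≡ true → u ≢ v
  G-irr {u} e refl = true≢false e (proj₂ simple u)

  Edges : List (Fin n × Fin n) → Set
  Edges = All (λ e → G (proj₁ e) (proj₂ e) ≡ true)

  Nonadjacent : Fin n → Fin n → Set
  Nonadjacent x y = G x y ≡ false

  Independent : List (Fin n) → Set
  Independent = AllPairs Nonadjacent

  independent-∈ : ∀ {U} → Independent U → ∀ {u v} → u ∈ U → v ∈ U → G u v ≡ false
  independent-∈ (_ ∷ _) (here refl) (here refl) = proj₂ simple _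
  independent-∈ (a ∷ _) (here refl) (there v∈)  = All.lookup a v∈
  independent-∈ (a ∷ _) (there u∈) (here refl)  = G-sym (All.lookup a u∈)
  independent-∈ (_ ∷ i) (there u∈) (there v∈)   = independent-∈ i u∈ v∈

  -- Stands in for equimatchability throughout: the vertices missed by a maximal matching form such
  -- a `U`, and once there is at most one of them, the parity of `n` fixes the size of the matching.
  DeficiencyAtMostOne : Set
  DeficiencyAtMostOne = ∀ U M → U ++ pairs M ↭ allFin n → Edges M → Independent U → length U ≤ 1

  -- The vertices outside xs are perfectly matched.
  infixr 4 _,_

  record Rest (xs : List (Fin n)) : Set where
    constructor _,_
    field
      matching : List (Fin n × Fin n)
      perfect  : Edges matching × xs ++ pairs matching ↭ allFin n

  Rest-unique : ∀ {xs} → Rest xs → Unique xs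
  Rest-unique {xs} (M , _ , p) = Unique-++ˡ xs (Unique-resp-↭ (↭-sym p) (allFin⁺ n))

  Rest-resp-↭ : ∀ {xs ys} → xs ↭ ys → Rest xs → Rest ys
  Rest-resp-↭ p (M , e , q) = M , e , ↭-trans (++⁺ʳ (pairs M) (↭-sym p)) q

  Rest-match : ∀ ys m {xs} → ys ++ pairs m ↭ xs → Edges m → Rest xs → Rest ys
  Rest-match ys m {xs} p e (M , e' , q) = m ++ M , All.++⁺ e e' ,
    ↭-trans (↭-reflexive (trans (cong (ys ++_) (pairs-++ m M)) (sym (List.++-assoc ys (pairs m) (pairs M)))))
            (↭-trans (++⁺ʳ (pairs M) p) q)

  partner : ∀ {u} M → Edges M → u ∈ pairs M →
            ∃[ w ] ∃[ M' ] (G u w ≡ true × Edges M' × length M ≡ suc (length M') × pairs M ↭ u ∷ w ∷ pairs M')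
  partner ((u , w) ∷ M) (e ∷ es) (here refl)         = w , M , e , es , refl , ↭-refl
  partner ((w , u) ∷ M) (e ∷ es) (there (here refl)) = w , M , G-sym e , es , refl , swap w u ↭-refl
  partner ((x , y) ∷ M) (e ∷ es) (there (there u∈)) with partner M es u∈
  ... | w , M' , e' , es' , l , p = w , (x , y) ∷ M' , e' , e ∷ es' , cong suc l ,
        ↭-trans (prep x (prep y p))
          (↭-trans (shift _ (x ∷ y ∷ []) _) (prep _ (shift w (x ∷ y ∷ []) _)))

  -- The way into the tables for an arbitrary vertex: it brings its partner along, and what remains
  -- outside is still perfectly matched.
  pull : ∀ {xs} → Rest xs → ∀ u → u ∉ xs → ∃[ w ] (Rest (xs ++ u ∷ w ∷ []) × G u w ≡ true)
  pull {xs} (M , es , p) u u∉ with ∈-++⁻ xs (∈-resp-↭ (↭-sym p) (∈-allFin u))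
  ... | inj₁ u∈ = contradiction u∈ u∉
  ... | inj₂ u∈ with partner M es u∈
  ...   | w , M' , e , es' , _ , q = w , (M' , es' ,
            ↭-trans (↭-reflexive (List.++-assoc xs _ _)) (↭-trans (++⁺ˡ xs (↭-sym q)) p)) , e

  pull-edge : ∀ {xs} (r : Rest xs) {x y} → (x , y) ∈ Rest.matching r → Rest (xs ++ x ∷ y ∷ []) × G x y ≡ true
  pull-edge {xs} (M , es , p) e∈ with ∈⇒↭ e∈
  ... | M' , q = (M' , All.tail es' ,
          ↭-trans (↭-reflexive (List.++-assoc xs _ _)) (↭-trans (++⁺ˡ xs (↭-sym (pairs-resp-↭ q))) p)) , All.head es'
    where es' = All-resp-↭ q es

  Perfect : List (Fin n) → List (Fin n) → Set
  Perfect xs ys = ∃[ M ] (Edges M × xs ++ pairs M ↭ ys)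

  picks : List (Fin n) → List (Fin n × List (Fin n))
  picks []       = []
  picks (x ∷ xs) = (x , xs) ∷ map (λ p → proj₁ p , x ∷ proj₂ p) (picks xs)

  picks-↭ : ∀ xs → All (λ p → proj₁ p ∷ proj₂ p ↭ xs) (picks xs)
  picks-↭ []       = []
  picks-↭ (x ∷ xs) = ↭-refl ∷
    All.map⁺ (All.map (λ {p} q → ↭-trans (swap (proj₁ p) x ↭-refl) (prep x q)) (picks-↭ xs))

  picks-complete : ∀ {x xs} → x ∈ xs → Any (λ p → proj₁ p ≡ x) (picks xs)
  picks-complete (here refl) = here refl
  picks-complete (there x∈)  = there (Any.map⁺ (picks-complete x∈))

  -- The head of the list must have a partner in any perfect matching, so trying each candidate and
  -- recursing on the rest is exhaustive. The bound `k` on the length serves termination.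
  perfect? : ∀ k ys → length ys ≤ k → Dec (Perfect [] ys)
  perfect? k       []       _ = yes ([] , [] , ↭-refl)
  perfect? (suc k) (y ∷ ys) h = found
    where
    good? : ∀ ps → All (λ p → proj₁ p ∷ proj₂ p ↭ ys) ps →
            Dec (Any (λ p → G y (proj₁ p) ≡ true × Perfect [] (proj₂ p)) ps)
    good? []       _        = no λ ()
    good? (p ∷ ps) (q ∷ qs)
      with (G y (proj₁ p) Bool.≟ true)
           ×-dec perfect? k (proj₂ p) (ℕ.≤-trans (ℕ.n≤1+n _) (subst (_≤ k) (sym (↭-length q)) (s≤s⁻¹ h)))
    ... | yes g = yes (here g)
    ... | no ¬g with good? ps qs
    ...   | yes g  = yes (there g)
    ...   | no ¬g' = no λ { (here g) → ¬g g ; (there g) → ¬g' g }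

    found : Dec (Perfect [] (y ∷ ys))
    found with good? (picks ys) (picks-↭ ys)
    ... | yes g with All.lookupAny (picks-↭ ys) g
    ...   | q , e , M , es , p = yes (_ ∷ M , e ∷ es , prep y (↭-trans (prep _ p) q))
    found | no ¬g = no λ { (M , es , p) → ¬g (goal M es p) }
      where
      goal : ∀ M → Edges M → pairs M ↭ y ∷ ys → Any (λ p → G y (proj₁ p) ≡ true × Perfect [] (proj₂ p)) (picks ys)
      goal M es p with partner M es (∈-resp-↭ (↭-sym p) (here refl))
      ... | w , M' , e , es' , _ , q =
        Any.map (λ { (r , refl) → e , M' , es' , drop-∷ (↭-trans wM' (↭-sym r)) })
          (both (picks-↭ ys) (picks-complete (∈-resp-↭ wM' (here refl))))
        where
        wM' : w ∷ pairs M' ↭ ys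
        wM' = drop-∷ (↭-trans (↭-sym q) p)
        both : ∀ {P Q : Fin n × List (Fin n) → Set} {ps} → All P ps → Any Q ps → Any (λ p → P p × Q p) ps
        both (x ∷ _)  (here q)  = here (x , q)
        both (_ ∷ xs) (there a) = there (both xs a)

  Perfect? : ∀ xs ys → Dec (Perfect xs ys)
  Perfect? []       ys = perfect? (length ys) ys ℕ.≤-refl
  Perfect? (x ∷ xs) ys with Any.any? (x ≟_) ys
  ... | no x∉  = no λ { (M , _ , p) → x∉ (∈-resp-↭ p (here refl)) }
  ... | yes x∈ with ∈⇒↭ x∈
  ...   | ys' , q with Perfect? xs ys'
  ...     | yes (M , es , p) = yes (M , es , ↭-trans (prep x p) (↭-sym q))
  ...     | no ¬p = no λ { (M , es , p) → ¬p (M , es , drop-∷ (↭-trans p q)) }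

  -- Makes the occurrence of a five-vertex pattern decidable, so that the forward direction can
  -- branch on which pattern occurs without excluded middle.
  Rest? : ∀ xs → Dec (Rest xs)
  Rest? xs = Dec.map′ (λ (M , q) → M , q) (λ (M , q) → M , q) (Perfect? xs (allFin n))

-- Constraints, patterns and tables over positions.

infix 10 _–_

_–_ : ℕ → ℕ → ℕ × ℕ
_–_ = _,_

-- The two sources of contradiction: an induced claw with centre `c`, and a matching inside the list
-- whose uncovered positions would be pairwise non-adjacent.
data Constraint : Set where
  claw : (c a b d : ℕ) → Constraint
  bad  : List (ℕ × ℕ) → Constraint

nonadjacentPairs : List ℕ → Conj
nonadjacentPairs []       = []
nonadjacentPairs (x ∷ xs) = map (x ≁_) xs ++ nonadjacentPairs xs

edgeLits : List (ℕ × ℕ) → Conj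
edgeLits = map (λ e → proj₁ e ~ proj₂ e)

unmatched : ℕ → List (ℕ × ℕ) → List ℕ
unmatched k m = filterᵇ (λ i → not (any (i ≡ᵇ_) (pairs m))) (upTo k)

conj : ℕ → Constraint → Conj
conj k (claw c a b d) = c ~ a ∷ c ~ b ∷ c ~ d ∷ a ≁ b ∷ a ≁ d ∷ b ≁ d ∷ []
conj k (bad m)        = edgeLits m ++ nonadjacentPairs (unmatched k m)

valid : ℕ → Constraint → Bool
valid k (claw c a b d) = (a <ᵇ k) ∧ (b <ᵇ k) ∧ (d <ᵇ k) ∧ not (a ≡ᵇ b) ∧ not (a ≡ᵇ d) ∧ not (b ≡ᵇ d)
-- One uncovered position is allowed, so only a matching that leaves two or more is contradictory.
valid k (bad m)        = permᵇ (unmatched k m ++ pairs m) (upTo k) ∧ (1 <ᵇ length (unmatched k m))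

-- The solver compares literals syntactically, while tables write a pair of positions in whichever
-- order is convenient; this identifies the two orders.
normal : Lit → Lit
normal (lit i j b) = if i ≤ᵇ j then lit i j b else lit j i b

-- A way of finding a smaller pattern inside a list: with the pairs of `matched` returned to the
-- matching, the other five positions have a perfectly matched complement. If they form a pattern
-- known not to occur, this is a contradiction.
record Escape : Set where
  constructor escape
  field
    e₀ e₁ e₂ e₃ e₄ : ℕ
    matched : List (ℕ × ℕ)

Pattern : Set
Pattern = (a b c d e : ℕ) → Conj

2K₂ C₄ : (a b c d : ℕ) → Conj
2K₂ a b c d = a ~ b ∷ c ~ d ∷ a ≁ c ∷ a ≁ d ∷ b ≁ c ∷ b ≁ d ∷ []
C₄  a b c d = a ~ b ∷ b ~ c ∷ c ~ d ∷ a ~ d ∷ a ≁ c ∷ b ≁ d ∷ []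

2K₂+K₁ C₄+K₁ K₂+P₃ P₅ : Pattern
2K₂+K₁ a b c d e = a ~ b ∷ c ~ d ∷ a ≁ c ∷ a ≁ d ∷ a ≁ e ∷ b ≁ c ∷ b ≁ d ∷ b ≁ e ∷ c ≁ e ∷ d ≁ e ∷ []
C₄+K₁  a b c d e = a ~ b ∷ b ~ c ∷ c ~ d ∷ a ~ d ∷ a ≁ c ∷ b ≁ d ∷ a ≁ e ∷ b ≁ e ∷ c ≁ e ∷ d ≁ e ∷ []
K₂+P₃  a b c d e = a ~ b ∷ c ~ d ∷ d ~ e ∷ a ≁ c ∷ a ≁ d ∷ a ≁ e ∷ b ≁ c ∷ b ≁ d ∷ b ≁ e ∷ c ≁ e ∷ []
P₅     a b c d e = a ~ b ∷ b ~ c ∷ c ~ d ∷ d ~ e ∷ a ≁ c ∷ a ≁ d ∷ a ≁ e ∷ b ≁ d ∷ b ≁ e ∷ c ≁ e ∷ []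

refuteAll : ℕ → List Constraint → Conj → List Conj → Bool
refuteAll k cs facts goals =
  all (valid k) cs
  -- The constant bounds the length of a branch of propagations and splits.
  ∧ refute 1000 (map (map normal) (map (λ l → negate l ∷ []) facts ++ map (conj k) cs ++ goals))

validEscape : ℕ → Escape → Bool
validEscape k (escape a b c d e m) = permᵇ (a ∷ b ∷ c ∷ d ∷ e ∷ pairs m) (upTo k)

escapeConj : Pattern → Escape → Conj
escapeConj P (escape a b c d e m) = edgeLits m ++ P a b c d e

validEscapes : ℕ → ℕ → List Escape → List Escape → Bool
validEscapes 0             k []  []  = true
validEscapes 1             k es₁ []  = all (validEscape k) es₁
validEscapes (suc (suc _)) k es₁ es₂ = all (validEscape k) es₁ ∧ all (validEscape k) es₂
validEscapes _             k _   _   = false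

-- A statement about any list of `size` vertices whose complement is perfectly
-- matched: if `given` and `facts` hold then one of `goals` does.  At level 1 the
-- graph is assumed to have no remaining 2K₂+K₁, at level 2 also no C₄+K₁.
record Table (ℓ : ℕ) : Set where
  constructor table
  field
    size         : ℕ
    given facts  : Conj
    goals        : List Conj
    es₁ es₂      : List Escape
    -- A selection: any list of valid constraints is sound, and a short one keeps the evaluation of
    -- `ok` cheap.
    cs           : List Constraint
    ok           : validEscapes ℓ size es₁ es₂ ∧ refuteAll size cs (given ++ facts)
                     (goals ++ map (escapeConj 2K₂+K₁) es₁ ++ map (escapeConj C₄+K₁) es₂) ≡ true

-- Soundness of the tables in a given graph.

module Local {n : ℕ} (G : Graph n) (simple : IsSimple G) (clawFree : ClawFree G)
             (deficiency : Matchings.DeficiencyAtMostOne G simple) (o : Fin n) where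

  open Matchings G simple

  adj : List (Fin n) → ℕ → ℕ → Bool
  adj xs i j = G (at o xs i) (at o xs j)

  Holds : List (Fin n) → Conj → Set
  Holds xs = Sat (adj xs)

  normal-true : ∀ xs l → True (adj xs) (normal l) → True (adj xs) l
  normal-true xs (lit i j b) t with i ≤ᵇ j
  ... | true  = t
  ... | false = G-sym t

  normal-sat : ∀ xs c → Holds xs (map normal c) → Holds xs c
  normal-sat xs []      _        = tt
  normal-sat xs (l ∷ c) (t , ts) = normal-true xs l t , normal-sat xs c ts

  map-pairs : ∀ (f : ℕ → Fin n) m → map f (pairs m) ≡ pairs (map (λ e → f (proj₁ e) , f (proj₂ e)) m)
  map-pairs f []      = refl
  map-pairs f (e ∷ m) = cong (λ z → f (proj₁ e) ∷ f (proj₂ e) ∷ z) (map-pairs f m)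

  edgeLits-edges : ∀ xs m → Holds xs (edgeLits m) → Edges (map (λ e → at o xs (proj₁ e) , at o xs (proj₂ e)) m)
  edgeLits-edges xs []      _        = []
  edgeLits-edges xs (_ ∷ m) (t , ts) = t ∷ edgeLits-edges xs m ts

  nonadjacent-sound : ∀ xs u → Holds xs (nonadjacentPairs u) → Independent (map (at o xs) u)
  nonadjacent-sound xs []      _ = []
  nonadjacent-sound xs (i ∷ u) h =
    All.map⁺ (row u (proj₁ (Sat-++⁻ _ (map (i ≁_) u) h))) ∷ nonadjacent-sound xs u (proj₂ (Sat-++⁻ _ (map (i ≁_) u) h))
    where
    row : ∀ u → Holds xs (map (i ≁_) u) → All (λ j → Nonadjacent (at o xs i) (at o xs j)) u
    row []      _       = []
    row (j ∷ u) (t , s) = t ∷ row u s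

  -- Keeps the positions `u`, in that order, and returns the pairs at `m` to the matching. With `m`
  -- empty it is a mere reordering, which is how symmetric situations are reduced to one another.
  Rest-select : ∀ {xs} → Rest xs → ∀ u m → permᵇ (u ++ pairs m) (upTo (length xs)) ≡ true →
                Holds xs (edgeLits m) → Rest (map (at o xs) u)
  Rest-select {xs} rest u m pe e =
    Rest-match _ (map (λ e → at o xs (proj₁ e) , at o xs (proj₂ e)) m)
      (↭-trans (↭-reflexive (trans (cong (map (at o xs) u ++_) (sym (map-pairs (at o xs) m)))
                                   (sym (List.map-++ (at o xs) u (pairs m)))))
        (↭-trans (map⁺ (at o xs) (permᵇ-sound _ (upTo (length xs)) pe)) (↭-reflexive (map-at-upTo o xs))))
      (edgeLits-edges xs m e) rest

  -- A matching inside the list together with the perfect matching outside leaves exactly the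
  -- uncovered positions, so their independence would break the deficiency bound.
  constraint-sound : ∀ {xs} → Rest xs → ∀ c → valid (length xs) c ≡ true → ¬ Holds xs (conj (length xs) c)
  constraint-sound {xs} rest (claw c a b d) v (p₁ , p₂ , p₃ , q₁ , q₂ , q₃ , _)
    with ∧-true {a <ᵇ length xs} v
  ... | a< , v with ∧-true {b <ᵇ length xs} v
  ... | b< , v with ∧-true {d <ᵇ length xs} v
  ... | d< , v with ∧-true {not (a ≡ᵇ b)} v
  ... | a≢b , v with ∧-true {not (a ≡ᵇ d)} v
  ... | a≢d , b≢d = clawFree _ _ _ _ (p₁ , p₂ , p₃ , distinct a< b< a≢b , distinct a< d< a≢d , distinct b< d< b≢d , q₁ , q₂ , q₃)
    where
    distinct : ∀ {i j} → (i <ᵇ length xs) ≡ true → (j <ᵇ length xs) ≡ true → not (i ≡ᵇ j) ≡ true → at o xs i ≢ at o xs j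
    distinct {i} {j} i< j< ne eq
      with at-injective o (Rest-unique rest) (ℕ.<ᵇ⇒< i _ (subst T (sym i<) _)) (ℕ.<ᵇ⇒< j _ (subst T (sym j<) _)) eq
    ... | refl with i ≡ᵇ i in e
    ...   | true  = case ne of λ ()
    ...   | false = subst T e (ℕ.≡⇒≡ᵇ i i refl)
  constraint-sound {xs} rest (bad m) v h with ∧-true {permᵇ (unmatched (length xs) m ++ pairs m) (upTo (length xs))} v
  ... | pe , two with Rest-select rest (unmatched (length xs) m) m pe (proj₁ (Sat-++⁻ _ (edgeLits m) h))
  ...   | M , es , p = ℕ.<⇒≱ (ℕ.<ᵇ⇒< 1 _ (subst T (sym two) _))
            (subst (_≤ 1) (List.length-map (at o xs) (unmatched (length xs) m))
              (deficiency _ M p es (nonadjacent-sound xs _ (proj₂ (Sat-++⁻ _ (edgeLits m) h)))))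

  constraints-sound : ∀ {xs} → Rest xs → ∀ cs → all (valid (length xs)) cs ≡ true →
                      All (λ c → ¬ Holds xs (conj (length xs) c)) cs
  constraints-sound rest []       _ = []
  constraints-sound {xs} rest (c ∷ cs) v with ∧-true {valid (length xs) c} v
  ... | v₁ , v₂ = constraint-sound rest c v₁ ∷ constraints-sound rest cs v₂

  -- The goals are decidable: if none holds, they too are excluded conjunctions and the refutation
  -- applies.
  solve : ∀ {xs} → Rest xs → (cs : List Constraint) (facts : Conj) (goals : List Conj) →
          refuteAll (length xs) cs facts goals ≡ true → Holds xs facts → Any (Holds xs) goals
  solve {xs} rest cs facts goals ok hs with Any.any? (Sat? (adj xs)) goals
  ... | yes g = g
  ... | no ¬g with ∧-true {all (valid (length xs)) cs} ok
  ...   | vs , r = ⊥-elim (refute-sound (adj xs) 1000 _ r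
            (All.map⁺ (All.map (λ {c} ¬s s → ¬s (normal-sat xs c s))
              (All.++⁺ (units-excluded (adj xs) facts hs)
                (All.++⁺ (All.map⁺ (constraints-sound rest cs vs)) (All.¬Any⇒All¬ goals ¬g))))))

  Base : Pattern → Set
  Base P = ∃[ a ] ∃[ b ] ∃[ c ] ∃[ d ] ∃[ e ]
    let xs = a ∷ b ∷ c ∷ d ∷ e ∷ [] in Rest xs × Holds xs (P 0 1 2 3 4)

  Base? : ∀ P → Dec (Base P)
  Base? P = Fin.any? λ a → Fin.any? λ b → Fin.any? λ c → Fin.any? λ d → Fin.any? λ e →
    Rest? (a ∷ b ∷ c ∷ d ∷ e ∷ []) ×-dec Sat? (adj (a ∷ b ∷ c ∷ d ∷ e ∷ [])) (P 0 1 2 3 4)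

  -- For each concrete pattern both sides compute to the same type, so the identity proves it; for a
  -- variable pattern they do not, hence the assumption.
  Transportable : Pattern → Set
  Transportable P = ∀ xs a b c d e → Holds xs (P a b c d e) →
    Holds (map (at o xs) (a ∷ b ∷ c ∷ d ∷ e ∷ [])) (P 0 1 2 3 4)

  escape-excluded : ∀ {xs} P → Transportable P → ¬ Base P → Rest xs → ∀ es →
                    all (validEscape (length xs)) es ≡ true → All (λ c → ¬ Holds xs c) (map (escapeConj P) es)
  escape-excluded P tr ¬b rest [] _ = []
  escape-excluded {xs} P tr ¬b rest (escape a b c d e m ∷ es) v
    with ∧-true {validEscape (length xs) (escape a b c d e m)} v
  ... | v₁ , v₂ = (λ h → ¬b (_ , _ , _ , _ , _ ,
          Rest-select rest (a ∷ b ∷ c ∷ d ∷ e ∷ []) m v₁ (proj₁ (Sat-++⁻ _ (edgeLits m) h)) ,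
          tr xs a b c d e (proj₂ (Sat-++⁻ _ (edgeLits m) h)))) ∷ escape-excluded P tr ¬b rest es v₂

  data Avoids : ℕ → Set where
    nothing      : Avoids 0
    no-2K₂       : ¬ Base 2K₂+K₁ → Avoids 1
    no-2K₂-or-C₄ : ∀ {ℓ} → ¬ Base 2K₂+K₁ → ¬ Base C₄+K₁ → Avoids (suc (suc ℓ))

  escapes-excluded : ∀ ℓ → Avoids ℓ → ∀ {xs} → Rest xs → ∀ es₁ es₂ → validEscapes ℓ (length xs) es₁ es₂ ≡ true →
                     All (λ c → ¬ Holds xs c) (map (escapeConj 2K₂+K₁) es₁ ++ map (escapeConj C₄+K₁) es₂)
  escapes-excluded 0 nothing  rest []  []  _ = []
  escapes-excluded 1 (no-2K₂ ¬a) {xs} rest es₁ [] v =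
    All.++⁺ (escape-excluded 2K₂+K₁ (λ _ _ _ _ _ _ h → h) ¬a rest es₁ v) []
  escapes-excluded (suc (suc _)) (no-2K₂-or-C₄ ¬a ¬b) {xs} rest es₁ es₂ v with ∧-true {all (validEscape (length xs)) es₁} v
  ... | v₁ , v₂ = All.++⁺ (escape-excluded 2K₂+K₁ (λ _ _ _ _ _ _ h → h) ¬a rest es₁ v₁)
                          (escape-excluded C₄+K₁ (λ _ _ _ _ _ _ h → h) ¬b rest es₂ v₂)

  apply : ∀ {ℓ} → Avoids ℓ → (t : Table ℓ) → let open Table t in
          ∀ {xs} → length xs ≡ size → Rest xs → Holds xs given → Holds xs facts → Any (Holds xs) goals
  apply {ℓ} av (table size given facts goals es₁ es₂ cs ok) {xs} refl rest hg hf
    with ∧-true {validEscapes ℓ size es₁ es₂} ok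
  ... | v , r with Any.++⁻ goals (solve rest cs (given ++ facts) _ r (Sat-++⁺ _ given hg hf))
  ...   | inj₁ g = g
  ...   | inj₂ g with All.lookupAny (escapes-excluded ℓ av rest es₁ es₂ v) g
  ...     | ¬h , h = contradiction h ¬h

  -- The empty conjunction unless there is exactly one alternative.
  sole : List Conj → Conj
  sole (c ∷ []) = c
  sole _        = []

  apply₁ : ∀ {ℓ} → Avoids ℓ → (t : Table ℓ) → let open Table t in
           ∀ {xs} → length xs ≡ size → Rest xs → Holds xs given → Holds xs facts → Holds xs (sole goals)
  apply₁ av t {xs} len r hg hf = from (Table.goals t) (apply av t {xs} len r hg hf)
    where
    from : ∀ cs → Any (Holds xs) cs → Holds xs (sole cs)
    from (_ ∷ [])    (here h) = h
    from (_ ∷ _ ∷ _) _        = tt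

-- Tables: graphs with a perfect matching.

-- For two independent pairs, an edge across forces the complementary one, since otherwise the two
-- vertices that it leaves are non-adjacent. One or both of the perfect matchings across must then
-- be present.
even-start : Table 0
even-start = table 4 [] (0 ≁ 1 ∷ 2 ≁ 3 ∷ [])
  (2K₂ 0 2 1 3 ∷ 2K₂ 0 3 1 2 ∷ C₄ 0 2 1 3 ∷ [])
  [] []
  (bad (1 – 3 ∷ []) ∷ bad (1 – 2 ∷ []) ∷ bad (0 – 3 ∷ []) ∷ bad (0 – 2 ∷ []) ∷ bad [] ∷ [])
  refl

-- With `2K₂-partner0`, `2K₂-spread0` and the mirror images ending in 1: a vertex attached to the
-- edge 01 sees neither 2 nor 3, and its neighbours outside the four are attached to 01 again. The
-- edge 23 is then out of reach.
2K₂-apart0 : Table 0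
2K₂-apart0 = table 6 (2K₂ 0 1 2 3) (4 ~ 5 ∷ 0 ~ 4 ∷ [])
  ((2 ≁ 4 ∷ 3 ≁ 4 ∷ []) ∷ [])
  [] []
  (bad (2 – 3 ∷ 0 – 4 ∷ []) ∷ bad (1 – 5 ∷ 3 – 4 ∷ []) ∷ bad (1 – 5 ∷ 2 – 4 ∷ []) ∷ [])
  refl

2K₂-partner0 : Table 0
2K₂-partner0 = table 6 (2K₂ 0 1 2 3) (4 ~ 5 ∷ 0 ~ 4 ∷ [])
  ((0 ~ 5 ∷ []) ∷ (1 ~ 5 ∷ []) ∷ [])
  [] []
  (bad (2 – 3 ∷ 0 – 4 ∷ []) ∷ [])
  refl

2K₂-spread0 : Table 0
2K₂-spread0 = table 8 (2K₂ 0 1 2 3) (4 ~ 5 ∷ 6 ~ 7 ∷ 0 ~ 4 ∷ 4 ~ 6 ∷ [])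
  ((0 ~ 6 ∷ []) ∷ (1 ~ 6 ∷ []) ∷ [])
  [] []
  (bad (2 – 3 ∷ 4 – 6 ∷ 0 – 1 ∷ []) ∷ bad (2 – 3 ∷ 5 – 7 ∷ 0 – 4 ∷ []) ∷ [])
  refl

2K₂-apart1 : Table 0
2K₂-apart1 = table 6 (2K₂ 0 1 2 3) (4 ~ 5 ∷ 1 ~ 4 ∷ [])
  ((2 ≁ 4 ∷ 3 ≁ 4 ∷ []) ∷ [])
  [] []
  (bad (2 – 3 ∷ 1 – 4 ∷ []) ∷ bad (0 – 5 ∷ 3 – 4 ∷ []) ∷ bad (2 – 4 ∷ 0 – 5 ∷ []) ∷ [])
  refl

2K₂-partner1 : Table 0
2K₂-partner1 = table 6 (2K₂ 0 1 2 3) (4 ~ 5 ∷ 1 ~ 4 ∷ [])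
  ((0 ~ 5 ∷ []) ∷ (1 ~ 5 ∷ []) ∷ [])
  [] []
  (bad (2 – 3 ∷ 1 – 4 ∷ []) ∷ [])
  refl

2K₂-spread1 : Table 0
2K₂-spread1 = table 8 (2K₂ 0 1 2 3) (4 ~ 5 ∷ 6 ~ 7 ∷ 1 ~ 4 ∷ 4 ~ 6 ∷ [])
  ((0 ~ 6 ∷ []) ∷ (1 ~ 6 ∷ []) ∷ [])
  [] []
  (bad (4 – 6 ∷ 0 – 1 ∷ 2 – 3 ∷ []) ∷ bad (5 – 7 ∷ 1 – 4 ∷ 2 – 3 ∷ []) ∷ [])
  refl

-- There is no goal: any vertex attached to a corner of the square is contradictory. Positions are
-- fixed, so each corner has its own table.
C₄-alone0 : Table 0
C₄-alone0 = table 6 (C₄ 0 1 2 3) (4 ~ 5 ∷ 0 ~ 4 ∷ [])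
  []
  [] []
  (bad (0 – 4 ∷ 2 – 5 ∷ []) ∷ claw 0 1 3 4 ∷ bad (3 – 4 ∷ 0 – 1 ∷ []) ∷ bad (1 – 4 ∷ 0 – 3 ∷ []) ∷ [])
  refl

C₄-alone1 : Table 0
C₄-alone1 = table 6 (C₄ 0 1 2 3) (4 ~ 5 ∷ 1 ~ 4 ∷ [])
  []
  [] []
  (bad (3 – 5 ∷ 1 – 4 ∷ []) ∷ bad (1 – 2 ∷ 0 – 4 ∷ []) ∷ claw 1 0 2 4 ∷ bad (0 – 1 ∷ 2 – 4 ∷ []) ∷ [])
  refl

C₄-alone2 : Table 0
C₄-alone2 = table 6 (C₄ 0 1 2 3) (4 ~ 5 ∷ 2 ~ 4 ∷ [])
  []
  [] []
  (bad (0 – 5 ∷ 2 – 4 ∷ []) ∷ bad (1 – 2 ∷ 3 – 4 ∷ []) ∷ bad (1 – 4 ∷ 2 – 3 ∷ []) ∷ claw 2 1 3 4 ∷ [])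
  refl

C₄-alone3 : Table 0
C₄-alone3 = table 6 (C₄ 0 1 2 3) (4 ~ 5 ∷ 3 ~ 4 ∷ [])
  []
  [] []
  (bad (3 – 4 ∷ 1 – 5 ∷ []) ∷ bad (2 – 4 ∷ 0 – 3 ∷ []) ∷ claw 3 0 2 4 ∷ bad (2 – 3 ∷ 0 – 4 ∷ []) ∷ [])
  refl

-- Tables: 2K₂ + K₁ and its links to the isolated vertex.

-- Each edge of the 2K₂ is closed to a cycle 0-5-6-1, respectively 2-7-8-3, by a further matching
-- edge, and the isolated vertex 4 sees the corners 6 and 8. This is the core of a graph in 𝒢₁
-- around its cut vertex 4.
gate : Conj
gate = 2K₂+K₁ 0 1 2 3 4 ++ (0 ~ 5 ∷ 1 ~ 6 ∷ 4 ~ 6 ∷ 5 ~ 6 ∷ 2 ~ 7 ∷ 3 ~ 8 ∷ 4 ~ 8 ∷ 7 ~ 8 ∷ [])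

-- Allows the matching edge 56 to take over the role of 01: nothing of 23 is seen from it, so 2K₂ +
-- K₁ persists one step further along a walk. `advance'` does the same with one more matching edge
-- kept in the list.
advance : Table 0
advance = table 7 (2K₂+K₁ 0 1 2 3 4) (5 ~ 6 ∷ 0 ~ 5 ∷ 4 ≁ 5 ∷ 4 ≁ 6 ∷ [])
  ((2 ≁ 5 ∷ 3 ≁ 5 ∷ 2 ≁ 6 ∷ 3 ≁ 6 ∷ []) ∷ [])
  [] []
  (bad (3 – 6 ∷ 0 – 5 ∷ []) ∷ bad (2 – 6 ∷ 0 – 5 ∷ []) ∷ bad (3 – 5 ∷ 0 – 1 ∷ []) ∷ bad (2 – 5 ∷ 0 – 1 ∷ []) ∷ [])
  refl

advance' : Table 0
advance' = table 9 (2K₂+K₁ 0 1 2 3 4) (5 ~ 6 ∷ 7 ~ 8 ∷ 0 ~ 7 ∷ 4 ≁ 7 ∷ 4 ≁ 8 ∷ [])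
  ((2 ≁ 7 ∷ 3 ≁ 7 ∷ 2 ≁ 8 ∷ 3 ≁ 8 ∷ []) ∷ [])
  [] []
  (bad (5 – 6 ∷ 0 – 7 ∷ 3 – 8 ∷ []) ∷ bad (5 – 6 ∷ 0 – 7 ∷ 2 – 8 ∷ []) ∷ bad (5 – 6 ∷ 0 – 1 ∷ 2 – 7 ∷ []) ∷
   bad (5 – 6 ∷ 0 – 1 ∷ 3 – 7 ∷ []) ∷ [])
  refl

-- Keeps the two links to vertex 4 apart: an edge 56 that links 23 to vertex 4 is not adjacent to 0.
-- The digits name the end next to 4 and the end next to 0.
one-side55 : Table 0
one-side55 = table 7 (2K₂+K₁ 0 1 2 3 4) (5 ~ 6 ∷ 2 ~ 5 ∷ 4 ~ 5 ∷ 0 ~ 5 ∷ [])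
  []
  [] []
  (claw 5 0 2 4 ∷ [])
  refl

one-side56 : Table 0
one-side56 = table 7 (2K₂+K₁ 0 1 2 3 4) (5 ~ 6 ∷ 2 ~ 5 ∷ 4 ~ 5 ∷ 0 ~ 6 ∷ [])
  []
  [] []
  (bad (0 – 6 ∷ 2 – 5 ∷ []) ∷ [])
  refl

one-side65 : Table 0
one-side65 = table 7 (2K₂+K₁ 0 1 2 3 4) (5 ~ 6 ∷ 2 ~ 5 ∷ 4 ~ 6 ∷ 0 ~ 5 ∷ [])
  []
  [] []
  (bad (2 – 6 ∷ 0 – 5 ∷ []) ∷ bad (2 – 5 ∷ 0 – 6 ∷ []) ∷ claw 5 0 2 6 ∷ [])
  refl

one-side66 : Table 0
one-side66 = table 7 (2K₂+K₁ 0 1 2 3 4) (5 ~ 6 ∷ 2 ~ 5 ∷ 4 ~ 6 ∷ 0 ~ 6 ∷ [])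
  []
  [] []
  (bad (0 – 6 ∷ 2 – 5 ∷ []) ∷ [])
  refl

-- After exchanging 5 and 6 if necessary, the link closes to a cycle through 0 and 1 whose corner
-- next to 1 sees vertex 4. The digits name the ends of the two links that are known to see 4.
orient57 : Table 0
orient57 = table 9 (2K₂+K₁ 0 1 2 3 4) (5 ~ 6 ∷ 7 ~ 8 ∷ 0 ~ 5 ∷ 2 ~ 7 ∷ 4 ~ 5 ∷ 4 ~ 7 ∷ [])
  ((1 ~ 6 ∷ 4 ~ 6 ∷ []) ∷ (0 ~ 6 ∷ 1 ~ 5 ∷ []) ∷ [])
  [] []
  (bad (2 – 7 ∷ 1 – 8 ∷ 5 – 6 ∷ []) ∷ bad (6 – 8 ∷ 0 – 5 ∷ 2 – 7 ∷ []) ∷ claw 5 0 4 6 ∷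
   bad (1 – 6 ∷ 2 – 7 ∷ 5 – 8 ∷ []) ∷ bad (2 – 3 ∷ 0 – 5 ∷ 4 – 7 ∷ []) ∷ bad (2 – 3 ∷ 4 – 7 ∷ 0 – 6 ∷ []) ∷ [])
  refl

orient67 : Table 0
orient67 = table 9 (2K₂+K₁ 0 1 2 3 4) (5 ~ 6 ∷ 7 ~ 8 ∷ 0 ~ 5 ∷ 2 ~ 7 ∷ 4 ~ 6 ∷ 4 ~ 7 ∷ [])
  ((1 ~ 6 ∷ []) ∷ [])
  [] []
  (bad (1 – 8 ∷ 2 – 7 ∷ 5 – 6 ∷ []) ∷ bad (2 – 7 ∷ 0 – 5 ∷ 6 – 8 ∷ []) ∷ bad (2 – 3 ∷ 4 – 7 ∷ 0 – 5 ∷ []) ∷ [])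
  refl

orient58 : Table 0
orient58 = table 9 (2K₂+K₁ 0 1 2 3 4) (5 ~ 6 ∷ 7 ~ 8 ∷ 0 ~ 5 ∷ 2 ~ 7 ∷ 4 ~ 5 ∷ 4 ~ 8 ∷ [])
  ((1 ~ 6 ∷ 4 ~ 6 ∷ []) ∷ (0 ~ 6 ∷ 1 ~ 5 ∷ []) ∷ [])
  [] []
  (claw 5 0 3 4 ∷ bad (0 – 5 ∷ 7 – 8 ∷ 3 – 6 ∷ []) ∷ claw 5 0 4 6 ∷ bad (2 – 7 ∷ 4 – 8 ∷ 0 – 5 ∷ []) ∷
   bad (4 – 8 ∷ 0 – 6 ∷ 2 – 7 ∷ []) ∷ [])
  refl

orient68 : Table 0
orient68 = table 9 (2K₂+K₁ 0 1 2 3 4) (5 ~ 6 ∷ 7 ~ 8 ∷ 0 ~ 5 ∷ 2 ~ 7 ∷ 4 ~ 6 ∷ 4 ~ 8 ∷ [])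
  ((1 ~ 6 ∷ []) ∷ [])
  [] []
  (bad (7 – 8 ∷ 0 – 5 ∷ 3 – 6 ∷ []) ∷ bad (4 – 8 ∷ 2 – 7 ∷ 0 – 5 ∷ []) ∷ [])
  refl

-- The source of the alternative in 𝒢₁ between a complete side and a C₄: the cycle 0-5-6-1 has both
-- diagonals or neither, and without them vertex 4 sees both 5 and 6.
gate-shape : Table 0
gate-shape = table 9 gate ([])
  ((1 ~ 5 ∷ 0 ~ 6 ∷ []) ∷ (1 ≁ 5 ∷ 0 ≁ 6 ∷ 4 ~ 5 ∷ []) ∷ [])
  [] []
  (claw 6 1 3 4 ∷ bad (1 – 6 ∷ 3 – 5 ∷ 7 – 8 ∷ []) ∷ claw 6 1 4 5 ∷ bad (4 – 8 ∷ 2 – 7 ∷ 1 – 5 ∷ []) ∷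
   bad (0 – 6 ∷ 4 – 8 ∷ 2 – 7 ∷ []) ∷ [])
  refl

gate-cross : Table 0
gate-cross = table 9 gate ([])
  ((2 ≁ 5 ∷ 3 ≁ 5 ∷ 2 ≁ 6 ∷ 3 ≁ 6 ∷ 5 ≁ 7 ∷ 5 ≁ 8 ∷ 6 ≁ 7 ∷ 6 ≁ 8 ∷ 0 ≁ 7 ∷ 1 ≁ 7 ∷ 0 ≁ 8 ∷ 1 ≁ 8 ∷ []) ∷ [])
  [] []
  (bad (5 – 6 ∷ 1 – 7 ∷ 3 – 8 ∷ []) ∷ claw 6 1 3 4 ∷ claw 8 0 3 4 ∷ bad (7 – 8 ∷ 2 – 5 ∷ 1 – 6 ∷ []) ∷
   claw 6 1 2 4 ∷ bad (7 – 8 ∷ 3 – 5 ∷ 1 – 6 ∷ []) ∷ bad (6 – 7 ∷ 3 – 8 ∷ 0 – 5 ∷ []) ∷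
   bad (0 – 5 ∷ 6 – 8 ∷ 2 – 7 ∷ []) ∷ bad (5 – 8 ∷ 1 – 6 ∷ 2 – 7 ∷ []) ∷ bad (2 – 7 ∷ 5 – 6 ∷ 1 – 8 ∷ []) ∷
   bad (0 – 7 ∷ 5 – 6 ∷ 3 – 8 ∷ []) ∷ bad (3 – 8 ∷ 5 – 7 ∷ 1 – 6 ∷ []) ∷ [])
  refl

-- A matching edge outside the gate lies entirely on the side of 01, entirely on the side of 23, or
-- sees nothing of the gate. The third kind persists along edges by `gate-far`, which is how
-- connectedness removes it.
gate-edge : Table 0
gate-edge = table 11 gate (9 ~ 10 ∷ [])
  ((0 ~ 9 ∷ 1 ~ 9 ∷ 2 ≁ 9 ∷ 3 ≁ 9 ∷ 0 ~ 10 ∷ 1 ~ 10 ∷ 2 ≁ 10 ∷ 3 ≁ 10 ∷ []) ∷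
   (2 ~ 9 ∷ 3 ~ 9 ∷ 0 ≁ 9 ∷ 1 ≁ 9 ∷ 2 ~ 10 ∷ 3 ~ 10 ∷ 0 ≁ 10 ∷ 1 ≁ 10 ∷ []) ∷
   (0 ≁ 9 ∷ 1 ≁ 9 ∷ 2 ≁ 9 ∷ 3 ≁ 9 ∷ 4 ≁ 9 ∷ 5 ≁ 9 ∷ 6 ≁ 9 ∷ 7 ≁ 9 ∷ 8 ≁ 9 ∷ 0 ≁ 10 ∷ 1 ≁ 10 ∷ 2 ≁ 10 ∷ 3 ≁ 10 ∷ 4 ≁ 10 ∷ 5 ≁ 10 ∷ 6 ≁ 10 ∷ 7 ≁ 10 ∷ 8 ≁ 10 ∷ []) ∷
   [])
  [] []
  (bad (0 – 5 ∷ 7 – 8 ∷ 3 – 10 ∷ 4 – 6 ∷ []) ∷ bad (1 – 6 ∷ 2 – 7 ∷ 0 – 10 ∷ 4 – 8 ∷ []) ∷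
   bad (2 – 7 ∷ 0 – 5 ∷ 3 – 10 ∷ 4 – 6 ∷ []) ∷ claw 0 1 5 9 ∷ bad (0 – 10 ∷ 5 – 6 ∷ 2 – 9 ∷ 7 – 8 ∷ []) ∷
   bad (9 – 10 ∷ 3 – 8 ∷ 0 – 5 ∷ 6 – 7 ∷ []) ∷ bad (8 – 9 ∷ 2 – 7 ∷ 0 – 5 ∷ 4 – 6 ∷ []) ∷
   bad (0 – 5 ∷ 2 – 7 ∷ 9 – 10 ∷ 6 – 8 ∷ []) ∷ claw 8 1 3 4 ∷ bad (3 – 9 ∷ 2 – 7 ∷ 0 – 5 ∷ 4 – 6 ∷ []) ∷
   bad (5 – 6 ∷ 4 – 8 ∷ 2 – 7 ∷ 1 – 10 ∷ []) ∷ bad (5 – 6 ∷ 7 – 8 ∷ 1 – 9 ∷ 3 – 10 ∷ []) ∷ claw 4 6 8 10 ∷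
   claw 0 1 5 10 ∷ bad (9 – 10 ∷ 4 – 8 ∷ 2 – 7 ∷ 1 – 5 ∷ []) ∷ claw 4 6 8 9 ∷
   bad (4 – 8 ∷ 2 – 3 ∷ 5 – 10 ∷ 0 – 1 ∷ []) ∷ bad (7 – 8 ∷ 1 – 6 ∷ 3 – 5 ∷ 9 – 10 ∷ []) ∷
   bad (0 – 9 ∷ 2 – 7 ∷ 1 – 6 ∷ 4 – 8 ∷ []) ∷ bad (0 – 5 ∷ 4 – 6 ∷ 3 – 8 ∷ 7 – 9 ∷ []) ∷
   bad (2 – 10 ∷ 1 – 6 ∷ 7 – 8 ∷ 5 – 9 ∷ []) ∷ bad (2 – 7 ∷ 1 – 9 ∷ 4 – 8 ∷ 5 – 6 ∷ []) ∷ claw 6 1 3 4 ∷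
   claw 8 3 4 9 ∷ bad (0 – 5 ∷ 2 – 3 ∷ 4 – 6 ∷ 7 – 10 ∷ []) ∷ bad (4 – 8 ∷ 0 – 6 ∷ 2 – 7 ∷ 5 – 10 ∷ []) ∷
   bad (4 – 6 ∷ 7 – 8 ∷ 2 – 10 ∷ 0 – 5 ∷ []) ∷ bad (0 – 5 ∷ 2 – 3 ∷ 4 – 6 ∷ 8 – 10 ∷ []) ∷
   bad (7 – 8 ∷ 3 – 9 ∷ 5 – 6 ∷ 0 – 10 ∷ []) ∷ claw 10 2 4 9 ∷ bad (0 – 5 ∷ 2 – 7 ∷ 4 – 8 ∷ 6 – 10 ∷ []) ∷
   bad (5 – 6 ∷ 1 – 7 ∷ 9 – 10 ∷ 3 – 8 ∷ []) ∷ bad (4 – 6 ∷ 2 – 9 ∷ 0 – 5 ∷ 7 – 8 ∷ []) ∷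
   bad (2 – 7 ∷ 5 – 9 ∷ 1 – 6 ∷ 4 – 8 ∷ []) ∷ bad (2 – 7 ∷ 5 – 6 ∷ 0 – 10 ∷ 4 – 8 ∷ []) ∷
   bad (6 – 9 ∷ 2 – 7 ∷ 0 – 5 ∷ 4 – 8 ∷ []) ∷ claw 8 3 4 10 ∷ bad (7 – 8 ∷ 1 – 10 ∷ 5 – 6 ∷ 3 – 9 ∷ []) ∷
   claw 9 2 4 10 ∷ bad (0 – 9 ∷ 5 – 6 ∷ 2 – 7 ∷ 8 – 10 ∷ []) ∷ bad (5 – 9 ∷ 4 – 8 ∷ 2 – 7 ∷ 0 – 6 ∷ []) ∷ [])
  refl

gate-left : Table 0
gate-left = table 11 gate (9 ~ 10 ∷ 0 ~ 9 ∷ 1 ~ 9 ∷ 2 ≁ 9 ∷ 3 ≁ 9 ∷ 0 ~ 10 ∷ 1 ~ 10 ∷ 2 ≁ 10 ∷ 3 ≁ 10 ∷ [])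
  ((1 ~ 5 ∷ 0 ~ 6 ∷ 5 ~ 9 ∷ 6 ~ 9 ∷ 7 ≁ 9 ∷ 8 ≁ 9 ∷ []) ∷ [])
  [] []
  (bad (5 – 6 ∷ 0 – 10 ∷ 3 – 8 ∷ 7 – 9 ∷ []) ∷ bad (0 – 10 ∷ 5 – 6 ∷ 2 – 7 ∷ 8 – 9 ∷ []) ∷
   bad (0 – 5 ∷ 7 – 8 ∷ 3 – 6 ∷ 9 – 10 ∷ []) ∷ bad (7 – 8 ∷ 3 – 5 ∷ 9 – 10 ∷ 1 – 6 ∷ []) ∷
   bad (1 – 6 ∷ 2 – 7 ∷ 0 – 10 ∷ 4 – 8 ∷ []) ∷ bad (0 – 5 ∷ 2 – 7 ∷ 4 – 8 ∷ 1 – 10 ∷ []) ∷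
   bad (2 – 7 ∷ 1 – 10 ∷ 5 – 9 ∷ 4 – 8 ∷ []) ∷ bad (4 – 8 ∷ 6 – 9 ∷ 2 – 7 ∷ 0 – 10 ∷ []) ∷ [])
  refl

gate-left-left : Table 0
gate-left-left = table 13 gate (9 ~ 10 ∷ 11 ~ 12 ∷ 0 ~ 9 ∷ 1 ~ 9 ∷ 2 ≁ 9 ∷ 3 ≁ 9 ∷ 0 ~ 10 ∷ 1 ~ 10 ∷ 2 ≁ 10 ∷ 3 ≁ 10 ∷ 0 ~ 11 ∷ 1 ~ 11 ∷ 2 ≁ 11 ∷ 3 ≁ 11 ∷ 0 ~ 12 ∷ 1 ~ 12 ∷ 2 ≁ 12 ∷ 3 ≁ 12 ∷ [])
  ((9 ~ 11 ∷ []) ∷ [])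
  [] []
  (bad (5 – 6 ∷ 1 – 10 ∷ 4 – 8 ∷ 2 – 7 ∷ 0 – 12 ∷ []) ∷ [])
  refl

gate-left-right : Table 0
gate-left-right = table 13 gate (9 ~ 10 ∷ 11 ~ 12 ∷ 0 ~ 9 ∷ 1 ~ 9 ∷ 2 ≁ 9 ∷ 3 ≁ 9 ∷ 0 ~ 10 ∷ 1 ~ 10 ∷ 2 ≁ 10 ∷ 3 ≁ 10 ∷ 2 ~ 11 ∷ 3 ~ 11 ∷ 0 ≁ 11 ∷ 1 ≁ 11 ∷ 2 ~ 12 ∷ 3 ~ 12 ∷ 0 ≁ 12 ∷ 1 ≁ 12 ∷ [])
  ((9 ≁ 11 ∷ []) ∷ [])
  [] []
  (bad (0 – 10 ∷ 9 – 11 ∷ 5 – 6 ∷ 2 – 12 ∷ 7 – 8 ∷ []) ∷ [])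
  refl

gate-far : Table 0
gate-far = table 13 gate (9 ~ 10 ∷ 11 ~ 12 ∷ 0 ≁ 9 ∷ 1 ≁ 9 ∷ 2 ≁ 9 ∷ 3 ≁ 9 ∷ 4 ≁ 9 ∷ 5 ≁ 9 ∷ 6 ≁ 9 ∷ 7 ≁ 9 ∷ 8 ≁ 9 ∷ 9 ~ 11 ∷ [])
  ((0 ≁ 11 ∷ 1 ≁ 11 ∷ 2 ≁ 11 ∷ 3 ≁ 11 ∷ 4 ≁ 11 ∷ 5 ≁ 11 ∷ 6 ≁ 11 ∷ 7 ≁ 11 ∷ 8 ≁ 11 ∷ []) ∷ [])
  [] []
  (bad (11 – 12 ∷ 0 – 1 ∷ 3 – 8 ∷ 5 – 6 ∷ 7 – 10 ∷ []) ∷ bad (5 – 6 ∷ 2 – 3 ∷ 7 – 8 ∷ 11 – 12 ∷ 1 – 10 ∷ []) ∷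
   bad (11 – 12 ∷ 7 – 8 ∷ 2 – 10 ∷ 0 – 1 ∷ 5 – 6 ∷ []) ∷ bad (11 – 12 ∷ 6 – 8 ∷ 9 – 10 ∷ 2 – 7 ∷ 0 – 5 ∷ []) ∷
   bad (8 – 11 ∷ 10 – 12 ∷ 4 – 6 ∷ 2 – 7 ∷ 0 – 5 ∷ []) ∷ bad (3 – 8 ∷ 0 – 5 ∷ 10 – 12 ∷ 6 – 11 ∷ 2 – 7 ∷ []) ∷
   bad (2 – 3 ∷ 5 – 6 ∷ 10 – 12 ∷ 7 – 8 ∷ 1 – 11 ∷ []) ∷ bad (3 – 8 ∷ 10 – 12 ∷ 1 – 6 ∷ 0 – 5 ∷ 7 – 11 ∷ []) ∷
   bad (5 – 6 ∷ 0 – 11 ∷ 10 – 12 ∷ 2 – 7 ∷ 4 – 8 ∷ []) ∷ bad (7 – 8 ∷ 1 – 6 ∷ 0 – 5 ∷ 10 – 12 ∷ 2 – 11 ∷ []) ∷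
   bad (5 – 11 ∷ 2 – 3 ∷ 1 – 6 ∷ 10 – 12 ∷ 7 – 8 ∷ []) ∷ bad (10 – 12 ∷ 0 – 1 ∷ 7 – 8 ∷ 5 – 6 ∷ 3 – 11 ∷ []) ∷
   bad (4 – 8 ∷ 0 – 1 ∷ 9 – 11 ∷ 2 – 3 ∷ 5 – 6 ∷ []) ∷ bad (3 – 8 ∷ 0 – 5 ∷ 9 – 11 ∷ 4 – 6 ∷ 7 – 12 ∷ []) ∷
   claw 4 6 8 11 ∷ [])
  refl

-- Tables: C₄ + K₁.

-- What survives is that an attached vertex sees exactly two consecutive corners. All four corner
-- tables list the same goals, so that their results share one type.
C₄-attach0 : Table 1
C₄-attach0 = table 7 (C₄+K₁ 0 1 2 3 4) (5 ~ 6 ∷ 0 ~ 5 ∷ [])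
  ((0 ~ 5 ∷ 1 ~ 5 ∷ 2 ≁ 5 ∷ 3 ≁ 5 ∷ []) ∷ (0 ≁ 5 ∷ 1 ~ 5 ∷ 2 ~ 5 ∷ 3 ≁ 5 ∷ []) ∷
   (0 ≁ 5 ∷ 1 ≁ 5 ∷ 2 ~ 5 ∷ 3 ~ 5 ∷ []) ∷ (0 ~ 5 ∷ 1 ≁ 5 ∷ 2 ≁ 5 ∷ 3 ~ 5 ∷ []) ∷ [])
  [] []
  (bad (2 – 6 ∷ 0 – 5 ∷ []) ∷ bad (2 – 5 ∷ 0 – 6 ∷ []) ∷ claw 0 1 3 5 ∷ bad (1 – 5 ∷ 3 – 6 ∷ []) ∷
   bad (1 – 6 ∷ 3 – 5 ∷ []) ∷ claw 5 0 2 6 ∷ claw 5 1 3 6 ∷ [])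
  refl

C₄-attach1 : Table 1
C₄-attach1 = table 7 (C₄+K₁ 0 1 2 3 4) (5 ~ 6 ∷ 1 ~ 5 ∷ [])
  ((0 ~ 5 ∷ 1 ~ 5 ∷ 2 ≁ 5 ∷ 3 ≁ 5 ∷ []) ∷ (0 ≁ 5 ∷ 1 ~ 5 ∷ 2 ~ 5 ∷ 3 ≁ 5 ∷ []) ∷
   (0 ≁ 5 ∷ 1 ≁ 5 ∷ 2 ~ 5 ∷ 3 ~ 5 ∷ []) ∷ (0 ~ 5 ∷ 1 ≁ 5 ∷ 2 ≁ 5 ∷ 3 ~ 5 ∷ []) ∷ [])
  [] []
  (claw 5 1 3 6 ∷ bad (3 – 6 ∷ 1 – 5 ∷ []) ∷ claw 1 0 2 5 ∷ bad (2 – 6 ∷ 0 – 5 ∷ []) ∷ bad (0 – 6 ∷ 2 – 5 ∷ []) ∷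
   bad (1 – 6 ∷ 3 – 5 ∷ []) ∷ claw 5 0 2 6 ∷ [])
  refl

C₄-attach2 : Table 1
C₄-attach2 = table 7 (C₄+K₁ 0 1 2 3 4) (5 ~ 6 ∷ 2 ~ 5 ∷ [])
  ((0 ~ 5 ∷ 1 ~ 5 ∷ 2 ≁ 5 ∷ 3 ≁ 5 ∷ []) ∷ (0 ≁ 5 ∷ 1 ~ 5 ∷ 2 ~ 5 ∷ 3 ≁ 5 ∷ []) ∷
   (0 ≁ 5 ∷ 1 ≁ 5 ∷ 2 ~ 5 ∷ 3 ~ 5 ∷ []) ∷ (0 ~ 5 ∷ 1 ≁ 5 ∷ 2 ≁ 5 ∷ 3 ~ 5 ∷ []) ∷ [])
  [] []
  (claw 5 0 2 6 ∷ claw 2 1 3 5 ∷ bad (2 – 5 ∷ 0 – 6 ∷ []) ∷ bad (3 – 6 ∷ 1 – 5 ∷ []) ∷ bad (3 – 5 ∷ 1 – 6 ∷ []) ∷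
   claw 5 1 3 6 ∷ bad (2 – 6 ∷ 0 – 5 ∷ []) ∷ [])
  refl

C₄-attach3 : Table 1
C₄-attach3 = table 7 (C₄+K₁ 0 1 2 3 4) (5 ~ 6 ∷ 3 ~ 5 ∷ [])
  ((0 ~ 5 ∷ 1 ~ 5 ∷ 2 ≁ 5 ∷ 3 ≁ 5 ∷ []) ∷ (0 ≁ 5 ∷ 1 ~ 5 ∷ 2 ~ 5 ∷ 3 ≁ 5 ∷ []) ∷
   (0 ≁ 5 ∷ 1 ≁ 5 ∷ 2 ~ 5 ∷ 3 ~ 5 ∷ []) ∷ (0 ~ 5 ∷ 1 ≁ 5 ∷ 2 ≁ 5 ∷ 3 ~ 5 ∷ []) ∷ [])
  [] []
  (claw 5 1 3 6 ∷ bad (2 – 5 ∷ 0 – 6 ∷ []) ∷ bad (0 – 5 ∷ 2 – 6 ∷ []) ∷ claw 5 0 2 6 ∷ claw 3 0 2 5 ∷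
   bad (3 – 6 ∷ 1 – 5 ∷ []) ∷ bad (1 – 6 ∷ 3 – 5 ∷ []) ∷ [])
  refl

-- The case in which the attached vertex 5 misses 4: all other outside vertices then avoid the
-- square, see 4 and form a clique with it, so 5 is a cut vertex.
cut-partner : Table 1
cut-partner = table 7 (C₄+K₁ 0 1 2 3 4) (5 ~ 6 ∷ 0 ~ 5 ∷ 1 ~ 5 ∷ 2 ≁ 5 ∷ 3 ≁ 5 ∷ 4 ≁ 5 ∷ [])
  ((0 ≁ 6 ∷ 1 ≁ 6 ∷ 2 ≁ 6 ∷ 3 ≁ 6 ∷ 4 ~ 6 ∷ []) ∷ [])
  [] []
  (bad (1 – 2 ∷ 0 – 6 ∷ []) ∷ bad (0 – 1 ∷ 3 – 6 ∷ []) ∷ bad (0 – 3 ∷ 1 – 6 ∷ []) ∷ bad (2 – 6 ∷ 0 – 1 ∷ []) ∷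
   bad (0 – 3 ∷ 1 – 5 ∷ []) ∷ [])
  refl

cut-other : Table 1
cut-other = table 9 (C₄+K₁ 0 1 2 3 4) (5 ~ 6 ∷ 7 ~ 8 ∷ 0 ~ 5 ∷ 1 ~ 5 ∷ 2 ≁ 5 ∷ 3 ≁ 5 ∷ 4 ≁ 5 ∷ [])
  ((0 ≁ 7 ∷ 1 ≁ 7 ∷ 2 ≁ 7 ∷ 3 ≁ 7 ∷ 4 ~ 7 ∷ 5 ~ 7 ∷ 6 ~ 7 ∷ []) ∷ [])
  (escape 2 3 4 8 5 (0 – 1 ∷ 6 – 7 ∷ []) ∷ escape 2 3 7 8 4 (0 – 1 ∷ 5 – 6 ∷ []) ∷
   escape 2 3 4 7 5 (0 – 1 ∷ 6 – 8 ∷ []) ∷ []) []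
  (bad (1 – 5 ∷ 0 – 3 ∷ 6 – 8 ∷ []) ∷ bad (6 – 8 ∷ 0 – 3 ∷ 1 – 7 ∷ []) ∷ bad (2 – 8 ∷ 0 – 5 ∷ 4 – 7 ∷ []) ∷
   bad (1 – 5 ∷ 4 – 8 ∷ 0 – 3 ∷ []) ∷ claw 2 1 3 7 ∷ bad (0 – 7 ∷ 2 – 8 ∷ 5 – 6 ∷ []) ∷ claw 0 1 3 8 ∷
   bad (1 – 7 ∷ 0 – 3 ∷ 5 – 6 ∷ []) ∷ bad (1 – 5 ∷ 0 – 3 ∷ 4 – 7 ∷ []) ∷ claw 5 0 6 8 ∷
   bad (4 – 8 ∷ 0 – 5 ∷ 2 – 7 ∷ []) ∷ bad (7 – 8 ∷ 0 – 3 ∷ 1 – 6 ∷ []) ∷ bad (0 – 1 ∷ 3 – 7 ∷ 6 – 8 ∷ []) ∷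
   bad (6 – 7 ∷ 0 – 3 ∷ 1 – 8 ∷ []) ∷ bad (5 – 6 ∷ 3 – 8 ∷ 1 – 2 ∷ []) ∷ bad (7 – 8 ∷ 0 – 1 ∷ 3 – 6 ∷ []) ∷
   bad (7 – 8 ∷ 0 – 6 ∷ 1 – 2 ∷ []) ∷ claw 0 1 3 7 ∷ bad (3 – 8 ∷ 6 – 7 ∷ 0 – 1 ∷ []) ∷
   bad (7 – 8 ∷ 0 – 5 ∷ 2 – 6 ∷ []) ∷ claw 5 1 6 7 ∷ claw 2 1 3 8 ∷ bad (0 – 1 ∷ 5 – 6 ∷ 3 – 7 ∷ []) ∷
   bad (2 – 3 ∷ 5 – 6 ∷ 1 – 8 ∷ []) ∷ [])
  refl

cut-clique : Table 1
cut-clique = table 11 (C₄+K₁ 0 1 2 3 4) (5 ~ 6 ∷ 7 ~ 8 ∷ 9 ~ 10 ∷ 0 ~ 5 ∷ 1 ~ 5 ∷ 2 ≁ 5 ∷ 3 ≁ 5 ∷ 4 ≁ 5 ∷ 0 ≁ 6 ∷ 1 ≁ 6 ∷ 2 ≁ 6 ∷ 3 ≁ 6 ∷ 4 ~ 6 ∷ 0 ≁ 7 ∷ 1 ≁ 7 ∷ 2 ≁ 7 ∷ 3 ≁ 7 ∷ 4 ~ 7 ∷ 5 ~ 7 ∷ 6 ~ 7 ∷ 0 ≁ 9 ∷ 1 ≁ 9 ∷ 2 ≁ 9 ∷ 3 ≁ 9 ∷ 4 ~ 9 ∷ 5 ~ 9 ∷ 6 ~ 9 ∷ [])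
  ((7 ~ 9 ∷ []) ∷ [])
  [] []
  (claw 5 0 7 9 ∷ [])
  refl

-- The case in which the attached vertex 5 also sees 4. An outside vertex then sees 4 and either no
-- corner, the corners 0 and 1, or the corners 2 and 3; the last kind cannot be the partner of 5.
hub-partner : Table 1
hub-partner = table 7 (C₄+K₁ 0 1 2 3 4) (5 ~ 6 ∷ 0 ~ 5 ∷ 1 ~ 5 ∷ 2 ≁ 5 ∷ 3 ≁ 5 ∷ 4 ~ 5 ∷ [])
  ((0 ≁ 6 ∷ 1 ≁ 6 ∷ 2 ≁ 6 ∷ 3 ≁ 6 ∷ 4 ~ 6 ∷ []) ∷ (0 ~ 6 ∷ 1 ~ 6 ∷ 2 ≁ 6 ∷ 3 ≁ 6 ∷ 4 ~ 6 ∷ []) ∷ [])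
  [] []
  (bad (1 – 5 ∷ 3 – 6 ∷ []) ∷ bad (0 – 5 ∷ 2 – 6 ∷ []) ∷ bad (0 – 5 ∷ 1 – 2 ∷ []) ∷ claw 1 0 2 6 ∷ claw 0 1 3 6 ∷
   [])
  refl

hub-other : Table 1
hub-other = table 9 (C₄+K₁ 0 1 2 3 4) (5 ~ 6 ∷ 7 ~ 8 ∷ 0 ~ 5 ∷ 1 ~ 5 ∷ 2 ≁ 5 ∷ 3 ≁ 5 ∷ 4 ~ 5 ∷ [])
  ((0 ≁ 7 ∷ 1 ≁ 7 ∷ 2 ≁ 7 ∷ 3 ≁ 7 ∷ 4 ~ 7 ∷ []) ∷ (0 ~ 7 ∷ 1 ~ 7 ∷ 2 ≁ 7 ∷ 3 ≁ 7 ∷ 4 ~ 7 ∷ []) ∷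
   (0 ≁ 7 ∷ 1 ≁ 7 ∷ 2 ~ 7 ∷ 3 ~ 7 ∷ 4 ~ 7 ∷ []) ∷ [])
  (escape 2 3 7 8 5 (0 – 1 ∷ 4 – 6 ∷ []) ∷ []) []
  (claw 2 1 3 7 ∷ bad (7 – 8 ∷ 1 – 5 ∷ 3 – 6 ∷ []) ∷ claw 0 1 3 7 ∷ claw 5 0 4 7 ∷
   bad (4 – 5 ∷ 0 – 1 ∷ 2 – 7 ∷ []) ∷ bad (0 – 1 ∷ 4 – 5 ∷ 3 – 7 ∷ []) ∷ bad (0 – 5 ∷ 6 – 8 ∷ 2 – 7 ∷ []) ∷
   bad (1 – 7 ∷ 3 – 8 ∷ 5 – 6 ∷ []) ∷ bad (2 – 8 ∷ 0 – 7 ∷ 5 – 6 ∷ []) ∷ claw 3 0 2 7 ∷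
   bad (0 – 6 ∷ 1 – 2 ∷ 4 – 8 ∷ []) ∷ bad (0 – 3 ∷ 7 – 8 ∷ 1 – 5 ∷ []) ∷ bad (6 – 8 ∷ 1 – 5 ∷ 3 – 7 ∷ []) ∷
   claw 1 0 2 7 ∷ bad (1 – 2 ∷ 6 – 8 ∷ 0 – 5 ∷ []) ∷ claw 5 1 4 8 ∷ bad (3 – 8 ∷ 1 – 2 ∷ 5 – 6 ∷ []) ∷
   bad (2 – 6 ∷ 7 – 8 ∷ 0 – 5 ∷ []) ∷ bad (0 – 3 ∷ 1 – 7 ∷ 4 – 5 ∷ []) ∷ bad (1 – 8 ∷ 5 – 6 ∷ 2 – 3 ∷ []) ∷
   claw 1 0 2 6 ∷ claw 5 1 6 8 ∷ bad (0 – 3 ∷ 5 – 6 ∷ 2 – 8 ∷ []) ∷ [])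
  refl

-- Vertices attached to opposite sides of the square, 5 to 01 and 7 to 23, lead to 𝒢₃: their
-- partners are attached in the same way, so each side contributes two vertices.
opposite-partners : Table 1
opposite-partners = table 9 (C₄+K₁ 0 1 2 3 4) (5 ~ 6 ∷ 7 ~ 8 ∷ 0 ~ 5 ∷ 1 ~ 5 ∷ 2 ≁ 5 ∷ 3 ≁ 5 ∷ 4 ~ 5 ∷ 0 ≁ 7 ∷ 1 ≁ 7 ∷ 2 ~ 7 ∷ 3 ~ 7 ∷ 4 ~ 7 ∷ [])
  ((0 ~ 6 ∷ 1 ~ 6 ∷ 2 ≁ 6 ∷ 3 ≁ 6 ∷ 4 ~ 6 ∷ 0 ≁ 8 ∷ 1 ≁ 8 ∷ 2 ~ 8 ∷ 3 ~ 8 ∷ 4 ~ 8 ∷ []) ∷ [])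
  [] []
  (bad (0 – 5 ∷ 2 – 6 ∷ 7 – 8 ∷ []) ∷ bad (5 – 6 ∷ 3 – 7 ∷ 1 – 8 ∷ []) ∷ bad (7 – 8 ∷ 1 – 5 ∷ 3 – 6 ∷ []) ∷
   bad (2 – 7 ∷ 0 – 5 ∷ 6 – 8 ∷ []) ∷ bad (5 – 6 ∷ 0 – 8 ∷ 2 – 7 ∷ []) ∷ bad (0 – 5 ∷ 1 – 2 ∷ 7 – 8 ∷ []) ∷
   bad (0 – 3 ∷ 2 – 7 ∷ 5 – 6 ∷ []) ∷ bad (1 – 5 ∷ 3 – 7 ∷ 4 – 6 ∷ []) ∷ bad (2 – 3 ∷ 4 – 7 ∷ 0 – 5 ∷ []) ∷
   bad (4 – 7 ∷ 1 – 2 ∷ 0 – 5 ∷ []) ∷ bad (3 – 7 ∷ 4 – 5 ∷ 1 – 2 ∷ []) ∷ [])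
  refl

opposite-other : Table 1
opposite-other = table 11 (C₄+K₁ 0 1 2 3 4) (5 ~ 6 ∷ 7 ~ 8 ∷ 9 ~ 10 ∷ 0 ~ 5 ∷ 1 ~ 5 ∷ 2 ≁ 5 ∷ 3 ≁ 5 ∷ 4 ~ 5 ∷ 0 ≁ 7 ∷ 1 ≁ 7 ∷ 2 ~ 7 ∷ 3 ~ 7 ∷ 4 ~ 7 ∷ [])
  ((0 ~ 9 ∷ 1 ~ 9 ∷ 2 ≁ 9 ∷ 3 ≁ 9 ∷ 4 ~ 9 ∷ []) ∷ (0 ≁ 9 ∷ 1 ≁ 9 ∷ 2 ~ 9 ∷ 3 ~ 9 ∷ 4 ~ 9 ∷ []) ∷ [])
  (escape 0 1 9 10 4 (2 – 3 ∷ 5 – 6 ∷ 7 – 8 ∷ []) ∷ []) []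
  (bad (0 – 5 ∷ 8 – 10 ∷ 6 – 9 ∷ 2 – 7 ∷ []) ∷ bad (1 – 10 ∷ 5 – 6 ∷ 4 – 7 ∷ 2 – 3 ∷ []) ∷
   bad (1 – 2 ∷ 7 – 8 ∷ 4 – 5 ∷ 0 – 10 ∷ []) ∷ bad (3 – 9 ∷ 1 – 10 ∷ 5 – 6 ∷ 7 – 8 ∷ []) ∷ claw 5 1 4 9 ∷
   bad (0 – 5 ∷ 7 – 8 ∷ 4 – 6 ∷ 2 – 9 ∷ []) ∷ bad (3 – 7 ∷ 1 – 8 ∷ 9 – 10 ∷ 5 – 6 ∷ []) ∷ claw 0 1 3 9 ∷
   bad (7 – 8 ∷ 3 – 10 ∷ 6 – 9 ∷ 1 – 5 ∷ []) ∷ bad (6 – 8 ∷ 2 – 7 ∷ 0 – 5 ∷ 9 – 10 ∷ []) ∷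
   bad (9 – 10 ∷ 5 – 6 ∷ 0 – 8 ∷ 2 – 7 ∷ []) ∷ bad (2 – 3 ∷ 9 – 10 ∷ 0 – 5 ∷ 4 – 7 ∷ []) ∷
   bad (1 – 2 ∷ 7 – 8 ∷ 3 – 10 ∷ 5 – 6 ∷ []) ∷ bad (3 – 7 ∷ 5 – 6 ∷ 8 – 9 ∷ 1 – 10 ∷ []) ∷ claw 9 1 3 4 ∷
   claw 0 1 3 10 ∷ bad (0 – 5 ∷ 7 – 8 ∷ 1 – 2 ∷ 6 – 10 ∷ []) ∷ bad (7 – 8 ∷ 9 – 10 ∷ 0 – 3 ∷ 1 – 5 ∷ []) ∷
   bad (2 – 3 ∷ 0 – 9 ∷ 4 – 7 ∷ 5 – 6 ∷ []) ∷ bad (0 – 6 ∷ 1 – 2 ∷ 7 – 8 ∷ 4 – 10 ∷ []) ∷ claw 1 0 2 6 ∷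
   bad (2 – 7 ∷ 0 – 3 ∷ 1 – 9 ∷ 4 – 5 ∷ []) ∷ bad (4 – 7 ∷ 0 – 5 ∷ 1 – 2 ∷ 8 – 10 ∷ []) ∷
   bad (7 – 8 ∷ 0 – 10 ∷ 2 – 9 ∷ 5 – 6 ∷ []) ∷ bad (5 – 6 ∷ 1 – 2 ∷ 4 – 9 ∷ 3 – 7 ∷ []) ∷
   bad (5 – 6 ∷ 2 – 7 ∷ 8 – 10 ∷ 0 – 9 ∷ []) ∷ bad (2 – 6 ∷ 7 – 8 ∷ 0 – 5 ∷ 9 – 10 ∷ []) ∷ claw 3 0 2 9 ∷
   bad (9 – 10 ∷ 7 – 8 ∷ 1 – 5 ∷ 3 – 6 ∷ []) ∷ [])
  refl

opposite-apart : Table 1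
opposite-apart = table 9 (C₄+K₁ 0 1 2 3 4) (5 ~ 6 ∷ 7 ~ 8 ∷ 0 ~ 5 ∷ 1 ~ 5 ∷ 2 ≁ 5 ∷ 3 ≁ 5 ∷ 4 ~ 5 ∷ 0 ≁ 7 ∷ 1 ≁ 7 ∷ 2 ~ 7 ∷ 3 ~ 7 ∷ 4 ~ 7 ∷ [])
  ((5 ≁ 7 ∷ []) ∷ [])
  [] []
  (bad (2 – 7 ∷ 6 – 8 ∷ 0 – 5 ∷ []) ∷ bad (5 – 6 ∷ 3 – 7 ∷ 1 – 8 ∷ []) ∷ bad (1 – 6 ∷ 5 – 8 ∷ 3 – 7 ∷ []) ∷
   claw 7 3 5 8 ∷ bad (0 – 3 ∷ 2 – 7 ∷ 4 – 5 ∷ []) ∷ bad (1 – 6 ∷ 5 – 7 ∷ 3 – 8 ∷ []) ∷ [])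
  refl

-- The two versions differ in the matching: one of the two far vertices is the partner of 5, or 5
-- and both of them have separate partners. If the far vertices are each other's partners there is
-- nothing to prove.
far-adjacent₁ : Table 1
far-adjacent₁ = table 9 (C₄+K₁ 0 1 2 3 4) (5 ~ 6 ∷ 7 ~ 8 ∷ 0 ~ 5 ∷ 1 ~ 5 ∷ 2 ≁ 5 ∷ 3 ≁ 5 ∷ 4 ~ 5 ∷ 0 ≁ 6 ∷ 1 ≁ 6 ∷ 2 ≁ 6 ∷ 3 ≁ 6 ∷ 4 ~ 6 ∷ 0 ≁ 7 ∷ 1 ≁ 7 ∷ 2 ≁ 7 ∷ 3 ≁ 7 ∷ 4 ~ 7 ∷ [])
  ((6 ~ 7 ∷ []) ∷ [])
  (escape 2 3 7 8 5 (0 – 1 ∷ 4 – 6 ∷ []) ∷ []) []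
  (bad (3 – 8 ∷ 4 – 7 ∷ 1 – 5 ∷ []) ∷ bad (4 – 7 ∷ 2 – 8 ∷ 0 – 5 ∷ []) ∷ claw 5 1 6 7 ∷
   bad (0 – 3 ∷ 4 – 8 ∷ 1 – 5 ∷ []) ∷ bad (4 – 5 ∷ 0 – 8 ∷ 1 – 2 ∷ []) ∷ claw 5 0 4 8 ∷ [])
  refl

far-adjacent₂ : Table 1
far-adjacent₂ = table 11 (C₄+K₁ 0 1 2 3 4) (5 ~ 6 ∷ 7 ~ 8 ∷ 9 ~ 10 ∷ 0 ~ 5 ∷ 1 ~ 5 ∷ 2 ≁ 5 ∷ 3 ≁ 5 ∷ 4 ~ 5 ∷ 0 ≁ 7 ∷ 1 ≁ 7 ∷ 2 ≁ 7 ∷ 3 ≁ 7 ∷ 4 ~ 7 ∷ 0 ≁ 9 ∷ 1 ≁ 9 ∷ 2 ≁ 9 ∷ 3 ≁ 9 ∷ 4 ~ 9 ∷ [])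
  ((7 ~ 9 ∷ []) ∷ [])
  [] []
  (bad (0 – 5 ∷ 9 – 10 ∷ 2 – 6 ∷ 7 – 8 ∷ []) ∷ bad (0 – 5 ∷ 2 – 10 ∷ 4 – 6 ∷ 7 – 8 ∷ []) ∷
   bad (0 – 3 ∷ 7 – 8 ∷ 9 – 10 ∷ 1 – 5 ∷ []) ∷ bad (0 – 5 ∷ 4 – 6 ∷ 2 – 8 ∷ 9 – 10 ∷ []) ∷
   bad (6 – 8 ∷ 0 – 5 ∷ 4 – 10 ∷ 2 – 3 ∷ []) ∷ bad (4 – 8 ∷ 0 – 5 ∷ 2 – 3 ∷ 6 – 10 ∷ []) ∷
   bad (1 – 5 ∷ 0 – 3 ∷ 9 – 10 ∷ 4 – 7 ∷ []) ∷ bad (9 – 10 ∷ 1 – 5 ∷ 0 – 3 ∷ 6 – 7 ∷ []) ∷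
   bad (1 – 5 ∷ 6 – 9 ∷ 7 – 8 ∷ 0 – 3 ∷ []) ∷ bad (0 – 3 ∷ 7 – 8 ∷ 1 – 5 ∷ 4 – 9 ∷ []) ∷ claw 4 6 7 9 ∷ [])
  refl

-- Three versions of one adjacency, with a second near vertex as witness: the near vertices are
-- partners, the far vertex is the partner of the second one, or all three have separate partners.
near-far₁ : Table 1
near-far₁ = table 9 (C₄+K₁ 0 1 2 3 4) (5 ~ 6 ∷ 7 ~ 8 ∷ 0 ~ 5 ∷ 1 ~ 5 ∷ 2 ≁ 5 ∷ 3 ≁ 5 ∷ 4 ~ 5 ∷ 0 ~ 6 ∷ 1 ~ 6 ∷ 2 ≁ 6 ∷ 3 ≁ 6 ∷ 4 ~ 6 ∷ 0 ≁ 7 ∷ 1 ≁ 7 ∷ 2 ≁ 7 ∷ 3 ≁ 7 ∷ 4 ~ 7 ∷ [])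
  ((5 ~ 7 ∷ []) ∷ [])
  [] []
  (bad (1 – 5 ∷ 3 – 8 ∷ 4 – 6 ∷ []) ∷ bad (0 – 6 ∷ 4 – 8 ∷ 1 – 2 ∷ []) ∷ bad (0 – 5 ∷ 4 – 7 ∷ 1 – 2 ∷ []) ∷
   bad (4 – 6 ∷ 0 – 3 ∷ 1 – 8 ∷ []) ∷ claw 6 1 4 8 ∷ [])
  refl

near-far₂ : Table 1
near-far₂ = table 9 (C₄+K₁ 0 1 2 3 4) (5 ~ 6 ∷ 7 ~ 8 ∷ 0 ~ 5 ∷ 1 ~ 5 ∷ 2 ≁ 5 ∷ 3 ≁ 5 ∷ 4 ~ 5 ∷ 0 ~ 7 ∷ 1 ~ 7 ∷ 2 ≁ 7 ∷ 3 ≁ 7 ∷ 4 ~ 7 ∷ 0 ≁ 8 ∷ 1 ≁ 8 ∷ 2 ≁ 8 ∷ 3 ≁ 8 ∷ 4 ~ 8 ∷ [])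
  ((5 ~ 8 ∷ []) ∷ [])
  [] []
  (claw 5 1 4 6 ∷ bad (4 – 7 ∷ 0 – 3 ∷ 1 – 6 ∷ []) ∷ bad (4 – 6 ∷ 0 – 3 ∷ 1 – 7 ∷ []) ∷ [])
  refl

near-far₃ : Table 1
near-far₃ = table 11 (C₄+K₁ 0 1 2 3 4) (5 ~ 6 ∷ 7 ~ 8 ∷ 9 ~ 10 ∷ 0 ~ 5 ∷ 1 ~ 5 ∷ 2 ≁ 5 ∷ 3 ≁ 5 ∷ 4 ~ 5 ∷ 0 ~ 7 ∷ 1 ~ 7 ∷ 2 ≁ 7 ∷ 3 ≁ 7 ∷ 4 ~ 7 ∷ 0 ≁ 9 ∷ 1 ≁ 9 ∷ 2 ≁ 9 ∷ 3 ≁ 9 ∷ 4 ~ 9 ∷ [])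
  ((5 ~ 9 ∷ []) ∷ [])
  [] []
  (bad (0 – 7 ∷ 5 – 6 ∷ 2 – 8 ∷ 9 – 10 ∷ []) ∷ bad (2 – 6 ∷ 7 – 8 ∷ 9 – 10 ∷ 0 – 5 ∷ []) ∷
   bad (1 – 5 ∷ 9 – 10 ∷ 0 – 3 ∷ 7 – 8 ∷ []) ∷ bad (4 – 6 ∷ 7 – 8 ∷ 2 – 10 ∷ 0 – 5 ∷ []) ∷
   bad (0 – 3 ∷ 5 – 6 ∷ 4 – 9 ∷ 1 – 7 ∷ []) ∷ bad (4 – 6 ∷ 1 – 7 ∷ 0 – 3 ∷ 8 – 10 ∷ []) ∷ [])
  refl

-- Tables: K₂ + P₃ and P₅.

-- A vertex attached to the K₂ sees both of its ends and at most one end of the P₃. If it sees one,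
-- `to-P₅-012` or `to-P₅-014` matches 1 with its partner, and an induced P₅ through 0 remains.
near-K₂0 : Table 2
near-K₂0 = table 7 (K₂+P₃ 0 1 2 3 4) (5 ~ 6 ∷ 0 ~ 5 ∷ [])
  ((0 ~ 5 ∷ 1 ~ 5 ∷ 2 ≁ 5 ∷ 3 ≁ 5 ∷ 4 ≁ 5 ∷ []) ∷ (0 ~ 5 ∷ 1 ~ 5 ∷ 2 ~ 5 ∷ 3 ≁ 5 ∷ 4 ≁ 5 ∷ []) ∷
   (0 ~ 5 ∷ 1 ~ 5 ∷ 2 ≁ 5 ∷ 3 ≁ 5 ∷ 4 ~ 5 ∷ []) ∷ [])
  [] (escape 0 1 6 5 2 (3 – 4 ∷ []) ∷ escape 0 1 6 5 4 (2 – 3 ∷ []) ∷ escape 2 3 4 6 1 (0 – 5 ∷ []) ∷ [])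
  (bad (3 – 4 ∷ 0 – 5 ∷ []) ∷ claw 5 0 2 4 ∷ bad (3 – 6 ∷ 0 – 5 ∷ []) ∷ bad (2 – 3 ∷ 0 – 5 ∷ []) ∷
   bad (3 – 4 ∷ 0 – 6 ∷ []) ∷ bad (1 – 6 ∷ 3 – 5 ∷ []) ∷ claw 6 1 2 5 ∷ claw 6 1 4 5 ∷ bad (2 – 3 ∷ 0 – 6 ∷ []) ∷
   [])
  refl

near-K₂1 : Table 2
near-K₂1 = table 7 (K₂+P₃ 0 1 2 3 4) (5 ~ 6 ∷ 1 ~ 5 ∷ [])
  ((0 ~ 5 ∷ 1 ~ 5 ∷ 2 ≁ 5 ∷ 3 ≁ 5 ∷ 4 ≁ 5 ∷ []) ∷ (0 ~ 5 ∷ 1 ~ 5 ∷ 2 ~ 5 ∷ 3 ≁ 5 ∷ 4 ≁ 5 ∷ []) ∷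
   (0 ~ 5 ∷ 1 ~ 5 ∷ 2 ≁ 5 ∷ 3 ≁ 5 ∷ 4 ~ 5 ∷ []) ∷ [])
  [] (escape 0 1 5 6 4 (2 – 3 ∷ []) ∷ escape 2 3 4 6 0 (1 – 5 ∷ []) ∷ escape 0 1 5 6 2 (3 – 4 ∷ []) ∷ [])
  (bad (3 – 4 ∷ 1 – 5 ∷ []) ∷ claw 5 1 2 6 ∷ bad (3 – 5 ∷ 0 – 6 ∷ []) ∷ bad (2 – 3 ∷ 1 – 6 ∷ []) ∷
   bad (1 – 5 ∷ 3 – 6 ∷ []) ∷ claw 6 0 2 5 ∷ bad (1 – 5 ∷ 2 – 3 ∷ []) ∷ bad (3 – 4 ∷ 1 – 6 ∷ []) ∷ claw 6 0 2 4 ∷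
   claw 5 1 2 4 ∷ [])
  refl

spread-partner : Table 2
spread-partner = table 7 (K₂+P₃ 0 1 2 3 4) (5 ~ 6 ∷ 0 ~ 5 ∷ 1 ~ 5 ∷ 2 ≁ 5 ∷ 3 ≁ 5 ∷ 4 ≁ 5 ∷ [])
  ((0 ~ 6 ∷ []) ∷ [])
  [] []
  (bad (3 – 4 ∷ 1 – 5 ∷ []) ∷ bad (1 – 5 ∷ 2 – 3 ∷ []) ∷ claw 6 2 4 5 ∷ [])
  refl

spread-other : Table 2
spread-other = table 9 (K₂+P₃ 0 1 2 3 4) (5 ~ 6 ∷ 7 ~ 8 ∷ 0 ~ 5 ∷ 1 ~ 5 ∷ 2 ≁ 5 ∷ 3 ≁ 5 ∷ 4 ≁ 5 ∷ 5 ~ 7 ∷ [])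
  ((0 ~ 7 ∷ []) ∷ [])
  [] (escape 2 3 4 8 1 (0 – 6 ∷ 5 – 7 ∷ []) ∷ [])
  (bad (5 – 7 ∷ 0 – 6 ∷ 3 – 4 ∷ []) ∷ bad (1 – 8 ∷ 5 – 6 ∷ 3 – 4 ∷ []) ∷ bad (2 – 3 ∷ 7 – 8 ∷ 1 – 5 ∷ []) ∷
   bad (5 – 6 ∷ 2 – 3 ∷ 1 – 8 ∷ []) ∷ claw 7 2 4 5 ∷ bad (0 – 6 ∷ 5 – 7 ∷ 2 – 3 ∷ []) ∷ claw 6 2 4 5 ∷
   bad (1 – 5 ∷ 7 – 8 ∷ 3 – 4 ∷ []) ∷ bad (3 – 8 ∷ 0 – 6 ∷ 5 – 7 ∷ []) ∷ [])
  refl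

to-P₅-012 : Table 2
to-P₅-012 = table 7 (K₂+P₃ 0 1 2 3 4) (5 ~ 6 ∷ 0 ~ 5 ∷ 1 ~ 5 ∷ 2 ~ 5 ∷ 3 ≁ 5 ∷ 4 ≁ 5 ∷ [])
  ((1 ~ 6 ∷ []) ∷ [])
  [] (escape 2 3 4 6 1 (0 – 5 ∷ []) ∷ [])
  (bad (3 – 6 ∷ 1 – 5 ∷ []) ∷ claw 5 1 2 6 ∷ bad (0 – 5 ∷ 2 – 3 ∷ []) ∷ [])
  refl

to-P₅-014 : Table 2
to-P₅-014 = table 7 (K₂+P₃ 0 1 2 3 4) (5 ~ 6 ∷ 0 ~ 5 ∷ 1 ~ 5 ∷ 2 ≁ 5 ∷ 3 ≁ 5 ∷ 4 ~ 5 ∷ [])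
  ((1 ~ 6 ∷ []) ∷ [])
  [] (escape 2 3 4 6 1 (0 – 5 ∷ []) ∷ [])
  (bad (1 – 5 ∷ 3 – 6 ∷ []) ∷ bad (3 – 4 ∷ 0 – 5 ∷ []) ∷ claw 5 1 4 6 ∷ [])
  refl

-- The first two goals are the two kinds of matching edge in a graph of 𝒢₂₂ or 𝒢₂₃ with the path in
-- this direction. The others are obstructions: a sharp vertex at either end, a blunt and a full
-- vertex in either order, a neighbour of 0 alone at either end.
P₅-edge : Table 2
P₅-edge = table 7 (P₅ 0 1 2 3 4) (5 ~ 6 ∷ [])
  ((0 ~ 5 ∷ 3 ≁ 5 ∷ 0 ~ 6 ∷ 3 ≁ 6 ∷ []) ∷ (2 ~ 5 ∷ 3 ~ 5 ∷ 0 ≁ 5 ∷ 2 ~ 6 ∷ 3 ~ 6 ∷ 0 ≁ 6 ∷ []) ∷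
   (3 ~ 5 ∷ 4 ~ 5 ∷ 1 ≁ 5 ∷ 2 ≁ 5 ∷ []) ∷ (3 ~ 6 ∷ 4 ~ 6 ∷ 1 ≁ 6 ∷ 2 ≁ 6 ∷ []) ∷
   (0 ~ 5 ∷ 1 ≁ 5 ∷ 2 ≁ 5 ∷ 3 ≁ 5 ∷ 4 ~ 5 ∷ 0 ≁ 6 ∷ 1 ≁ 6 ∷ 2 ~ 6 ∷ 3 ~ 6 ∷ 4 ~ 6 ∷ []) ∷
   (0 ≁ 5 ∷ 1 ≁ 5 ∷ 2 ~ 5 ∷ 3 ~ 5 ∷ 4 ~ 5 ∷ 0 ~ 6 ∷ 1 ≁ 6 ∷ 2 ≁ 6 ∷ 3 ≁ 6 ∷ 4 ~ 6 ∷ []) ∷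
   (0 ~ 5 ∷ 1 ≁ 5 ∷ 2 ≁ 5 ∷ 3 ≁ 5 ∷ 4 ≁ 5 ∷ []) ∷ (0 ~ 6 ∷ 1 ≁ 6 ∷ 2 ≁ 6 ∷ 3 ≁ 6 ∷ 4 ≁ 6 ∷ []) ∷ [])
  (escape 0 1 5 6 4 (2 – 3 ∷ []) ∷ []) (escape 3 4 6 5 0 (1 – 2 ∷ []) ∷ escape 0 1 2 6 4 (3 – 5 ∷ []) ∷ escape 3 4 5 6 0 (1 – 2 ∷ []) ∷
   escape 2 3 4 5 0 (1 – 6 ∷ []) ∷ escape 0 1 2 5 4 (3 – 6 ∷ []) ∷ escape 2 3 4 6 0 (1 – 5 ∷ []) ∷ [])
  (bad (3 – 4 ∷ 1 – 5 ∷ []) ∷ bad (2 – 3 ∷ 1 – 6 ∷ []) ∷ claw 6 0 3 5 ∷ claw 3 2 4 5 ∷ bad (1 – 2 ∷ 4 – 6 ∷ []) ∷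
   bad (3 – 4 ∷ 1 – 6 ∷ []) ∷ bad (4 – 5 ∷ 1 – 2 ∷ []) ∷ claw 5 1 3 6 ∷ bad (2 – 3 ∷ 0 – 6 ∷ []) ∷ claw 6 1 3 5 ∷
   claw 5 0 2 4 ∷ bad (2 – 3 ∷ 1 – 5 ∷ []) ∷ claw 3 2 4 6 ∷ claw 2 1 3 5 ∷ bad (3 – 5 ∷ 1 – 6 ∷ []) ∷
   claw 2 1 3 6 ∷ bad (1 – 5 ∷ 3 – 6 ∷ []) ∷ claw 5 0 3 6 ∷ claw 6 0 2 4 ∷ bad (2 – 3 ∷ 0 – 5 ∷ []) ∷ [])
  refl

-- A vertex attached only to the end 0 of the path has a partner attached only to the end 4, which
-- closes a seven-cycle; `C₇-alone` then leaves room for no further edge.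
C₇-partner : Table 2
C₇-partner = table 7 (P₅ 0 1 2 3 4) (5 ~ 6 ∷ 0 ~ 5 ∷ 1 ≁ 5 ∷ 2 ≁ 5 ∷ 3 ≁ 5 ∷ 4 ≁ 5 ∷ [])
  ((0 ≁ 6 ∷ 1 ≁ 6 ∷ 2 ≁ 6 ∷ 3 ≁ 6 ∷ 4 ~ 6 ∷ []) ∷ [])
  [] (escape 0 1 6 5 4 (2 – 3 ∷ []) ∷ [])
  (bad (0 – 6 ∷ 2 – 3 ∷ []) ∷ bad (3 – 6 ∷ 0 – 1 ∷ []) ∷ claw 6 1 4 5 ∷ bad (0 – 5 ∷ 2 – 3 ∷ []) ∷ claw 2 1 3 6 ∷
   [])
  refl

C₇-alone : Table 2
C₇-alone = table 9 (P₅ 0 1 2 3 4) (5 ~ 6 ∷ 7 ~ 8 ∷ 0 ~ 5 ∷ 1 ≁ 5 ∷ 2 ≁ 5 ∷ 3 ≁ 5 ∷ 4 ≁ 5 ∷ 0 ≁ 6 ∷ 1 ≁ 6 ∷ 2 ≁ 6 ∷ 3 ≁ 6 ∷ 4 ~ 6 ∷ [])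
  []
  (escape 5 6 7 8 2 (0 – 1 ∷ 3 – 4 ∷ []) ∷ []) []
  (bad (2 – 7 ∷ 0 – 5 ∷ 4 – 8 ∷ []) ∷ claw 4 3 6 7 ∷ claw 0 1 5 8 ∷ claw 6 4 5 7 ∷
   bad (1 – 8 ∷ 3 – 4 ∷ 0 – 5 ∷ []) ∷ bad (5 – 7 ∷ 4 – 6 ∷ 1 – 2 ∷ []) ∷ bad (4 – 7 ∷ 5 – 8 ∷ 1 – 2 ∷ []) ∷
   bad (1 – 2 ∷ 5 – 7 ∷ 4 – 8 ∷ []) ∷ bad (1 – 7 ∷ 2 – 3 ∷ 5 – 6 ∷ []) ∷ bad (0 – 5 ∷ 4 – 7 ∷ 2 – 8 ∷ []) ∷
   bad (6 – 7 ∷ 3 – 4 ∷ 0 – 1 ∷ []) ∷ claw 2 1 3 7 ∷ bad (0 – 8 ∷ 4 – 6 ∷ 2 – 7 ∷ []) ∷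
   bad (5 – 8 ∷ 0 – 1 ∷ 3 – 4 ∷ []) ∷ bad (3 – 7 ∷ 5 – 6 ∷ 1 – 2 ∷ []) ∷ bad (0 – 1 ∷ 5 – 6 ∷ 3 – 8 ∷ []) ∷
   bad (6 – 8 ∷ 0 – 1 ∷ 3 – 4 ∷ []) ∷ bad (6 – 7 ∷ 0 – 8 ∷ 2 – 3 ∷ []) ∷ claw 2 1 3 8 ∷ [])
  refl

-- An obstruction to the left-hand description makes the description with the path reversed hold for
-- every matching edge 56. The seven tables differ in which of the obstructing vertices lie on that
-- edge and which are partners.
right₁ : Table 2
right₁ = table 7 (P₅ 0 1 2 3 4) (5 ~ 6 ∷ 3 ~ 5 ∷ 4 ~ 5 ∷ 1 ≁ 5 ∷ 2 ≁ 5 ∷ [])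
  ((4 ~ 5 ∷ 1 ≁ 5 ∷ 4 ~ 6 ∷ 1 ≁ 6 ∷ []) ∷ [])
  [] (escape 0 1 2 6 4 (3 – 5 ∷ []) ∷ [])
  (bad (1 – 6 ∷ 3 – 5 ∷ []) ∷ bad (3 – 5 ∷ 0 – 1 ∷ []) ∷ bad (3 – 5 ∷ 1 – 2 ∷ []) ∷ [])
  refl

right₂ : Table 2
right₂ = table 9 (P₅ 0 1 2 3 4) (5 ~ 6 ∷ 7 ~ 8 ∷ 3 ~ 7 ∷ 4 ~ 7 ∷ 1 ≁ 7 ∷ 2 ≁ 7 ∷ [])
  ((4 ~ 5 ∷ 1 ≁ 5 ∷ 4 ~ 6 ∷ 1 ≁ 6 ∷ []) ∷ (2 ~ 5 ∷ 1 ~ 5 ∷ 4 ≁ 5 ∷ 2 ~ 6 ∷ 1 ~ 6 ∷ 4 ≁ 6 ∷ []) ∷ [])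
  (escape 0 6 4 7 2 (1 – 5 ∷ 3 – 8 ∷ []) ∷ escape 0 5 4 7 2 (1 – 6 ∷ 3 – 8 ∷ []) ∷
   escape 3 4 5 6 0 (1 – 2 ∷ 7 – 8 ∷ []) ∷ []) (escape 0 1 2 6 4 (3 – 7 ∷ 5 – 8 ∷ []) ∷ escape 2 3 4 5 0 (1 – 6 ∷ 7 – 8 ∷ []) ∷
   escape 0 5 4 7 2 (1 – 6 ∷ 3 – 8 ∷ []) ∷ escape 0 1 2 5 4 (3 – 7 ∷ 6 – 8 ∷ []) ∷
   escape 0 6 4 7 2 (1 – 5 ∷ 3 – 8 ∷ []) ∷ escape 2 3 4 6 0 (1 – 5 ∷ 7 – 8 ∷ []) ∷ [])
  (bad (5 – 6 ∷ 1 – 8 ∷ 3 – 7 ∷ []) ∷ bad (2 – 3 ∷ 0 – 6 ∷ 7 – 8 ∷ []) ∷ bad (2 – 3 ∷ 1 – 5 ∷ 7 – 8 ∷ []) ∷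
   claw 6 0 2 4 ∷ bad (5 – 8 ∷ 3 – 7 ∷ 0 – 1 ∷ []) ∷ bad (3 – 8 ∷ 6 – 7 ∷ 1 – 5 ∷ []) ∷
   bad (4 – 7 ∷ 2 – 3 ∷ 0 – 5 ∷ []) ∷ bad (5 – 7 ∷ 3 – 8 ∷ 1 – 6 ∷ []) ∷ bad (1 – 5 ∷ 3 – 7 ∷ 6 – 8 ∷ []) ∷
   bad (7 – 8 ∷ 3 – 5 ∷ 1 – 2 ∷ []) ∷ bad (5 – 6 ∷ 4 – 7 ∷ 1 – 2 ∷ []) ∷ bad (1 – 2 ∷ 7 – 8 ∷ 3 – 6 ∷ []) ∷
   bad (5 – 8 ∷ 1 – 6 ∷ 3 – 7 ∷ []) ∷ claw 2 1 3 5 ∷ bad (6 – 8 ∷ 3 – 7 ∷ 0 – 1 ∷ []) ∷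
   bad (1 – 5 ∷ 3 – 8 ∷ 0 – 7 ∷ []) ∷ bad (5 – 8 ∷ 1 – 2 ∷ 4 – 7 ∷ []) ∷ bad (7 – 8 ∷ 3 – 5 ∷ 1 – 6 ∷ []) ∷
   bad (2 – 5 ∷ 0 – 8 ∷ 4 – 7 ∷ []) ∷ claw 5 0 2 4 ∷ bad (4 – 8 ∷ 0 – 1 ∷ 3 – 6 ∷ []) ∷ claw 2 1 3 6 ∷
   bad (7 – 8 ∷ 1 – 2 ∷ 4 – 6 ∷ []) ∷ claw 3 2 4 5 ∷ bad (1 – 6 ∷ 3 – 8 ∷ 0 – 7 ∷ []) ∷
   bad (4 – 7 ∷ 2 – 3 ∷ 0 – 6 ∷ []) ∷ bad (7 – 8 ∷ 1 – 2 ∷ 4 – 5 ∷ []) ∷ claw 1 0 2 5 ∷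
   bad (1 – 6 ∷ 3 – 8 ∷ 4 – 5 ∷ []) ∷ bad (3 – 8 ∷ 1 – 2 ∷ 5 – 7 ∷ []) ∷ bad (3 – 7 ∷ 1 – 2 ∷ 4 – 6 ∷ []) ∷
   claw 3 2 4 6 ∷ bad (1 – 2 ∷ 4 – 7 ∷ 0 – 6 ∷ []) ∷ bad (3 – 8 ∷ 4 – 6 ∷ 1 – 5 ∷ []) ∷
   bad (7 – 8 ∷ 3 – 6 ∷ 1 – 5 ∷ []) ∷ bad (5 – 6 ∷ 3 – 7 ∷ 1 – 2 ∷ []) ∷ claw 1 0 2 6 ∷
   bad (4 – 7 ∷ 2 – 6 ∷ 0 – 8 ∷ []) ∷ [])
  refl

right₃ : Table 2
right₃ = table 7 (P₅ 0 1 2 3 4) (5 ~ 6 ∷ 0 ~ 5 ∷ 1 ≁ 5 ∷ 2 ≁ 5 ∷ 3 ≁ 5 ∷ 4 ~ 5 ∷ 0 ≁ 6 ∷ 1 ≁ 6 ∷ 2 ~ 6 ∷ 3 ~ 6 ∷ 4 ~ 6 ∷ [])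
  ((4 ~ 5 ∷ 1 ≁ 5 ∷ 4 ~ 6 ∷ 1 ≁ 6 ∷ []) ∷ [])
  [] []
  []
  refl

right₄ : Table 2
right₄ = table 9 (P₅ 0 1 2 3 4) (5 ~ 6 ∷ 7 ~ 8 ∷ 0 ~ 7 ∷ 1 ≁ 7 ∷ 2 ≁ 7 ∷ 3 ≁ 7 ∷ 4 ~ 7 ∷ 0 ≁ 8 ∷ 1 ≁ 8 ∷ 2 ~ 8 ∷ 3 ~ 8 ∷ 4 ~ 8 ∷ [])
  ((4 ~ 5 ∷ 1 ≁ 5 ∷ 4 ~ 6 ∷ 1 ≁ 6 ∷ []) ∷ (2 ~ 5 ∷ 1 ~ 5 ∷ 4 ≁ 5 ∷ 2 ~ 6 ∷ 1 ~ 6 ∷ 4 ≁ 6 ∷ []) ∷ [])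
  (escape 0 7 5 6 3 (1 – 2 ∷ 4 – 8 ∷ []) ∷ []) []
  (bad (3 – 5 ∷ 2 – 8 ∷ 0 – 7 ∷ []) ∷ bad (0 – 7 ∷ 1 – 5 ∷ 3 – 8 ∷ []) ∷ bad (3 – 6 ∷ 1 – 5 ∷ 7 – 8 ∷ []) ∷
   bad (3 – 5 ∷ 7 – 8 ∷ 1 – 6 ∷ []) ∷ bad (4 – 6 ∷ 0 – 5 ∷ 2 – 8 ∷ []) ∷ claw 7 0 6 8 ∷
   bad (7 – 8 ∷ 2 – 3 ∷ 0 – 6 ∷ []) ∷ bad (6 – 8 ∷ 0 – 7 ∷ 2 – 3 ∷ []) ∷ bad (3 – 8 ∷ 6 – 7 ∷ 1 – 5 ∷ []) ∷
   claw 2 1 3 6 ∷ claw 4 3 6 7 ∷ bad (2 – 8 ∷ 1 – 6 ∷ 4 – 7 ∷ []) ∷ bad (5 – 7 ∷ 0 – 1 ∷ 3 – 8 ∷ []) ∷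
   claw 4 3 5 7 ∷ bad (1 – 2 ∷ 0 – 5 ∷ 4 – 8 ∷ []) ∷ bad (2 – 8 ∷ 0 – 7 ∷ 3 – 6 ∷ []) ∷
   bad (0 – 7 ∷ 2 – 6 ∷ 4 – 8 ∷ []) ∷ [])
  refl

right₅ : Table 2
right₅ = table 9 (P₅ 0 1 2 3 4) (5 ~ 6 ∷ 7 ~ 8 ∷ 0 ~ 5 ∷ 1 ≁ 5 ∷ 2 ≁ 5 ∷ 3 ≁ 5 ∷ 4 ~ 5 ∷ 0 ≁ 7 ∷ 1 ≁ 7 ∷ 2 ~ 7 ∷ 3 ~ 7 ∷ 4 ~ 7 ∷ [])
  ((4 ~ 5 ∷ 1 ≁ 5 ∷ 4 ~ 6 ∷ 1 ≁ 6 ∷ []) ∷ [])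
  [] []
  (claw 5 0 4 6 ∷ claw 6 1 3 5 ∷ bad (4 – 5 ∷ 1 – 2 ∷ 7 – 8 ∷ []) ∷ claw 7 2 4 8 ∷
   bad (2 – 7 ∷ 4 – 8 ∷ 0 – 6 ∷ []) ∷ bad (2 – 8 ∷ 0 – 6 ∷ 4 – 7 ∷ []) ∷ [])
  refl

right₆ : Table 2
right₆ = table 9 (P₅ 0 1 2 3 4) (5 ~ 6 ∷ 7 ~ 8 ∷ 0 ~ 7 ∷ 1 ≁ 7 ∷ 2 ≁ 7 ∷ 3 ≁ 7 ∷ 4 ~ 7 ∷ 0 ≁ 5 ∷ 1 ≁ 5 ∷ 2 ~ 5 ∷ 3 ~ 5 ∷ 4 ~ 5 ∷ [])
  ((4 ~ 5 ∷ 1 ≁ 5 ∷ 4 ~ 6 ∷ 1 ≁ 6 ∷ []) ∷ [])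
  [] []
  (bad (7 – 8 ∷ 3 – 5 ∷ 1 – 6 ∷ []) ∷ claw 5 2 4 6 ∷ bad (7 – 8 ∷ 1 – 2 ∷ 3 – 5 ∷ []) ∷
   bad (2 – 5 ∷ 0 – 6 ∷ 4 – 8 ∷ []) ∷ bad (2 – 6 ∷ 0 – 8 ∷ 4 – 5 ∷ []) ∷ claw 7 0 4 8 ∷ [])
  refl

right₇ : Table 2
right₇ = table 11 (P₅ 0 1 2 3 4) (5 ~ 6 ∷ 7 ~ 8 ∷ 9 ~ 10 ∷ 0 ~ 7 ∷ 1 ≁ 7 ∷ 2 ≁ 7 ∷ 3 ≁ 7 ∷ 4 ~ 7 ∷ 0 ≁ 9 ∷ 1 ≁ 9 ∷ 2 ~ 9 ∷ 3 ~ 9 ∷ 4 ~ 9 ∷ [])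
  ((4 ~ 5 ∷ 1 ≁ 5 ∷ 4 ~ 6 ∷ 1 ≁ 6 ∷ []) ∷ (2 ~ 5 ∷ 1 ~ 5 ∷ 4 ≁ 5 ∷ 2 ~ 6 ∷ 1 ~ 6 ∷ 4 ≁ 6 ∷ []) ∷ [])
  (escape 3 4 5 6 0 (1 – 2 ∷ 7 – 8 ∷ 9 – 10 ∷ []) ∷ []) (escape 0 1 2 10 4 (3 – 9 ∷ 5 – 6 ∷ 7 – 8 ∷ []) ∷ [])
  (bad (4 – 7 ∷ 9 – 10 ∷ 5 – 6 ∷ 1 – 2 ∷ []) ∷ claw 8 1 3 7 ∷ claw 0 1 5 7 ∷ claw 4 3 6 7 ∷
   bad (1 – 2 ∷ 3 – 5 ∷ 9 – 10 ∷ 7 – 8 ∷ []) ∷ bad (7 – 8 ∷ 0 – 5 ∷ 3 – 4 ∷ 2 – 9 ∷ []) ∷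
   bad (6 – 10 ∷ 1 – 5 ∷ 7 – 8 ∷ 3 – 9 ∷ []) ∷ bad (0 – 7 ∷ 5 – 6 ∷ 3 – 4 ∷ 2 – 9 ∷ []) ∷
   bad (2 – 9 ∷ 3 – 4 ∷ 1 – 5 ∷ 7 – 8 ∷ []) ∷ claw 9 2 4 10 ∷ bad (5 – 6 ∷ 1 – 10 ∷ 7 – 8 ∷ 3 – 9 ∷ []) ∷
   bad (0 – 10 ∷ 4 – 8 ∷ 2 – 9 ∷ 5 – 6 ∷ []) ∷ bad (3 – 9 ∷ 1 – 2 ∷ 4 – 5 ∷ 7 – 8 ∷ []) ∷ claw 0 1 6 7 ∷
   claw 7 0 4 8 ∷ bad (6 – 7 ∷ 8 – 10 ∷ 1 – 2 ∷ 3 – 9 ∷ []) ∷ bad (3 – 8 ∷ 5 – 7 ∷ 9 – 10 ∷ 1 – 6 ∷ []) ∷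
   bad (0 – 8 ∷ 4 – 10 ∷ 2 – 9 ∷ 5 – 6 ∷ []) ∷ bad (3 – 6 ∷ 9 – 10 ∷ 7 – 8 ∷ 1 – 2 ∷ []) ∷
   bad (6 – 10 ∷ 7 – 8 ∷ 4 – 9 ∷ 1 – 2 ∷ []) ∷ bad (1 – 6 ∷ 3 – 5 ∷ 9 – 10 ∷ 7 – 8 ∷ []) ∷
   bad (4 – 9 ∷ 8 – 10 ∷ 1 – 2 ∷ 0 – 6 ∷ []) ∷ bad (4 – 5 ∷ 8 – 10 ∷ 0 – 6 ∷ 2 – 9 ∷ []) ∷
   bad (3 – 9 ∷ 7 – 8 ∷ 1 – 2 ∷ 5 – 6 ∷ []) ∷ bad (6 – 10 ∷ 4 – 8 ∷ 0 – 5 ∷ 2 – 9 ∷ []) ∷ [])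
  refl

left-A : Table 2
left-A = table 7 (P₅ 0 1 2 3 4) (5 ~ 6 ∷ 0 ~ 5 ∷ 3 ≁ 5 ∷ 0 ~ 6 ∷ 3 ≁ 6 ∷ [])
  ((0 ~ 5 ∷ 1 ~ 5 ∷ 2 ≁ 5 ∷ 3 ≁ 5 ∷ 4 ≁ 5 ∷ []) ∷ (0 ~ 5 ∷ 1 ~ 5 ∷ 2 ~ 5 ∷ 3 ≁ 5 ∷ 4 ≁ 5 ∷ []) ∷
   (0 ~ 5 ∷ 1 ~ 5 ∷ 2 ≁ 5 ∷ 3 ≁ 5 ∷ 4 ~ 5 ∷ []) ∷ (0 ~ 5 ∷ 1 ≁ 5 ∷ 2 ≁ 5 ∷ 3 ≁ 5 ∷ 4 ~ 5 ∷ []) ∷ [])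
  [] []
  (bad (0 – 6 ∷ 2 – 3 ∷ []) ∷ claw 5 0 2 4 ∷ [])
  refl

left-B : Table 2
left-B = table 7 (P₅ 0 1 2 3 4) (5 ~ 6 ∷ 2 ~ 5 ∷ 3 ~ 5 ∷ 0 ≁ 5 ∷ 2 ~ 6 ∷ 3 ~ 6 ∷ 0 ≁ 6 ∷ [])
  ((0 ≁ 5 ∷ 1 ≁ 5 ∷ 2 ~ 5 ∷ 3 ~ 5 ∷ 4 ~ 5 ∷ []) ∷ [])
  [] []
  (bad (3 – 6 ∷ 1 – 5 ∷ []) ∷ bad (1 – 2 ∷ 3 – 6 ∷ []) ∷ [])
  refl

left-AA : Table 2
left-AA = table 9 (P₅ 0 1 2 3 4) (5 ~ 6 ∷ 7 ~ 8 ∷ 0 ~ 5 ∷ 3 ≁ 5 ∷ 0 ~ 6 ∷ 3 ≁ 6 ∷ 0 ~ 7 ∷ 3 ≁ 7 ∷ 0 ~ 8 ∷ 3 ≁ 8 ∷ [])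
  ((5 ~ 7 ∷ []) ∷ (2 ~ 5 ∷ 4 ~ 7 ∷ []) ∷ (4 ~ 5 ∷ 2 ~ 7 ∷ []) ∷ [])
  [] []
  (bad (1 – 2 ∷ 0 – 6 ∷ 4 – 8 ∷ []) ∷ bad (5 – 6 ∷ 2 – 3 ∷ 0 – 7 ∷ []) ∷ claw 5 0 2 4 ∷ claw 7 0 2 4 ∷
   bad (0 – 6 ∷ 2 – 3 ∷ 1 – 8 ∷ []) ∷ bad (1 – 8 ∷ 3 – 4 ∷ 0 – 6 ∷ []) ∷ [])
  refl

left-AB : Table 2
left-AB = table 9 (P₅ 0 1 2 3 4) (5 ~ 6 ∷ 7 ~ 8 ∷ 0 ~ 5 ∷ 3 ≁ 5 ∷ 0 ~ 6 ∷ 3 ≁ 6 ∷ 2 ~ 7 ∷ 3 ~ 7 ∷ 0 ≁ 7 ∷ 2 ~ 8 ∷ 3 ~ 8 ∷ 0 ≁ 8 ∷ [])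
  ((5 ≁ 7 ∷ []) ∷ [])
  [] []
  (bad (5 – 6 ∷ 1 – 2 ∷ 3 – 7 ∷ []) ∷ bad (1 – 6 ∷ 3 – 8 ∷ 5 – 7 ∷ []) ∷ bad (4 – 8 ∷ 0 – 5 ∷ 2 – 7 ∷ []) ∷ [])
  refl

left-BB : Table 2
left-BB = table 9 (P₅ 0 1 2 3 4) (5 ~ 6 ∷ 7 ~ 8 ∷ 2 ~ 5 ∷ 3 ~ 5 ∷ 0 ≁ 5 ∷ 2 ~ 6 ∷ 3 ~ 6 ∷ 0 ≁ 6 ∷ 2 ~ 7 ∷ 3 ~ 7 ∷ 0 ≁ 7 ∷ 2 ~ 8 ∷ 3 ~ 8 ∷ 0 ≁ 8 ∷ [])
  ((5 ~ 7 ∷ []) ∷ [])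
  [] []
  (bad (3 – 7 ∷ 5 – 6 ∷ 1 – 2 ∷ []) ∷ bad (3 – 6 ∷ 4 – 8 ∷ 1 – 2 ∷ []) ∷ [])
  refl

-- All tables of this group are contradictions. `star₁` is about a vertex that sees 0 and 4 but not
-- 1; `star₂` about a non-adjacent pair, both seeing 1, one seeing 2 and the other 4. The suffix `B`
-- adds a vertex of the second type, a letter one more neighbour of 4 (for `star₁` also one of 2) in
-- each position that the matching allows.
star₁-B : Table 2
star₁-B = table 9 (P₅ 0 1 2 3 4) (5 ~ 6 ∷ 7 ~ 8 ∷ 0 ~ 5 ∷ 3 ≁ 5 ∷ 0 ~ 6 ∷ 3 ≁ 6 ∷ 2 ~ 7 ∷ 3 ~ 7 ∷ 0 ≁ 7 ∷ 2 ~ 8 ∷ 3 ~ 8 ∷ 0 ≁ 8 ∷ 0 ~ 5 ∷ 1 ≁ 5 ∷ 2 ≁ 5 ∷ 3 ≁ 5 ∷ 4 ~ 5 ∷ [])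
  []
  [] []
  (bad (2 – 7 ∷ 4 – 8 ∷ 0 – 6 ∷ []) ∷ bad (5 – 6 ∷ 3 – 7 ∷ 1 – 2 ∷ []) ∷ [])
  refl

star₁-a : Table 2
star₁-a = table 9 (P₅ 0 1 2 3 4) (5 ~ 6 ∷ 7 ~ 8 ∷ 0 ~ 5 ∷ 3 ≁ 5 ∷ 0 ~ 6 ∷ 3 ≁ 6 ∷ 0 ~ 7 ∷ 3 ≁ 7 ∷ 0 ~ 8 ∷ 3 ≁ 8 ∷ 0 ~ 5 ∷ 1 ≁ 5 ∷ 2 ≁ 5 ∷ 3 ≁ 5 ∷ 4 ~ 5 ∷ 0 ~ 6 ∷ 2 ~ 6 ∷ 0 ~ 7 ∷ 4 ~ 7 ∷ 3 ≁ 7 ∷ [])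
  []
  [] []
  (bad (4 – 7 ∷ 2 – 6 ∷ 0 – 8 ∷ []) ∷ [])
  refl

star₁-b : Table 2
star₁-b = table 9 (P₅ 0 1 2 3 4) (5 ~ 6 ∷ 7 ~ 8 ∷ 0 ~ 5 ∷ 3 ≁ 5 ∷ 0 ~ 6 ∷ 3 ≁ 6 ∷ 0 ~ 7 ∷ 3 ≁ 7 ∷ 0 ~ 8 ∷ 3 ≁ 8 ∷ 0 ~ 5 ∷ 1 ≁ 5 ∷ 2 ≁ 5 ∷ 3 ≁ 5 ∷ 4 ~ 5 ∷ 0 ~ 6 ∷ 4 ~ 6 ∷ 3 ≁ 6 ∷ 0 ~ 7 ∷ 2 ~ 7 ∷ [])
  []
  [] []
  (bad (4 – 6 ∷ 2 – 7 ∷ 0 – 8 ∷ []) ∷ [])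
  refl

star₁-c : Table 2
star₁-c = table 9 (P₅ 0 1 2 3 4) (5 ~ 6 ∷ 7 ~ 8 ∷ 0 ~ 5 ∷ 3 ≁ 5 ∷ 0 ~ 6 ∷ 3 ≁ 6 ∷ 0 ~ 7 ∷ 3 ≁ 7 ∷ 0 ~ 8 ∷ 3 ≁ 8 ∷ 0 ~ 5 ∷ 2 ~ 5 ∷ 0 ~ 6 ∷ 4 ~ 6 ∷ 3 ≁ 6 ∷ 0 ~ 7 ∷ 1 ≁ 7 ∷ 2 ≁ 7 ∷ 3 ≁ 7 ∷ 4 ~ 7 ∷ [])
  []
  [] []
  (bad (4 – 6 ∷ 2 – 5 ∷ 0 – 8 ∷ []) ∷ [])
  refl

star₁-d : Table 2
star₁-d = table 11 (P₅ 0 1 2 3 4) (5 ~ 6 ∷ 7 ~ 8 ∷ 9 ~ 10 ∷ 0 ~ 5 ∷ 3 ≁ 5 ∷ 0 ~ 6 ∷ 3 ≁ 6 ∷ 0 ~ 7 ∷ 3 ≁ 7 ∷ 0 ~ 8 ∷ 3 ≁ 8 ∷ 0 ~ 9 ∷ 3 ≁ 9 ∷ 0 ~ 10 ∷ 3 ≁ 10 ∷ 0 ~ 5 ∷ 1 ≁ 5 ∷ 2 ≁ 5 ∷ 3 ≁ 5 ∷ 4 ~ 5 ∷ 0 ~ 7 ∷ 2 ~ 7 ∷ 0 ~ 9 ∷ 4 ~ 9 ∷ 3 ≁ 9 ∷ [])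
  []
  [] []
  (bad (2 – 7 ∷ 5 – 6 ∷ 4 – 9 ∷ 0 – 1 ∷ []) ∷ bad (4 – 9 ∷ 2 – 7 ∷ 8 – 10 ∷ 0 – 6 ∷ []) ∷ [])
  refl

star₂-B : Table 2
star₂-B = table 11 (P₅ 0 1 2 3 4) (5 ~ 6 ∷ 7 ~ 8 ∷ 9 ~ 10 ∷ 0 ~ 5 ∷ 3 ≁ 5 ∷ 0 ~ 6 ∷ 3 ≁ 6 ∷ 0 ~ 7 ∷ 3 ≁ 7 ∷ 0 ~ 8 ∷ 3 ≁ 8 ∷ 2 ~ 9 ∷ 3 ~ 9 ∷ 0 ≁ 9 ∷ 2 ~ 10 ∷ 3 ~ 10 ∷ 0 ≁ 10 ∷ 0 ~ 5 ∷ 1 ~ 5 ∷ 2 ~ 5 ∷ 3 ≁ 5 ∷ 4 ≁ 5 ∷ 0 ~ 7 ∷ 1 ~ 7 ∷ 2 ≁ 7 ∷ 3 ≁ 7 ∷ 4 ~ 7 ∷ 5 ≁ 7 ∷ [])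
  []
  [] []
  (bad (0 – 6 ∷ 9 – 10 ∷ 2 – 5 ∷ 4 – 7 ∷ []) ∷ bad (7 – 8 ∷ 5 – 6 ∷ 1 – 2 ∷ 3 – 9 ∷ []) ∷
   bad (0 – 6 ∷ 4 – 10 ∷ 2 – 9 ∷ 1 – 8 ∷ []) ∷ [])
  refl

star₂-a : Table 2
star₂-a = table 9 (P₅ 0 1 2 3 4) (5 ~ 6 ∷ 7 ~ 8 ∷ 0 ~ 5 ∷ 3 ≁ 5 ∷ 0 ~ 6 ∷ 3 ≁ 6 ∷ 0 ~ 7 ∷ 3 ≁ 7 ∷ 0 ~ 8 ∷ 3 ≁ 8 ∷ 0 ~ 5 ∷ 1 ~ 5 ∷ 2 ~ 5 ∷ 3 ≁ 5 ∷ 4 ≁ 5 ∷ 0 ~ 7 ∷ 1 ~ 7 ∷ 2 ≁ 7 ∷ 3 ≁ 7 ∷ 4 ~ 7 ∷ 5 ≁ 7 ∷ 0 ~ 6 ∷ 4 ~ 6 ∷ 3 ≁ 6 ∷ [])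
  []
  [] []
  (bad (4 – 6 ∷ 0 – 8 ∷ 1 – 2 ∷ []) ∷ [])
  refl

star₂-b : Table 2
star₂-b = table 9 (P₅ 0 1 2 3 4) (5 ~ 6 ∷ 7 ~ 8 ∷ 0 ~ 5 ∷ 3 ≁ 5 ∷ 0 ~ 6 ∷ 3 ≁ 6 ∷ 0 ~ 7 ∷ 3 ≁ 7 ∷ 0 ~ 8 ∷ 3 ≁ 8 ∷ 0 ~ 7 ∷ 1 ~ 7 ∷ 2 ~ 7 ∷ 3 ≁ 7 ∷ 4 ≁ 7 ∷ 0 ~ 5 ∷ 1 ~ 5 ∷ 2 ≁ 5 ∷ 3 ≁ 5 ∷ 4 ~ 5 ∷ 7 ≁ 5 ∷ 0 ~ 6 ∷ 4 ~ 6 ∷ 3 ≁ 6 ∷ [])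
  []
  [] []
  (bad (4 – 6 ∷ 1 – 2 ∷ 0 – 8 ∷ []) ∷ [])
  refl

star₂-c : Table 2
star₂-c = table 11 (P₅ 0 1 2 3 4) (5 ~ 6 ∷ 7 ~ 8 ∷ 9 ~ 10 ∷ 0 ~ 5 ∷ 3 ≁ 5 ∷ 0 ~ 6 ∷ 3 ≁ 6 ∷ 0 ~ 7 ∷ 3 ≁ 7 ∷ 0 ~ 8 ∷ 3 ≁ 8 ∷ 0 ~ 9 ∷ 3 ≁ 9 ∷ 0 ~ 10 ∷ 3 ≁ 10 ∷ 0 ~ 5 ∷ 1 ~ 5 ∷ 2 ~ 5 ∷ 3 ≁ 5 ∷ 4 ≁ 5 ∷ 0 ~ 7 ∷ 1 ~ 7 ∷ 2 ≁ 7 ∷ 3 ≁ 7 ∷ 4 ~ 7 ∷ 5 ≁ 7 ∷ 0 ~ 9 ∷ 4 ~ 9 ∷ 3 ≁ 9 ∷ [])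
  []
  [] []
  (bad (0 – 6 ∷ 8 – 10 ∷ 1 – 2 ∷ 4 – 9 ∷ []) ∷ bad (5 – 6 ∷ 0 – 9 ∷ 1 – 2 ∷ 4 – 7 ∷ []) ∷ [])
  refl

-- Augmenting walks in claw-free graphs.

module Augment {n : ℕ} (G : Graph n) (simple : IsSimple G) (clawFree : ClawFree G) where

  open Matchings G simple

  -- The index is only an upper bound for the length, since `end` accepts any value; the induction
  -- on it needs no more.
  data Walk : Fin n → List (Fin n) → ℕ → Set where
    end  : ∀ {u U k} → u ∈ U → Walk u U k
    step : ∀ {u v U k} → G u v ≡ true → Walk v U k → Walk u U (suc k)

  Larger : ℕ → Set
  Larger k = ∃[ U ] ∃[ M ] (Edges M × pairs M ++ U ↭ allFin n × k < length M)

  -- The free vertex `u` is kept apart from `U` because the exchanges move it along the walk, while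
  -- the other free vertices never change.
  Augments : ℕ → Set
  Augments k = ∀ {u U M} → Edges M → pairs M ++ u ∷ U ↭ allFin n → Walk u U k → u ∉ U → Larger (length M)

  -- The free vertex u moves along the walk by exchanging matching edges: if v is
  -- the next vertex, m its partner and x the one after, then u, m, x are not
  -- pairwise non-adjacent.
  augment-step : ∀ k → (∀ {j} → j < k → Augments j) → Augments k
  augment-step k ih es p (end u∈) u∉ = contradiction u∈ u∉
  augment-step (suc k) ih {u} {U} {M} es p (step {v = v} uv w) u∉ with Any.any? (v ≟_) U
  ... | yes v∈U with ∈⇒↭ v∈U
  ...   | U' , q = U' , (u , v) ∷ M , uv ∷ es ,
          ↭-trans (↭-sym (↭-trans (++⁺ˡ (pairs M) (prep u q))
            (↭-trans (shift u (pairs M) _) (prep u (shift v (pairs M) U'))))) p , ℕ.≤-refl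
  augment-step (suc k) ih {u} {U} {M} es p (step {v = v} uv w) u∉ | no v∉U
    with ∈-++⁻ (pairs M) (∈-resp-↭ (↭-sym p) (∈-allFin v))
  ... | inj₂ (here refl) = contradiction refl (G-irr uv)
  ... | inj₂ (there v∈)  = contradiction v∈ v∉U
  ... | inj₁ v∈M with partner M es v∈M
  ...   | m , M' , vm , es' , len , q with w
  ...     | end v∈ = contradiction v∈ v∉U
  ...     | step {v = x} {k = k'} vx w' = go
    where
    Z : List (Fin n)
    Z = pairs M' ++ U

    base : v ∷ m ∷ u ∷ Z ↭ allFin n
    base = ↭-trans (prep v (prep m (↭-sym (shift u (pairs M') U)))) (↭-trans (++⁺ʳ (u ∷ U) (↭-sym q)) p)

    distinct : Unique (v ∷ m ∷ u ∷ Z)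
    distinct = Unique-resp-↭ (↭-sym base) (allFin⁺ n)

    place : ∀ {a b f} → a ∷ b ∷ f ∷ Z ↭ v ∷ m ∷ u ∷ Z → pairs ((a , b) ∷ M') ++ f ∷ U ↭ allFin n
    place {a} {b} {f} r = ↭-trans (prep a (prep b (shift f (pairs M') U))) (↭-trans r base)

    fresh : ∀ {f} M₁ → pairs M₁ ++ f ∷ U ↭ allFin n → f ∉ U
    fresh {f} M₁ r f∈ = Unique[x∷xs]⇒x∉xs
      (Unique-resp-↭ (↭-trans (↭-sym r) (shift f (pairs M₁) U)) (allFin⁺ n)) (∈-++⁺ʳ (pairs M₁) f∈)

    next : ∀ {f} M₁ → length M₁ ≡ suc (length M') → (Edges M₁ → pairs M₁ ++ f ∷ U ↭ allFin n → f ∉ U → Larger (length M₁)) →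
           Edges M₁ → pairs M₁ ++ f ∷ U ↭ allFin n → Larger (length M)
    next M₁ l continue es₁ r = subst Larger (trans l (sym len)) (continue es₁ r (fresh M₁ r))

    -- Both `uv` and `mx` become matching edges. If `x` was free this is already an augmentation;
    -- otherwise the former partner `y` of `x` is the new free vertex, and it re-enters the walk at
    -- `x`, one step shorter.
    through : G m x ≡ true → x ≢ v → x ≢ m → x ≢ u → Larger (length M)
    through mx x≢v x≢m x≢u with ∈-resp-↭ (↭-sym base) (∈-allFin x)
    ... | here x≡v                 = contradiction x≡v x≢v
    ... | there (here x≡m)         = contradiction x≡m x≢m
    ... | there (there (here x≡u)) = contradiction x≡u x≢u
    ... | there (there (there x∈)) with ∈-++⁻ (pairs M') x∈
    ...   | inj₂ x∈U with ∈⇒↭ x∈U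
    ...     | U' , r = U' , (u , v) ∷ (m , x) ∷ M' , uv ∷ mx ∷ es' ,
              ↭-trans (shuffle (v ∷ m ∷ u ∷ x ∷ []) (2 ∷ 0 ∷ 1 ∷ 3 ∷ []) refl v)
                (↭-trans (prep v (prep m (prep u (↭-sym (↭-trans (++⁺ˡ (pairs M') r) (shift x (pairs M') U')))))) base) ,
              subst (_< 2 + length M') (sym len) ℕ.≤-refl
    through mx x≢v x≢m x≢u | there (there (there x∈)) | inj₁ x∈M' with partner M' es' x∈M'
    ... | y , M'' , xy , es'' , len' , r =
      next ((u , v) ∷ (m , x) ∷ M'') (cong suc (sym len')) (λ es₁ r₁ → ih ℕ.≤-refl es₁ r₁ (step (G-sym xy) w'))
        (uv ∷ mx ∷ es'')
        (↭-trans (prep u (prep v (prep m (prep x (shift y (pairs M'') U)))))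
          (↭-trans (shuffle (v ∷ m ∷ u ∷ x ∷ y ∷ []) (2 ∷ 0 ∷ 1 ∷ 3 ∷ 4 ∷ []) refl v)
            (↭-trans (prep v (prep m (prep u (++⁺ʳ U (↭-sym r))))) base)))

    go : Larger (length M)
    -- In order: the walk has returned to `u`; it can skip `v`; it follows the matching edge, so
    -- exchanging `vm` for `uv` frees `x`; exchanging `vm` for `um` frees `v`; the edge `mx` allows
    -- a double exchange. If all fail, `v` is the centre of a claw.
    go with x ≟ u | G u x Bool.≟ true | x ≟ m | G u m Bool.≟ true | G m x Bool.≟ true
    ... | yes refl | _ | _ | _ | _ = ih (ℕ.m≤n⇒m≤1+n ℕ.≤-refl) es p w' u∉
    ... | no _ | yes ux | _ | _ | _ = ih ℕ.≤-refl es p (step ux w') u∉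
    ... | no _ | no _ | yes refl | _ | _ =
      next ((u , v) ∷ M') refl (λ es₁ r₁ → ih (ℕ.m≤n⇒m≤1+n ℕ.≤-refl) es₁ r₁ w') (uv ∷ es')
        (place (shuffle (v ∷ m ∷ u ∷ []) (2 ∷ 0 ∷ 1 ∷ []) refl v))
    ... | no _ | no _ | no _ | yes um | _ =
      next ((u , m) ∷ M') refl (λ es₁ r₁ → ih ℕ.≤-refl es₁ r₁ (step vx w')) (um ∷ es')
        (place (shuffle (v ∷ m ∷ u ∷ []) (2 ∷ 1 ∷ 0 ∷ []) refl v))
    ... | no x≢u | no _ | no x≢m | no _ | yes mx = through mx (λ { refl → G-irr vx refl }) x≢m x≢u
    ... | no x≢u | no ¬ux | no x≢m | no ¬um | no ¬mx = ⊥-elim (clawFree v u m x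
          ( G-sym uv , vm , vx
          , (λ { refl → All.lookup (AllPairs.head (AllPairs.tail distinct)) (here refl) refl }) , x≢u ∘ sym , x≢m ∘ sym
          , Bool.¬-not ¬um , Bool.¬-not ¬ux , Bool.¬-not ¬mx ))

  augment : ∀ k → Augments k
  augment = <-rec Augments augment-step

  connect : ∀ {u v U} → WalkIn G full u v → v ∈ U → ∃[ k ] Walk u U k
  connect here            v∈ = 0 , end v∈
  connect (step e _ w) v∈ with connect w v∈
  ... | k , w' = suc k , step e w'

  edge? : ∀ u V → (∃[ v ] ∃[ V' ] (G u v ≡ true × V ↭ v ∷ V')) ⊎ All (Nonadjacent u) V
  edge? u V with Any.any? (λ v → G u v Bool.≟ true) V
  ... | no ¬e = inj₂ (All.map Bool.¬-not (All.¬Any⇒All¬ V ¬e))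
  ... | yes e with find e
  ...   | v , v∈ , uv with ∈⇒↭ v∈
  ...     | V' , r = inj₁ (v , V' , uv , r)

  -- `I` collects the vertices that turned out to have no neighbour among the remaining `U`; it
  -- stays independent and apart from `U`, so it is the final independent set once `U` is exhausted.
  greedy : ∀ {W} k U {M} I → length U ≤ k → Edges M → pairs M ++ I ++ U ↭ W →
           Independent I → All (λ i → All (Nonadjacent i) U) I →
           ∃[ U' ] ∃[ M' ] (Edges M' × pairs M' ++ U' ↭ W × Independent U' × length M ≤ length M')
  greedy k []      {M} I _ es p ind _ =
    I , M , es , ↭-trans (++⁺ˡ (pairs M) (↭-reflexive (sym (List.++-identityʳ I)))) p , ind , ℕ.≤-refl
  greedy (suc k) (u ∷ U) {M} I h es p ind apart with edge? u U
  ... | inj₂ none = greedy k U (u ∷ I) (s≤s⁻¹ h) es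
        (↭-trans (++⁺ˡ (pairs M) (↭-sym (shift u I U))) p)
        (All.map (λ a → G-sym (All.head a)) apart ∷ ind) (none ∷ All.map All.tail apart)
  ... | inj₁ (v , U' , uv , r) with greedy k U' {(u , v) ∷ M} I
          (ℕ.≤-trans (ℕ.n≤1+n _) (subst (_≤ k) (↭-length r) (s≤s⁻¹ h))) (uv ∷ es)
          (↭-trans (↭-trans (↭-sym (bring (pairs M) I)) (++⁺ˡ (pairs M) (++⁺ˡ I (prep u (↭-sym r))))) p) ind
          (All.map (λ a → All.tail (All-resp-↭ r (All.tail a))) apart)
    where
    bring : ∀ Y I {a b : Fin n} {Z} → Y ++ I ++ a ∷ b ∷ Z ↭ a ∷ b ∷ Y ++ I ++ Z
    bring Y I {a} {b} {Z} = ↭-trans (++⁺ˡ Y (↭-trans (shift a I (b ∷ Z)) (prep a (shift b I Z))))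
      (↭-trans (shift a Y _) (prep a (shift b Y _)))
  ...   | U'' , M' , es' , p' , ind' , l = U'' , M' , es' , p' , ind' , ℕ.≤-trans (ℕ.n≤1+n _) l

  maximal : ∀ {M U} → Edges M → pairs M ++ U ↭ allFin n → Independent U → IsMaximalMatching G M
  maximal {M} {U} es p ind =
    (es , subst Unique (pairs≡ends M) (Unique-++ˡ (pairs M) (Unique-resp-↭ (↭-sym p) (allFin⁺ n)))) , covers
    where
    covers : ∀ u v → G u v ≡ true → u ∈ ends M ⊎ v ∈ ends M
    covers u v uv with ∈-++⁻ (pairs M) (∈-resp-↭ (↭-sym p) (∈-allFin u))
                     | ∈-++⁻ (pairs M) (∈-resp-↭ (↭-sym p) (∈-allFin v))
    ... | inj₁ u∈ | _       = inj₁ (subst (u ∈_) (pairs≡ends M) u∈)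
    ... | inj₂ _  | inj₁ v∈ = inj₂ (subst (v ∈_) (pairs≡ends M) v∈)
    ... | inj₂ u∈ | inj₂ v∈ = ⊥-elim (true≢false uv (independent-∈ ind u∈ v∈))

  -- A matching that leaves an independent set is maximal. If it left two vertices, a walk between
  -- them would give a strictly larger matching, and its greedy extension a maximal matching of
  -- another size.
  deficiency≤1 : Connected G → Equimatchable G → DeficiencyAtMostOne
  deficiency≤1 conn eq []          M p es ind = z≤n
  deficiency≤1 conn eq (u ∷ [])    M p es ind = ℕ.≤-refl
  deficiency≤1 conn eq (u ∷ v ∷ U) M p es ind
    with connect (proj₂ conn u v refl refl) (here refl)
  ... | k , w with augment k es q w (Unique[x∷xs]⇒x∉xs (Unique-++ˡ (u ∷ v ∷ U) (Unique-resp-↭ (↭-sym p) (allFin⁺ n))))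
    where
    q : pairs M ++ u ∷ v ∷ U ↭ allFin n
    q = ↭-trans (++-comm (pairs M) (u ∷ v ∷ U)) p
  ...   | V , M₁ , es₁ , p₁ , l₁ with greedy (length V) V [] ℕ.≤-refl es₁ p₁ [] []
  ...     | V' , M₂ , es₂ , p₂ , ind₂ , l₂ = contradiction
            (eq M M₂ (maximal es (↭-trans (++-comm (pairs M) (u ∷ v ∷ U)) p) ind) (maximal es₂ p₂ ind₂))
            (ℕ.<⇒≢ (ℕ.<-≤-trans l₁ l₂))

-- Counting, induced copies of small graphs, and pairs of pulled vertices.

countIn : ∀ {n} → VSet n → List (Fin n) → ℕ
countIn X xs = sum (map (λ x → if X x then 1 else 0) xs)

countIn-++ : ∀ {n} (X : VSet n) xs ys → countIn X (xs ++ ys) ≡ countIn X xs + countIn X ys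
countIn-++ X xs ys = trans (cong sum (List.map-++ _ xs ys)) (sum-++ (map _ xs) (map _ ys))

countIn-↭ : ∀ {n} (X : VSet n) {xs ys} → xs ↭ ys → countIn X xs ≡ countIn X ys
countIn-↭ X p = sum-↭ (map⁺ _ p)

countIn-filter : ∀ {n} (X : VSet n) xs → length (filterᵇ X xs) ≡ countIn X xs
countIn-filter X []       = refl
countIn-filter X (x ∷ xs) with X x
... | true  = cong suc (countIn-filter X xs)
... | false = countIn-filter X xs

countIn-pairs : ∀ {n} (X : VSet n) M → All (λ e → X (proj₁ e) ≡ X (proj₂ e)) M → ∃[ k ] countIn X (pairs M) ≡ 2 * k
countIn-pairs X []            []       = 0 , refl
countIn-pairs X ((x , y) ∷ M) (e ∷ es) with countIn-pairs X M es
... | k , eq with X x | X y | e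
... | true  | true  | refl = suc k , trans (cong (2 +_) eq) (cong suc (sym (ℕ.+-suc k (k + 0))))
... | false | false | refl = k , eq

∈⇒at : ∀ {A : Set} (o : A) {x xs} → x ∈ xs → ∃[ i ] (i < length xs × at o xs i ≡ x)
∈⇒at o (here refl) = 0 , s≤s z≤n , refl
∈⇒at o (there x∈) with ∈⇒at o x∈
... | i , h , eq = suc i , s≤s h , eq

-- One literal per pair `i < j`, in lexicographic order. For a concrete graph `Sat` of it unfolds to
-- a tuple of adjacencies in that order, which is how induced copies are supplied below.
describe : ∀ {k} → Graph k → Conj
describe {k} H = concatMap (λ i → concatMap (row i) (allFin k)) (allFin k)
  where
  row : Fin k → Fin k → Conj
  row i j = if toℕ i <ᵇ toℕ j then lit (toℕ i) (toℕ j) (H i j) ∷ [] else []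

Sat-lookup : ∀ ρ c → Sat ρ c → ∀ {l} → l ∈ c → True ρ l
Sat-lookup ρ (_ ∷ _) (t , _) (here refl) = t
Sat-lookup ρ (_ ∷ c) (_ , s) (there l∈)  = Sat-lookup ρ c s l∈

describe-sound : ∀ {k} (H : Graph k) ρ → Sat ρ (describe H) → ∀ i j → toℕ i < toℕ j → ρ (toℕ i) (toℕ j) ≡ H i j
describe-sound {k} H ρ s i j i<j = Sat-lookup ρ (describe H) s
  (∈-concatMap⁺ _ (lose (∈-allFin i) (∈-concatMap⁺ _ (lose (∈-allFin j) member))))
  where
  member : lit (toℕ i) (toℕ j) (H i j) ∈ (if toℕ i <ᵇ toℕ j then lit (toℕ i) (toℕ j) (H i j) ∷ [] else [])
  member with toℕ i <ᵇ toℕ j | ℕ.<⇒<ᵇ i<j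
  ... | true | _ = here refl

simple? : ∀ {k} (H : Graph k) → Dec (IsSimple H)
simple? H = (Fin.all? λ u → Fin.all? λ v → H u v Bool.≟ H v u) ×-dec (Fin.all? λ u → H u u Bool.≟ false)

iso-from-induced : ∀ {n k} {G : Graph n} {H : Graph k} → InducedIso G full H → Iso G H
iso-from-induced {n} {k} {G} {H} (f , inj , _ , surj , adj) = mk↔ₛ′ to f invˡ invʳ , λ u v →
  trans (cong₂ G (sym (invʳ u)) (sym (invʳ v))) (sym (adj (to u) (to v)))
  where
  to : Fin n → Fin k
  to x = proj₁ (surj x refl)
  invʳ : ∀ x → f (to x) ≡ x
  invʳ x = proj₂ (surj x refl)
  invˡ : ∀ i → to (f i) ≡ i
  invˡ i = inj (invʳ (f i))

module Assemble {n : ℕ} (G : Graph n) (simple : IsSimple G) where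

  open Matchings G simple

  Clique : VSet n → Set
  Clique X = ∀ {x y} → X x ≡ true → X y ≡ true → x ≢ y → G x y ≡ true

  list-iso : ∀ {X k} (H : Graph k) o xs → length xs ≡ k → Unique xs → All (λ x → X x ≡ true) xs →
             (∀ {x} → X x ≡ true → x ∈ xs) →
             (∀ i j → H i j ≡ G (at o xs (toℕ i)) (at o xs (toℕ j))) → InducedIso G X H
  list-iso {X} H o xs refl u all-in back adj = (λ i → at o xs (toℕ i)) ,
    (λ {i} {j} e → Fin.toℕ-injective (at-injective o u (Fin.toℕ<n i) (Fin.toℕ<n j) e)) ,
    (λ i → All.lookup all-in (at-∈ o xs (Fin.toℕ<n i))) , onto , adj
    where
    onto : ∀ x → X x ≡ true → ∃[ i ] at o xs (toℕ i) ≡ x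
    onto x Xx with ∈⇒at o (back Xx)
    ... | i , h , e = Data.Fin.fromℕ< h , trans (cong (at o xs) (Fin.toℕ-fromℕ< h)) e

  described-iso : ∀ {X k} (H : Graph k) → IsSimple H → ∀ o xs → length xs ≡ k → Unique xs →
                  All (λ x → X x ≡ true) xs → (∀ {x} → X x ≡ true → x ∈ xs) →
                  Sat (λ i j → G (at o xs i) (at o xs j)) (describe H) → InducedIso G X H
  described-iso H (H-sym , H-irr) o xs l u all-in back s = list-iso H o xs l u all-in back adj
    where
    adj : ∀ i j → H i j ≡ G (at o xs (toℕ i)) (at o xs (toℕ j))
    adj i j with ℕ.<-cmp (toℕ i) (toℕ j)
    ... | tri< i<j _ _ = sym (describe-sound H _ s i j i<j)
    ... | tri> _ _ j<i = trans (H-sym i j) (sym (G-sym (describe-sound H _ s j i j<i)))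
    ... | tri≈ _ i≡j _ with Fin.toℕ-injective i≡j
    ...   | refl = trans (H-irr i) (sym (proj₂ simple _))

  -- Any enumeration of a clique is an isomorphism, so the set filtered from `allFin n` serves and
  -- only its size has to be computed.
  clique-iso : ∀ {X p} → Clique X → Fin n → count X ≡ p → InducedIso G X (Complete p)
  clique-iso {X} {p} clique o refl = list-iso (Complete (count X)) o xs (countIn-filter X (allFin n)) uniq
      (All.tabulate (λ x∈ → in-X x∈))
      (λ {x} Xx → ∈-filter⁺ (T? ∘ X) (∈-allFin x) (subst T (sym Xx) _)) adj
    where
    xs : List (Fin n)
    xs = filterᵇ X (allFin n)

    uniq : Unique xs
    uniq = filter⁺ (T? ∘ X) (allFin⁺ n)

    in-X : ∀ {x} → x ∈ xs → X x ≡ true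
    in-X x∈ = T⇒≡ (proj₂ (∈-filter⁻ (T? ∘ X) {xs = allFin n} x∈))
      where
      T⇒≡ : ∀ {b} → T b → b ≡ true
      T⇒≡ {true} _ = refl

    bound : ∀ (i : Fin (count X)) → toℕ i < length xs
    bound i = subst (toℕ i <_) (sym (countIn-filter X (allFin n))) (Fin.toℕ<n i)

    adj : ∀ i j → not (toℕ i ≡ᵇ toℕ j) ≡ G (at o xs (toℕ i)) (at o xs (toℕ j))
    adj i j with toℕ i ≡ᵇ toℕ j in e
    ... | true  = sym (trans (cong (λ z → G (at o xs (toℕ i)) (at o xs z)) (sym (≡ᵇ-sound {toℕ i} e))) (proj₂ simple _))
    ... | false = sym (clique (in-X (at-∈ o xs (bound i))) (in-X (at-∈ o xs (bound j)))
                        (λ eq → subst T e (ℕ.≡⇒≡ᵇ (toℕ i) (toℕ j) (at-injective o uniq (bound i) (bound j) eq))))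

  -- If no matching edge outside the list crosses the border of `X`, the outside part of `X` is a
  -- union of such edges, so the parity of `X` is read off the finite list. The hypothesis receives
  -- the edge together with its `Rest`, ready for a table.
  count-parity : ∀ X {xs} (r : Rest xs) →
                 (∀ {x y} → Rest (xs ++ x ∷ y ∷ []) → G x y ≡ true → X x ≡ X y) →
                 ∃[ k ] count X ≡ countIn X xs + 2 * k
  count-parity X {xs} r@(M , es , p) same
    with countIn-pairs X M (All.tabulate (λ e∈ → let r' , e = pull-edge r e∈ in same r' e))
  ... | k , eq = k , trans (sym (countIn-↭ X p)) (trans (countIn-++ X xs (pairs M)) (cong (countIn X xs +_) eq))

  clique-connected : ∀ {X} → Clique X → ∃[ x ] X x ≡ true → ConnectedIn G X
  clique-connected {X} clique x = x , walk
    where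
    walk : ∀ u v → X u ≡ true → X v ≡ true → WalkIn G X u v
    walk u v Xu Xv with u ≟ v
    ... | yes refl = here
    ... | no u≢v   = step (clique Xu Xv u≢v) Xv here

  hub-connected : ∀ {X} h → X h ≡ true → (∀ {x} → X x ≡ true → WalkIn G X x h × WalkIn G X h x) → ConnectedIn G X
  hub-connected {X} h Xh near = (h , Xh) , λ u v Xu Xv → proj₁ (near Xu) ∙ proj₂ (near Xv)
    where
    _∙_ : ∀ {u v w} → WalkIn G X u v → WalkIn G X v w → WalkIn G X u w
    here       ∙ q = q
    step e x p ∙ q = step e x (p ∙ q)

  -- Connectedness in the form of an invariant: a property that passes along edges and holds
  -- somewhere holds everywhere.
  spread : (P : Fin n → Set) → (∀ {x y} → P x → G x y ≡ true → P y) → ∀ {u v} → WalkIn G full u v → P u → P v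
  spread P stays here         Pu = Pu
  spread P stays (step e _ w) Pu = spread P stays w (stays Pu e)

  crossing : {P : Fin n → Set} → (∀ x → Dec (P x)) → ∀ {u v} → WalkIn G full u v → P u → ¬ P v →
             ∃[ x ] ∃[ y ] (P x × ¬ P y × G x y ≡ true)
  crossing P? here         Pu ¬Pv = contradiction Pu ¬Pv
  crossing P? (step {u} {w} e _ p) Pu ¬Pv with P? w
  ... | yes Pw = crossing P? p Pw ¬Pv
  ... | no ¬Pw = u , w , Pu , ¬Pw , e

  ∉-snoc : ∀ {xs} {x u w : Fin n} → x ∉ xs → x ≢ u → x ≢ w → x ∉ xs ++ u ∷ w ∷ []
  ∉-snoc {xs} x∉ x≢u x≢w x∈ with ∈-++⁻ xs x∈
  ... | inj₁ x∈xs                = x∉ x∈xs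
  ... | inj₂ (here refl)         = x≢u refl
  ... | inj₂ (there (here refl)) = x≢w refl

  module _ {xs : List (Fin n)} (r : Rest xs) where

    flip : ∀ {u w} → Rest (xs ++ u ∷ w ∷ []) → Rest (xs ++ w ∷ u ∷ [])
    flip = Rest-resp-↭ (++⁺ˡ xs (swap _ _ ↭-refl))

    Partners : Fin n → Fin n → Set
    Partners u w = Rest (xs ++ u ∷ w ∷ []) × G u w ≡ true

    Apart₂ : Fin n → Fin n → Set
    Apart₂ u v = ∃[ u' ] ∃[ v' ] (Rest ((xs ++ u ∷ u' ∷ []) ++ v ∷ v' ∷ []) × G u u' ≡ true × G v v' ≡ true)

    -- The second vertex may turn out to be the partner of the first; callers treat this coincidence
    -- separately, often with a smaller table.
    pull₂ : ∀ {u v} → u ∉ xs → v ∉ xs → u ≢ v → Partners u v ⊎ Apart₂ u v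
    pull₂ {u} {v} u∉ v∉ u≢v with pull r u u∉
    ... | u' , r' , e with v ≟ u'
    ...   | yes refl = inj₁ (r' , e)
    ...   | no v≢u' with pull r' v (∉-snoc v∉ (u≢v ∘ sym) v≢u')
    ...     | v' , r'' , e' = inj₂ (u' , v' , r'' , e , e')

    PartnersApart : Fin n → Fin n → Fin n → Set
    PartnersApart u v w = ∃[ w' ] (Rest ((xs ++ u ∷ v ∷ []) ++ w ∷ w' ∷ []) × G u v ≡ true × G w w' ≡ true)

    Apart₃ : Fin n → Fin n → Fin n → Set
    Apart₃ u v w = ∃[ u' ] ∃[ v' ] ∃[ w' ] (Rest (((xs ++ u ∷ u' ∷ []) ++ v ∷ v' ∷ []) ++ w ∷ w' ∷ [])
                     × G u u' ≡ true × G v v' ≡ true × G w w' ≡ true)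

    -- A matching admits at most one partnership among three vertices, which gives three
    -- coincidences besides the general position.
    pull₃ : ∀ {u v w} → u ∉ xs → v ∉ xs → w ∉ xs → u ≢ v → u ≢ w → v ≢ w →
            PartnersApart u v w ⊎ PartnersApart u w v ⊎ PartnersApart v w u ⊎ Apart₃ u v w
    pull₃ {u} {v} {w} u∉ v∉ w∉ u≢v u≢w v≢w with pull r u u∉
    ... | u' , r' , e with v ≟ u' | w ≟ u'
    ...   | yes refl | _ with pull r' w (∉-snoc w∉ (u≢w ∘ sym) (v≢w ∘ sym))
    ...     | w' , r'' , e' = inj₁ (w' , r'' , e , e')
    pull₃ {u} {v} {w} u∉ v∉ w∉ u≢v u≢w v≢w | u' , r' , e | no _ | yes refl with pull r' v (∉-snoc v∉ (u≢v ∘ sym) v≢w)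
    ...     | v' , r'' , e' = inj₂ (inj₁ (v' , r'' , e , e'))
    pull₃ {u} {v} {w} u∉ v∉ w∉ u≢v u≢w v≢w | u' , r' , e | no v≢u' | no w≢u'
      with pull r' v (∉-snoc v∉ (u≢v ∘ sym) v≢u')
    ...     | v' , r'' , e' with w ≟ v'
    ...       | yes refl = inj₂ (inj₂ (inj₁ (u' , Rest-resp-↭ exchange r'' , e' , e)))
      where
      exchange : (xs ++ u ∷ u' ∷ []) ++ v ∷ w ∷ [] ↭ (xs ++ v ∷ w ∷ []) ++ u ∷ u' ∷ []
      exchange = ↭-trans (↭-reflexive (List.++-assoc xs _ _))
        (↭-trans (++⁺ˡ xs (++-comm (u ∷ u' ∷ []) (v ∷ w ∷ []))) (↭-reflexive (sym (List.++-assoc xs _ _))))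
    ...       | no w≢v' with pull r'' w (∉-snoc (∉-snoc w∉ (u≢w ∘ sym) w≢u') (v≢w ∘ sym) w≢v')
    ...         | w' , r''' , e'' = inj₂ (inj₂ (inj₂ (u' , v' , w' , r''' , e , e' , e'')))

evenᵇ : ℕ → Bool
evenᵇ zero    = true
evenᵇ (suc k) = not (evenᵇ k)

evenᵇ-+-double : ∀ k m → evenᵇ (k + 2 * m) ≡ evenᵇ k
evenᵇ-+-double k zero    = cong evenᵇ (ℕ.+-identityʳ k)
evenᵇ-+-double k (suc m) = trans (cong evenᵇ (trans (cong (k +_) (cong suc (ℕ.+-suc m (m + 0))))
  (trans (ℕ.+-suc k _) (cong suc (ℕ.+-suc k _))))) (trans (Bool.not-involutive _) (evenᵇ-+-double k m))


-- Greedy completions, and graphs with a perfect matching.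

module Start {n : ℕ} (G : Graph n) (simple : IsSimple G) (clawFree : ClawFree G)
             (deficiency : Matchings.DeficiencyAtMostOne G simple) (conn : Connected G) where

  -- Any vertex serves as the default value of `at`; connectedness provides one.
  o : Fin n
  o = proj₁ (proj₁ conn)

  path : ∀ u v → WalkIn G full u v
  path u v = proj₂ conn u v refl refl

  open Matchings G simple public
  open Augment G simple clawFree using (edge?; greedy)
  open Local G simple clawFree deficiency o public
  open Assemble G simple public

  Rest-even : ∀ {xs} → Rest xs → evenᵇ (length xs) ≡ evenᵇ n
  Rest-even {xs} (M , es , p) = trans (sym (evenᵇ-+-double (length xs) (length M)))
    (cong evenᵇ (trans (sym (trans (List.length-++ xs) (cong (length xs +_) (pairs-length M))))
      (trans (↭-length p) (List.length-tabulate {n = n} (λ i → i)))))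
    where
    pairs-length : ∀ {A : Set} (m : List (A × A)) → length (pairs m) ≡ 2 * length m
    pairs-length []      = refl
    pairs-length (_ ∷ m) = cong suc (trans (cong suc (pairs-length m)) (sym (ℕ.+-suc (length m) (length m + 0))))

  -- An edge between the two independent sets is matched and removed.
  cross : ∀ S U → Rest (S ++ U) → Independent S → Independent U → 2 ≤ length (S ++ U) →
          ∃[ S' ] ∃[ U' ] (Rest (S' ++ U') × Independent S' × Independent U' ×
            length S ≡ suc (length S') × length U ≡ suc (length U'))
  cross S U r@(M , es , p) indS indU two with search S
    where
    search : ∀ S → (∃[ s ] ∃[ S' ] ∃[ u ] ∃[ U' ] (S ↭ s ∷ S' × U ↭ u ∷ U' × G s u ≡ true)) ⊎
             All (λ s → All (Nonadjacent s) U) S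
    search []      = inj₂ []
    search (s ∷ S) with edge? s U
    ... | inj₁ (u , U' , su , q) = inj₁ (s , S , u , U' , ↭-refl , q , su)
    ... | inj₂ none with search S
    ...   | inj₂ nones = inj₂ (none ∷ nones)
    ...   | inj₁ (s' , S' , u , U' , q , q' , su) =
              inj₁ (s' , s ∷ S' , u , U' , ↭-trans (prep s q) (swap s s' ↭-refl) , q' , su)
  ... | inj₂ none = contradiction (deficiency _ M p es (AllPairs-++ indS indU none)) (ℕ.<⇒≱ two)
    where
    AllPairs-++ : ∀ {S U} → Independent S → Independent U → All (λ s → All (Nonadjacent s) U) S → Independent (S ++ U)
    AllPairs-++ []         indU []       = indU
    AllPairs-++ (s ∷ indS) indU (a ∷ as) = All.++⁺ s a ∷ AllPairs-++ indS indU as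
  ... | inj₁ (s , S' , u , U' , q , q' , su) = S' , U' ,
        Rest-match (S' ++ U') ((s , u) ∷ []) (↭-trans (++-comm (S' ++ U') (s ∷ u ∷ []))
          (↭-trans (prep s (↭-sym (shift u S' U'))) (↭-sym (++⁺ q q')))) (su ∷ []) r ,
        AllPairs.tail (resp q indS) , AllPairs.tail (resp q' indU) , ↭-length q , ↭-length q'
    where
    resp : ∀ {xs ys} → xs ↭ ys → Independent xs → Independent ys
    resp p = ↭ₛ.AllPairs-resp-↭ (setoid _) G-sym ((λ { refl e → e }) , (λ { refl e → e })) (↭⇒↭ₛ p)

  -- Each cross edge uses one vertex of either set, so when `S` is exhausted `U` still has two
  -- independent vertices, against the deficiency bound.
  surplus : ∀ k S U → length S ≡ k → Rest (S ++ U) → Independent S → Independent U → 2 + k ≤ length U → ⊥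
  surplus zero    []      U _ (M , es , p) _ indU h = ℕ.<⇒≱ h (deficiency U M p es indU)
  surplus (suc k) S U eq r indS indU h
    with cross S U r indS indU (ℕ.≤-trans (ℕ.≤-trans (s≤s (s≤s z≤n)) h) (subst (length U ≤_) (sym (List.length-++ S)) (ℕ.m≤n+m _ _)))
  ... | S' , U' , r' , indS' , indU' , l , l' =
        surplus k S' U' (ℕ.suc-injective (trans (sym l) eq)) r' indS' indU' (s≤s⁻¹ (subst (3 + k ≤_) l' h))

  -- The vertices of `S` are withheld while the others are matched greedily; what is left over is an
  -- independent set to be confronted with `S`.
  leftover : ∀ S {W} → S ++ W ↭ allFin n → ∃[ U ] (Rest (S ++ U) × Independent U)
  leftover S {W} p with greedy (length W) W {[]} [] ℕ.≤-refl [] ↭-refl [] []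
  ... | U , M , es , q , ind , _ = U , (M , es ,
        ↭-trans (↭-reflexive (List.++-assoc S U (pairs M))) (↭-trans (++⁺ˡ S (↭-trans (++-comm U (pairs M)) q)) p)) , ind

  perfect-or-near : Rest [] ⊎ ∃[ v ] Rest (v ∷ [])
  perfect-or-near with leftover [] ↭-refl
  ... | []        , r            , _   = inj₁ r
  ... | v ∷ []    , r            , _   = inj₂ (v , r)
  ... | v ∷ w ∷ U , (M , es , p) , ind = contradiction (deficiency _ M p es ind) (ℕ.<⇒≱ (s≤s (s≤s z≤n)))

  without₂ : ∀ {x y} → x ≢ y → ∃[ W ] x ∷ y ∷ W ↭ allFin n
  without₂ {x} {y} x≢y with ∈⇒↭ (∈-allFin x)
  ... | X , p with ∈-resp-↭ p (∈-allFin y)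
  ...   | here y≡x = contradiction (sym y≡x) x≢y
  ...   | there y∈ with ∈⇒↭ y∈
  ...     | W , q = W , ↭-sym (↭-trans p (prep x q))

  Goal-even : Set
  Goal-even = Iso G (Cycle 4) ⊎ (∃[ p ] (1 ≤ p × Iso G (Complete (2 * p))))

  -- The invariant `P` consists of `a`, `b` and the outside vertices that see one of them. The
  -- tables show that it passes along edges and never reaches `c` or `d`, so the graph would be
  -- disconnected.
  not-2K₂ : ∀ {a b c d} → Rest (a ∷ b ∷ c ∷ d ∷ []) → Holds (a ∷ b ∷ c ∷ d ∷ []) (2K₂ 0 1 2 3) → ⊥
  not-2K₂ {a} {b} {c} {d} r h@(ab , cd , ac , ad , bc , bd , _) = absurd (spread P stays (path a c) (inj₁ refl))
    where
    H : List (Fin n)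
    H = a ∷ b ∷ c ∷ d ∷ []

    P : Fin n → Set
    P x = x ≡ a ⊎ x ≡ b ⊎ (x ∉ H × (G a x ≡ true ⊎ G b x ≡ true))

    absurd : ¬ P c
    absurd (inj₁ refl)               = true≢false cd ad
    absurd (inj₂ (inj₁ refl))        = true≢false cd bd
    absurd (inj₂ (inj₂ (c∉ , _)))    = c∉ (there (there (here refl)))

    far : ∀ {x} → x ∉ H → G a x ≡ true ⊎ G b x ≡ true → G c x ≡ false × G d x ≡ false
    far x∉ near with pull r _ x∉
    far x∉ (inj₁ ax) | w , r' , xw with apply₁ nothing 2K₂-apart0 refl r' h (xw , ax , tt)
    ... | cx , dx , _ = cx , dx
    far x∉ (inj₂ bx) | w , r' , xw with apply₁ nothing 2K₂-apart1 refl r' h (xw , bx , tt)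
    ... | cx , dx , _ = cx , dx

    follow : ∀ {x y} → x ∉ H → G a x ≡ true ⊎ G b x ≡ true → y ∉ H → G x y ≡ true → G a y ≡ true ⊎ G b y ≡ true
    follow x∉ near y∉ xy with pull₂ r x∉ y∉ (G-irr xy)
    follow x∉ (inj₁ ax) y∉ xy | inj₁ (r' , _) with apply nothing 2K₂-partner0 refl r' h (xy , ax , tt)
    ... | here (ay , _)         = inj₁ ay
    ... | there (here (by , _)) = inj₂ by
    follow x∉ (inj₂ bx) y∉ xy | inj₁ (r' , _) with apply nothing 2K₂-partner1 refl r' h (xy , bx , tt)
    ... | here (ay , _)         = inj₁ ay
    ... | there (here (by , _)) = inj₂ by
    follow x∉ (inj₁ ax) y∉ xy | inj₂ (_ , _ , r' , xx , yy) with apply nothing 2K₂-spread0 refl r' h (xx , yy , ax , xy , tt)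
    ... | here (ay , _)         = inj₁ ay
    ... | there (here (by , _)) = inj₂ by
    follow x∉ (inj₂ bx) y∉ xy | inj₂ (_ , _ , r' , xx , yy) with apply nothing 2K₂-spread1 refl r' h (xx , yy , bx , xy , tt)
    ... | here (ay , _)         = inj₁ ay
    ... | there (here (by , _)) = inj₂ by

    stays : ∀ {x y} → P x → G x y ≡ true → P y
    stays {x} {y} Px xy with Any.any? (y ≟_) H
    ... | yes (here y≡a)         = inj₁ y≡a
    ... | yes (there (here y≡b)) = inj₂ (inj₁ y≡b)
    stays (inj₁ refl)                   xy | yes (there (there (here refl)))         = ⊥-elim (true≢false xy ac)
    stays (inj₂ (inj₁ refl))            xy | yes (there (there (here refl)))         = ⊥-elim (true≢false xy bc)
    stays (inj₂ (inj₂ (x∉ , near)))     xy | yes (there (there (here refl)))         = ⊥-elim (true≢false (G-sym xy) (proj₁ (far x∉ near)))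
    stays (inj₁ refl)                   xy | yes (there (there (there (here refl)))) = ⊥-elim (true≢false xy ad)
    stays (inj₂ (inj₁ refl))            xy | yes (there (there (there (here refl)))) = ⊥-elim (true≢false xy bd)
    stays (inj₂ (inj₂ (x∉ , near)))     xy | yes (there (there (there (here refl)))) = ⊥-elim (true≢false (G-sym xy) (proj₂ (far x∉ near)))
    stays (inj₁ refl)                   xy | no y∉ = inj₂ (inj₂ (y∉ , inj₁ xy))
    stays (inj₂ (inj₁ refl))            xy | no y∉ = inj₂ (inj₂ (y∉ , inj₂ xy))
    stays (inj₂ (inj₂ (x∉ , near)))     xy | no y∉ = inj₂ (inj₂ (y∉ , follow x∉ near y∉ xy))

  -- No vertex can be attached to a corner, so by connectedness the square is the whole graph.
  just-C₄ : ∀ {a b c d} → Rest (a ∷ b ∷ c ∷ d ∷ []) → Holds (a ∷ b ∷ c ∷ d ∷ []) (C₄ 0 1 2 3) → Iso G (Cycle 4)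
  just-C₄ {a} {b} {c} {d} r h@(ab , bc , cd , ad , ac , bd , _) = iso-from-induced
    (described-iso (Cycle 4) (toWitness {a? = simple? (Cycle 4)} tt) o H refl (Rest-unique r)
      (All.tabulate (λ _ → refl)) (λ {x} _ → spread (_∈ H) stays (path a x) (here refl))
      (ab , ac , ad , bc , bd , cd , tt))
    where
    H : List (Fin n)
    H = a ∷ b ∷ c ∷ d ∷ []

    stays : ∀ {x y} → x ∈ H → G x y ≡ true → y ∈ H
    stays {x} {y} x∈ xy with Any.any? (y ≟_) H
    ... | yes y∈ = y∈
    ... | no y∉ with pull r y y∉
    stays (here refl) xy | no y∉ | w , r' , yw = case apply nothing C₄-alone0 refl r' h (yw , xy , tt) of λ ()
    stays (there (here refl)) xy | no y∉ | w , r' , yw = case apply nothing C₄-alone1 refl r' h (yw , xy , tt) of λ ()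
    stays (there (there (here refl))) xy | no y∉ | w , r' , yw = case apply nothing C₄-alone2 refl r' h (yw , xy , tt) of λ ()
    stays (there (there (there (here refl)))) xy | no y∉ | w , r' , yw = case apply nothing C₄-alone3 refl r' h (yw , xy , tt) of λ ()

  -- With a non-edge `xy` withheld, greedy matching leaves an independent set of even size. Size
  -- zero breaks the deficiency bound, size four or more is a surplus, so exactly two vertices
  -- remain and `even-start` applies.
  even-case : Rest [] → Goal-even
  even-case r with Fin.any? (λ x → Fin.any? λ y → ¬? (x ≟ y) ×-dec (G x y Bool.≟ false))
  ... | no complete with count-parity full r (λ _ _ → refl)
  ...   | k , eq = inj₂ (k , positive k iso , iso)
    where
    iso : Iso G (Complete (2 * k))
    iso = iso-from-induced (clique-iso (λ {x} {y} _ _ x≢y → Bool.¬-not λ e → complete (x , y , x≢y , e)) o eq)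
    positive : ∀ k → Iso G (Complete (2 * k)) → 1 ≤ k
    positive zero    (f , _) = case Inverse.to f o of λ ()
    positive (suc k) _       = s≤s z≤n
  even-case r | yes (x , y , x≢y , xy) with without₂ x≢y
  ... | W , p with leftover (x ∷ y ∷ []) p
  ...   | []                  , (M , es , q) , _ = contradiction (deficiency (x ∷ y ∷ []) M q es ((xy ∷ []) ∷ [] ∷ [])) (ℕ.<⇒≱ ℕ.≤-refl)
  ...   | u ∷ []              , r' , _ = case trans (Rest-even r) (sym (Rest-even r')) of λ ()
  ...   | u ∷ v ∷ w ∷ []      , r' , _ = case trans (Rest-even r) (sym (Rest-even r')) of λ ()
  ...   | u ∷ v ∷ w ∷ t ∷ U   , r' , ind = ⊥-elim (surplus 2 (x ∷ y ∷ []) _ refl r' ((xy ∷ []) ∷ [] ∷ []) ind (s≤s (s≤s (s≤s (s≤s z≤n)))))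
  ...   | u ∷ v ∷ []          , r' , (uv ∷ []) ∷ _ with apply nothing even-start refl r' tt (xy , uv , tt)
  ...     | here h                 = ⊥-elim (not-2K₂ (Rest-select r' (0 ∷ 2 ∷ 1 ∷ 3 ∷ []) [] refl tt) h)
  ...     | there (here h)         = ⊥-elim (not-2K₂ (Rest-select r' (0 ∷ 3 ∷ 1 ∷ 2 ∷ []) [] refl tt) h)
  ...     | there (there (here h)) = inj₁ (just-C₄ (Rest-select r' (0 ∷ 2 ∷ 1 ∷ 3 ∷ []) [] refl tt) h)

≟-true : ∀ {n} {x y : Fin n} → x ≡ y → ⌊ x ≟ y ⌋ ≡ true
≟-true {x = x} refl with x ≟ x
... | yes _ = refl
... | no ¬e = contradiction refl ¬e

≟-false : ∀ {n} {x y : Fin n} → x ≢ y → ⌊ x ≟ y ⌋ ≡ false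
≟-false {x = x} {y} ne with x ≟ y
... | yes e = contradiction e ne
... | no _  = refl

≟-sound : ∀ {n} {x y : Fin n} → ⌊ x ≟ y ⌋ ≡ true → x ≡ y
≟-sound {x = x} {y} e with x ≟ y
... | yes x≡y = x≡y

∨-true : ∀ {a b} → a ≡ true ⊎ b ≡ true → a ∨ b ≡ true
∨-true         (inj₁ refl) = refl
∨-true {true}  (inj₂ refl) = refl
∨-true {false} (inj₂ refl) = refl

∨-false : ∀ {a b} → a ≡ false → b ≡ false → a ∨ b ≡ false
∨-false refl refl = refl

∨-split : ∀ {a b} → a ∨ b ≡ true → a ≡ true ⊎ b ≡ true
∨-split {true}  _ = inj₁ refl
∨-split {false} e = inj₂ e

countIn-values : ∀ {n} {X : VSet n} {xs bs} → Pointwise (λ x b → X x ≡ b) xs bs →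
                 countIn X xs ≡ sum (map (λ b → if b then 1 else 0) bs)
countIn-values []         = refl
countIn-values (refl ∷ p) = cong (_ +_) (countIn-values p)

-- The three membership values of a vertex in a partition into `S`, `A`, `B`. Matching on it settles
-- cover and disjointness together.
data Part : Bool → Bool → Bool → Set where
  inS : Part true false false
  inA : Part false true false
  inB : Part false false true

part-S : ∀ {s a b} → s ≡ true → a ≡ false → b ≡ false → Part s a b
part-S refl refl refl = inS

part-A : ∀ {s a b} → s ≡ false → a ≡ true → b ≡ false → Part s a b
part-A refl refl refl = inA

part-B : ∀ {s a b} → s ≡ false → a ≡ false → b ≡ true → Part s a b
part-B refl refl refl = inB

two-components : ∀ {n} {G : Graph n} {S A B : VSet n} → (∀ x → Part (S x) (A x) (B x)) →
                 ConnectedIn G A → ConnectedIn G B →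
                 (∀ a b → A a ≡ true → B b ≡ true → G a b ≡ false) → TwoComponents G S A B
two-components {S = S} {A} {B} part cA cB apart =
  (λ x → cover (part x)) , (λ x → SA (part x)) , (λ x → SB (part x)) , (λ x → AB (part x)) , cA , cB , apart
  where
  cover : ∀ {s a b} → Part s a b → s ∨ a ∨ b ≡ true
  cover inS = refl
  cover inA = refl
  cover inB = refl
  SA : ∀ {s a b} → Part s a b → s ∧ a ≡ false
  SA inS = refl
  SA inA = refl
  SA inB = refl
  SB : ∀ {s a b} → Part s a b → s ∧ b ≡ false
  SB inS = refl
  SB inA = refl
  SB inB = refl
  AB : ∀ {s a b} → Part s a b → a ∧ b ≡ false
  AB inS = refl
  AB inA = refl
  AB inB = refl

listed? : ∀ {n} (x : Fin n) xs → x ∈ xs ⊎ x ∉ xs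
listed? x xs with Any.any? (x ≟_) xs
... | yes x∈ = inj₁ x∈
... | no x∉  = inj₂ x∉

-- 2K₂ + K₁ leads to 𝒢₁.

module TwoSides {n : ℕ} (G : Graph n) (simple : IsSimple G) (clawFree : ClawFree G)
                (deficiency : Matchings.DeficiencyAtMostOne G simple) (conn : Connected G) where

  open Start G simple clawFree deficiency conn

  module Gate {a b c d v p q s t : Fin n} (r : Rest (a ∷ b ∷ c ∷ d ∷ v ∷ p ∷ q ∷ s ∷ t ∷ []))
              (h : Holds (a ∷ b ∷ c ∷ d ∷ v ∷ p ∷ q ∷ s ∷ t ∷ []) gate) where

    J : List (Fin n)
    J = a ∷ b ∷ c ∷ d ∷ v ∷ p ∷ q ∷ s ∷ t ∷ []

    ab = Sat-nth (adj J) gate h 0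
    cd = Sat-nth (adj J) gate h 1
    ac = Sat-nth (adj J) gate h 2
    ad = Sat-nth (adj J) gate h 3
    av = Sat-nth (adj J) gate h 4
    bc = Sat-nth (adj J) gate h 5
    bd = Sat-nth (adj J) gate h 6
    bv = Sat-nth (adj J) gate h 7
    cv = Sat-nth (adj J) gate h 8
    dv = Sat-nth (adj J) gate h 9
    ap = Sat-nth (adj J) gate h 10
    bq = Sat-nth (adj J) gate h 11
    vq = Sat-nth (adj J) gate h 12
    pq = Sat-nth (adj J) gate h 13
    cs = Sat-nth (adj J) gate h 14
    dt = Sat-nth (adj J) gate h 15
    vt = Sat-nth (adj J) gate h 16
    st = Sat-nth (adj J) gate h 17

    L R : Fin n → Set
    L x = G a x ≡ true × G b x ≡ true × G c x ≡ false × G d x ≡ false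
    R x = G c x ≡ true × G d x ≡ true × G a x ≡ false × G b x ≡ false

    -- The kind of vertex that should not exist: it sees nothing of the gate, and adjacency
    -- preserves it, so a walk from it could never arrive at `a`.
    Far : Fin n → Set
    Far x = x ∉ J × All (λ j → G j x ≡ false) J

    far-stays : ∀ {x y} → Far x → G x y ≡ true → Far y
    far-stays {x} {y} (x∉ , far) xy with Any.any? (y ≟_) J
    ... | yes y∈ = ⊥-elim (true≢false (G-sym xy) (All.lookup far y∈))
    ... | no y∉ with pull₂ r x∉ y∉ (G-irr xy)
    ...   | inj₁ (r' , _) with apply nothing gate-edge refl r' h (xy , tt)
    ...     | here (ax , _)         = ⊥-elim (true≢false ax (All.head far))
    ...     | there (here (cx , _)) = ⊥-elim (true≢false cx (All.lookup far (there (there (here refl)))))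
    ...     | there (there (here (_ , _ , _ , _ , _ , _ , _ , _ , _ , e₀ , e₁ , e₂ , e₃ , e₄ , e₅ , e₆ , e₇ , e₈ , _))) =
                y∉ , e₀ ∷ e₁ ∷ e₂ ∷ e₃ ∷ e₄ ∷ e₅ ∷ e₆ ∷ e₇ ∷ e₈ ∷ []
    far-stays {x} {y} (x∉ , f₀ ∷ f₁ ∷ f₂ ∷ f₃ ∷ f₄ ∷ f₅ ∷ f₆ ∷ f₇ ∷ f₈ ∷ []) xy | no y∉ | inj₂ (_ , _ , r' , xx , yy)
      with apply₁ nothing gate-far refl r' h (xx , yy , f₀ , f₁ , f₂ , f₃ , f₄ , f₅ , f₆ , f₇ , f₈ , xy , tt)
    ... | e₀ , e₁ , e₂ , e₃ , e₄ , e₅ , e₆ , e₇ , e₈ , _ = y∉ , e₀ ∷ e₁ ∷ e₂ ∷ e₃ ∷ e₄ ∷ e₅ ∷ e₆ ∷ e₇ ∷ e₈ ∷ []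

    edge-sides : ∀ {x w} → x ∉ J → Rest (J ++ x ∷ w ∷ []) → G x w ≡ true → L x × L w ⊎ R x × R w
    edge-sides {x} x∉ r' xw with apply nothing gate-edge refl r' h (xw , tt)
    ... | here (e₀ , e₁ , e₂ , e₃ , f₀ , f₁ , f₂ , f₃ , _) = inj₁ ((e₀ , e₁ , e₂ , e₃) , f₀ , f₁ , f₂ , f₃)
    ... | there (here (e₀ , e₁ , e₂ , e₃ , f₀ , f₁ , f₂ , f₃ , _)) = inj₂ ((e₀ , e₁ , e₂ , e₃) , f₀ , f₁ , f₂ , f₃)
    ... | there (there (here (e₀ , e₁ , e₂ , e₃ , e₄ , e₅ , e₆ , e₇ , e₈ , _))) =
          contradiction (here refl) (proj₁ (spread Far far-stays (path x a)
            (x∉ , e₀ ∷ e₁ ∷ e₂ ∷ e₃ ∷ e₄ ∷ e₅ ∷ e₆ ∷ e₇ ∷ e₈ ∷ [])))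

    L-or-R : ∀ {x} → x ∉ J → L x ⊎ R x
    L-or-R x∉ with pull r _ x∉
    ... | w , r' , xw = [ inj₁ ∘ proj₁ , inj₂ ∘ proj₁ ]′ (edge-sides x∉ r' xw)

    L-R-absurd : ∀ {x} → L x → R x → ⊥
    L-R-absurd (ax , _) (_ , _ , ax' , _) = true≢false ax ax'

    L-partner : ∀ {x w} → x ∉ J → L x → Rest (J ++ x ∷ w ∷ []) → G x w ≡ true → L w
    L-partner x∉ Lx r' xw with edge-sides x∉ r' xw
    ... | inj₁ (_ , Lw) = Lw
    ... | inj₂ (Rx , _) = ⊥-elim (L-R-absurd Lx Rx)

    R-partner : ∀ {x w} → x ∉ J → R x → Rest (J ++ x ∷ w ∷ []) → G x w ≡ true → R w
    R-partner x∉ Rx r' xw with edge-sides x∉ r' xw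
    ... | inj₂ (_ , Rw) = Rw
    ... | inj₁ (Lx , _) = ⊥-elim (L-R-absurd Lx Rx)

    L-near : ∀ {x} → x ∉ J → L x →
             G b p ≡ true × G a q ≡ true × G p x ≡ true × G q x ≡ true × G s x ≡ false × G t x ≡ false
    L-near {x} x∉ Lx@(e₀ , e₁ , e₂ , e₃) with pull r x x∉
    ... | w , r' , xw with L-partner x∉ Lx r' xw
    ...   | f₀ , f₁ , f₂ , f₃
      with apply₁ nothing gate-left refl r' h (xw , e₀ , e₁ , e₂ , e₃ , f₀ , f₁ , f₂ , f₃ , tt)
    ...     | g₀ , g₁ , g₂ , g₃ , g₄ , g₅ , _ = g₀ , g₁ , g₂ , g₃ , g₄ , g₅

    -- Returns one of two pulled edges to the matching, so that facts about a single outside edge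
    -- apply to the other.
    first : ∀ {x x' y y'} → Rest (J ++ x ∷ x' ∷ y ∷ y' ∷ []) → G y y' ≡ true → Rest (J ++ x ∷ x' ∷ [])
    first r' yy = Rest-select r' (upTo 11) ((11 , 12) ∷ []) refl (yy , tt)

    second : ∀ {x x' y y'} → Rest (J ++ x ∷ x' ∷ y ∷ y' ∷ []) → G x x' ≡ true → Rest (J ++ y ∷ y' ∷ [])
    second r' xx = Rest-select r' (upTo 9 ++ 11 ∷ 12 ∷ []) ((9 , 10) ∷ []) refl (xx , tt)

    L-clique : ∀ {x y} → x ∉ J → y ∉ J → L x → L y → x ≢ y → G x y ≡ true
    L-clique x∉ y∉ Lx Ly x≢y with pull₂ r x∉ y∉ x≢y
    ... | inj₁ (_ , xy) = xy
    ... | inj₂ (x' , y' , r' , xx , yy)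
      with Lx | L-partner x∉ Lx (first r' yy) xx | Ly | L-partner y∉ Ly (second r' xx) yy
    ... | e₀ , e₁ , e₂ , e₃ | f₀ , f₁ , f₂ , f₃ | g₀ , g₁ , g₂ , g₃ | k₀ , k₁ , k₂ , k₃ =
      proj₁ ((apply₁ nothing gate-left-left refl r' h
        (xx , yy , e₀ , e₁ , e₂ , e₃ , f₀ , f₁ , f₂ , f₃ , g₀ , g₁ , g₂ , g₃ , k₀ , k₁ , k₂ , k₃ , tt)))

    L-R-apart : ∀ {x y} → x ∉ J → y ∉ J → L x → R y → G x y ≡ false
    L-R-apart {x} {y} x∉ y∉ Lx Ry with pull₂ r x∉ y∉ (λ { refl → L-R-absurd Lx Ry })
    ... | inj₁ (r' , xy) = ⊥-elim (L-R-absurd (L-partner x∉ Lx r' xy) Ry)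
    ... | inj₂ (x' , y' , r' , xx , yy)
      with Lx | L-partner x∉ Lx (first r' yy) xx | Ry | R-partner y∉ Ry (second r' xx) yy
    ... | e₀ , e₁ , e₂ , e₃ | f₀ , f₁ , f₂ , f₃ | g₀ , g₁ , g₂ , g₃ | k₀ , k₁ , k₂ , k₃ =
      proj₁ ((apply₁ nothing gate-left-right refl r' h
        (xx , yy , e₀ , e₁ , e₂ , e₃ , f₀ , f₁ , f₂ , f₃ , g₀ , g₁ , g₂ , g₃ , k₀ , k₁ , k₂ , k₃ , tt)))

    -- Contains `a` and `b`, each seen by the other, as well as `p`, `q` and every outside vertex of
    -- type `L`; the cut vertex `v` sees neither `a` nor `b` and stays out.
    Left : VSet n
    Left x = G a x ∨ G b x

    data InLeft (x : Fin n) : Set where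
      is-a : x ≡ a → InLeft x
      is-b : x ≡ b → InLeft x
      is-p : x ≡ p → InLeft x
      is-q : x ≡ q → InLeft x
      outL : x ∉ J → L x → InLeft x

    left-values : Pointwise (λ x e → Left x ≡ e) J
                    (true ∷ true ∷ false ∷ false ∷ false ∷ true ∷ true ∷ false ∷ false ∷ [])
    left-values with apply₁ nothing gate-cross refl r h tt
    ... | cp , dp , cq , dq , ps , pt , qs , qt , as , bs , at' , bt , _ =
      ∨-true (inj₂ (G-sym ab)) ∷ ∨-true (inj₁ ab) ∷ ∨-false ac bc ∷ ∨-false ad bd ∷ ∨-false av bv ∷
      ∨-true (inj₁ ap) ∷ ∨-true (inj₂ bq) ∷ ∨-false as bs ∷ ∨-false at' bt ∷ []

    in-left : ∀ {x} → Left x ≡ true → InLeft x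
    in-left {x} e = [ (λ x∈ → All.lookup (listed left-values) x∈ e) , (λ x∉ → [ outL x∉ , not-right ]′ (L-or-R x∉)) ]′ (listed? x J)
      where
      listed : Pointwise (λ x e → Left x ≡ e) J
                 (true ∷ true ∷ false ∷ false ∷ false ∷ true ∷ true ∷ false ∷ false ∷ []) →
               All (λ x → Left x ≡ true → InLeft x) J
      listed (_ ∷ _ ∷ c ∷ d ∷ v ∷ _ ∷ _ ∷ s ∷ t ∷ []) =
        (λ _ → is-a refl) ∷ (λ _ → is-b refl) ∷ absurd c ∷ absurd d ∷ absurd v ∷
        (λ _ → is-p refl) ∷ (λ _ → is-q refl) ∷ absurd s ∷ absurd t ∷ []
        where
        absurd : ∀ {y} → Left y ≡ false → Left y ≡ true → InLeft y
        absurd f t = ⊥-elim (true≢false t f)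

      not-right : R x → InLeft x
      not-right (_ , _ , ax , bx) = ⊥-elim (true≢false e (∨-false ax bx))

    left-a : Left a ≡ true
    left-a with left-values
    ... | e ∷ _ = e

    left-connected : ConnectedIn G Left
    left-connected with left-values
    ... | la ∷ lb ∷ _ ∷ _ ∷ _ ∷ lp ∷ lq ∷ _ = hub-connected a la (λ e → near e (in-left e))
      where
      near : ∀ {x} → Left x ≡ true → InLeft x → WalkIn G Left x a × WalkIn G Left a x
      near e (is-a refl)        = here , here
      near e (is-b refl)        = step (G-sym ab) la here , step ab lb here
      near e (is-p refl)        = step (G-sym ap) la here , step ap lp here
      near e (is-q refl)        = step (G-sym bq) lb (step (G-sym ab) la here) , step ab lb (step bq lq here)
      near e (outL _ (ax , _))  = step (G-sym ax) la here , step ax e here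

    -- The two outcomes of `gate-shape`. With both diagonals the side is a clique whose outside part
    -- is a union of matching edges. Without them no outside vertex can be of type `L`, as `L-near`
    -- would supply a diagonal, so the side is the cycle itself and `v` sees the edge `pq`.
    left-part : G1Part G v Left
    left-part with apply nothing gate-shape refl r h tt
    ... | here (bp , aq , _) = inj₁ (complete (count-parity Left r same))
      where
      adjacent : ∀ {x y} → InLeft x → InLeft y → x ≢ y → G x y ≡ true
      adjacent (is-a refl) (is-a refl) ne = contradiction refl ne
      adjacent (is-a refl) (is-b refl) _  = ab
      adjacent (is-a refl) (is-p refl) _  = ap
      adjacent (is-a refl) (is-q refl) _  = aq
      adjacent (is-a refl) (outL _ l)  _  = proj₁ l
      adjacent (is-b refl) (is-a refl) _  = G-sym ab
      adjacent (is-b refl) (is-b refl) ne = contradiction refl ne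
      adjacent (is-b refl) (is-p refl) _  = bp
      adjacent (is-b refl) (is-q refl) _  = bq
      adjacent (is-b refl) (outL _ l)  _  = proj₁ (proj₂ l)
      adjacent (is-p refl) (is-a refl) _  = G-sym ap
      adjacent (is-p refl) (is-b refl) _  = G-sym bp
      adjacent (is-p refl) (is-p refl) ne = contradiction refl ne
      adjacent (is-p refl) (is-q refl) _  = pq
      adjacent (is-p refl) (outL o l)  _  = proj₁ (proj₂ (proj₂ (L-near o l)))
      adjacent (is-q refl) (is-a refl) _  = G-sym aq
      adjacent (is-q refl) (is-b refl) _  = G-sym bq
      adjacent (is-q refl) (is-p refl) _  = G-sym pq
      adjacent (is-q refl) (is-q refl) ne = contradiction refl ne
      adjacent (is-q refl) (outL o l)  _  = proj₁ (proj₂ (proj₂ (proj₂ (L-near o l))))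
      adjacent (outL _ l)  (is-a refl) _  = G-sym (proj₁ l)
      adjacent (outL _ l)  (is-b refl) _  = G-sym (proj₁ (proj₂ l))
      adjacent (outL o l)  (is-p refl) _  = G-sym (proj₁ (proj₂ (proj₂ (L-near o l))))
      adjacent (outL o l)  (is-q refl) _  = G-sym (proj₁ (proj₂ (proj₂ (proj₂ (L-near o l)))))
      adjacent (outL o l)  (outL o' l') ne = L-clique o o' l l' ne

      same : ∀ {x y} → Rest (J ++ x ∷ y ∷ []) → G x y ≡ true → Left x ≡ Left y
      same {x} {y} r' xy with edge-sides (λ x∈ → Unique-apart J (Rest-unique r') x∈ (here refl)) r' xy
      ... | inj₁ ((ax , _) , (ay , _)) = trans (∨-true (inj₁ ax)) (sym (∨-true (inj₁ ay)))
      ... | inj₂ ((_ , _ , ax , bx) , (_ , _ , ay , by)) = trans (∨-false ax bx) (sym (∨-false ay by))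

      complete : ∃[ k ] count Left ≡ countIn Left J + 2 * k → CompleteEven G Left
      -- Four gate vertices lie on this side, the others come in matched pairs: 4 + 2k = 2(2 + k).
      complete (k , eq) = 2 + k , clique-iso (λ lx ly ne → adjacent (in-left lx) (in-left ly) ne) o
        (trans eq (trans (cong (_+ 2 * k) (countIn-values left-values)) (sym (ℕ.*-distribˡ-+ 2 2 k))))
    left-part | there (here (bp , aq , vp , _)) = inj₂
      ( described-iso (Cycle 4) (toWitness {a? = simple? (Cycle 4)} tt) o (a ∷ b ∷ q ∷ p ∷ []) refl distinct
          (values left-values) (λ e → four (in-left e)) (ab , aq , ap , bq , bp , G-sym pq , tt)
      , p , q , G-irr pq , All.lookup (values left-values) (there (there (there (here refl))))
      , All.lookup (values left-values) (there (there (here refl))) , pq , (λ x e vx → touching (in-left e) vx) , vp , vq )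
      where
      distinct : Unique (a ∷ b ∷ q ∷ p ∷ [])
      distinct = Unique-++ˡ (a ∷ b ∷ q ∷ p ∷ []) {v ∷ []}
        (Rest-unique (Rest-select r (0 ∷ 1 ∷ 6 ∷ 5 ∷ 4 ∷ []) ((2 , 3) ∷ (7 , 8) ∷ []) refl (cd , st , tt)))

      values : ∀ {e₂ e₃ e₄ e₇ e₈} → Pointwise (λ x e → Left x ≡ e) J (true ∷ true ∷ e₂ ∷ e₃ ∷ e₄ ∷ true ∷ true ∷ e₇ ∷ e₈ ∷ []) →
               All (λ x → Left x ≡ true) (a ∷ b ∷ q ∷ p ∷ [])
      values (la ∷ lb ∷ _ ∷ _ ∷ _ ∷ lp ∷ lq ∷ _) = la ∷ lb ∷ lq ∷ lp ∷ []

      four : ∀ {x} → InLeft x → x ∈ a ∷ b ∷ q ∷ p ∷ []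
      four (is-a refl) = here refl
      four (is-b refl) = there (here refl)
      four (is-q refl) = there (there (here refl))
      four (is-p refl) = there (there (there (here refl)))
      four (outL x∉ l) = ⊥-elim (true≢false (proj₁ (L-near x∉ l)) bp)

      touching : ∀ {x} → InLeft x → G v x ≡ true → x ≡ p ⊎ x ≡ q
      touching (is-a refl) vx = ⊥-elim (true≢false (G-sym vx) av)
      touching (is-b refl) vx = ⊥-elim (true≢false (G-sym vx) bv)
      touching (is-p refl) _  = inj₁ refl
      touching (is-q refl) _  = inj₂ refl
      touching (outL x∉ l) _  = ⊥-elim (true≢false (proj₁ (L-near x∉ l)) bp)

  -- The gate is symmetric under exchanging its sides, so the right side is the `Left` of the
  -- exchanged gate. The non-neighbours of `v` are `a` and `c`.
  two-gates : ∀ {a b c d v p q s t} (r : Rest (a ∷ b ∷ c ∷ d ∷ v ∷ p ∷ q ∷ s ∷ t ∷ [])) (r' : Rest (c ∷ d ∷ a ∷ b ∷ v ∷ s ∷ t ∷ p ∷ q ∷ [])) →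
              Holds (a ∷ b ∷ c ∷ d ∷ v ∷ p ∷ q ∷ s ∷ t ∷ []) gate → Holds (c ∷ d ∷ a ∷ b ∷ v ∷ s ∷ t ∷ p ∷ q ∷ []) gate → InG1 G
  two-gates {a} {b} {c} {d} {v} {p} {q} {s} {t} r r' h h' =
    v , Gate.Left r h , Gate.Left r' h' , two-components part (Gate.left-connected r h) (Gate.left-connected r' h')
      (λ x y ex ey → apart ((apply₁ nothing gate-cross refl r h tt)) (Gate.in-left r h ex) (Gate.in-left r' h' ey)) , Gate.left-part r h , Gate.left-part r' h' ,
      λ _ _ → (a , Gate.left-a r h , G-sym (Gate.av r h)) , (c , Gate.left-a r' h' , G-sym (Gate.cv r h))
    where
    J J' : List (Fin n)
    J  = a ∷ b ∷ c ∷ d ∷ v ∷ p ∷ q ∷ s ∷ t ∷ []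
    J' = c ∷ d ∷ a ∷ b ∷ v ∷ s ∷ t ∷ p ∷ q ∷ []

    part : ∀ x → Part (singleton v x) (Gate.Left r h x) (Gate.Left r' h' x)
    part x = [ All.lookup (listed (Gate.left-values r h) (Gate.left-values r' h')) , (λ x∉ → [ left x∉ , right x∉ ]′ (Gate.L-or-R r h x∉)) ]′ (listed? x J)
      where
      ≢v : ∀ {y z} → G y z ≡ true → G z v ≡ false → singleton v y ≡ false
      ≢v yz zv = ≟-false λ { refl → true≢false (G-sym yz) zv }

      listed : Pointwise (λ x e → Gate.Left r h x ≡ e) J (true ∷ true ∷ false ∷ false ∷ false ∷ true ∷ true ∷ false ∷ false ∷ []) →
               Pointwise (λ x e → Gate.Left r' h' x ≡ e) J' (true ∷ true ∷ false ∷ false ∷ false ∷ true ∷ true ∷ false ∷ false ∷ []) →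
               All (λ x → Part (singleton v x) (Gate.Left r h x) (Gate.Left r' h' x)) J
      listed (a₁ ∷ b₁ ∷ c₁ ∷ d₁ ∷ v₁ ∷ p₁ ∷ q₁ ∷ s₁ ∷ t₁ ∷ []) (c₂ ∷ d₂ ∷ a₂ ∷ b₂ ∷ v₂ ∷ s₂ ∷ t₂ ∷ p₂ ∷ q₂ ∷ []) =
        part-A (≢v (Gate.ab r h) (Gate.bv r h)) a₁ a₂ ∷ part-A (≢v (G-sym (Gate.ab r h)) (Gate.av r h)) b₁ b₂ ∷ part-B (≢v (Gate.cd r h) (Gate.dv r h)) c₁ c₂ ∷ part-B (≢v (G-sym (Gate.cd r h)) (Gate.cv r h)) d₁ d₂ ∷
        part-S (≟-true refl) v₁ v₂ ∷ part-A (≢v (G-sym (Gate.ap r h)) (Gate.av r h)) p₁ p₂ ∷ part-A (≢v (G-sym (Gate.bq r h)) (Gate.bv r h)) q₁ q₂ ∷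
        part-B (≢v (G-sym (Gate.cs r h)) (Gate.cv r h)) s₁ s₂ ∷ part-B (≢v (G-sym (Gate.dt r h)) (Gate.dv r h)) t₁ t₂ ∷ []

      v∉ : x ∉ J → singleton v x ≡ false
      v∉ x∉ = ≟-false λ { refl → x∉ (there (there (there (there (here refl))))) }

      left : x ∉ J → Gate.L r h x → Part (singleton v x) (Gate.Left r h x) (Gate.Left r' h' x)
      left x∉ (ax , bx , cx , dx) = part-A (v∉ x∉) (∨-true (inj₁ ax)) (∨-false cx dx)

      right : x ∉ J → Gate.R r h x → Part (singleton v x) (Gate.Left r h x) (Gate.Left r' h' x)
      right x∉ (cx , dx , ax , bx) = part-B (v∉ x∉) (∨-false ax bx) (∨-true (inj₁ cx))

    apart : Holds J (2 ≁ 5 ∷ 3 ≁ 5 ∷ 2 ≁ 6 ∷ 3 ≁ 6 ∷ 5 ≁ 7 ∷ 5 ≁ 8 ∷ 6 ≁ 7 ∷ 6 ≁ 8 ∷ 0 ≁ 7 ∷ 1 ≁ 7 ∷ 0 ≁ 8 ∷ 1 ≁ 8 ∷ []) → ∀ {x y} → Gate.InLeft r h x → Gate.InLeft r' h' y → G x y ≡ false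
    apart (cp , dp , cq , dq , ps , pt , qs , qt , as , bs , at' , bt , _) = go
      where
      go : ∀ {x y} → Gate.InLeft r h x → Gate.InLeft r' h' y → G x y ≡ false
      go (Gate.is-a refl) (Gate.is-a refl) = Gate.ac r h
      go (Gate.is-a refl) (Gate.is-b refl) = Gate.ad r h
      go (Gate.is-a refl) (Gate.is-p refl) = as
      go (Gate.is-a refl) (Gate.is-q refl) = at'
      go (Gate.is-a refl) (Gate.outL _ (_ , _ , e , _)) = e
      go (Gate.is-b refl) (Gate.is-a refl) = Gate.bc r h
      go (Gate.is-b refl) (Gate.is-b refl) = Gate.bd r h
      go (Gate.is-b refl) (Gate.is-p refl) = bs
      go (Gate.is-b refl) (Gate.is-q refl) = bt
      go (Gate.is-b refl) (Gate.outL _ (_ , _ , _ , e)) = e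
      go (Gate.is-p refl) (Gate.is-a refl) = G-sym cp
      go (Gate.is-p refl) (Gate.is-b refl) = G-sym dp
      go (Gate.is-p refl) (Gate.is-p refl) = ps
      go (Gate.is-p refl) (Gate.is-q refl) = pt
      go (Gate.is-p refl) (Gate.outL o l) = proj₁ (proj₂ (proj₂ (proj₂ (proj₂ (Gate.L-near r' h' o l)))))
      go (Gate.is-q refl) (Gate.is-a refl) = G-sym cq
      go (Gate.is-q refl) (Gate.is-b refl) = G-sym dq
      go (Gate.is-q refl) (Gate.is-p refl) = qs
      go (Gate.is-q refl) (Gate.is-q refl) = qt
      go (Gate.is-q refl) (Gate.outL o l) = proj₂ (proj₂ (proj₂ (proj₂ (proj₂ (Gate.L-near r' h' o l)))))
      go (Gate.outL _ (_ , _ , e , _)) (Gate.is-a refl) = G-sym e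
      go (Gate.outL _ (_ , _ , _ , e)) (Gate.is-b refl) = G-sym e
      go (Gate.outL o l) (Gate.is-p refl) = G-sym (proj₁ (proj₂ (proj₂ (proj₂ (proj₂ (Gate.L-near r h o l))))))
      go (Gate.outL o l) (Gate.is-q refl) = G-sym (proj₂ (proj₂ (proj₂ (proj₂ (proj₂ (Gate.L-near r h o l))))))
      go (Gate.outL o l) (Gate.outL o' l') = Gate.L-R-apart r h o (λ y∈ → o' (∈-resp-↭ regroup y∈)) l l'
        where
        regroup : J ↭ J'
        regroup = ↭-sym (map⁺ (at a J) (permᵇ-sound (2 ∷ 3 ∷ 0 ∷ 1 ∷ 4 ∷ 7 ∷ 8 ∷ 5 ∷ 6 ∷ []) (upTo 9) refl))

  gate-G1 : ∀ {a b c d v p q s t} → Rest (a ∷ b ∷ c ∷ d ∷ v ∷ p ∷ q ∷ s ∷ t ∷ []) →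
            Holds (a ∷ b ∷ c ∷ d ∷ v ∷ p ∷ q ∷ s ∷ t ∷ []) gate → InG1 G
  gate-G1 r h@(ab , cd , ac , ad , av , bc , bd , bv , cv , dv , ap , bq , vq , pq , cs , dt , vt , st , _) =
    two-gates r (Rest-select r (2 ∷ 3 ∷ 0 ∷ 1 ∷ 4 ∷ 7 ∷ 8 ∷ 5 ∷ 6 ∷ []) [] refl tt) h
      (cd , ab , G-sym ac , G-sym bc , cv , G-sym ad , G-sym bd , dv , av , bv , cs , dt , vt , st , ap , bq , vq , pq , tt)

  -- A matching edge `pq` that starts next to `a` and touches `v`. Which of its ends touches `v`
  -- stays open here and is settled by `orient`.
  Clamp₁ : Fin n → Fin n → Fin n → Set
  Clamp₁ c d v = ∃[ a ] ∃[ b ] ∃[ p ] ∃[ q ]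
    (Rest (a ∷ b ∷ c ∷ d ∷ v ∷ p ∷ q ∷ []) × Holds (a ∷ b ∷ c ∷ d ∷ v ∷ []) (2K₂+K₁ 0 1 2 3 4)
      × G a p ≡ true × G p q ≡ true × (G v p ≡ true ⊎ G v q ≡ true))

  Clamp₂ : Fin n → Fin n → Fin n → Fin n → Fin n → Set
  Clamp₂ c d v p q = ∃[ a ] ∃[ b ] ∃[ s ] ∃[ t ]
    (Rest (a ∷ b ∷ c ∷ d ∷ v ∷ p ∷ q ∷ s ∷ t ∷ []) × Holds (a ∷ b ∷ c ∷ d ∷ v ∷ []) (2K₂+K₁ 0 1 2 3 4)
      × G a s ≡ true × G s t ≡ true × (G v s ≡ true ⊎ G v t ≡ true))

  touches : ∀ v x y → (G v x ≡ true ⊎ G v y ≡ true) ⊎ (G v x ≡ false × G v y ≡ false)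
  touches v x y with G v x | G v y
  ... | true  | _     = inj₁ (inj₁ refl)
  ... | false | true  = inj₁ (inj₂ refl)
  ... | false | false = inj₂ (refl , refl)

  -- The matching edge ab follows a walk to v until the next edge meets N(v).
  clamp₁ : ∀ {a b c d v} → WalkIn G full a v → Rest (a ∷ b ∷ c ∷ d ∷ v ∷ []) →
           Holds (a ∷ b ∷ c ∷ d ∷ v ∷ []) (2K₂+K₁ 0 1 2 3 4) → Clamp₁ c d v
  clamp₁ here r (ab , cd , ac , ad , av , bc , bd , bv , cv , dv , _) = ⊥-elim (true≢false (G-sym ab) bv)
  clamp₁ {a} {b} {c} {d} {v} (step {w = y} ay _ w) r h@(ab , cd , ac , ad , av , bc , bd , bv , cv , dv , _) =
    [ (λ y∈ → All.lookup listed y∈ ay (clamp₁ w)) , (λ y∉ → continue y∉ ay (clamp₁ w)) ]′ (listed? y (a ∷ b ∷ c ∷ d ∷ v ∷ []))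
    where
    From : Fin n → Set
    From y = ∀ {b} → Rest (y ∷ b ∷ c ∷ d ∷ v ∷ []) → Holds (y ∷ b ∷ c ∷ d ∷ v ∷ []) (2K₂+K₁ 0 1 2 3 4) → Clamp₁ c d v

    absurd : ∀ {y} → G a y ≡ false → G a y ≡ true → From y → Clamp₁ c d v
    absurd f t _ = ⊥-elim (true≢false t f)

    listed : All (λ y → G a y ≡ true → From y → Clamp₁ c d v) (a ∷ b ∷ c ∷ d ∷ v ∷ [])
    listed = (λ _ k → k r h) ∷
      (λ _ k → k (Rest-select r (1 ∷ 0 ∷ 2 ∷ 3 ∷ 4 ∷ []) [] refl tt) (G-sym ab , cd , bc , bd , bv , ac , ad , av , cv , dv , tt)) ∷
      absurd ac ∷ absurd ad ∷ absurd av ∷ []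

    continue : ∀ {y} → y ∉ a ∷ b ∷ c ∷ d ∷ v ∷ [] → G a y ≡ true → From y → Clamp₁ c d v
    continue {y} y∉ ay k with pull r y y∉
    ... | z , r' , yz = [ (λ touch → a , b , y , z , r' , h , ay , yz , touch)
      , (λ (vy , vz) → further vy vz ((apply₁ nothing advance refl r' h (yz , ay , vy , vz , tt)))) ]′ (touches v y z)
      where
      further : G v y ≡ false → G v z ≡ false → G c y ≡ false × G d y ≡ false × G c z ≡ false × G d z ≡ false × ⊤ → Clamp₁ c d v
      further vy vz (cy , dy , cz , dz , _) = k (Rest-select r' (5 ∷ 6 ∷ 2 ∷ 3 ∷ 4 ∷ []) ((0 , 1) ∷ []) refl (ab , tt))
        (yz , cd , G-sym cy , G-sym dy , G-sym vy , G-sym cz , G-sym dz , G-sym vz , cv , dv , tt)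

  -- The same walk for the other edge, with the link `pq` of the first edge held in the list. The
  -- `one-side` tables prevent the walk from running into that link.
  clamp₂ : ∀ {a b c d v p q} → WalkIn G full a v → Rest (a ∷ b ∷ c ∷ d ∷ v ∷ p ∷ q ∷ []) →
           Holds (a ∷ b ∷ c ∷ d ∷ v ∷ []) (2K₂+K₁ 0 1 2 3 4) →
           G c p ≡ true → G p q ≡ true → G v p ≡ true ⊎ G v q ≡ true → Clamp₂ c d v p q
  clamp₂ here r (ab , cd , ac , ad , av , bc , bd , bv , cv , dv , _) cp pq touch = ⊥-elim (true≢false (G-sym ab) bv)
  clamp₂ {a} {b} {c} {d} {v} {p} {q} (step {w = y} ay _ w) r h@(ab , cd , ac , ad , av , bc , bd , bv , cv , dv , _) cp pq touch =
    [ (λ y∈ → All.lookup listed y∈ ay (λ r h → clamp₂ w r h cp pq touch)) , (λ y∉ → continue y∉ ay (λ r h → clamp₂ w r h cp pq touch)) ]′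
      (listed? y (a ∷ b ∷ c ∷ d ∷ v ∷ p ∷ q ∷ []))
    where
    From : Fin n → Set
    From y = ∀ {b} → Rest (y ∷ b ∷ c ∷ d ∷ v ∷ p ∷ q ∷ []) → Holds (y ∷ b ∷ c ∷ d ∷ v ∷ []) (2K₂+K₁ 0 1 2 3 4) → Clamp₂ c d v p q

    absurd : ∀ {y} → G a y ≡ false → G a y ≡ true → From y → Clamp₂ c d v p q
    absurd f t _ = ⊥-elim (true≢false t f)

    listed : All (λ y → G a y ≡ true → From y → Clamp₂ c d v p q) (a ∷ b ∷ c ∷ d ∷ v ∷ p ∷ q ∷ [])
    listed = (λ _ k → k r h) ∷
      (λ _ k → k (Rest-select r (1 ∷ 0 ∷ 2 ∷ 3 ∷ 4 ∷ 5 ∷ 6 ∷ []) [] refl tt) (G-sym ab , cd , bc , bd , bv , ac , ad , av , cv , dv , tt)) ∷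
      absurd ac ∷ absurd ad ∷ absurd av ∷
      (λ ay _ → [ (λ vp → case apply nothing one-side55 refl r h (pq , cp , vp , ay , tt) of λ ())
                , (λ vq → case apply nothing one-side65 refl r h (pq , cp , vq , ay , tt) of λ ()) ]′ touch) ∷
      (λ ay _ → [ (λ vp → case apply nothing one-side56 refl r h (pq , cp , vp , ay , tt) of λ ())
                , (λ vq → case apply nothing one-side66 refl r h (pq , cp , vq , ay , tt) of λ ()) ]′ touch) ∷ []

    continue : ∀ {y} → y ∉ a ∷ b ∷ c ∷ d ∷ v ∷ p ∷ q ∷ [] → G a y ≡ true → From y → Clamp₂ c d v p q
    continue {y} y∉ ay k with pull r y y∉
    ... | z , r' , yz = [ (λ touch' → a , b , y , z , r' , h , ay , yz , touch')
      , (λ (vy , vz) → further vy vz ((apply₁ nothing advance' refl r' h (pq , yz , ay , vy , vz , tt)))) ]′ (touches v y z)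
      where
      further : G v y ≡ false → G v z ≡ false → G c y ≡ false × G d y ≡ false × G c z ≡ false × G d z ≡ false × ⊤ → Clamp₂ c d v p q
      further vy vz (cy , dy , cz , dz , _) = k (Rest-select r' (7 ∷ 8 ∷ 2 ∷ 3 ∷ 4 ∷ 5 ∷ 6 ∷ []) ((0 , 1) ∷ []) refl (ab , tt))
        (yz , cd , G-sym cy , G-sym dy , G-sym vy , G-sym cz , G-sym dz , G-sym vz , cv , dv , tt)

  orient : ∀ {a b c d v p q s t} → Rest (a ∷ b ∷ c ∷ d ∷ v ∷ p ∷ q ∷ s ∷ t ∷ []) →
           Holds (a ∷ b ∷ c ∷ d ∷ v ∷ []) (2K₂+K₁ 0 1 2 3 4) →
           G a p ≡ true → G p q ≡ true → G v p ≡ true ⊎ G v q ≡ true →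
           G c s ≡ true → G s t ≡ true → G v s ≡ true ⊎ G v t ≡ true →
           ∃[ p' ] ∃[ q' ] (Rest (a ∷ b ∷ c ∷ d ∷ v ∷ p' ∷ q' ∷ s ∷ t ∷ [])
             × G a p' ≡ true × G b q' ≡ true × G v q' ≡ true × G p' q' ≡ true)
  orient {p = p} {q} r h ap pq (inj₁ vp) cs st vst with vst
  ... | inj₁ vs with apply nothing orient57 refl r h (pq , st , ap , cs , vp , vs , tt)
  ...   | here (bq , vq , _)         = p , q , r , ap , bq , vq , pq
  ...   | there (here (aq , bp , _)) = q , p , Rest-select r (0 ∷ 1 ∷ 2 ∷ 3 ∷ 4 ∷ 6 ∷ 5 ∷ 7 ∷ 8 ∷ []) [] refl tt , aq , bp , vp , G-sym pq
  orient {p = p} {q} r h ap pq (inj₁ vp) cs st vst | inj₂ vt with apply nothing orient58 refl r h (pq , st , ap , cs , vp , vt , tt)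
  ...   | here (bq , vq , _)         = p , q , r , ap , bq , vq , pq
  ...   | there (here (aq , bp , _)) = q , p , Rest-select r (0 ∷ 1 ∷ 2 ∷ 3 ∷ 4 ∷ 6 ∷ 5 ∷ 7 ∷ 8 ∷ []) [] refl tt , aq , bp , vp , G-sym pq
  orient {p = p} {q} r h ap pq (inj₂ vq) cs st (inj₁ vs) with apply₁ nothing orient67 refl r h (pq , st , ap , cs , vq , vs , tt)
  ... | bq , _ = p , q , r , ap , bq , vq , pq
  orient {p = p} {q} r h ap pq (inj₂ vq) cs st (inj₂ vt) with apply₁ nothing orient68 refl r h (pq , st , ap , cs , vq , vt , tt)
  ... | bq , _ = p , q , r , ap , bq , vq , pq

  -- The second clamp moves only the edge that the first one kept fixed, so both links survive. Each
  -- is then oriented, using the other as the evidence that `orient` requires.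
  two-sides : Base 2K₂+K₁ → InG1 G
  two-sides (a₀ , b₀ , c₀ , d₀ , v , r₀ , h₀) with clamp₁ (path a₀ v) r₀ h₀
  ... | a , b , p₀ , q₀ , r₁ , (ab , cd , ac , ad , av , bc , bd , bv , cv , dv , _) , ap , pq , touch
    with clamp₂ (path c₀ v) (Rest-select r₁ (2 ∷ 3 ∷ 0 ∷ 1 ∷ 4 ∷ 5 ∷ 6 ∷ []) [] refl tt)
           (cd , ab , G-sym ac , G-sym bc , cv , G-sym ad , G-sym bd , dv , av , bv , tt) ap pq touch
  ... | c , d , s₀ , t₀ , r₂ , h₂ , cs , st , touch' with orient r₂' h₂' ap pq touch cs st touch'
    where
    r₂' = Rest-select r₂ (2 ∷ 3 ∷ 0 ∷ 1 ∷ 4 ∷ 5 ∷ 6 ∷ 7 ∷ 8 ∷ []) [] refl tt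
    mirror : ∀ {a b c d v} → Holds (c ∷ d ∷ a ∷ b ∷ v ∷ []) (2K₂+K₁ 0 1 2 3 4) → Holds (a ∷ b ∷ c ∷ d ∷ v ∷ []) (2K₂+K₁ 0 1 2 3 4)
    mirror (cd , ab , ca , cb , cv , da , db , dv , av , bv , _) =
      ab , cd , G-sym ca , G-sym da , av , G-sym cb , G-sym db , bv , cv , dv , tt
    h₂' = mirror h₂
  ... | p , q , r₃ , ap' , bq' , vq' , pq'
    with orient (Rest-select r₃ (2 ∷ 3 ∷ 0 ∷ 1 ∷ 4 ∷ 7 ∷ 8 ∷ 5 ∷ 6 ∷ []) [] refl tt) h₂ cs st touch' ap' pq' (inj₂ vq')
  ... | s , t , r₄ , cs' , dt' , vt' , st' = gate-G1 r₄
        (proj₁ h₂ , proj₁ (proj₂ h₂) , proj₁ (proj₂ (proj₂ h₂)) , nth 3 , nth 4 , nth 5 , nth 6 , nth 7 , nth 8 , nth 9 ,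
         cs' , dt' , vt' , st' , ap' , bq' , vq' , pq' , tt)
    where
    nth = Sat-nth (adj (c ∷ d ∷ a ∷ b ∷ v ∷ [])) (2K₂+K₁ 0 1 2 3 4) h₂

-- Listed sets and comparisons of counts.

member : ∀ {n} → List (Fin n) → VSet n
member []       x = false
member (y ∷ ys) x = ⌊ x ≟ y ⌋ ∨ member ys x

member-∈ : ∀ {n} {x : Fin n} {ys} → x ∈ ys → member ys x ≡ true
member-∈ (here e)   = ∨-true (inj₁ (≟-true e))
member-∈ (there x∈) = ∨-true (inj₂ (member-∈ x∈))

member-∉ : ∀ {n} {x : Fin n} {ys} → x ∉ ys → member ys x ≡ false
member-∉ {ys = []}     x∉ = refl
member-∉ {ys = y ∷ ys} x∉ = ∨-false (≟-false (x∉ ∘ here)) (member-∉ (x∉ ∘ there))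

∈-member : ∀ {n} {x : Fin n} ys → member ys x ≡ true → x ∈ ys
∈-member {x = x} ys e with Any.any? (x ≟_) ys
... | yes x∈ = x∈
... | no x∉  = ⊥-elim (true≢false e (member-∉ x∉))

countIn-≤ : ∀ {n} (X Y : VSet n) → (∀ x → X x ≡ true → Y x ≡ true) → ∀ xs → countIn X xs ≤ countIn Y xs
countIn-≤ X Y sub []       = z≤n
countIn-≤ X Y sub (x ∷ xs) with X x in e
... | false = ℕ.m≤n⇒m≤o+n (if Y x then 1 else 0) (countIn-≤ X Y sub xs)
... | true rewrite sub x e = s≤s (countIn-≤ X Y sub xs)

count-< : ∀ {n} (X Y : VSet n) → (∀ x → X x ≡ true → Y x ≡ true) → ∀ {z} → X z ≡ false → Y z ≡ true → count X < count Y
count-< X Y sub {z} Xz Yz with ∈⇒↭ (∈-allFin z)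
... | W , p = subst (count X <_) (sym (trans (countIn-↭ Y p) (cong (λ b → (if b then 1 else 0) + countIn Y W) Yz)))
  (s≤s (ℕ.≤-trans (ℕ.≤-reflexive (trans (countIn-↭ X p) (cong (λ b → (if b then 1 else 0) + countIn X W) Xz)))
                  (countIn-≤ X Y sub W)))

count-remove : ∀ {n} (X : VSet n) z → X z ≡ true → count X ≡ suc (count (λ x → X x ∧ not ⌊ x ≟ z ⌋))
count-remove {n} X z Xz with ∈⇒↭ (∈-allFin z)
... | W , p = trans (countIn-↭ X p) (trans (cong (λ b → (if b then 1 else 0) + countIn X W) Xz)
    (cong suc (sym (trans (countIn-↭ Y p) (trans (cong (λ b → (if b then 1 else 0) + countIn Y W) Yz) (agree W z∉W))))))
  where
  Y : VSet n
  Y x = X x ∧ not ⌊ x ≟ z ⌋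
  Yz : Y z ≡ false
  Yz = trans (cong (λ b → X z ∧ not b) (≟-true {x = z} refl)) (Bool.∧-zeroʳ _)
  z∉W : z ∉ W
  z∉W = Unique[x∷xs]⇒x∉xs (Unique-resp-↭ p (allFin⁺ n))
  agree : ∀ xs → z ∉ xs → countIn Y xs ≡ countIn X xs
  agree []       _  = refl
  agree (x ∷ xs) z∉ = cong₂ (λ b k → (if b then 1 else 0) + k)
    (trans (cong (λ b → X x ∧ not b) (≟-false (λ e → z∉ (here (sym e))))) (Bool.∧-identityʳ _)) (agree xs (z∉ ∘ there))

count-≥2 : ∀ {n} (X : VSet n) {x y} → x ≢ y → X x ≡ true → X y ≡ true → 2 ≤ count X
count-≥2 X {x} {y} x≢y Xx Xy with ∈⇒↭ (∈-allFin x)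
... | V , p with ∈-resp-↭ p (∈-allFin y)
...   | here y≡x = contradiction (sym y≡x) x≢y
...   | there y∈ with ∈⇒↭ y∈
...     | W , q = subst (2 ≤_) (sym (trans (countIn-↭ X (↭-trans p (prep x q)))
          (cong₂ (λ b b' → (if b then 1 else 0) + ((if b' then 1 else 0) + countIn X W)) Xx Xy))) (s≤s (s≤s z≤n))

-- C₄ + K₁ leads to 𝒢₁, 𝒢₂₁ or 𝒢₃.

module Squares {n : ℕ} (G : Graph n) (simple : IsSimple G) (clawFree : ClawFree G)
               (deficiency : Matchings.DeficiencyAtMostOne G simple) (conn : Connected G)
               (avoid : Local.Avoids G simple clawFree deficiency (proj₁ (proj₁ conn)) 1) where

  open Start G simple clawFree deficiency conn

  -- A vertex `u` attached to the consecutive corners `a` and `b`; the other three positions are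
  -- reduced to this one by rotating the square.
  module Square {a b c d v : Fin n} (r : Rest (a ∷ b ∷ c ∷ d ∷ v ∷ []))
                (h : Holds (a ∷ b ∷ c ∷ d ∷ v ∷ []) (C₄+K₁ 0 1 2 3 4))
                {u : Fin n} (u∉ : u ∉ a ∷ b ∷ c ∷ d ∷ v ∷ [])
                (au : G a u ≡ true) (bu : G b u ≡ true) (cu : G c u ≡ false) (du : G d u ≡ false) where

    private
      ab = Sat-nth (adj (a ∷ b ∷ c ∷ d ∷ v ∷ [])) (C₄+K₁ 0 1 2 3 4) h 0
      bc = Sat-nth (adj (a ∷ b ∷ c ∷ d ∷ v ∷ [])) (C₄+K₁ 0 1 2 3 4) h 1
      cd = Sat-nth (adj (a ∷ b ∷ c ∷ d ∷ v ∷ [])) (C₄+K₁ 0 1 2 3 4) h 2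
      ad = Sat-nth (adj (a ∷ b ∷ c ∷ d ∷ v ∷ [])) (C₄+K₁ 0 1 2 3 4) h 3
      ac = Sat-nth (adj (a ∷ b ∷ c ∷ d ∷ v ∷ [])) (C₄+K₁ 0 1 2 3 4) h 4
      bd = Sat-nth (adj (a ∷ b ∷ c ∷ d ∷ v ∷ [])) (C₄+K₁ 0 1 2 3 4) h 5
      av = Sat-nth (adj (a ∷ b ∷ c ∷ d ∷ v ∷ [])) (C₄+K₁ 0 1 2 3 4) h 6
      bv = Sat-nth (adj (a ∷ b ∷ c ∷ d ∷ v ∷ [])) (C₄+K₁ 0 1 2 3 4) h 7
      cv = Sat-nth (adj (a ∷ b ∷ c ∷ d ∷ v ∷ [])) (C₄+K₁ 0 1 2 3 4) h 8
      dv = Sat-nth (adj (a ∷ b ∷ c ∷ d ∷ v ∷ [])) (C₄+K₁ 0 1 2 3 4) h 9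

    H S : List (Fin n)
    H = a ∷ b ∷ c ∷ d ∷ v ∷ []
    S = a ∷ b ∷ c ∷ d ∷ []

    Sq : VSet n
    Sq = member S

    H-unique : Unique H
    H-unique = Rest-unique r

    a∈ : a ∈ S
    a∈ = here refl

    b∈ : b ∈ S
    b∈ = there (here refl)

    c∈ : c ∈ S
    c∈ = there (there (here refl))

    d∈ : d ∈ S
    d∈ = there (there (there (here refl)))

    v∉S : v ∉ S
    v∉S v∈ = Unique-apart S H-unique v∈ (here refl)

    ∉S : ∀ {x} → x ∉ H → x ∉ S
    ∉S x∉ x∈ = x∉ (∈-++⁺ˡ x∈)

    square-iso : InducedIso G Sq (Cycle 4)
    square-iso = described-iso (Cycle 4) (toWitness {a? = simple? (Cycle 4)} tt) o S refl (Unique-++ˡ S H-unique)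
      (All.tabulate member-∈) (∈-member S) (ab , ac , ad , bc , bd , cd , tt)

    square-connected : ConnectedIn G Sq
    square-connected = hub-connected a (member-∈ a∈) (λ e → near (∈-member S e))
      where
      near : ∀ {x} → x ∈ S → WalkIn G Sq x a × WalkIn G Sq a x
      near (here refl)                         = here , here
      near (there (here refl))                 = step (G-sym ab) (member-∈ a∈) here , step ab (member-∈ b∈) here
      near (there (there (here refl)))         =
        step (G-sym bc) (member-∈ b∈) (step (G-sym ab) (member-∈ a∈) here) ,
        step ab (member-∈ b∈) (step bc (member-∈ c∈) here)
      near (there (there (there (here refl)))) = step (G-sym ad) (member-∈ a∈) here , step ad (member-∈ d∈) here

    -- Opposite corners are distinct and non-adjacent. This answers the clause of 𝒢₁ about two
    -- complete sides when one side is a square.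
    square-incomplete : ¬ CompleteEven G Sq
    square-incomplete (p , f , inj , _ , onto , adj)
      with onto a (member-∈ a∈) | onto c (member-∈ c∈)
    ... | i , refl | j , refl with toℕ i ≡ᵇ toℕ j in e | trans (adj i j) ac
    ...   | true | _ with Fin.toℕ-injective {i = i} {j} (≡ᵇ-sound {toℕ i} e)
    ...     | refl = ⊥-elim (All.lookup (AllPairs.head H-unique) (there (here refl)) refl)

    square-part : G1Part G u Sq
    square-part = inj₂ (square-iso , a , b , G-irr ab , member-∈ a∈ , member-∈ b∈ , ab ,
      (λ x e ux → touching (∈-member S e) ux) , G-sym au , G-sym bu)
      where
      touching : ∀ {x} → x ∈ S → G u x ≡ true → x ≡ a ⊎ x ≡ b
      touching (here e)                              _  = inj₁ e
      touching (there (here e))                      _  = inj₂ e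
      touching (there (there (here refl)))           ux = ⊥-elim (true≢false (G-sym ux) cu)
      touching (there (there (there (here refl))))   ux = ⊥-elim (true≢false (G-sym ux) du)

    -- Below, the second side of a cut vertex u is what lies outside the square.
    Outer : VSet n
    Outer x = not (Sq x) ∧ not ⌊ x ≟ u ⌋

    outer-true : ∀ {x} → x ∉ S → x ≢ u → Outer x ≡ true
    outer-true x∉ x≢u = cong₂ (λ p q → not p ∧ not q) (member-∉ x∉) (≟-false x≢u)

    in-outer : ∀ {x} → Outer x ≡ true → x ∉ S × x ≢ u
    in-outer {x} e with ∧-true {not (Sq x)} e
    ... | e₁ , e₂ = (λ x∈ → true≢false e₁ (cong not (member-∈ x∈))) , (λ x≡u → true≢false e₂ (cong not (≟-true x≡u)))

    -- Common ending of the two situations in which `u` is a cut vertex: it misses `v`, or it sees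
    -- `v` but is the only outside vertex attached to the square.
    cut-at-u : (∀ {x y} → x ∉ S → y ∉ S → x ≢ u → y ≢ u → x ≢ y → G x y ≡ true) →
               (∀ {x} → x ∉ S → x ≢ u → G a x ≡ false × G b x ≡ false × G c x ≡ false × G d x ≡ false) → InG1 G
    cut-at-u clique apart = u , Sq , Outer ,
      two-components part square-connected (clique-connected outer-clique (v , outer-true v∉S v≢u))
        (λ x y x∈ y∈ → nonadjacent (∈-member S x∈) (apart (proj₁ (in-outer y∈)) (proj₂ (in-outer y∈)))) ,
      square-part , inj₁ even , λ ce _ → contradiction ce square-incomplete
      where
      v≢u : v ≢ u
      v≢u refl = u∉ (there (there (there (there (here refl)))))

      outer-clique : Clique Outer
      outer-clique x∈ y∈ = clique (proj₁ (in-outer x∈)) (proj₁ (in-outer y∈)) (proj₂ (in-outer x∈)) (proj₂ (in-outer y∈))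

      nonadjacent : ∀ {x y} → x ∈ S → G a y ≡ false × G b y ≡ false × G c y ≡ false × G d y ≡ false → G x y ≡ false
      nonadjacent (here refl)                         (e , _ , _ , _) = e
      nonadjacent (there (here refl))                 (_ , e , _ , _) = e
      nonadjacent (there (there (here refl)))         (_ , _ , e , _) = e
      nonadjacent (there (there (there (here refl)))) (_ , _ , _ , e) = e

      part : ∀ x → Part (singleton u x) (Sq x) (Outer x)
      part x with Any.any? (x ≟_) S | x ≟ u
      ... | yes x∈ | yes refl = contradiction (∈-++⁺ˡ x∈) u∉
      ... | yes x∈ | no x≢u = part-A refl (member-∈ x∈) (cong (λ p → not p ∧ true) (member-∈ x∈))
      ... | no x∉  | yes refl = part-S refl (member-∉ x∉) (cong (λ p → not p ∧ false) (member-∉ x∉))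
      ... | no x∉  | no x≢u = part-B refl (member-∉ x∉) (cong (λ p → not p ∧ true) (member-∉ x∉))

      even : CompleteEven G Outer
      even with pull r u u∉
      ... | w , r' , uw with count-parity Outer r' same
        where
        same : ∀ {x y} → Rest ((H ++ u ∷ w ∷ []) ++ x ∷ y ∷ []) → G x y ≡ true → Outer x ≡ Outer y
        same {x} {y} r'' _ = trans (out (here refl)) (sym (out (there (here refl))))
          where
          out : ∀ {z} → z ∈ x ∷ y ∷ [] → Outer z ≡ true
          out z∈ = outer-true (λ z∈S → Unique-apart (H ++ u ∷ w ∷ []) (Rest-unique r'') (∈-++⁺ˡ {xs = H} (∈-++⁺ˡ {xs = S} z∈S)) z∈)
            (λ { refl → Unique-apart (H ++ u ∷ w ∷ []) (Rest-unique r'') (∈-++⁺ʳ H (here refl)) z∈ })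
      ...   | k , eq = 1 + k , clique-iso outer-clique o
                -- Of the seven listed vertices exactly `v` and `w` lie beyond `u`, hence 2 + 2k.
                (trans eq (trans (cong (_+ 2 * k) (countIn-values values)) (sym (ℕ.*-distribˡ-+ 2 1 k))))
        where
        w∉ : w ∉ H
        w∉ w∈ = Unique-apart H (Rest-unique r') w∈ (there (here refl))
        inside : ∀ {x} → x ∈ S → Outer x ≡ false
        inside {x} x∈ = cong (λ p → not p ∧ not ⌊ x ≟ u ⌋) (member-∈ x∈)
        values : Pointwise (λ x e → Outer x ≡ e) (H ++ u ∷ w ∷ []) (false ∷ false ∷ false ∷ false ∷ true ∷ false ∷ true ∷ [])
        values = inside a∈ ∷ inside b∈ ∷ inside c∈ ∷
          inside d∈ ∷ outer-true v∉S v≢u ∷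
          trans (cong (λ p → not (Sq u) ∧ not p) (≟-true {x = u} refl)) (Bool.∧-zeroʳ _) ∷
          outer-true (∉S w∉) (λ w≡u → G-irr uw (sym w≡u)) ∷ []

    outside-cases : ∀ {x} → x ∉ S → x ≡ v ⊎ x ∉ H
    outside-cases {x} x∉ with x ≟ v
    ... | yes e = inj₁ e
    ... | no x≢v = inj₂ λ x∈ → [ x∉ , (λ { (here e) → x≢v e }) ]′ (∈-++⁻ S x∈)

    -- u is not adjacent to v: it separates the square from a clique.
    module Separating (vu : G v u ≡ false) {w : Fin n} (r' : Rest (H ++ u ∷ w ∷ [])) (uw : G u w ≡ true)
                      (aw : G a w ≡ false) (bw : G b w ≡ false) (cw : G c w ≡ false) (dw : G d w ≡ false) (vw : G v w ≡ true) where

      Others : Fin n → Set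
      Others x = G a x ≡ false × G b x ≡ false × G c x ≡ false × G d x ≡ false × G v x ≡ true × G u x ≡ true × G w x ≡ true

      others : ∀ {x} → x ∉ H → x ≢ u → x ≢ w → Others x
      others {x} x∉ x≢u x≢w with pull r' x (∉-snoc x∉ x≢u x≢w)
      ... | x' , r'' , xx with apply₁ avoid cut-other refl r'' h (uw , xx , au , bu , cu , du , vu , tt)
      ...   | e₀ , e₁ , e₂ , e₃ , e₄ , e₅ , e₆ , _ = e₀ , e₁ , e₂ , e₃ , e₄ , e₅ , e₆

      apart : ∀ {x} → x ∉ S → x ≢ u → G a x ≡ false × G b x ≡ false × G c x ≡ false × G d x ≡ false
      apart {x} x∉ x≢u with outside-cases x∉ | x ≟ w
      ... | inj₁ refl | _        = av , bv , cv , dv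
      ... | inj₂ _    | yes refl = aw , bw , cw , dw
      ... | inj₂ x∉H  | no x≢w with others x∉H x≢u x≢w
      ...   | e₀ , e₁ , e₂ , e₃ , _ = e₀ , e₁ , e₂ , e₃

      both : ∀ {x y} → x ∉ H → y ∉ H → x ≢ u → y ≢ u → x ≢ w → y ≢ w → x ≢ y → G x y ≡ true
      both {x} {y} x∉ y∉ x≢u y≢u x≢w y≢w x≢y with pull₂ r' (∉-snoc x∉ x≢u x≢w) (∉-snoc y∉ y≢u y≢w) x≢y
      ... | inj₁ (_ , xy) = xy
      ... | inj₂ (_ , _ , r'' , xx , yy) with others x∉ x≢u x≢w | others y∉ y≢u y≢w
      ...   | e₀ , e₁ , e₂ , e₃ , e₄ , e₅ , e₆ | f₀ , f₁ , f₂ , f₃ , f₄ , f₅ , f₆ =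
        proj₁ ((apply₁ avoid cut-clique refl r'' h (uw , xx , yy , au , bu , cu , du , vu , aw , bw , cw , dw , vw ,
          e₀ , e₁ , e₂ , e₃ , e₄ , e₅ , e₆ , f₀ , f₁ , f₂ , f₃ , f₄ , f₅ , f₆ , tt)))

      clique : ∀ {x y} → x ∉ S → y ∉ S → x ≢ u → y ≢ u → x ≢ y → G x y ≡ true
      clique {x} {y} x∉ y∉ x≢u y≢u x≢y with outside-cases x∉ | outside-cases y∉ | x ≟ w | y ≟ w
      ... | inj₁ refl | inj₁ refl | _        | _        = contradiction refl x≢y
      ... | inj₁ refl | inj₂ _    | _        | yes refl = vw
      ... | inj₁ refl | inj₂ y∉H  | _        | no y≢w   = proj₁ (proj₂ (proj₂ (proj₂ (proj₂ (others y∉H y≢u y≢w)))))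
      ... | inj₂ _    | inj₁ refl | yes refl | _        = G-sym vw
      ... | inj₂ x∉H  | inj₁ refl | no x≢w   | _        = G-sym (proj₁ (proj₂ (proj₂ (proj₂ (proj₂ (others x∉H x≢u x≢w))))))
      ... | inj₂ _    | inj₂ _    | yes refl | yes refl = contradiction refl x≢y
      ... | inj₂ _    | inj₂ y∉H  | yes refl | no y≢w   = proj₂ (proj₂ (proj₂ (proj₂ (proj₂ (proj₂ (others y∉H y≢u y≢w))))))
      ... | inj₂ x∉H  | inj₂ _    | no x≢w   | yes refl = G-sym (proj₂ (proj₂ (proj₂ (proj₂ (proj₂ (proj₂ (others x∉H x≢u x≢w)))))))
      ... | inj₂ x∉H  | inj₂ y∉H  | no x≢w   | no y≢w   = both x∉H y∉H x≢u y≢u x≢w y≢w x≢y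

      solution : InG1 G
      solution = cut-at-u clique apart

    separating : G v u ≡ false → InG1 G
    separating vu with pull r u u∉
    ... | w , r' , uw with apply₁ avoid cut-partner refl r' h (uw , au , bu , cu , du , vu , tt)
    ...   | aw , bw , cw , dw , vw , _ = Separating.solution vu r' uw aw bw cw dw vw

    module Hub (vu : G v u ≡ true) where

      -- The three ways in which an outside vertex can meet the square once `u` sees `v`; all of
      -- them see `v`.
      Near Far Opposite : Fin n → Set
      Near x     = G a x ≡ true × G b x ≡ true × G c x ≡ false × G d x ≡ false × G v x ≡ true
      Far x      = G a x ≡ false × G b x ≡ false × G c x ≡ false × G d x ≡ false × G v x ≡ true
      Opposite x = G a x ≡ false × G b x ≡ false × G c x ≡ true × G d x ≡ true × G v x ≡ true

      near-u : Near u
      near-u = au , bu , cu , du , vu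

      near-partner : ∀ {x y} → Near x → Rest (H ++ x ∷ y ∷ []) → G x y ≡ true → Near y ⊎ Far y
      near-partner (e₀ , e₁ , e₂ , e₃ , e₄) r' xy with apply avoid hub-partner refl r' h (xy , e₀ , e₁ , e₂ , e₃ , e₄ , tt)
      ... | here (f₀ , f₁ , f₂ , f₃ , f₄ , _)         = inj₂ (f₀ , f₁ , f₂ , f₃ , f₄)
      ... | there (here (f₀ , f₁ , f₂ , f₃ , f₄ , _)) = inj₁ (f₀ , f₁ , f₂ , f₃ , f₄)

      kind : ∀ {x} → x ∉ H → Near x ⊎ Far x ⊎ Opposite x
      kind {x} x∉ with x ≟ u
      ... | yes refl = inj₁ near-u
      ... | no x≢u with pull₂ r u∉ x∉ (x≢u ∘ sym)
      ...   | inj₁ (r' , ux) = [ inj₁ , inj₂ ∘ inj₁ ]′ (near-partner near-u r' ux)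
      ...   | inj₂ (_ , _ , r' , uu , xx) with apply avoid hub-other refl r' h (uu , xx , au , bu , cu , du , vu , tt)
      ...     | here (f₀ , f₁ , f₂ , f₃ , f₄ , _)                 = inj₂ (inj₁ (f₀ , f₁ , f₂ , f₃ , f₄))
      ...     | there (here (f₀ , f₁ , f₂ , f₃ , f₄ , _))         = inj₁ (f₀ , f₁ , f₂ , f₃ , f₄)
      ...     | there (there (here (f₀ , f₁ , f₂ , f₃ , f₄ , _))) = inj₂ (inj₂ (f₀ , f₁ , f₂ , f₃ , f₄))

      -- Two non-adjacent near vertices would form a claw at `a` together with the corner `d`. For
      -- `opposite-clique` the claw is at `c` with the corner `b`.
      near-clique : ∀ {x y} → Near x → Near y → x ≢ y → G x y ≡ true
      near-clique {x} {y} (ax , _ , cx , dx , _) (ay , _ , cy , dy , _) x≢y with G x y Bool.≟ true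
      ... | yes xy = xy
      ... | no ¬xy = ⊥-elim (clawFree a d x y (ad , ax , ay , (λ { refl → true≢false cd cx }) ,
              (λ { refl → true≢false cd cy }) , x≢y , dx , dy , Bool.¬-not ¬xy))

      opposite-clique : ∀ {x y} → Opposite x → Opposite y → x ≢ y → G x y ≡ true
      opposite-clique {x} {y} (ax , bx , cx , _) (ay , by , cy , _) x≢y with G x y Bool.≟ true
      ... | yes xy = xy
      ... | no ¬xy = ⊥-elim (clawFree c b x y (G-sym bc , cx , cy , (λ { refl → true≢false ab ax }) ,
              (λ { refl → true≢false ab ay }) , x≢y , bx , by , Bool.¬-not ¬xy))

      near-opposite-apart : ∀ {x y} → x ∉ H → y ∉ H → Near x → Opposite y → G x y ≡ false
      near-opposite-apart x∉ y∉ nx@(e₀ , e₁ , e₂ , e₃ , e₄) oy@(f₀ , f₁ , f₂ , f₃ , f₄)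
        with pull₂ r x∉ y∉ (λ { refl → true≢false e₀ f₀ })
      ... | inj₁ (r' , xy) = ⊥-elim ([ (λ ny → true≢false (proj₁ ny) f₀) , (λ fy → true≢false f₂ (proj₁ (proj₂ (proj₂ fy)))) ]′ (near-partner nx r' xy))
      ... | inj₂ (_ , _ , r' , xx , yy) = proj₁ ((apply₁ avoid opposite-apart refl r' h
              (xx , yy , e₀ , e₁ , e₂ , e₃ , e₄ , f₀ , f₁ , f₂ , f₃ , f₄ , tt)))

      module BothEnds {t : Fin n} (t∉ : t ∉ H) (opp-t : Opposite t) where

        private
          ta = proj₁ opp-t
          bt = proj₁ (proj₂ opp-t)
          ct = proj₁ (proj₂ (proj₂ opp-t))
          dt = proj₁ (proj₂ (proj₂ (proj₂ opp-t)))
          vt = proj₂ (proj₂ (proj₂ (proj₂ opp-t)))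

        -- The cliques of 𝒢₃, with independent set `a`, `c`, `v` and with `b` and `d` in the roles
        -- of the two exceptional vertices. Asking for adjacency to `v` removes `a` and `c` from the
        -- neighbourhoods of `b` and `d`.
        A A' : VSet n
        A x  = ⌊ x ≟ b ⌋ ∨ (G b x ∧ G v x)
        A' x = ⌊ x ≟ d ⌋ ∨ (G d x ∧ G v x)

        Frame : Fin n → Fin n → Set
        Frame w s = Rest ((H ++ u ∷ w ∷ []) ++ t ∷ s ∷ []) × G u w ≡ true × G t s ≡ true × Near w × Opposite s

        frame : ∃[ w ] ∃[ s ] Frame w s
        frame with pull₂ r u∉ t∉ (λ { refl → true≢false ct cu })
        ... | inj₁ (r' , ut) = ⊥-elim ([ (λ nt → true≢false (proj₁ nt) ta)
                , (λ ft → true≢false ct (proj₁ (proj₂ (proj₂ ft)))) ]′ (near-partner near-u r' ut))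
        ... | inj₂ (w , s , r' , uw , ts)
          with apply₁ avoid opposite-partners refl r' h (uw , ts , au , bu , cu , du , vu , ta , bt , ct , dt , vt , tt)
        ...     | g₀ , g₁ , g₂ , g₃ , g₄ , k₀ , k₁ , k₂ , k₃ , k₄ , _ =
                    w , s , r' , uw , ts , (g₀ , g₁ , g₂ , g₃ , g₄) , k₀ , k₁ , k₂ , k₃ , k₄

        -- Far vertices are impossible once both sides of the square have attached vertices. The
        -- five-vertex base alone does not show this: both attached edges `uw` and `ts` must be
        -- present in the list.
        ends-kind : ∀ {x} → x ∉ H → Near x ⊎ Opposite x
        ends-kind {x} x∉ with frame
        ... | w , s , r' , uw , ts , nw , os with x ≟ u | x ≟ w | x ≟ t | x ≟ s
        ...   | yes refl | _ | _ | _ = inj₁ near-u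
        ...   | no _ | yes refl | _ | _ = inj₁ nw
        ...   | no _ | no _ | yes refl | _ = inj₂ opp-t
        ...   | no _ | no _ | no _ | yes refl = inj₂ os
        ...   | no x≢u | no x≢w | no x≢t | no x≢s with pull r' x (∉-snoc (∉-snoc x∉ x≢u x≢w) x≢t x≢s)
        ...     | _ , r'' , xx
          with apply avoid opposite-other refl r'' h (uw , ts , xx , au , bu , cu , du , vu , ta , bt , ct , dt , vt , tt)
        ...       | here (e₀ , e₁ , e₂ , e₃ , e₄ , _)         = inj₁ (e₀ , e₁ , e₂ , e₃ , e₄)
        ...       | there (here (e₀ , e₁ , e₂ , e₃ , e₄ , _)) = inj₂ (e₀ , e₁ , e₂ , e₃ , e₄)

        -- One row per kind of vertex: adjacency to a, c, v; membership in A, A';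
        -- equality with a, b, c, d, v.
        data Row : (ga gc gv α α' =a =b =c =d =v : Bool) → Set where
          row-a : Row false false false false false true  false false false false
          row-b : Row true  true  false true  false false true  false false false
          row-c : Row false false false false false false false true  false false
          row-d : Row true  true  false false true  false false false true  false
          row-v : Row false false false false false false false false false true
          near  : Row true  false true  true  false false false false false false
          opp   : Row false true  true  false true  false false false false false

        Row-of : Fin n → Set
        Row-of x = Row (G a x) (G c x) (G v x) (A x) (A' x) ⌊ x ≟ a ⌋ ⌊ x ≟ b ⌋ ⌊ x ≟ c ⌋ ⌊ x ≟ d ⌋ ⌊ x ≟ v ⌋

        assemble-row : ∀ {x g₀ g₁ g₂ gb gd e₀ e₁ e₂ e₃ e₄} →
          Row g₀ g₁ g₂ (e₁ ∨ (gb ∧ g₂)) (e₃ ∨ (gd ∧ g₂)) e₀ e₁ e₂ e₃ e₄ →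
          G a x ≡ g₀ → G b x ≡ gb → G c x ≡ g₁ → G d x ≡ gd → G v x ≡ g₂ →
          ⌊ x ≟ a ⌋ ≡ e₀ → ⌊ x ≟ b ⌋ ≡ e₁ → ⌊ x ≟ c ⌋ ≡ e₂ → ⌊ x ≟ d ⌋ ≡ e₃ → ⌊ x ≟ v ⌋ ≡ e₄ → Row-of x
        assemble-row row refl refl refl refl refl refl refl refl refl refl = row

        row : ∀ x → Row-of x
        row x with Any.any? (x ≟_) H | H-unique
        ... | yes (here refl) | (a≢b ∷ a≢c ∷ a≢d ∷ a≢v ∷ []) ∷ _ =
          assemble-row row-a (proj₂ simple a) (G-sym ab) (G-sym ac) (G-sym ad) (G-sym av)
            (≟-true refl) (≟-false a≢b) (≟-false a≢c) (≟-false a≢d) (≟-false a≢v)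
        ... | yes (there (here refl)) | (a≢b ∷ _) ∷ (b≢c ∷ b≢d ∷ b≢v ∷ []) ∷ _ =
          assemble-row row-b ab (proj₂ simple b) (G-sym bc) (G-sym bd) (G-sym bv)
            (≟-false (a≢b ∘ sym)) (≟-true refl) (≟-false b≢c) (≟-false b≢d) (≟-false b≢v)
        ... | yes (there (there (here refl))) | (_ ∷ a≢c ∷ _) ∷ (b≢c ∷ _) ∷ (c≢d ∷ c≢v ∷ []) ∷ _ =
          assemble-row row-c ac bc (proj₂ simple c) (G-sym cd) (G-sym cv)
            (≟-false (a≢c ∘ sym)) (≟-false (b≢c ∘ sym)) (≟-true refl) (≟-false c≢d) (≟-false c≢v)
        ... | yes (there (there (there (here refl)))) | (_ ∷ _ ∷ a≢d ∷ _) ∷ (_ ∷ b≢d ∷ _) ∷ (c≢d ∷ _) ∷ (d≢v ∷ []) ∷ _ =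
          assemble-row row-d ad bd cd (proj₂ simple d) (G-sym dv)
            (≟-false (a≢d ∘ sym)) (≟-false (b≢d ∘ sym)) (≟-false (c≢d ∘ sym)) (≟-true refl) (≟-false d≢v)
        ... | yes (there (there (there (there (here refl))))) | (_ ∷ _ ∷ _ ∷ a≢v ∷ []) ∷ (_ ∷ _ ∷ b≢v ∷ []) ∷ (_ ∷ c≢v ∷ []) ∷ (d≢v ∷ []) ∷ _ =
          assemble-row row-v av bv cv dv (proj₂ simple v)
            (≟-false (a≢v ∘ sym)) (≟-false (b≢v ∘ sym)) (≟-false (c≢v ∘ sym)) (≟-false (d≢v ∘ sym)) (≟-true refl)
        ... | no x∉ | _ with ends-kind x∉
        ...   | inj₁ (e₀ , e₁ , e₂ , e₃ , e₄) = assemble-row near e₀ e₁ e₂ e₃ e₄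
                (≟-false (x∉ ∘ here)) (≟-false (x∉ ∘ there ∘ here)) (≟-false (x∉ ∘ there ∘ there ∘ here))
                (≟-false (x∉ ∘ there ∘ there ∘ there ∘ here)) (≟-false (x∉ ∘ there ∘ there ∘ there ∘ there ∘ here))
        ...   | inj₂ (e₀ , e₁ , e₂ , e₃ , e₄) = assemble-row opp e₀ e₁ e₂ e₃ e₄
                (≟-false (x∉ ∘ here)) (≟-false (x∉ ∘ there ∘ here)) (≟-false (x∉ ∘ there ∘ there ∘ here))
                (≟-false (x∉ ∘ there ∘ there ∘ there ∘ here)) (≟-false (x∉ ∘ there ∘ there ∘ there ∘ there ∘ here))

        not-H : ∀ {x} → ⌊ x ≟ a ⌋ ≡ false → ⌊ x ≟ b ⌋ ≡ false → ⌊ x ≟ c ⌋ ≡ false → ⌊ x ≟ d ⌋ ≡ false → ⌊ x ≟ v ⌋ ≡ false → x ∉ H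
        not-H e₀ e₁ e₂ e₃ e₄ (here e)                                 = true≢false (≟-true e) e₀
        not-H e₀ e₁ e₂ e₃ e₄ (there (here e))                         = true≢false (≟-true e) e₁
        not-H e₀ e₁ e₂ e₃ e₄ (there (there (here e)))                 = true≢false (≟-true e) e₂
        not-H e₀ e₁ e₂ e₃ e₄ (there (there (there (here e))))         = true≢false (≟-true e) e₃
        not-H e₀ e₁ e₂ e₃ e₄ (there (there (there (there (here e))))) = true≢false (≟-true e) e₄

        in-A : ∀ {x} → A x ≡ true → x ≡ b ⊎ (x ∉ H × Near x)
        in-A {x} e with split (row x) e
          where
          split : ∀ {g₀ g₁ g₂ α α' e₀ e₁ e₂ e₃ e₄} → Row g₀ g₁ g₂ α α' e₀ e₁ e₂ e₃ e₄ → α ≡ true →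
                  e₁ ≡ true ⊎ (g₀ ≡ true × e₀ ≡ false × e₁ ≡ false × e₂ ≡ false × e₃ ≡ false × e₄ ≡ false)
          split row-b _ = inj₁ refl
          split near  _ = inj₂ (refl , refl , refl , refl , refl , refl)
        ... | inj₁ e₁ = inj₁ (≟-sound e₁)
        ... | inj₂ (ax , e₀ , e₁ , e₂ , e₃ , e₄) with ends-kind (not-H e₀ e₁ e₂ e₃ e₄)
        ...   | inj₁ nx = inj₂ (not-H e₀ e₁ e₂ e₃ e₄ , nx)
        ...   | inj₂ (ax' , _) = ⊥-elim (true≢false ax ax')

        in-A' : ∀ {x} → A' x ≡ true → x ≡ d ⊎ (x ∉ H × Opposite x)
        in-A' {x} e with split (row x) e
          where
          split : ∀ {g₀ g₁ g₂ α α' e₀ e₁ e₂ e₃ e₄} → Row g₀ g₁ g₂ α α' e₀ e₁ e₂ e₃ e₄ → α' ≡ true →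
                  e₃ ≡ true ⊎ (g₀ ≡ false × e₀ ≡ false × e₁ ≡ false × e₂ ≡ false × e₃ ≡ false × e₄ ≡ false)
          split row-d _ = inj₁ refl
          split opp   _ = inj₂ (refl , refl , refl , refl , refl , refl)
        ... | inj₁ e₃ = inj₁ (≟-sound e₃)
        ... | inj₂ (ax , e₀ , e₁ , e₂ , e₃ , e₄) with ends-kind (not-H e₀ e₁ e₂ e₃ e₄)
        ...   | inj₁ (ax' , _) = ⊥-elim (true≢false ax' ax)
        ...   | inj₂ ox = inj₂ (not-H e₀ e₁ e₂ e₃ e₄ , ox)

        A-b : A b ≡ true
        A-b = ∨-true (inj₁ (≟-true {x = b} refl))

        A'-d : A' d ≡ true
        A'-d = ∨-true (inj₁ (≟-true {x = d} refl))

        A-clique : Clique A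
        A-clique x∈ y∈ x≢y with in-A x∈ | in-A y∈
        ... | inj₁ refl | inj₁ refl = contradiction refl x≢y
        ... | inj₁ refl | inj₂ (_ , _ , by , _) = by
        ... | inj₂ (_ , _ , bx , _) | inj₁ refl = G-sym bx
        ... | inj₂ (_ , nx) | inj₂ (_ , ny) = near-clique nx ny x≢y

        A'-clique : Clique A'
        A'-clique x∈ y∈ x≢y with in-A' x∈ | in-A' y∈
        ... | inj₁ refl | inj₁ refl = contradiction refl x≢y
        ... | inj₁ refl | inj₂ (_ , _ , _ , _ , dy , _) = dy
        ... | inj₂ (_ , _ , _ , _ , dx , _) | inj₁ refl = G-sym dx
        ... | inj₂ (_ , ox) | inj₂ (_ , oy) = opposite-clique ox oy x≢y

        apart : ∀ x y → A x ≡ true → A' y ≡ true → G x y ≡ false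
        apart x y x∈ y∈ with in-A x∈ | in-A' y∈
        ... | inj₁ refl | inj₁ refl = bd
        ... | inj₁ refl | inj₂ (_ , _ , by , _) = by
        ... | inj₂ (_ , _ , _ , _ , dx , _) | inj₁ refl = G-sym dx
        ... | inj₂ (x∉ , nx) | inj₂ (y∉ , oy) = near-opposite-apart x∉ y∉ nx oy

        near-values : ∀ {x} → x ∉ H → Near x → A x ≡ true × A' x ≡ false
        near-values {x} x∉ (_ , bx , _ , dx , vx) = ∨-true (inj₂ (cong₂ _∧_ bx vx)) ,
          ∨-false (≟-false (x∉ ∘ there ∘ there ∘ there ∘ here)) (cong (_∧ G v x) dx)

        opposite-values : ∀ {x} → x ∉ H → Opposite x → A x ≡ false × A' x ≡ true
        opposite-values {x} x∉ (_ , bx , _ , dx , vx) = ∨-false (≟-false (x∉ ∘ there ∘ here)) (cong (_∧ G v x) bx) ,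
          ∨-true (inj₂ (cong₂ _∧_ dx vx))

        same : ∀ {x y} → x ∉ H → y ∉ H → G x y ≡ true → A x ≡ A y × A' x ≡ A' y
        same x∉ y∉ xy with ends-kind x∉ | ends-kind y∉
        ... | inj₁ nx | inj₁ ny = trans (proj₁ (near-values x∉ nx)) (sym (proj₁ (near-values y∉ ny))) ,
                                  trans (proj₂ (near-values x∉ nx)) (sym (proj₂ (near-values y∉ ny)))
        ... | inj₂ ox | inj₂ oy = trans (proj₁ (opposite-values x∉ ox)) (sym (proj₁ (opposite-values y∉ oy))) ,
                                  trans (proj₂ (opposite-values x∉ ox)) (sym (proj₂ (opposite-values y∉ oy)))
        ... | inj₁ nx | inj₂ oy = ⊥-elim (true≢false xy (near-opposite-apart x∉ y∉ nx oy))
        ... | inj₂ ox | inj₁ ny = ⊥-elim (true≢false (G-sym xy) (near-opposite-apart y∉ x∉ ny ox))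

        -- Three of the nine listed vertices lie in `X`: a corner and one of the pulled edges. The
        -- others come in matched pairs, so the size is 3 + 2k.
        odd-size : ∀ X {es} → Clique X → (∀ {x y} → x ∉ H → y ∉ H → G x y ≡ true → X x ≡ X y) →
                   (∀ {w s} → Frame w s → Pointwise (λ x e → X x ≡ e) ((H ++ u ∷ w ∷ []) ++ t ∷ s ∷ []) es) →
                   sum (map (λ b → if b then 1 else 0) es) ≡ 3 →
                   ∃[ q ] (1 ≤ q × InducedIso G X (Complete (suc (2 * q))))
        odd-size X clique same' values three with frame
        ... | w , s , f with count-parity X (proj₁ f) (λ r' xy → same' (out r' (here refl)) (out r' (there (here refl))) xy)
          where
          out : ∀ {x y z} → Rest (((H ++ u ∷ w ∷ []) ++ t ∷ s ∷ []) ++ x ∷ y ∷ []) → z ∈ x ∷ y ∷ [] → z ∉ H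
          out r' z∈ z∈H = Unique-apart ((H ++ u ∷ w ∷ []) ++ t ∷ s ∷ []) (Rest-unique r')
            (∈-++⁺ˡ {xs = H ++ u ∷ w ∷ []} (∈-++⁺ˡ {xs = H} z∈H)) z∈
        ...   | k , eq = 1 + k , s≤s z≤n , clique-iso clique o
                (trans eq (trans (cong (_+ 2 * k) (trans (countIn-values (values f)) three)) (cong suc (sym (ℕ.*-distribˡ-+ 2 1 k)))))

        frame-∉ : ∀ {w s} → Frame w s → w ∉ H × s ∉ H
        frame-∉ {w} {s} (r' , _) =
          (λ w∈ → Unique-apart H (Unique-++ˡ (H ++ u ∷ w ∷ []) (Rest-unique r')) w∈ (there (here refl))) ,
          (λ s∈ → Unique-apart (H ++ u ∷ w ∷ []) (Rest-unique r') (∈-++⁺ˡ {xs = H} s∈) (there (here refl)))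

        H-values : Pointwise (λ x e → A x ≡ e) H (false ∷ true ∷ false ∷ false ∷ false ∷ []) ×
                   Pointwise (λ x e → A' x ≡ e) H (false ∷ false ∷ false ∷ true ∷ false ∷ [])
        H-values with H-unique
        ... | (a≢b ∷ a≢c ∷ a≢d ∷ a≢v ∷ []) ∷ (b≢c ∷ b≢d ∷ b≢v ∷ []) ∷ (c≢d ∷ c≢v ∷ []) ∷ (d≢v ∷ []) ∷ _ =
          (∨-false (≟-false a≢b) (off (G-sym av)) ∷ A-b ∷ ∨-false (≟-false (b≢c ∘ sym)) (off (G-sym cv)) ∷
           ∨-false (≟-false (b≢d ∘ sym)) (off (G-sym dv)) ∷ ∨-false (≟-false (b≢v ∘ sym)) (off (proj₂ simple v)) ∷ []) ,
          (∨-false (≟-false a≢d) (off (G-sym av)) ∷ ∨-false (≟-false b≢d) (off (G-sym bv)) ∷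
           ∨-false (≟-false c≢d) (off (G-sym cv)) ∷ A'-d ∷ ∨-false (≟-false (d≢v ∘ sym)) (off (proj₂ simple v)) ∷ [])
          where
          off : ∀ {p q} → q ≡ false → p ∧ q ≡ false
          off refl = Bool.∧-zeroʳ _

        in-G3 : InG3 G
        in-G3 with H-unique
        ... | (_ ∷ a≢c ∷ _ ∷ a≢v ∷ []) ∷ _ ∷ (_ ∷ c≢v ∷ []) ∷ _ =
          a , c , v , A , A' , a≢c , a≢v , c≢v , ac , av , cv ,
          two-components (λ x → part (row x)) (clique-connected A-clique (b , A-b)) (clique-connected A'-clique (d , A'-d)) apart ,
          odd-size A A-clique (λ x∉ y∉ xy → proj₁ (same x∉ y∉ xy)) A-values refl ,
          odd-size A' A'-clique (λ x∉ y∉ xy → proj₂ (same x∉ y∉ xy)) A'-values refl ,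
          b , d , A-b , A'-d , (λ x → row₁ (row x)) , (λ x → row₂ (row x)) , (λ x → row₃ (row x))
          where
          part : ∀ {g₀ g₁ g₂ α α' e₀ e₁ e₂ e₃ e₄} → Row g₀ g₁ g₂ α α' e₀ e₁ e₂ e₃ e₄ → Part (e₀ ∨ e₂ ∨ e₄) α α'
          part row-a = inS
          part row-b = inA
          part row-c = inS
          part row-d = inB
          part row-v = inS
          part near  = inA
          part opp   = inB

          row₁ : ∀ {g₀ g₁ g₂ α α' e₀ e₁ e₂ e₃ e₄} → Row g₀ g₁ g₂ α α' e₀ e₁ e₂ e₃ e₄ → g₀ ≡ α ∨ e₃
          row₁ row-a = refl
          row₁ row-b = refl
          row₁ row-c = refl
          row₁ row-d = refl
          row₁ row-v = refl
          row₁ near  = refl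
          row₁ opp   = refl

          row₂ : ∀ {g₀ g₁ g₂ α α' e₀ e₁ e₂ e₃ e₄} → Row g₀ g₁ g₂ α α' e₀ e₁ e₂ e₃ e₄ → g₁ ≡ α' ∨ e₁
          row₂ row-a = refl
          row₂ row-b = refl
          row₂ row-c = refl
          row₂ row-d = refl
          row₂ row-v = refl
          row₂ near  = refl
          row₂ opp   = refl

          row₃ : ∀ {g₀ g₁ g₂ α α' e₀ e₁ e₂ e₃ e₄} → Row g₀ g₁ g₂ α α' e₀ e₁ e₂ e₃ e₄ → g₂ ≡ (α ∨ α') ∧ not (e₁ ∨ e₃)
          row₃ row-a = refl
          row₃ row-b = refl
          row₃ row-c = refl
          row₃ row-d = refl
          row₃ row-v = refl
          row₃ near  = refl
          row₃ opp   = refl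

          A-values : ∀ {w s} → Frame w s → Pointwise (λ x e → A x ≡ e) ((H ++ u ∷ w ∷ []) ++ t ∷ s ∷ [])
                       (false ∷ true ∷ false ∷ false ∷ false ∷ true ∷ true ∷ false ∷ false ∷ [])
          A-values f@(_ , _ , _ , nw , os) with proj₁ H-values | frame-∉ f
          ... | e₀ ∷ e₁ ∷ e₂ ∷ e₃ ∷ e₄ ∷ [] | w∉ , s∉ = e₀ ∷ e₁ ∷ e₂ ∷ e₃ ∷ e₄ ∷ proj₁ (near-values u∉ near-u) ∷
            proj₁ (near-values w∉ nw) ∷ proj₁ (opposite-values t∉ opp-t) ∷ proj₁ (opposite-values s∉ os) ∷ []

          A'-values : ∀ {w s} → Frame w s → Pointwise (λ x e → A' x ≡ e) ((H ++ u ∷ w ∷ []) ++ t ∷ s ∷ [])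
                        (false ∷ false ∷ false ∷ true ∷ false ∷ false ∷ false ∷ true ∷ true ∷ [])
          A'-values f@(_ , _ , _ , nw , os) with proj₂ H-values | frame-∉ f
          ... | e₀ ∷ e₁ ∷ e₂ ∷ e₃ ∷ e₄ ∷ [] | w∉ , s∉ = e₀ ∷ e₁ ∷ e₂ ∷ e₃ ∷ e₄ ∷ proj₂ (near-values u∉ near-u) ∷
            proj₂ (near-values w∉ nw) ∷ proj₂ (opposite-values t∉ opp-t) ∷ proj₂ (opposite-values s∉ os) ∷ []

      -- Without opposite vertices the corners `c` and `d` see nothing outside the square. The
      -- number of near vertices decides: one makes it a cut vertex, two give 𝒢₂₁.
      module OneEnd (none : ∀ {x} → x ∉ H → ¬ Opposite x) where

        near-or-far : ∀ {x} → x ∉ H → Near x ⊎ Far x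
        near-or-far x∉ with kind x∉
        ... | inj₁ nx        = inj₁ nx
        ... | inj₂ (inj₁ fx) = inj₂ fx
        ... | inj₂ (inj₂ ox) = contradiction ox (none x∉)

        near≢far : ∀ {x y} → Near x → Far y → x ≢ y
        near≢far (ax , _) (ax' , _) refl = true≢false ax ax'

        far-clique : ∀ {x y} → x ∉ H → y ∉ H → Far x → Far y → x ≢ y → G x y ≡ true
        far-clique x∉ y∉ fx@(e₀ , e₁ , e₂ , e₃ , e₄) fy@(f₀ , f₁ , f₂ , f₃ , f₄) x≢y
          with pull₃ r u∉ x∉ y∉ (near≢far near-u fx) (near≢far near-u fy) x≢y
        ... | inj₁ (_ , r' , ux , yy) = proj₁ ((apply₁ avoid far-adjacent₁ refl r' h
                (ux , yy , au , bu , cu , du , vu , e₀ , e₁ , e₂ , e₃ , e₄ , f₀ , f₁ , f₂ , f₃ , f₄ , tt)))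
        ... | inj₂ (inj₁ (_ , r' , uy , xx)) = G-sym (proj₁ ((apply₁ avoid far-adjacent₁ refl r' h
                (uy , xx , au , bu , cu , du , vu , f₀ , f₁ , f₂ , f₃ , f₄ , e₀ , e₁ , e₂ , e₃ , e₄ , tt))))
        ... | inj₂ (inj₂ (inj₁ (_ , _ , xy , _))) = xy
        ... | inj₂ (inj₂ (inj₂ (_ , _ , _ , r' , uu , xx , yy))) = proj₁ ((apply₁ avoid far-adjacent₂ refl r' h
                (uu , xx , yy , au , bu , cu , du , vu , e₀ , e₁ , e₂ , e₃ , e₄ , f₀ , f₁ , f₂ , f₃ , f₄ , tt)))

        -- The second near vertex `x'` is what forces the adjacency. A sole near vertex may miss far
        -- vertices, as in 𝒢₁.
        near-far : ∀ {x x' y} → x ∉ H → x' ∉ H → y ∉ H → Near x → Near x' → Far y → x ≢ x' → G x y ≡ true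
        near-far x∉ x'∉ y∉ nx@(e₀ , e₁ , e₂ , e₃ , e₄) nx'@(g₀ , g₁ , g₂ , g₃ , g₄) fy@(f₀ , f₁ , f₂ , f₃ , f₄) x≢x'
          with pull₃ r x∉ x'∉ y∉ x≢x' (near≢far nx fy) (near≢far nx' fy)
        ... | inj₁ (_ , r' , xx , yy) = proj₁ ((apply₁ avoid near-far₁ refl r' h
                (xx , yy , e₀ , e₁ , e₂ , e₃ , e₄ , g₀ , g₁ , g₂ , g₃ , g₄ , f₀ , f₁ , f₂ , f₃ , f₄ , tt)))
        ... | inj₂ (inj₁ (_ , _ , xy , _)) = xy
        ... | inj₂ (inj₂ (inj₁ (_ , r' , x'y , xx))) = proj₁ ((apply₁ avoid near-far₂ refl
                (Rest-select r' (0 ∷ 1 ∷ 2 ∷ 3 ∷ 4 ∷ 7 ∷ 8 ∷ 5 ∷ 6 ∷ []) [] refl tt) h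
                (xx , x'y , e₀ , e₁ , e₂ , e₃ , e₄ , g₀ , g₁ , g₂ , g₃ , g₄ , f₀ , f₁ , f₂ , f₃ , f₄ , tt)))
        ... | inj₂ (inj₂ (inj₂ (_ , _ , _ , r' , xx , xx' , yy))) = proj₁ ((apply₁ avoid near-far₃ refl r' h
                (xx , xx' , yy , e₀ , e₁ , e₂ , e₃ , e₄ , g₀ , g₁ , g₂ , g₃ , g₄ , f₀ , f₁ , f₂ , f₃ , f₄ , tt)))

        sole-near : (∀ {x} → x ∉ H → x ≢ u → Far x) → InG1 G
        sole-near far = cut-at-u clique apart
          where
          apart : ∀ {x} → x ∉ S → x ≢ u → G a x ≡ false × G b x ≡ false × G c x ≡ false × G d x ≡ false
          apart x∉ x≢u with outside-cases x∉
          ... | inj₁ refl = av , bv , cv , dv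
          ... | inj₂ x∉H with far x∉H x≢u
          ...   | e₀ , e₁ , e₂ , e₃ , _ = e₀ , e₁ , e₂ , e₃

          v~ : ∀ {x} → Far x → G v x ≡ true
          v~ (_ , _ , _ , _ , vx) = vx

          clique : ∀ {x y} → x ∉ S → y ∉ S → x ≢ u → y ≢ u → x ≢ y → G x y ≡ true
          clique x∉ y∉ x≢u y≢u x≢y with outside-cases x∉ | outside-cases y∉
          ... | inj₁ refl | inj₁ refl = contradiction refl x≢y
          ... | inj₁ refl | inj₂ y∉H  = v~ (far y∉H y≢u)
          ... | inj₂ x∉H  | inj₁ refl = G-sym (v~ (far x∉H x≢u))
          ... | inj₂ x∉H  | inj₂ y∉H  = far-clique x∉H y∉H (far x∉H x≢u) (far y∉H y≢u) x≢y

        two-near : ∀ {u'} → u' ∉ H → u' ≢ u → Near u' → InG21 G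
        two-near {u'} u'∉ u'≢u near-u' = V₁ , Sq , (λ _ → refl) , odd , square-iso ,
          (λ x x∈ → sees (outside-cases (in-V₁ {x} x∈))) ,
          count-≥2 N₁ {u} {u'} (u'≢u ∘ sym) (cong₂ _∧_ (V₁-true {u} (∉S u∉)) au) (cong₂ _∧_ (V₁-true {u'} (∉S u'∉)) (proj₁ near-u')) ,
          -- The isolated vertex `v` lies in `V₁` and misses `a`, which makes the inclusion strict.
          count-< N₁ V₁ (λ x e → proj₁ (∧-true {V₁ x} e)) {v} (trans (cong (V₁ v ∧_) av) (Bool.∧-zeroʳ _)) (V₁-true {v} v∉S) ,
          (λ x x∈ → proj₁ (blind (outside-cases (in-V₁ {x} x∈)))) , (λ x x∈ → proj₂ (blind (outside-cases (in-V₁ {x} x∈))))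
          where
          V₁ N₁ : VSet n
          V₁ x = not (Sq x)
          N₁ x = V₁ x ∧ G a x

          V₁-true : ∀ {x} → x ∉ S → V₁ x ≡ true
          V₁-true {x} x∉ = cong not (member-∉ {x = x} {S} x∉)

          in-V₁ : ∀ {x} → V₁ x ≡ true → x ∉ S
          in-V₁ {x} e x∈ = true≢false e (cong not (member-∈ {x = x} {S} x∈))

          sees : ∀ {x} → x ≡ v ⊎ x ∉ H → G a x ≡ G b x
          sees (inj₁ refl) = trans av (sym bv)
          sees (inj₂ x∉) with near-or-far x∉
          ... | inj₁ (ax , bx , _) = trans ax (sym bx)
          ... | inj₂ (ax , bx , _) = trans ax (sym bx)

          blind : ∀ {x} → x ≡ v ⊎ x ∉ H → G c x ≡ false × G d x ≡ false
          blind (inj₁ refl) = cv , dv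
          blind (inj₂ x∉) with near-or-far x∉
          ... | inj₁ (_ , _ , cx , dx , _) = cx , dx
          ... | inj₂ (_ , _ , cx , dx , _) = cx , dx

          v~ : ∀ {x} → x ∉ H → G v x ≡ true
          v~ x∉ with near-or-far x∉
          ... | inj₁ (_ , _ , _ , _ , vx) = vx
          ... | inj₂ (_ , _ , _ , _ , vx) = vx

          mixed-adjacent : ∀ {x y} → x ∉ H → y ∉ H → Near x → Far y → G x y ≡ true
          mixed-adjacent {x} x∉ y∉ nx fy with x ≟ u
          ... | no x≢u   = near-far x∉ u∉ y∉ nx near-u fy x≢u
          ... | yes refl = near-far u∉ u'∉ y∉ near-u near-u' fy (u'≢u ∘ sym)

          clique : Clique V₁
          clique {x} {y} x∈ y∈ x≢y with outside-cases (in-V₁ {x} x∈) | outside-cases (in-V₁ {y} y∈)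
          ... | inj₁ refl | inj₁ refl = contradiction refl x≢y
          ... | inj₁ refl | inj₂ y∉   = v~ y∉
          ... | inj₂ x∉   | inj₁ refl = G-sym (v~ x∉)
          ... | inj₂ x∉   | inj₂ y∉ with near-or-far x∉ | near-or-far y∉
          ...   | inj₁ nx | inj₁ ny = near-clique nx ny x≢y
          ...   | inj₁ nx | inj₂ fy = mixed-adjacent x∉ y∉ nx fy
          ...   | inj₂ fx | inj₁ ny = G-sym (mixed-adjacent y∉ x∉ ny fx)
          ...   | inj₂ fx | inj₂ fy = far-clique x∉ y∉ fx fy x≢y

          odd : ∃[ q ] (1 ≤ q × InducedIso G V₁ (Complete (suc (2 * q))))
          odd with pull r u u∉
          ... | w , r' , uw with count-parity V₁ r' same
            where
            same : ∀ {x y} → Rest ((H ++ u ∷ w ∷ []) ++ x ∷ y ∷ []) → G x y ≡ true → V₁ x ≡ V₁ y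
            same {x} {y} r'' _ = trans (V₁-true {x} (out (here refl))) (sym (V₁-true {y} (out (there (here refl)))))
              where
              out : ∀ {z} → z ∈ x ∷ y ∷ [] → z ∉ S
              out z∈ z∈S = Unique-apart (H ++ u ∷ w ∷ []) (Rest-unique r'') (∈-++⁺ˡ {xs = H} (∈-++⁺ˡ {xs = S} z∈S)) z∈
          ...   | k , eq = 1 + k , s≤s z≤n , clique-iso clique o
                    (trans eq (trans (cong (_+ 2 * k) (countIn-values values)) (cong suc (sym (ℕ.*-distribˡ-+ 2 1 k)))))
            where
            w∉ : w ∉ H
            w∉ w∈ = Unique-apart H (Rest-unique r') w∈ (there (here refl))
            inside : ∀ {x} → x ∈ S → V₁ x ≡ false
            inside {x} x∈ = cong not (member-∈ {x = x} {S} x∈)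
            values : Pointwise (λ x e → V₁ x ≡ e) (H ++ u ∷ w ∷ []) (false ∷ false ∷ false ∷ false ∷ true ∷ true ∷ true ∷ [])
            values = inside a∈ ∷ inside b∈ ∷ inside c∈ ∷ inside d∈ ∷ V₁-true {v} v∉S ∷ V₁-true {u} (∉S u∉) ∷ V₁-true {w} (∉S w∉) ∷ []

      opposite? : ∀ x → Dec (Opposite x)
      opposite? x = (G a x Bool.≟ false) ×-dec (G b x Bool.≟ false) ×-dec (G c x Bool.≟ true) ×-dec (G d x Bool.≟ true) ×-dec (G v x Bool.≟ true)

      hub-cases : InG1 G ⊎ InG21 G ⊎ InG3 G
      hub-cases with Fin.any? (λ x → ¬? (Any.any? (x ≟_) H) ×-dec opposite? x)
      ... | yes (t , t∉ , opp-t) = inj₂ (inj₂ (BothEnds.in-G3 t∉ opp-t))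
      ... | no none with Fin.any? (λ x → ¬? (Any.any? (x ≟_) H) ×-dec ¬? (x ≟ u) ×-dec (G a x Bool.≟ true))
      ...   | yes (u' , u'∉ , u'≢u , au') = inj₂ (inj₁ (OneEnd.two-near (λ x∉ ox → none (_ , x∉ , ox)) u'∉ u'≢u (near-of (OneEnd.near-or-far (λ x∉ ox → none (_ , x∉ , ox)) u'∉))))
        where
        near-of : Near u' ⊎ Far u' → Near u'
        near-of (inj₁ nu')       = nu'
        near-of (inj₂ (au'' , _)) = ⊥-elim (true≢false au' au'')
      ...   | no sole = inj₁ (OneEnd.sole-near (λ x∉ ox → none (_ , x∉ , ox)) λ x∉ x≢u → far-of x∉ x≢u (OneEnd.near-or-far (λ x∉ ox → none (_ , x∉ , ox)) x∉))
        where
        far-of : ∀ {x} → x ∉ H → x ≢ u → Near x ⊎ Far x → Far x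
        far-of x∉ x≢u (inj₁ (ax , _)) = contradiction (_ , x∉ , x≢u , ax) sole
        far-of x∉ x≢u (inj₂ fx)       = fx

    square-cases : InG1 G ⊎ InG21 G ⊎ InG3 G
    square-cases with G v u in vu
    ... | true  = Hub.hub-cases vu
    ... | false = inj₁ (separating vu)

  squares : Base C₄+K₁ → InG1 G ⊎ InG21 G ⊎ InG3 G
  squares (a , b , c , d , v , r , h@(ab , bc , cd , ad , ac , bd , av , bv , cv , dv , _))
    -- A walk from the square to `v` must leave the square; its first vertex outside is the attached
    -- vertex `u`.
    with crossing (λ x → Any.any? (x ≟_) (a ∷ b ∷ c ∷ d ∷ [])) (path a v) (here refl)
           (λ v∈ → Unique-apart (a ∷ b ∷ c ∷ d ∷ []) (Rest-unique r) v∈ (here refl))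
  ... | x , u , x∈ , u∉S , xu = attach (touched x∈)
    where
    u∉ : u ∉ a ∷ b ∷ c ∷ d ∷ v ∷ []
    u∉ u∈ with ∈-++⁻ (a ∷ b ∷ c ∷ d ∷ []) u∈
    ... | inj₁ u∈S = u∉S u∈S
    ... | inj₂ (here refl) = off x∈
      where
      off : ¬ x ∈ a ∷ b ∷ c ∷ d ∷ []
      off (here refl)                         = true≢false xu av
      off (there (here refl))                 = true≢false xu bv
      off (there (there (here refl)))         = true≢false xu cv
      off (there (there (there (here refl)))) = true≢false xu dv

    Attached : Set
    Attached = ∃[ w ] Any (Holds (a ∷ b ∷ c ∷ d ∷ v ∷ u ∷ w ∷ [])) (Table.goals C₄-attach0)

    touched : x ∈ a ∷ b ∷ c ∷ d ∷ [] → Attached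
    touched x∈ with pull r u u∉
    touched (here refl)                         | w , r' , uw = w , apply avoid C₄-attach0 refl r' h (uw , xu , tt)
    touched (there (here refl))                 | w , r' , uw = w , apply avoid C₄-attach1 refl r' h (uw , xu , tt)
    touched (there (there (here refl)))         | w , r' , uw = w , apply avoid C₄-attach2 refl r' h (uw , xu , tt)
    touched (there (there (there (here refl)))) | w , r' , uw = w , apply avoid C₄-attach3 refl r' h (uw , xu , tt)

    rotated : ∀ is → permᵇ is (upTo 5) ≡ true → u ∉ map (at o (a ∷ b ∷ c ∷ d ∷ v ∷ [])) is
    rotated is ok = u∉ ∘ ∈-resp-↭ (map⁺ (at o (a ∷ b ∷ c ∷ d ∷ v ∷ [])) (permᵇ-sound is (upTo 5) ok))

    attach : Attached → InG1 G ⊎ InG21 G ⊎ InG3 G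
    attach (_ , here (au , bu , cu , du , _)) = Square.square-cases r h u∉ au bu cu du
    attach (_ , there (here (au , bu , cu , du , _))) =
      Square.square-cases (Rest-select r (1 ∷ 2 ∷ 3 ∷ 0 ∷ 4 ∷ []) [] refl tt)
        (bc , cd , G-sym ad , G-sym ab , bd , G-sym ac , bv , cv , dv , av , tt) (rotated (1 ∷ 2 ∷ 3 ∷ 0 ∷ 4 ∷ []) refl) bu cu du au
    attach (_ , there (there (here (au , bu , cu , du , _)))) =
      Square.square-cases (Rest-select r (2 ∷ 3 ∷ 0 ∷ 1 ∷ 4 ∷ []) [] refl tt)
        (cd , G-sym ad , ab , G-sym bc , G-sym ac , G-sym bd , cv , dv , av , bv , tt) (rotated (2 ∷ 3 ∷ 0 ∷ 1 ∷ 4 ∷ []) refl) cu du au bu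
    attach (_ , there (there (there (here (au , bu , cu , du , _))))) =
      Square.square-cases (Rest-select r (3 ∷ 0 ∷ 1 ∷ 2 ∷ 4 ∷ []) [] refl tt)
        (G-sym ad , ab , bc , G-sym cd , G-sym bd , ac , dv , av , bv , cv , tt) (rotated (3 ∷ 0 ∷ 1 ∷ 2 ∷ 4 ∷ []) refl) du au bu cu

-- K₂ + P₃ and P₅ lead to 𝒢₂₂, 𝒢₂₃ or C₇.

module Paths {n : ℕ} (G : Graph n) (simple : IsSimple G) (clawFree : ClawFree G)
             (deficiency : Matchings.DeficiencyAtMostOne G simple) (conn : Connected G)
             (avoid : Local.Avoids G simple clawFree deficiency (proj₁ (proj₁ conn)) 2) where

  open Start G simple clawFree deficiency conn

  -- Walking away from the edge `ab`, every vertex met outside the pattern sees both `a` and `b`. As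
  -- soon as one also sees an end of the P₃, a P₅ appears; if none did, the walk could not reach
  -- `c`.
  to-P₅ : Base K₂+P₃ → Base P₅
  to-P₅ (a , b , c , d , e , r , h@(ab , cd , de , ac , ad , ae , bc , bd , be , ce , _)) =
    [ id , ⊥-elim ∘ absurd ]′ (walk (path a c) (inj₁ refl , ac , ad , ae))
    where
    H : List (Fin n)
    H = a ∷ b ∷ c ∷ d ∷ e ∷ []

    Near : Fin n → Set
    Near x = (x ≡ a ⊎ x ≡ b ⊎ (x ∉ H × G a x ≡ true × G b x ≡ true)) × G x c ≡ false × G x d ≡ false × G x e ≡ false

    absurd : ¬ Near c
    absurd (_ , _ , cd' , _) = true≢false cd cd'

    near-K₂ : ∀ {x} → x ∉ H → G a x ≡ true ⊎ G b x ≡ true → Base P₅ ⊎ Near x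
    near-K₂ {x} x∉ touch with pull r x x∉
    ... | w , r' , xw with [ (λ ax → apply avoid near-K₂0 refl r' h (xw , ax , tt))
                           , (λ bx → apply avoid near-K₂1 refl r' h (xw , bx , tt)) ]′ touch
    ...   | here (ax , bx , cx , dx , ex , _) = inj₂ (inj₂ (inj₂ (x∉ , ax , bx)) , G-sym cx , G-sym dx , G-sym ex)
    ...   | there (here (ax , bx , cx , dx , ex , _))
      with apply₁ avoid to-P₅-012 refl r' h (xw , ax , bx , cx , dx , ex , tt)
    ...     | bw , _ = inj₁ (_ , _ , _ , _ , _ , Rest-select r' (0 ∷ 5 ∷ 2 ∷ 3 ∷ 4 ∷ []) ((1 , 6) ∷ []) refl (bw , tt) ,
                ax , G-sym cx , cd , de , ac , ad , ae , G-sym dx , G-sym ex , ce , tt)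
    near-K₂ {x} x∉ touch | w , r' , xw | there (there (here (ax , bx , cx , dx , ex , _)))
      with apply₁ avoid to-P₅-014 refl r' h (xw , ax , bx , cx , dx , ex , tt)
    ...     | bw , _ = inj₁ (_ , _ , _ , _ , _ , Rest-select r' (0 ∷ 5 ∷ 4 ∷ 3 ∷ 2 ∷ []) ((1 , 6) ∷ []) refl (bw , tt) ,
                ax , G-sym ex , G-sym de , G-sym cd , ae , ad , ac , G-sym dx , G-sym cx , G-sym ce , tt)

    next : ∀ {x y} → Near x → G x y ≡ true → Base P₅ ⊎ Near y
    next {x} {y} (pos , xc , xd , xe) xy with Any.any? (y ≟_) H
    ... | yes (here refl)                                 = inj₂ (inj₁ refl , ac , ad , ae)
    ... | yes (there (here refl))                         = inj₂ (inj₂ (inj₁ refl) , bc , bd , be)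
    ... | yes (there (there (here refl)))                 = ⊥-elim (true≢false xy xc)
    ... | yes (there (there (there (here refl))))         = ⊥-elim (true≢false xy xd)
    ... | yes (there (there (there (there (here refl))))) = ⊥-elim (true≢false xy xe)
    next (inj₁ refl , _) xy        | no y∉ = near-K₂ y∉ (inj₁ xy)
    next (inj₂ (inj₁ refl) , _) xy | no y∉ = near-K₂ y∉ (inj₂ xy)
    next (inj₂ (inj₂ (x∉ , ax , bx)) , xc , xd , xe) xy | no y∉ with pull₂ r x∉ y∉ (G-irr xy)
    ... | inj₁ (r' , _) = near-K₂ y∉ (inj₁ (proj₁ ((apply₁ avoid spread-partner refl r' h
            (xy , ax , bx , G-sym xc , G-sym xd , G-sym xe , tt)))))
    ... | inj₂ (_ , _ , r' , xx , yy) = near-K₂ y∉ (inj₁ (proj₁ ((apply₁ avoid spread-other refl r' h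
            (xx , yy , ax , bx , G-sym xc , G-sym xd , G-sym xe , xy , tt)))))

    walk : ∀ {x y} → WalkIn G full x y → Near x → Base P₅ ⊎ Near y
    walk here         nx = inj₂ nx
    walk (step e _ w) nx = [ inj₁ , walk w ]′ (next nx e)

  -- The vertices outside the path abcde are of two types: those of A see a and not
  -- d, and see at most one of c and e; those of B see exactly c, d and e.
  module Spine {a b c d e : Fin n} (r : Rest (a ∷ b ∷ c ∷ d ∷ e ∷ []))
               (h : Holds (a ∷ b ∷ c ∷ d ∷ e ∷ []) (P₅ 0 1 2 3 4)) where

    H : List (Fin n)
    H = a ∷ b ∷ c ∷ d ∷ e ∷ []

    private
      ab = Sat-nth (adj H) (P₅ 0 1 2 3 4) h 0
      bc = Sat-nth (adj H) (P₅ 0 1 2 3 4) h 1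
      cd = Sat-nth (adj H) (P₅ 0 1 2 3 4) h 2
      de = Sat-nth (adj H) (P₅ 0 1 2 3 4) h 3
      ac = Sat-nth (adj H) (P₅ 0 1 2 3 4) h 4
      ad = Sat-nth (adj H) (P₅ 0 1 2 3 4) h 5
      ae = Sat-nth (adj H) (P₅ 0 1 2 3 4) h 6
      bd = Sat-nth (adj H) (P₅ 0 1 2 3 4) h 7
      be = Sat-nth (adj H) (P₅ 0 1 2 3 4) h 8
      ce = Sat-nth (adj H) (P₅ 0 1 2 3 4) h 9

    H-unique : Unique H
    H-unique = Rest-unique r

    LA LB : Fin n → Set
    LA x = G a x ≡ true × G d x ≡ false
    LB x = G c x ≡ true × G d x ≡ true × G a x ≡ false

    -- Everything about the two sides follows from this one dichotomy for outside matching edges. It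
    -- is obtained either for the given path or, when an obstruction is found, for the reversed one.
    module Sides (edge : ∀ {x w} → Rest (H ++ x ∷ w ∷ []) → G x w ≡ true → LA x × LA w ⊎ LB x × LB w) where

      TypeA TypeB : Fin n → Set
      TypeA x = G a x ≡ true × G d x ≡ false ×
        ((G b x ≡ true × G c x ≡ false × G e x ≡ false) ⊎ (G b x ≡ true × G c x ≡ true × G e x ≡ false) ⊎
         (G b x ≡ true × G c x ≡ false × G e x ≡ true) ⊎ (G b x ≡ false × G c x ≡ false × G e x ≡ true))
      TypeB x = G a x ≡ false × G b x ≡ false × G c x ≡ true × G d x ≡ true × G e x ≡ true

      A-B-absurd : ∀ {x} → LA x → LB x → ⊥
      A-B-absurd (ax , _) (_ , _ , ax') = true≢false ax ax'

      A-partner : ∀ {x w} → LA x → Rest (H ++ x ∷ w ∷ []) → G x w ≡ true → LA w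
      A-partner Ax r' xw with edge r' xw
      ... | inj₁ (_ , Aw) = Aw
      ... | inj₂ (Bx , _) = ⊥-elim (A-B-absurd Ax Bx)

      B-partner : ∀ {x w} → LB x → Rest (H ++ x ∷ w ∷ []) → G x w ≡ true → LB w
      B-partner Bx r' xw with edge r' xw
      ... | inj₂ (_ , Bw) = Bw
      ... | inj₁ (Ax , _) = ⊥-elim (A-B-absurd Ax Bx)

      side : ∀ {x} → x ∉ H → LA x ⊎ LB x
      side x∉ with pull r _ x∉
      ... | w , r' , xw = [ inj₁ ∘ proj₁ , inj₂ ∘ proj₁ ]′ (edge r' xw)

      typeA : ∀ {x} → x ∉ H → LA x → TypeA x
      typeA {x} x∉ Ax with pull r x x∉
      ... | w , r' , xw with A-partner Ax r' xw
      ...   | aw , dw with apply avoid left-A refl r' h (xw , proj₁ Ax , proj₂ Ax , aw , dw , tt)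
      ...     | here (ax , bx , cx , dx , ex , _)                         = ax , dx , inj₁ (bx , cx , ex)
      ...     | there (here (ax , bx , cx , dx , ex , _))                 = ax , dx , inj₂ (inj₁ (bx , cx , ex))
      ...     | there (there (here (ax , bx , cx , dx , ex , _)))         = ax , dx , inj₂ (inj₂ (inj₁ (bx , cx , ex)))
      ...     | there (there (there (here (ax , bx , cx , dx , ex , _)))) = ax , dx , inj₂ (inj₂ (inj₂ (bx , cx , ex)))

      typeB : ∀ {x} → x ∉ H → LB x → TypeB x
      typeB {x} x∉ Bx with pull r x x∉
      ... | w , r' , xw with B-partner Bx r' xw
      ...   | cw , dw , aw with apply₁ avoid left-B refl r' h
                (xw , proj₁ Bx , proj₁ (proj₂ Bx) , proj₂ (proj₂ Bx) , cw , dw , aw , tt)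
      ...     | ax , bx , cx , dx , ex , _ = ax , bx , cx , dx , ex

      first : ∀ {x x' y y'} → Rest (H ++ x ∷ x' ∷ y ∷ y' ∷ []) → G y y' ≡ true → Rest (H ++ x ∷ x' ∷ [])
      first r' yy = Rest-select r' (upTo 7) ((7 , 8) ∷ []) refl (yy , tt)

      second : ∀ {x x' y y'} → Rest (H ++ x ∷ x' ∷ y ∷ y' ∷ []) → G x x' ≡ true → Rest (H ++ y ∷ y' ∷ [])
      second r' xx = Rest-select r' (upTo 5 ++ 7 ∷ 8 ∷ []) ((5 , 6) ∷ []) refl (xx , tt)

      -- The only possible non-edges inside A join a neighbour of c to a neighbour of e.
      Split : Fin n → Fin n → Set
      Split x y = (G c x ≡ true × G e y ≡ true) ⊎ (G e x ≡ true × G c y ≡ true)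

      out-AA : ∀ {x y} → x ∉ H → y ∉ H → LA x → LA y → x ≢ y → G x y ≡ true ⊎ Split x y
      out-AA x∉ y∉ Ax Ay x≢y with pull₂ r x∉ y∉ x≢y
      ... | inj₁ (_ , xy) = inj₁ xy
      ... | inj₂ (_ , _ , r' , xx , yy) with A-partner Ax (first r' yy) xx | A-partner Ay (second r' xx) yy
      ...   | e₀ , e₁ | f₀ , f₁ with apply avoid left-AA refl r' h
                (xx , yy , proj₁ Ax , proj₂ Ax , e₀ , e₁ , proj₁ Ay , proj₂ Ay , f₀ , f₁ , tt)
      ...     | here (xy , _)                   = inj₁ xy
      ...     | there (here (cx , ey , _))         = inj₂ (inj₁ (cx , ey))
      ...     | there (there (here (ex , cy , _))) = inj₂ (inj₂ (ex , cy))

      out-AB : ∀ {x y} → x ∉ H → y ∉ H → LA x → LB y → G x y ≡ false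
      out-AB x∉ y∉ Ax By@(cy , dy , ay) with pull₂ r x∉ y∉ (λ { refl → A-B-absurd Ax By })
      ... | inj₁ (r' , xy) = ⊥-elim (A-B-absurd (A-partner Ax r' xy) By)
      ... | inj₂ (_ , _ , r' , xx , yy) with A-partner Ax (first r' yy) xx | B-partner By (second r' xx) yy
      ...   | e₀ , e₁ | f₀ , f₁ , f₂ = proj₁ ((apply₁ avoid left-AB refl r' h
                (xx , yy , proj₁ Ax , proj₂ Ax , e₀ , e₁ , cy , dy , ay , f₀ , f₁ , f₂ , tt)))

      out-BB : ∀ {x y} → x ∉ H → y ∉ H → LB x → LB y → x ≢ y → G x y ≡ true
      out-BB x∉ y∉ Bx@(cx , dx , ax) By@(cy , dy , ay) x≢y with pull₂ r x∉ y∉ x≢y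
      ... | inj₁ (_ , xy) = xy
      ... | inj₂ (_ , _ , r' , xx , yy) with B-partner Bx (first r' yy) xx | B-partner By (second r' xx) yy
      ...   | e₀ , e₁ , e₂ | f₀ , f₁ , f₂ = proj₁ ((apply₁ avoid left-BB refl r' h
                (xx , yy , cx , dx , ax , e₀ , e₁ , e₂ , cy , dy , ay , f₀ , f₁ , f₂ , tt)))

      -- The components after removal of `c` and `e`. `A` is the closed neighbourhood of `a`;
      -- demanding adjacency to `c` as well as to `d` keeps `c` and `e` themselves out of `B`.
      A B : VSet n
      A x = ⌊ x ≟ a ⌋ ∨ G a x
      B x = ⌊ x ≟ d ⌋ ∨ (G d x ∧ G c x)

      data InA (x : Fin n) : Set where
        is-a : x ≡ a → InA x
        is-b : x ≡ b → InA x
        outA : x ∉ H → LA x → InA x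

      data InB (x : Fin n) : Set where
        is-d : x ≡ d → InB x
        outB : x ∉ H → LB x → InB x

      A-out : ∀ {x} → LA x → A x ≡ true
      A-out (ax , _) = ∨-true (inj₂ ax)

      B-out : ∀ {x} → LB x → B x ≡ true
      B-out (cx , dx , _) = ∨-true (inj₂ (cong₂ _∧_ dx cx))

      A∌B : ∀ {x} → x ∉ H → LB x → A x ≡ false
      A∌B x∉ (_ , _ , ax) = ∨-false (≟-false (x∉ ∘ here)) ax

      B∌A : ∀ {x} → x ∉ H → LA x → B x ≡ false
      B∌A {x} x∉ (_ , dx) = ∨-false (≟-false (x∉ ∘ there ∘ there ∘ there ∘ here)) (cong (_∧ G c x) dx)

      H-values : Pointwise (λ x e → A x ≡ e) H (true ∷ true ∷ false ∷ false ∷ false ∷ []) ×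
                 Pointwise (λ x e → B x ≡ e) H (false ∷ false ∷ false ∷ true ∷ false ∷ [])
      H-values with H-unique
      ... | (a≢b ∷ a≢c ∷ a≢d ∷ a≢e ∷ []) ∷ (b≢c ∷ b≢d ∷ b≢e ∷ []) ∷ (c≢d ∷ c≢e ∷ []) ∷ (d≢e ∷ []) ∷ _ =
        (∨-true (inj₁ (≟-true {x = a} refl)) ∷ ∨-true (inj₂ ab) ∷ ∨-false (≟-false (a≢c ∘ sym)) ac ∷
         ∨-false (≟-false (a≢d ∘ sym)) ad ∷ ∨-false (≟-false (a≢e ∘ sym)) ae ∷ []) ,
        (∨-false (≟-false a≢d) (cong (_∧ G c a) (G-sym ad)) ∷ ∨-false (≟-false b≢d) (cong (_∧ G c b) (G-sym bd)) ∷
         ∨-false (≟-false c≢d) (off (proj₂ simple c)) ∷ ∨-true (inj₁ (≟-true {x = d} refl)) ∷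
         ∨-false (≟-false (d≢e ∘ sym)) (off ce) ∷ [])
        where
        off : ∀ {p q} → q ≡ false → p ∧ q ≡ false
        off refl = Bool.∧-zeroʳ _

      in-A : ∀ {x} → A x ≡ true → InA x
      in-A {x} e with Any.any? (x ≟_) H | proj₁ H-values
      ... | yes (here refl) | _ = is-a refl
      ... | yes (there (here refl)) | _ = is-b refl
      ... | yes (there (there (here refl))) | _ ∷ _ ∷ e' ∷ _ = ⊥-elim (true≢false e e')
      ... | yes (there (there (there (here refl)))) | _ ∷ _ ∷ _ ∷ e' ∷ _ = ⊥-elim (true≢false e e')
      ... | yes (there (there (there (there (here refl))))) | _ ∷ _ ∷ _ ∷ _ ∷ e' ∷ _ = ⊥-elim (true≢false e e')
      ... | no x∉ | _ with side x∉
      ...   | inj₁ Ax = outA x∉ Ax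
      ...   | inj₂ Bx = ⊥-elim (true≢false e (A∌B x∉ Bx))

      in-B : ∀ {x} → B x ≡ true → InB x
      in-B {x} e with Any.any? (x ≟_) H | proj₂ H-values
      ... | yes (here refl) | e' ∷ _ = ⊥-elim (true≢false e e')
      ... | yes (there (here refl)) | _ ∷ e' ∷ _ = ⊥-elim (true≢false e e')
      ... | yes (there (there (here refl))) | _ ∷ _ ∷ e' ∷ _ = ⊥-elim (true≢false e e')
      ... | yes (there (there (there (here refl)))) | _ = is-d refl
      ... | yes (there (there (there (there (here refl))))) | _ ∷ _ ∷ _ ∷ _ ∷ e' ∷ _ = ⊥-elim (true≢false e e')
      ... | no x∉ | _ with side x∉
      ...   | inj₁ Ax = ⊥-elim (true≢false e (B∌A x∉ Ax))
      ...   | inj₂ Bx = outB x∉ Bx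

      A-d : ∀ {x} → InA x → G d x ≡ false
      A-d (is-a refl) = G-sym ad
      A-d (is-b refl) = G-sym bd
      A-d (outA _ (_ , dx)) = dx

      A-not-both : ∀ {x} → InA x → G c x ≡ true → G e x ≡ true → ⊥
      A-not-both (is-a refl) ca _ = true≢false (G-sym ca) ac
      A-not-both (is-b refl) _ eb = true≢false (G-sym eb) be
      A-not-both (outA x∉ Ax) cx ex with typeA x∉ Ax
      ... | _ , _ , inj₁ (_ , cx' , _)               = true≢false cx cx'
      ... | _ , _ , inj₂ (inj₁ (_ , _ , ex'))        = true≢false ex ex'
      ... | _ , _ , inj₂ (inj₂ (inj₁ (_ , cx' , _))) = true≢false cx cx'
      ... | _ , _ , inj₂ (inj₂ (inj₂ (_ , cx' , _))) = true≢false cx cx'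

      AA : ∀ {x y} → InA x → InA y → x ≢ y → G x y ≡ true ⊎ Split x y
      AA (is-a refl) (is-a refl) x≢y = contradiction refl x≢y
      AA (is-a refl) (is-b refl) _   = inj₁ ab
      AA (is-a refl) (outA _ (ay , _)) _ = inj₁ ay
      AA (is-b refl) (is-a refl) _   = inj₁ (G-sym ab)
      AA (is-b refl) (is-b refl) x≢y = contradiction refl x≢y
      AA (is-b refl) (outA y∉ Ay) _ with typeA y∉ Ay
      ... | _ , _ , inj₁ (by , _)               = inj₁ by
      ... | _ , _ , inj₂ (inj₁ (by , _))        = inj₁ by
      ... | _ , _ , inj₂ (inj₂ (inj₁ (by , _))) = inj₁ by
      ... | _ , _ , inj₂ (inj₂ (inj₂ (_ , _ , ey))) = inj₂ (inj₁ (G-sym bc , ey))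
      AA (outA _ (ax , _)) (is-a refl) _ = inj₁ (G-sym ax)
      AA (outA x∉ Ax) (is-b refl) _ with typeA x∉ Ax
      ... | _ , _ , inj₁ (bx , _)               = inj₁ (G-sym bx)
      ... | _ , _ , inj₂ (inj₁ (bx , _))        = inj₁ (G-sym bx)
      ... | _ , _ , inj₂ (inj₂ (inj₁ (bx , _))) = inj₁ (G-sym bx)
      ... | _ , _ , inj₂ (inj₂ (inj₂ (_ , _ , ex))) = inj₂ (inj₂ (ex , G-sym bc))
      AA (outA x∉ Ax) (outA y∉ Ay) x≢y = out-AA x∉ y∉ Ax Ay x≢y

      AB : ∀ {x y} → InA x → InB y → G x y ≡ false
      AB Ax          (is-d refl)               = G-sym (A-d Ax)
      AB (is-a refl) (outB _ (_ , _ , ay))     = ay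
      AB (is-b refl) (outB y∉ By)              = proj₁ (proj₂ (typeB y∉ By))
      AB (outA x∉ Ax) (outB y∉ By)             = out-AB x∉ y∉ Ax By

      BB : ∀ {x y} → InB x → InB y → x ≢ y → G x y ≡ true
      BB (is-d refl) (is-d refl) x≢y             = contradiction refl x≢y
      BB (is-d refl) (outB _ (_ , dy , _)) _     = dy
      BB (outB _ (_ , dx , _)) (is-d refl) _     = G-sym dx
      BB (outB x∉ Bx) (outB y∉ By) x≢y           = out-BB x∉ y∉ Bx By x≢y

      B-ends : ∀ {x} → InB x → G c x ≡ true × G e x ≡ true
      B-ends (is-d refl)  = cd , G-sym de
      B-ends (outB x∉ Bx) with typeB x∉ Bx
      ... | _ , _ , cx , _ , ex = cx , ex

      same : ∀ {x y} → Rest (H ++ x ∷ y ∷ []) → G x y ≡ true → A x ≡ A y × B x ≡ B y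
      same {x} {y} r' xy with edge r' xy
      ... | inj₁ (Ax , Ay) = trans (A-out Ax) (sym (A-out Ay)) , trans (B∌A (out (here refl)) Ax) (sym (B∌A (out (there (here refl))) Ay))
        where
        out : ∀ {z} → z ∈ x ∷ y ∷ [] → z ∉ H
        out z∈ z∈H = Unique-apart H (Rest-unique r') z∈H z∈
      ... | inj₂ (Bx , By) = trans (A∌B (out (here refl)) Bx) (sym (A∌B (out (there (here refl))) By)) , trans (B-out Bx) (sym (B-out By))
        where
        out : ∀ {z} → z ∈ x ∷ y ∷ [] → z ∉ H
        out z∈ z∈H = Unique-apart H (Rest-unique r') z∈H z∈

      data Position (x : Fin n) : Set where
        at-c : x ≡ c → Position x
        at-e : x ≡ e → Position x
        pos-A : InA x → Position x
        pos-B : InB x → Position x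

      position : ∀ x → Position x
      position x with Any.any? (x ≟_) H
      ... | yes (here x≡)                                 = pos-A (is-a x≡)
      ... | yes (there (here x≡))                         = pos-A (is-b x≡)
      ... | yes (there (there (here x≡)))                 = at-c x≡
      ... | yes (there (there (there (here x≡))))         = pos-B (is-d x≡)
      ... | yes (there (there (there (there (here x≡))))) = at-e x≡
      ... | no x∉ = [ pos-A ∘ outA x∉ , pos-B ∘ outB x∉ ]′ (side x∉)

      A-even : ∃[ k ] count A ≡ 2 + 2 * k
      A-even with count-parity A r (λ r' xy → proj₁ (same r' xy))
      ... | k , eq = k , trans eq (cong (_+ 2 * k) (countIn-values (proj₁ H-values)))

      B-odd : ∃[ k ] count B ≡ 1 + 2 * k
      B-odd with count-parity B r (λ r' xy → proj₂ (same r' xy))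
      ... | k , eq = k , trans eq (cong (_+ 2 * k) (countIn-values (proj₂ H-values)))

      A-true : ∀ {x} → InA x → A x ≡ true
      A-true (is-a refl)  = ∨-true (inj₁ (≟-true {x = a} refl))
      A-true (is-b refl)  = ∨-true (inj₂ ab)
      A-true (outA _ Ax) = A-out Ax

      A-false : ∀ {x} → InB x → A x ≡ false
      A-false (is-d refl) with proj₁ H-values
      ... | _ ∷ _ ∷ _ ∷ e ∷ _ = e
      A-false (outB x∉ Bx) = A∌B x∉ Bx

      B-true : ∀ {x} → InB x → B x ≡ true
      B-true (is-d refl)  = ∨-true (inj₁ (≟-true {x = d} refl))
      B-true (outB _ Bx) = B-out Bx

      B-false : ∀ {x} → InA x → B x ≡ false
      B-false (is-a refl) with proj₂ H-values
      ... | e ∷ _ = e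
      B-false (is-b refl) with proj₂ H-values
      ... | _ ∷ e ∷ _ = e
      B-false (outA x∉ Ax) = B∌A x∉ Ax

      c-values : A c ≡ false × B c ≡ false
      c-values with H-values
      ... | (_ ∷ _ ∷ e₁ ∷ _) , (_ ∷ _ ∷ e₂ ∷ _) = e₁ , e₂

      e-values : A e ≡ false × B e ≡ false
      e-values with H-values
      ... | (_ ∷ _ ∷ _ ∷ _ ∷ e₁ ∷ _) , (_ ∷ _ ∷ _ ∷ _ ∷ e₂ ∷ _) = e₁ , e₂

      c≢e : c ≢ e
      c≢e = All.lookup (AllPairs.head (AllPairs.tail (AllPairs.tail H-unique))) (there (here refl))

      ends-outside : ∀ {x} → A x ≡ true ⊎ B x ≡ true → x ≢ c × x ≢ e
      ends-outside Px = (λ { refl → off Px c-values }) , (λ { refl → off Px e-values })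
        where
        off : ∀ {x} → A x ≡ true ⊎ B x ≡ true → A x ≡ false × B x ≡ false → ⊥
        off (inj₁ Ax) (Ax' , _) = true≢false Ax Ax'
        off (inj₂ Bx) (_ , Bx') = true≢false Bx Bx'

      in-G22 : (∀ {x y} → InA x → InA y → x ≢ y → G x y ≡ true) → InG22 G
      in-G22 complete = c , e , A , B , c≢e , ce ,
        two-components part (clique-connected A-clique (a , A-true (is-a refl))) (clique-connected B-clique (d , B-true (is-d refl)))
          (λ x y x∈ y∈ → AB (in-A x∈) (in-B y∈)) ,
        (let k , eq = A-even in 1 + k , s≤s z≤n , clique-iso A-clique o (trans eq (sym (ℕ.*-distribˡ-+ 2 1 k)))) ,
        (let k , eq = B-odd in k , clique-iso B-clique o eq) ,
        -- The end `a` of the path is a vertex of `A` that neither `c` nor `e` sees.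
        (λ x x∈ → B-ends (in-B x∈)) , (a , A-true (is-a refl) , G-sym ac , G-sym ae) , (λ x x∈ → exclusive (in-A x∈))
        where
        A-clique : Clique A
        A-clique x∈ y∈ = complete (in-A x∈) (in-A y∈)

        B-clique : Clique B
        B-clique x∈ y∈ = BB (in-B x∈) (in-B y∈)

        exclusive : ∀ {x} → InA x → G c x ∧ G e x ≡ false
        exclusive {x} Ax with G c x in cx | G e x in ex
        ... | false | _     = refl
        ... | true  | false = refl
        ... | true  | true  = ⊥-elim (A-not-both Ax cx ex)

        part : ∀ x → Part (pair c e x) (A x) (B x)
        part x with position x
        ... | at-c refl = part-S (∨-true (inj₁ (≟-true {x = c} refl))) (proj₁ c-values) (proj₂ c-values)
        ... | at-e refl = part-S (∨-true (inj₂ (≟-true {x = e} refl))) (proj₁ e-values) (proj₂ e-values)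
        ... | pos-A Ax = part-A (∨-false (≟-false (proj₁ (ends-outside (inj₁ (A-true Ax))))) (≟-false (proj₂ (ends-outside (inj₁ (A-true Ax))))))
                           (A-true Ax) (B-false Ax)
        ... | pos-B Bx = part-B (∨-false (≟-false (proj₁ (ends-outside (inj₂ (B-true Bx))))) (≟-false (proj₂ (ends-outside (inj₂ (B-true Bx))))))
                           (A-false Bx) (B-true Bx)

      d∉A : ∀ {x} → InA x → x ≢ d
      d∉A Ax refl = true≢false (A-true Ax) (A-false (is-d refl))

      Ends : Fin n → Fin n → Set
      Ends p q = (p ≡ c × q ≡ e) ⊎ (p ≡ e × q ≡ c)

      -- What `Star` needs to know about the cut vertices, phrased so that `c`, `e` and `e`, `c`
      -- both satisfy it; the star of non-edges may be centred at a neighbour of either.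
      record EndFacts (p q : Fin n) : Set where
        field
          pd       : G p d ≡ true
          dq       : G d q ≡ true
          pq       : G p q ≡ false
          p≢q      : p ≢ q
          pa       : G p a ≡ false
          qa       : G q a ≡ false
          p∉A      : ∀ {x} → InA x → x ≢ p
          q∉A      : ∀ {x} → InA x → x ≢ q
          not-both : ∀ {x} → InA x → G p x ≡ true → G q x ≡ true → ⊥
          split    : ∀ {x y} → Split x y → (G p x ≡ true × G q y ≡ true) ⊎ (G q x ≡ true × G p y ≡ true)
          one-of   : ∀ {x} → x ≡ c ⊎ x ≡ e → x ≡ p ⊎ x ≡ q

      end-facts : ∀ {p q} → Ends p q → EndFacts p q
      end-facts (inj₁ (refl , refl)) = record
        { pd = cd ; dq = de ; pq = ce ; p≢q = c≢e ; pa = G-sym ac ; qa = G-sym ae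
        ; p∉A = λ Ax → proj₁ (ends-outside (inj₁ (A-true Ax))) ; q∉A = λ Ax → proj₂ (ends-outside (inj₁ (A-true Ax)))
        ; not-both = A-not-both ; split = id ; one-of = id }
      end-facts (inj₂ (refl , refl)) = record
        { pd = G-sym de ; dq = G-sym cd ; pq = G-sym ce ; p≢q = c≢e ∘ sym ; pa = G-sym ae ; qa = G-sym ac
        ; p∉A = λ Ax → proj₂ (ends-outside (inj₁ (A-true Ax))) ; q∉A = λ Ax → proj₁ (ends-outside (inj₁ (A-true Ax)))
        ; not-both = λ Ax ex cx → A-not-both Ax cx ex ; split = [ inj₂ , inj₁ ]′ ; one-of = [ inj₂ , inj₁ ]′ }

      -- All non-edges of A are at s, and B is the single vertex d.
      module Star {s p q z : Fin n} (ends : Ends p q) (As : InA s) (ps : G p s ≡ true)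
                  (only-s : ∀ {x} → InA x → G p x ≡ true → x ≡ s) (only-d : ∀ {x} → InB x → x ≡ d)
                  (Az : InA z) (z≢s : z ≢ s) (sz : G s z ≡ false) where

        open EndFacts (end-facts ends)

        sq : G s q ≡ false
        sq = Bool.¬-not λ e₁ → not-both As ps (G-sym e₁)

        a≢s : a ≢ s
        a≢s refl = true≢false ps pa

        a≢z : a ≢ z
        a≢z refl with AA As (is-a refl) (z≢s ∘ sym)
        ... | inj₁ sa = true≢false sa sz
        ... | inj₂ sp with split sp
        ...   | inj₁ (_ , qa') = true≢false qa' qa
        ...   | inj₂ (_ , pa') = true≢false pa' pa

        covered : ∀ {x} → InA x → x ≢ s → G s x ≡ true ⊎ G q x ≡ true
        covered Ax x≢s with AA As Ax (x≢s ∘ sym)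
        ... | inj₁ sx = inj₁ sx
        ... | inj₂ sp with split sp
        ...   | inj₁ (_ , qx) = inj₂ qx
        ...   | inj₂ (_ , px) = contradiction (only-s Ax px) x≢s

        -- For 𝒢₂₃ the cut moves from `p`, `q` to `s`, `q`. The vertices `p` and `d` form its K₂
        -- inside the path s-p-d-q, and `A` without `s`, all non-edges being at `s`, is its odd
        -- clique.
        K : VSet n
        K x = A x ∧ not ⌊ x ≟ s ⌋

        PD : VSet n
        PD = member (p ∷ d ∷ [])

        K-true : ∀ {x} → InA x → x ≢ s → K x ≡ true
        K-true Ax x≢s = cong₂ (λ e₁ e₂ → e₁ ∧ not e₂) (A-true Ax) (≟-false x≢s)

        in-K : ∀ {x} → K x ≡ true → InA x × x ≢ s
        in-K {x} e₁ with ∧-true {A x} e₁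
        ... | Ax , ne = in-A Ax , λ x≡s → true≢false ne (cong not (≟-true x≡s))

        K-clique : Clique K
        K-clique x∈ y∈ x≢y with in-K x∈ | in-K y∈
        ... | Ax , x≢s | Ay , y≢s with AA Ax Ay x≢y
        ...   | inj₁ xy = xy
        ...   | inj₂ sp with split sp
        ...     | inj₁ (px , _) = contradiction (only-s Ax px) x≢s
        ...     | inj₂ (_ , py) = contradiction (only-s Ay py) y≢s

        K-odd : ∃[ k ] (1 ≤ k × InducedIso G K (Complete (suc (2 * k))))
        K-odd with A-even
        ... | k , eq = k , positive k size , clique-iso K-clique o size
          where
          size : count K ≡ suc (2 * k)
          size = ℕ.suc-injective (trans (sym (count-remove A s (A-true As))) eq)
          positive : ∀ k → count K ≡ suc (2 * k) → 1 ≤ k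
          -- The clique has more than one vertex: `a` and the non-neighbour `z` of `s` are distinct
          -- members of it.
          positive zero    eq₁ = contradiction (count-≥2 K {a} {z} a≢z (K-true (is-a refl) a≢s) (K-true Az z≢s))
                                   (ℕ.<⇒≱ (subst (_< 2) (sym eq₁) ℕ.≤-refl))
          positive (suc _) _   = s≤s z≤n

        p≢d : p ≢ d
        p≢d = G-irr pd

        s≢p : s ≢ p
        s≢p refl = G-irr ps refl

        four : List (Fin n)
        four = s ∷ p ∷ d ∷ q ∷ []

        four-unique : Unique four
        four-unique = (s≢p ∷ d∉A As ∷ q∉A As ∷ []) ∷ (p≢d ∷ p≢q ∷ []) ∷ (G-irr dq ∷ []) ∷ [] ∷ []

        X : VSet n
        X = pair s q ∪ˢ PD

        in-X : ∀ {x} → X x ≡ true → x ∈ four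
        in-X {x} e₁ with ∨-split {pair s q x} e₁
        ... | inj₂ e₂ = inner (∈-member (p ∷ d ∷ []) e₂)
          where
          inner : ∀ {x} → x ∈ p ∷ d ∷ [] → x ∈ four
          inner (here e₃)         = there (here e₃)
          inner (there (here e₃)) = there (there (here e₃))
        ... | inj₁ e₂ with ∨-split {⌊ x ≟ s ⌋} e₂
        ...   | inj₁ e₃ = here (≟-sound e₃)
        ...   | inj₂ e₃ = there (there (there (here (≟-sound e₃))))

        p∈ : p ∈ p ∷ d ∷ []
        p∈ = here refl

        d∈ : d ∈ p ∷ d ∷ []
        d∈ = there (here refl)

        X-values : All (λ x → X x ≡ true) four
        X-values = ∨-true (inj₁ (∨-true (inj₁ (≟-true {x = s} refl)))) ∷ ∨-true {pair s q p} (inj₂ (member-∈ p∈)) ∷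
          ∨-true {pair s q d} (inj₂ (member-∈ d∈)) ∷ ∨-true (inj₁ (∨-true {⌊ q ≟ s ⌋} (inj₂ (≟-true {x = q} refl)))) ∷ []

        not-K : ∀ {x} → (InA x → ⊥) ⊎ x ≡ s → K x ≡ false
        not-K {x} why with K x in e₁
        ... | false = refl
        ... | true with in-K e₁ | why
        ...   | Ax , _   | inj₁ ¬Ax = contradiction Ax ¬Ax
        ...   | _ , x≢s  | inj₂ x≡s = contradiction x≡s x≢s

        part : ∀ x → Part (pair s q x) (PD x) (K x)
        part x = go (x ≟ s) (x ≟ q) (x ≟ p) (x ≟ d)
          where
          outside : x ≢ p → x ≢ d → PD x ≡ false
          outside x≢p x≢d = member-∉ {ys = p ∷ d ∷ []} λ { (here e₁) → x≢p e₁ ; (there (here e₁)) → x≢d e₁ }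

          remaining : x ≢ p → x ≢ q → x ≢ d → Position x → InA x
          remaining x≢p x≢q x≢d (pos-A Ax)  = Ax
          remaining x≢p x≢q x≢d (pos-B Bx)  = contradiction (only-d Bx) x≢d
          remaining x≢p x≢q x≢d (at-c x≡c) = ⊥-elim ([ x≢p , x≢q ]′ (one-of (inj₁ x≡c)))
          remaining x≢p x≢q x≢d (at-e x≡e) = ⊥-elim ([ x≢p , x≢q ]′ (one-of (inj₂ x≡e)))

          go : Dec (x ≡ s) → Dec (x ≡ q) → Dec (x ≡ p) → Dec (x ≡ d) → Part (pair s q x) (PD x) (K x)
          go (yes refl) _ _ _ = part-S (∨-true (inj₁ (≟-true {x = s} refl))) (outside s≢p (d∉A As)) (not-K (inj₂ refl))
          go (no _) (yes refl) _ _ = part-S (∨-true {⌊ q ≟ s ⌋} (inj₂ (≟-true {x = q} refl)))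
            (outside (p≢q ∘ sym) (G-irr dq ∘ sym)) (not-K (inj₁ λ Aq → q∉A Aq refl))
          go (no x≢s) (no x≢q) (yes refl) _ = part-A (∨-false (≟-false x≢s) (≟-false x≢q)) (member-∈ p∈) (not-K (inj₁ λ Ap → p∉A Ap refl))
          go (no x≢s) (no x≢q) (no _) (yes refl) = part-A (∨-false (≟-false x≢s) (≟-false x≢q)) (member-∈ d∈) (not-K (inj₁ λ Ad → d∉A Ad refl))
          go (no x≢s) (no x≢q) (no x≢p) (no x≢d) = part-B (∨-false (≟-false x≢s) (≟-false x≢q)) (outside x≢p x≢d)
            (K-true (remaining x≢p x≢q x≢d (position x)) x≢s)

        in-G23 : InG23 G
        in-G23 = s , q , PD , K , q∉A As , sq ,
          two-components part (clique-connected PD-clique (p , member-∈ p∈)) (clique-connected K-clique (a , K-true (is-a refl) a≢s))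
            (λ x y x∈ y∈ → apart (∈-member (p ∷ d ∷ []) x∈) (in-K y∈)) ,
          described-iso (Complete 2) (toWitness {a? = simple? (Complete 2)} tt) o (p ∷ d ∷ []) refl ((p≢d ∷ []) ∷ [] ∷ [])
            (member-∈ p∈ ∷ member-∈ d∈ ∷ []) (∈-member (p ∷ d ∷ [])) (pd , tt) ,
          described-iso (PathGraph 4) (toWitness {a? = simple? (PathGraph 4)} tt) o four refl four-unique X-values in-X
            (G-sym ps , G-sym (A-d As) , sq , pd , pq , dq , tt) ,
          K-odd , (λ x x∈ → ∨-true (covered (proj₁ (in-K x∈)) (proj₂ (in-K x∈))))
          where
          PD-clique : Clique PD
          PD-clique {x} {y} x∈ y∈ x≢y with ∈-member {x = x} (p ∷ d ∷ []) x∈ | ∈-member {x = y} (p ∷ d ∷ []) y∈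
          ... | here refl         | here refl         = contradiction refl x≢y
          ... | here refl         | there (here refl) = pd
          ... | there (here refl) | here refl         = G-sym pd
          ... | there (here refl) | there (here refl) = contradiction refl x≢y

          apart : ∀ {x y} → x ∈ p ∷ d ∷ [] → InA y × y ≢ s → G x y ≡ false
          apart (here refl) (Ay , y≢s) = Bool.¬-not λ py → y≢s (only-s Ay py)
          apart (there (here refl)) (Ay , _) = A-d Ay

      module StarFromB {t : Fin n} (t∉ : t ∉ H) (At : LA t) (bt : G b t ≡ false) (ct : G c t ≡ false) (et : G e t ≡ true) where

        only-d : ∀ {x} → InB x → x ≡ d
        only-d (is-d refl) = refl
        only-d (outB x∉ Bx@(cx , dx , ax)) with pull₂ r t∉ x∉ (λ { refl → A-B-absurd At Bx })
        ... | inj₁ (r' , tx) = ⊥-elim (A-B-absurd (A-partner At r' tx) Bx)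
        ... | inj₂ (_ , _ , r' , tt' , xx) with A-partner At (first r' xx) tt' | B-partner Bx (second r' tt') xx
        ...   | e₀ , e₁ | f₀ , f₁ , f₂ with apply avoid star₁-B refl r' h
                (tt' , xx , proj₁ At , proj₂ At , e₀ , e₁ , cx , dx , ax , f₀ , f₁ , f₂ , proj₁ At , bt , ct , proj₂ At , et , tt)
        ...     | ()

        -- With `t` present, a neighbour of `c` and a further neighbour of `e` cannot both occur
        -- outside. The four tables correspond to the possible partnerships among `t`, `z`, `z'`.
        clash : ∀ {z z'} → z ∉ H → z' ∉ H → LA z → LA z' → G c z ≡ true → G e z' ≡ true → z' ≢ t → ⊥
        clash {z} {z'} z∉ z'∉ Az@(az , dz) Az'@(az' , dz') cz ez' z'≢t
          with pull₃ r t∉ z∉ z'∉ (λ { refl → true≢false cz ct }) (z'≢t ∘ sym) (λ { refl → A-not-both (outA z∉ Az) cz ez' })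
        ... | inj₁ (_ , r' , tz , zz') with A-partner Az' (second r' tz) zz'
        ...   | f₀ , f₁ = case apply avoid star₁-a refl r' h
                (tz , zz' , proj₁ At , proj₂ At , az , dz , az' , dz' , f₀ , f₁ ,
                 proj₁ At , bt , ct , proj₂ At , et , az , cz , az' , ez' , dz' , tt) of λ ()
        clash {z} {z'} z∉ z'∉ Az@(az , dz) Az'@(az' , dz') cz ez' z'≢t | inj₂ (inj₁ (_ , r' , tz' , zz)) with A-partner Az (second r' tz') zz
        ...   | f₀ , f₁ = case apply avoid star₁-b refl r' h
                (tz' , zz , proj₁ At , proj₂ At , az' , dz' , az , dz , f₀ , f₁ ,
                 proj₁ At , bt , ct , proj₂ At , et , az' , ez' , dz' , az , cz , tt) of λ ()
        clash {z} {z'} z∉ z'∉ Az@(az , dz) Az'@(az' , dz') cz ez' z'≢t | inj₂ (inj₂ (inj₁ (_ , r' , zz' , tt'))) with A-partner At (second r' zz') tt'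
        ...   | f₀ , f₁ = case apply avoid star₁-c refl r' h
                (zz' , tt' , az , dz , az' , dz' , proj₁ At , proj₂ At , f₀ , f₁ ,
                 az , cz , az' , ez' , dz' , proj₁ At , bt , ct , proj₂ At , et , tt) of λ ()
        clash {z} {z'} z∉ z'∉ Az@(az , dz) Az'@(az' , dz') cz ez' z'≢t | inj₂ (inj₂ (inj₂ (_ , _ , _ , r' , tt' , zz , zz')))
          with A-partner At (Rest-select r' (upTo 7) ((7 , 8) ∷ (9 , 10) ∷ []) refl (zz , zz' , tt)) tt'
             | A-partner Az (Rest-select r' (upTo 5 ++ 7 ∷ 8 ∷ []) ((5 , 6) ∷ (9 , 10) ∷ []) refl (tt' , zz' , tt)) zz
             | A-partner Az' (Rest-select r' (upTo 5 ++ 9 ∷ 10 ∷ []) ((5 , 6) ∷ (7 , 8) ∷ []) refl (tt' , zz , tt)) zz'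
        ...   | e₀ , e₁ | f₀ , f₁ | g₀ , g₁ = case apply avoid star₁-d refl r' h
                (tt' , zz , zz' , proj₁ At , proj₂ At , e₀ , e₁ , az , dz , f₀ , f₁ , az' , dz' , g₀ , g₁ ,
                 proj₁ At , bt , ct , proj₂ At , et , az , cz , az' , ez' , dz' , tt) of λ ()

        -- `b` and `t` are non-adjacent, so one of them is the centre. If no outside vertex of `A`
        -- sees `c`, then `b` is the only neighbour of `c` in `A` and the centre is `b`; otherwise
        -- `clash` makes `t` the only neighbour of `e` and hence the centre.
        star : InG23 G
        star with Fin.any? (λ z → ¬? (Any.any? (z ≟_) H) ×-dec (G a z Bool.≟ true) ×-dec (G d z Bool.≟ false) ×-dec (G c z Bool.≟ true))
        ... | no none = Star.in-G23 (inj₁ (refl , refl)) (is-b refl) (G-sym bc) only-b only-d (outA t∉ At) (λ { refl → t∉ (there (here refl)) }) bt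
          where
          only-b : ∀ {x} → InA x → G c x ≡ true → x ≡ b
          only-b (is-a refl) ca = ⊥-elim (true≢false (G-sym ca) ac)
          only-b (is-b refl) _  = refl
          only-b (outA x∉ (ax , dx)) cx = contradiction (_ , x∉ , ax , dx , cx) none
        ... | yes (z , z∉ , az , dz , cz) =
          Star.in-G23 (inj₂ (refl , refl)) (outA t∉ At) et only-t only-d (is-b refl) (λ { refl → t∉ (there (here refl)) }) (G-sym bt)
          where
          only-t : ∀ {x} → InA x → G e x ≡ true → x ≡ t
          only-t (is-a refl) ea = ⊥-elim (true≢false (G-sym ea) ae)
          only-t (is-b refl) eb = ⊥-elim (true≢false (G-sym eb) be)
          only-t {x} (outA x∉ Ax) ex with x ≟ t
          ... | yes x≡t = x≡t
          ... | no x≢t  = ⊥-elim (clash z∉ x∉ (az , dz) Ax cz ex x≢t)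

      -- The remaining kind of non-edge, between outside vertices and with `t` seeing `b`. Here the
      -- centre is always `t`, the only neighbour of `e` in `A`.
      module StarOutside {y t : Fin n} (y∉ : y ∉ H) (t∉ : t ∉ H) (Ay : LA y) (At : LA t) (cy : G c y ≡ true) (bt : G b t ≡ true)
                         (et : G e t ≡ true) (yt : G y t ≡ false) where

        ct : G c t ≡ false
        ct = Bool.¬-not λ e₁ → A-not-both (outA t∉ At) e₁ et

        y-type : G b y ≡ true × G e y ≡ false
        y-type with typeA y∉ Ay
        ... | _ , _ , inj₁ (_ , cy' , _)               = ⊥-elim (true≢false cy cy')
        ... | _ , _ , inj₂ (inj₁ (by , _ , ey))        = by , ey
        ... | _ , _ , inj₂ (inj₂ (inj₁ (_ , cy' , _))) = ⊥-elim (true≢false cy cy')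
        ... | _ , _ , inj₂ (inj₂ (inj₂ (_ , cy' , _))) = ⊥-elim (true≢false cy cy')

        y≢t : y ≢ t
        y≢t refl = true≢false cy ct

        only-d : ∀ {x} → InB x → x ≡ d
        only-d (is-d refl) = refl
        only-d (outB x∉ Bx@(cx , dx , ax))
          with pull₃ r y∉ t∉ x∉ y≢t (λ { refl → A-B-absurd Ay Bx }) (λ { refl → A-B-absurd At Bx })
        ... | inj₁ (_ , _ , yt' , _) = ⊥-elim (true≢false yt' yt)
        ... | inj₂ (inj₁ (_ , r' , yx , tt')) = ⊥-elim (A-B-absurd (A-partner Ay (first r' tt') yx) Bx)
        ... | inj₂ (inj₂ (inj₁ (_ , r' , tx , yy))) = ⊥-elim (A-B-absurd (A-partner At (first r' yy) tx) Bx)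
        ... | inj₂ (inj₂ (inj₂ (_ , _ , _ , r' , yy , tt' , xx)))
          with A-partner Ay (Rest-select r' (upTo 7) ((7 , 8) ∷ (9 , 10) ∷ []) refl (tt' , xx , tt)) yy
             | A-partner At (Rest-select r' (upTo 5 ++ 7 ∷ 8 ∷ []) ((5 , 6) ∷ (9 , 10) ∷ []) refl (yy , xx , tt)) tt'
             | B-partner Bx (Rest-select r' (upTo 5 ++ 9 ∷ 10 ∷ []) ((5 , 6) ∷ (7 , 8) ∷ []) refl (yy , tt' , tt)) xx | y-type
        ...   | e₀ , e₁ | f₀ , f₁ | g₀ , g₁ , g₂ | by , ey = case apply avoid star₂-B refl r' h
                (yy , tt' , xx , proj₁ Ay , proj₂ Ay , e₀ , e₁ , proj₁ At , proj₂ At , f₀ , f₁ , cx , dx , ax , g₀ , g₁ , g₂ ,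
                 proj₁ Ay , by , cy , proj₂ Ay , ey , proj₁ At , bt , ct , proj₂ At , et , yt , tt) of λ ()

        clash : ∀ {z} → z ∉ H → LA z → G e z ≡ true → z ≢ t → ⊥
        clash {z} z∉ Az@(az , dz) ez z≢t with y-type
        ... | by , ey with pull₃ r y∉ t∉ z∉ y≢t (λ { refl → true≢false ez ey }) (z≢t ∘ sym)
        ...   | inj₁ (_ , _ , yt' , _) = true≢false yt' yt
        ...   | inj₂ (inj₁ (_ , r' , yz , tt')) with A-partner At (second r' yz) tt'
        ...     | f₀ , f₁ = case apply avoid star₂-a refl r' h
                  (yz , tt' , proj₁ Ay , proj₂ Ay , az , dz , proj₁ At , proj₂ At , f₀ , f₁ ,
                   proj₁ Ay , by , cy , proj₂ Ay , ey , proj₁ At , bt , ct , proj₂ At , et , yt , az , ez , dz , tt) of λ ()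
        clash {z} z∉ Az@(az , dz) ez z≢t | by , ey | inj₂ (inj₂ (inj₁ (_ , r' , tz , yy))) with A-partner Ay (second r' tz) yy
        ...     | f₀ , f₁ = case apply avoid star₂-b refl r' h
                  (tz , yy , proj₁ At , proj₂ At , az , dz , proj₁ Ay , proj₂ Ay , f₀ , f₁ ,
                   proj₁ Ay , by , cy , proj₂ Ay , ey , proj₁ At , bt , ct , proj₂ At , et , yt , az , ez , dz , tt) of λ ()
        clash {z} z∉ Az@(az , dz) ez z≢t | by , ey | inj₂ (inj₂ (inj₂ (_ , _ , _ , r' , yy , tt' , zz)))
          with A-partner Ay (Rest-select r' (upTo 7) ((7 , 8) ∷ (9 , 10) ∷ []) refl (tt' , zz , tt)) yy
             | A-partner At (Rest-select r' (upTo 5 ++ 7 ∷ 8 ∷ []) ((5 , 6) ∷ (9 , 10) ∷ []) refl (yy , zz , tt)) tt'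
             | A-partner Az (Rest-select r' (upTo 5 ++ 9 ∷ 10 ∷ []) ((5 , 6) ∷ (7 , 8) ∷ []) refl (yy , tt' , tt)) zz
        ...   | e₀ , e₁ | f₀ , f₁ | g₀ , g₁ = case apply avoid star₂-c refl r' h
                  (yy , tt' , zz , proj₁ Ay , proj₂ Ay , e₀ , e₁ , proj₁ At , proj₂ At , f₀ , f₁ , az , dz , g₀ , g₁ ,
                   proj₁ Ay , by , cy , proj₂ Ay , ey , proj₁ At , bt , ct , proj₂ At , et , yt , az , ez , dz , tt) of λ ()

        star : InG23 G
        star = Star.in-G23 (inj₂ (refl , refl)) (outA t∉ At) et only-t only-d (outA y∉ Ay) y≢t (G-sym yt)
          where
          only-t : ∀ {x} → InA x → G e x ≡ true → x ≡ t
          only-t (is-a refl) ea = ⊥-elim (true≢false (G-sym ea) ae)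
          only-t (is-b refl) eb = ⊥-elim (true≢false (G-sym eb) be)
          only-t {x} (outA x∉ Ax) ex with x ≟ t
          ... | yes x≡t = x≡t
          ... | no x≢t  = ⊥-elim (clash x∉ Ax ex x≢t)

      split-star : ∀ {x y} → InA x → InA y → G x y ≡ false → G c x ≡ true → G e y ≡ true → InG23 G
      split-star _ (is-a refl) _ _ ea = ⊥-elim (true≢false (G-sym ea) ae)
      split-star _ (is-b refl) _ _ eb = ⊥-elim (true≢false (G-sym eb) be)
      split-star (is-a refl) _ _ ca _ = ⊥-elim (true≢false (G-sym ca) ac)
      split-star (is-b refl) (outA y∉ Ay) by cb ey =
        StarFromB.star y∉ Ay by (Bool.¬-not λ cy → A-not-both (outA y∉ Ay) cy ey) ey
      split-star {x} {y} (outA x∉ Ax) (outA y∉ Ay) xy cx ey with G b y in by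
      ... | true  = StarOutside.star x∉ y∉ Ax Ay cx by ey xy
      ... | false = StarFromB.star y∉ Ay by (Bool.¬-not λ cy → A-not-both (outA y∉ Ay) cy ey) ey

      spine-cases : InG22 G ⊎ InG23 G
      spine-cases with Fin.any? (λ x → Fin.any? λ y → (A x Bool.≟ true) ×-dec (A y Bool.≟ true) ×-dec ¬? (x ≟ y) ×-dec (G x y Bool.≟ false))
      ... | no none = inj₁ (in-G22 λ {x} {y} Ax Ay x≢y → Bool.¬-not λ xy → none (x , y , A-true Ax , A-true Ay , x≢y , xy))
      ... | yes (x , y , Ax , Ay , x≢y , xy) with AA (in-A Ax) (in-A Ay) x≢y
      ...   | inj₁ xy'              = ⊥-elim (true≢false xy' xy)
      ...   | inj₂ (inj₁ (cx , ey)) = inj₂ (split-star (in-A Ax) (in-A Ay) xy cx ey)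
      ...   | inj₂ (inj₂ (ex , cy)) = inj₂ (split-star (in-A Ay) (in-A Ax) (G-sym xy) cy ex)

    -- The partner `w` of `u` is attached to `e` alone, so the path and this edge form a
    -- seven-cycle; a further outside vertex would come with a matching edge that `C₇-alone`
    -- forbids.
    seven : ∀ {u} → u ∉ H → G a u ≡ true → G b u ≡ false → G c u ≡ false → G d u ≡ false → G e u ≡ false → Iso G (Cycle 7)
    seven {u} u∉ au bu cu du eu with pull r u u∉
    ... | w , r' , uw with apply₁ avoid C₇-partner refl r' h (uw , au , bu , cu , du , eu , tt)
    ...   | aw , bw , cw , dw , ew , _ = iso-from-induced (described-iso (Cycle 7) (toWitness {a? = simple? (Cycle 7)} tt) o
            (a ∷ b ∷ c ∷ d ∷ e ∷ w ∷ u ∷ []) refl (Rest-unique (Rest-select r' (0 ∷ 1 ∷ 2 ∷ 3 ∷ 4 ∷ 6 ∷ 5 ∷ []) [] refl tt))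
            (All.tabulate λ _ → refl) (λ {x} _ → all-in x)
            (ab , ac , ad , ae , aw , au , bc , bd , be , bw , bu , cd , ce , cw , cu , de , dw , du , ew , eu , G-sym uw , tt))
      where
      all-in : ∀ x → x ∈ a ∷ b ∷ c ∷ d ∷ e ∷ w ∷ u ∷ []
      all-in x with Any.any? (x ≟_) (a ∷ b ∷ c ∷ d ∷ e ∷ w ∷ u ∷ [])
      ... | yes x∈ = x∈
      ... | no x∉ with pull r' x (λ x∈ → x∉ (∈-resp-↭ (↭-sym (++⁺ˡ H (swap w u ↭-refl))) x∈))
      ...   | _ , r'' , xx = case apply avoid C₇-alone refl r'' h
                (uw , xx , au , bu , cu , du , eu , aw , bw , cw , dw , ew , tt) of λ ()

    -- `LA` and `LB` for the path read from `e` to `a`.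
    RA RB : Fin n → Set
    RA x = G e x ≡ true × G b x ≡ false
    RB x = G c x ≡ true × G b x ≡ true × G e x ≡ false

    -- The obstructions to the description read from `a`. A sharp vertex is one by itself. A blunt
    -- or a full vertex alone still fits the types, and only the two together call for reversing the
    -- path.
    Sharp Blunt Full : Fin n → Set
    Sharp x = G d x ≡ true × G e x ≡ true × G b x ≡ false × G c x ≡ false
    Blunt x = G a x ≡ true × G b x ≡ false × G c x ≡ false × G d x ≡ false × G e x ≡ true
    Full x  = G a x ≡ false × G b x ≡ false × G c x ≡ true × G d x ≡ true × G e x ≡ true

    RightEdge : Fin n → Fin n → Set
    RightEdge x w = RA x × RA w ⊎ RB x × RB w

    right-swap : ∀ {x w} → RightEdge x w → RightEdge w x
    right-swap (inj₁ (p , q)) = inj₁ (q , p)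
    right-swap (inj₂ (p , q)) = inj₂ (q , p)

    right-by-sharp : ∀ {p} → p ∉ H → Sharp p → ∀ {x w} → Rest (H ++ x ∷ w ∷ []) → G x w ≡ true → RightEdge x w
    right-by-sharp {p} p∉ sp@(dp , ep , bp , cp) {x} {w} r' xw with p ≟ x | p ≟ w
    ... | yes refl | _ with apply₁ avoid right₁ refl r' h (xw , dp , ep , bp , cp , tt)
    ...   | e₀ , e₁ , e₂ , e₃ , _ = inj₁ ((e₀ , e₁) , e₂ , e₃)
    right-by-sharp {p} p∉ sp@(dp , ep , bp , cp) {x} {w} r' xw | no _ | yes refl
      with apply₁ avoid right₁ refl (flip r r') h (G-sym xw , dp , ep , bp , cp , tt)
    ...   | e₀ , e₁ , e₂ , e₃ , _ = inj₁ ((e₂ , e₃) , e₀ , e₁)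
    right-by-sharp {p} p∉ sp@(dp , ep , bp , cp) {x} {w} r' xw | no p≢x | no p≢w with pull r' p (∉-snoc p∉ p≢x p≢w)
    ... | _ , r'' , pp with apply avoid right₂ refl r'' h (xw , pp , dp , ep , bp , cp , tt)
    ...   | here (e₀ , e₁ , e₂ , e₃ , _)                   = inj₁ ((e₀ , e₁) , e₂ , e₃)
    ...   | there (here (e₀ , e₁ , e₂ , e₃ , e₄ , e₅ , _)) = inj₂ ((e₀ , e₁ , e₂) , e₃ , e₄ , e₅)

    right-from-blunt : ∀ {p z} → p ∉ H → z ∉ H → Blunt p → Full z → p ≢ z →
                       ∀ {w} → Rest (H ++ p ∷ w ∷ []) → G p w ≡ true → RightEdge p w
    right-from-blunt {p} {z} p∉ z∉ (ap , bp , cp , dp , ep) (az , bz , cz , dz , ez) p≢z {w} r' pw with z ≟ w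
    ... | yes refl with apply₁ avoid right₃ refl r' h (pw , ap , bp , cp , dp , ep , az , bz , cz , dz , ez , tt)
    ...   | e₀ , e₁ , e₂ , e₃ , _ = inj₁ ((e₀ , e₁) , e₂ , e₃)
    right-from-blunt {p} {z} p∉ z∉ (ap , bp , cp , dp , ep) (az , bz , cz , dz , ez) p≢z {w} r' pw | no z≢w
      with pull r' z (∉-snoc z∉ (p≢z ∘ sym) z≢w)
    ... | _ , r'' , zz with apply₁ avoid right₅ refl r'' h (pw , zz , ap , bp , cp , dp , ep , az , bz , cz , dz , ez , tt)
    ...   | e₀ , e₁ , e₂ , e₃ , _ = inj₁ ((e₀ , e₁) , e₂ , e₃)

    right-from-full : ∀ {p z} → p ∉ H → Blunt p → Full z → p ≢ z →
                      ∀ {w} → p ≢ w → Rest (H ++ z ∷ w ∷ []) → G z w ≡ true → RightEdge z w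
    right-from-full {p} {z} p∉ (ap , bp , cp , dp , ep) (az , bz , cz , dz , ez) p≢z p≢w r' zw with pull r' p (∉-snoc p∉ p≢z p≢w)
    ... | _ , r'' , pp with apply₁ avoid right₆ refl r'' h (zw , pp , ap , bp , cp , dp , ep , az , bz , cz , dz , ez , tt)
    ...   | e₀ , e₁ , e₂ , e₃ , _ = inj₁ ((e₀ , e₁) , e₂ , e₃)

    right-by-pair : ∀ {p z} → p ∉ H → z ∉ H → Blunt p → Full z →
                    ∀ {x w} → Rest (H ++ x ∷ w ∷ []) → G x w ≡ true → RightEdge x w
    right-by-pair {p} {z} p∉ z∉ bp@(e₀ , e₁ , e₂ , e₃ , e₄) fz@(f₀ , f₁ , f₂ , f₃ , f₄) {x} {w} r' xw = go (p ≟ x) (p ≟ w) (z ≟ x) (z ≟ w)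
      where
      p≢z : p ≢ z
      p≢z refl = true≢false e₀ f₀

      go : Dec (p ≡ x) → Dec (p ≡ w) → Dec (z ≡ x) → Dec (z ≡ w) → RightEdge x w
      go (yes refl) _ _ _ = right-from-blunt p∉ z∉ bp fz p≢z r' xw
      go (no _) (yes refl) _ _ = right-swap (right-from-blunt p∉ z∉ bp fz p≢z (flip r r') (G-sym xw))
      go (no _) (no p≢w) (yes refl) _ = right-from-full p∉ bp fz p≢z p≢w r' xw
      go (no p≢x) (no _) (no _) (yes refl) = right-swap (right-from-full p∉ bp fz p≢z p≢x (flip r r') (G-sym xw))
      go (no p≢x) (no p≢w) (no z≢x) (no z≢w) with pull₂ r' (∉-snoc p∉ p≢x p≢w) (∉-snoc z∉ z≢x z≢w) p≢z
      ... | inj₁ (r'' , pz) with apply avoid right₄ refl r'' h (xw , pz , e₀ , e₁ , e₂ , e₃ , e₄ , f₀ , f₁ , f₂ , f₃ , f₄ , tt)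
      ...   | here (g₀ , g₁ , g₂ , g₃ , _)                   = inj₁ ((g₀ , g₁) , g₂ , g₃)
      ...   | there (here (g₀ , g₁ , g₂ , g₃ , g₄ , g₅ , _)) = inj₂ ((g₀ , g₁ , g₂) , g₃ , g₄ , g₅)
      go (no p≢x) (no p≢w) (no z≢x) (no z≢w) | inj₂ (_ , _ , r'' , pp , zz)
        with apply avoid right₇ refl r'' h (xw , pp , zz , e₀ , e₁ , e₂ , e₃ , e₄ , f₀ , f₁ , f₂ , f₃ , f₄ , tt)
      ...   | here (g₀ , g₁ , g₂ , g₃ , _)                   = inj₁ ((g₀ , g₁) , g₂ , g₃)
      ...   | there (here (g₀ , g₁ , g₂ , g₃ , g₄ , g₅ , _)) = inj₂ ((g₀ , g₁ , g₂) , g₃ , g₄ , g₅)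

    pendant? : ∀ x → Dec (x ∉ H × G a x ≡ true × G b x ≡ false × G c x ≡ false × G d x ≡ false × G e x ≡ false)
    pendant? x = ¬? (Any.any? (x ≟_) H) ×-dec (G a x Bool.≟ true) ×-dec (G b x Bool.≟ false) ×-dec (G c x Bool.≟ false) ×-dec (G d x Bool.≟ false) ×-dec (G e x Bool.≟ false)

    sharp? : ∀ x → Dec (x ∉ H × Sharp x)
    sharp? x = ¬? (Any.any? (x ≟_) H) ×-dec (G d x Bool.≟ true) ×-dec (G e x Bool.≟ true) ×-dec (G b x Bool.≟ false) ×-dec (G c x Bool.≟ false)

    blunt? : ∀ x → Dec (x ∉ H × Blunt x)
    blunt? x = ¬? (Any.any? (x ≟_) H) ×-dec (G a x Bool.≟ true) ×-dec (G b x Bool.≟ false) ×-dec (G c x Bool.≟ false) ×-dec (G d x Bool.≟ false) ×-dec (G e x Bool.≟ true)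

    full? : ∀ x → Dec (x ∉ H × Full x)
    full? x = ¬? (Any.any? (x ≟_) H) ×-dec (G a x Bool.≟ false) ×-dec (G b x Bool.≟ false) ×-dec (G c x Bool.≟ true) ×-dec (G d x Bool.≟ true) ×-dec (G e x Bool.≟ true)

    left-edge : (∀ {x} → x ∉ H → ¬ (G a x ≡ true × G b x ≡ false × G c x ≡ false × G d x ≡ false × G e x ≡ false)) →
                (∀ {x} → x ∉ H → ¬ Sharp x) → (∀ {x z} → x ∉ H → z ∉ H → Blunt x → ¬ Full z) →
                ∀ {x w} → Rest (H ++ x ∷ w ∷ []) → G x w ≡ true → LA x × LA w ⊎ LB x × LB w
    left-edge no-pendant no-sharp no-pair {x} {w} r' xw with apply avoid P₅-edge refl r' h (xw , tt)
    ... | here (e₀ , e₁ , e₂ , e₃ , _)                   = inj₁ ((e₀ , e₁) , e₂ , e₃)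
    ... | there (here (e₀ , e₁ , e₂ , e₃ , e₄ , e₅ , _)) = inj₂ ((e₀ , e₁ , e₂) , e₃ , e₄ , e₅)
    ... | there (there (here (e₀ , e₁ , e₂ , e₃ , _)))   = ⊥-elim (no-sharp x∉ (e₀ , e₁ , e₂ , e₃))
      where
      x∉ : x ∉ H
      x∉ x∈ = Unique-apart H (Rest-unique r') x∈ (here refl)
    ... | there (there (there (here (e₀ , e₁ , e₂ , e₃ , _)))) = ⊥-elim (no-sharp w∉ (e₀ , e₁ , e₂ , e₃))
      where
      w∉ : w ∉ H
      w∉ w∈ = Unique-apart H (Rest-unique r') w∈ (there (here refl))
    ... | there (there (there (there (here (e₀ , e₁ , e₂ , e₃ , e₄ , f₀ , f₁ , f₂ , f₃ , f₄ , _))))) =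
      ⊥-elim (no-pair (λ x∈ → Unique-apart H (Rest-unique r') x∈ (here refl)) (λ w∈ → Unique-apart H (Rest-unique r') w∈ (there (here refl)))
        (e₀ , e₁ , e₂ , e₃ , e₄) (f₀ , f₁ , f₂ , f₃ , f₄))
    ... | there (there (there (there (there (here (e₀ , e₁ , e₂ , e₃ , e₄ , f₀ , f₁ , f₂ , f₃ , f₄ , _)))))) =
      ⊥-elim (no-pair (λ w∈ → Unique-apart H (Rest-unique r') w∈ (there (here refl))) (λ x∈ → Unique-apart H (Rest-unique r') x∈ (here refl))
        (f₀ , f₁ , f₂ , f₃ , f₄) (e₀ , e₁ , e₂ , e₃ , e₄))
    ... | there (there (there (there (there (there (here (e₀ , e₁ , e₂ , e₃ , e₄ , _))))))) =
      ⊥-elim (no-pendant (λ x∈ → Unique-apart H (Rest-unique r') x∈ (here refl)) (e₀ , e₁ , e₂ , e₃ , e₄))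
    ... | there (there (there (there (there (there (there (here (e₀ , e₁ , e₂ , e₃ , e₄ , _)))))))) =
      ⊥-elim (no-pendant (λ w∈ → Unique-apart H (Rest-unique r') w∈ (there (here refl))) (e₀ , e₁ , e₂ , e₃ , e₄))

  -- A pendant vertex gives C₇; a sharp vertex, or a blunt and a full one together, give the
  -- reversed description. If none of this occurs, all obstructions in `P₅-edge` are excluded and
  -- the path is used as it stands.
  paths : Base P₅ → InG22 G ⊎ InG23 G ⊎ Iso G (Cycle 7)
  paths (a , b , c , d , e , r , h) = go
    where
    mirror : Holds (a ∷ b ∷ c ∷ d ∷ e ∷ []) (P₅ 0 1 2 3 4) → Holds (e ∷ d ∷ c ∷ b ∷ a ∷ []) (P₅ 0 1 2 3 4)
    mirror (ab , bc , cd , de , ac , ad , ae , bd , be , ce , _) =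
      G-sym de , G-sym cd , G-sym bc , G-sym ab , G-sym ce , G-sym be , G-sym ae , G-sym bd , G-sym ad , G-sym ac , tt

    widen : InG22 G ⊎ InG23 G → InG22 G ⊎ InG23 G ⊎ Iso G (Cycle 7)
    widen = [ inj₁ , inj₂ ∘ inj₁ ]′

    reversed : (∀ {x w} → Rest (a ∷ b ∷ c ∷ d ∷ e ∷ x ∷ w ∷ []) → G x w ≡ true → Spine.RightEdge r h x w) →
               InG22 G ⊎ InG23 G ⊎ Iso G (Cycle 7)
    reversed right = widen (Spine.Sides.spine-cases (Rest-select r (4 ∷ 3 ∷ 2 ∷ 1 ∷ 0 ∷ []) [] refl tt) (mirror h)
      λ r' xw → right (Rest-select r' (4 ∷ 3 ∷ 2 ∷ 1 ∷ 0 ∷ 5 ∷ 6 ∷ []) [] refl tt) xw)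

    go : InG22 G ⊎ InG23 G ⊎ Iso G (Cycle 7)
    go with Fin.any? (Spine.pendant? r h)
    ... | yes (u , u∉ , au , bu , cu , du , eu) = inj₂ (inj₂ (Spine.seven r h u∉ au bu cu du eu))
    ... | no no-pendant with Fin.any? (Spine.sharp? r h)
    ...   | yes (p , p∉ , sp) = reversed (Spine.right-by-sharp r h p∉ sp)
    ...   | no no-sharp with Fin.any? (Spine.blunt? r h) | Fin.any? (Spine.full? r h)
    ...     | yes (p , p∉ , bp) | yes (z , z∉ , fz) = reversed (Spine.right-by-pair r h p∉ z∉ bp fz)
    ...     | no no-blunt | _ = widen (Spine.Sides.spine-cases r h (Spine.left-edge r h (λ x∉ px → no-pendant (_ , x∉ , px)) (λ x∉ sx → no-sharp (_ , x∉ , sx))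
                                  (λ x∉ _ bx _ → no-blunt (_ , x∉ , bx))))
    ...     | _ | no no-full  = widen (Spine.Sides.spine-cases r h (Spine.left-edge r h (λ x∉ px → no-pendant (_ , x∉ , px)) (λ x∉ sx → no-sharp (_ , x∉ , sx))
                                  (λ _ z∉ _ fz → no-full (_ , z∉ , fz))))

-- The start of the odd case, and the classification.

-- These four lists give placements of the patterns on an independent triple 0, 1, 2 and an
-- independent pair 3, 4. They serve as goals rather than as exclusions, with an empty matching
-- since all five positions are used.
2K₂+K₁-starts : List Escape
2K₂+K₁-starts = escape 0 3 1 4 2 [] ∷ escape 0 3 2 4 1 [] ∷ escape 1 3 0 4 2 [] ∷ escape 1 3 2 4 0 [] ∷ escape 2 3 0 4 1 [] ∷ escape 2 3 1 4 0 [] ∷ []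

C₄+K₁-starts : List Escape
C₄+K₁-starts = escape 0 3 1 4 2 [] ∷ escape 0 3 2 4 1 [] ∷ escape 1 3 2 4 0 [] ∷ []

K₂+P₃-starts : List Escape
K₂+P₃-starts = escape 0 3 1 4 2 [] ∷ escape 0 4 1 3 2 [] ∷ escape 1 3 0 4 2 [] ∷ escape 1 4 0 3 2 [] ∷ escape 2 3 0 4 1 [] ∷ escape 2 4 0 3 1 [] ∷ []

P₅-starts : List Escape
P₅-starts = escape 1 3 0 4 2 [] ∷ escape 1 4 0 3 2 [] ∷ escape 0 3 1 4 2 [] ∷ escape 0 4 1 3 2 [] ∷ escape 0 3 2 4 1 [] ∷ escape 0 4 2 3 1 [] ∷ []

triple-start : Table 0
triple-start = table 5 [] (0 ≁ 1 ∷ 0 ≁ 2 ∷ 1 ≁ 2 ∷ 3 ≁ 4 ∷ [])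
  (map (escapeConj 2K₂+K₁) 2K₂+K₁-starts ++ map (escapeConj C₄+K₁) C₄+K₁-starts ++
   map (escapeConj K₂+P₃) K₂+P₃-starts ++ map (escapeConj P₅) P₅-starts)
  [] []
  (bad (1 – 3 ∷ []) ∷ bad (0 – 4 ∷ []) ∷ bad (1 – 4 ∷ []) ∷ bad (2 – 4 ∷ []) ∷ bad (2 – 3 ∷ []) ∷ bad (0 – 3 ∷ []) ∷ bad [] ∷ claw 3 0 1 2 ∷ claw 4 0 1 2 ∷ [])
  refl

module Forward {n : ℕ} (G : Graph n) (simple : IsSimple G) (clawFree : ClawFree G)
               (deficiency : Matchings.DeficiencyAtMostOne G simple) (conn : Connected G) where

  open Start G simple clawFree deficiency conn

  start-base : ∀ {x y z u v} → Rest (x ∷ y ∷ z ∷ u ∷ v ∷ []) → Independent (x ∷ y ∷ z ∷ []) → Independent (u ∷ v ∷ []) →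
               ¬ Base 2K₂+K₁ → ¬ Base C₄+K₁ → ¬ Base K₂+P₃ → ¬ Base P₅ → ⊥
  start-base {x} {y} {z} {u} {v} r ((xy ∷ xz ∷ []) ∷ (yz ∷ []) ∷ _) ((uv ∷ []) ∷ _) no₁ no₂ no₃ no₄ =
    excluded (apply nothing triple-start refl r tt (xy , xz , yz , uv , tt))
    where
    excluded : ¬ Any (Holds (x ∷ y ∷ z ∷ u ∷ v ∷ [])) (Table.goals triple-start)
    excluded = All.All¬⇒¬Any (All.++⁺ (escape-excluded 2K₂+K₁ (λ _ _ _ _ _ _ h → h) no₁ r 2K₂+K₁-starts refl)
      (All.++⁺ (escape-excluded C₄+K₁ (λ _ _ _ _ _ _ h → h) no₂ r C₄+K₁-starts refl)
        (All.++⁺ (escape-excluded K₂+P₃ (λ _ _ _ _ _ _ h → h) no₃ r K₂+P₃-starts refl)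
          (escape-excluded P₅ (λ _ _ _ _ _ _ h → h) no₄ r P₅-starts refl))))

  -- Withholding the triple leaves an independent set of even size. Zero breaks the deficiency
  -- bound, five or more is a surplus, two is the desired start; with four, one cross edge turns the
  -- triple into a pair and the four into a triple, and the roles are exchanged.
  triple-base : ∀ {v x y z} → Rest (v ∷ []) → x ≢ y → x ≢ z → y ≢ z → Independent (x ∷ y ∷ z ∷ []) →
                ¬ Base 2K₂+K₁ → ¬ Base C₄+K₁ → ¬ Base K₂+P₃ → ¬ Base P₅ → ⊥
  triple-base {v} {x} {y} {z} r x≢y x≢z y≢z ind no₁ no₂ no₃ no₄ with without₂ x≢y
  ... | W , p with ∈-resp-↭ (↭-sym p) (∈-allFin z)
  ...   | here z≡x         = x≢z (sym z≡x)
  ...   | there (here z≡y) = y≢z (sym z≡y)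
  ...   | there (there z∈) with ∈⇒↭ z∈
  ...     | W' , q with leftover (x ∷ y ∷ z ∷ []) (↭-trans (prep x (prep y (↭-sym q))) p)
  ...       | []                          , (M , es , p') , _ = ℕ.<⇒≱ (s≤s (s≤s z≤n)) (deficiency _ M p' es ind)
  ...       | _ ∷ []                      , r' , _    = case trans (Rest-even r) (sym (Rest-even r')) of λ ()
  ...       | _ ∷ _ ∷ _ ∷ []              , r' , _    = case trans (Rest-even r) (sym (Rest-even r')) of λ ()
  ...       | _ ∷ _ ∷ _ ∷ _ ∷ _ ∷ _       , r' , indU = surplus 3 (x ∷ y ∷ z ∷ []) _ refl r' ind indU (s≤s (s≤s (s≤s (s≤s (s≤s z≤n)))))
  ...       | _ ∷ _ ∷ []                  , r' , indU = start-base r' ind indU no₁ no₂ no₃ no₄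
  ...       | U@(_ ∷ _ ∷ _ ∷ _ ∷ [])      , r' , indU with cross (x ∷ y ∷ z ∷ []) U r' ind indU (s≤s (s≤s z≤n))
  ...         | s ∷ t ∷ [] , a ∷ b ∷ c ∷ [] , r'' , indS' , indU' , refl , refl =
                  start-base (Rest-select r'' (2 ∷ 3 ∷ 4 ∷ 0 ∷ 1 ∷ []) [] refl tt) indU' indS' no₁ no₂ no₃ no₄

  Classes : Set
  Classes = (OddNat n × IndepNumberAtMost G 2) ⊎ InG1 G ⊎ (InG21 G ⊎ InG22 G ⊎ InG23 G ⊎ Iso G (Cycle 7)) ⊎ InG3 G

  -- The patterns are tested in the order in which their absence becomes usable: the later tables
  -- assume that no 2K₂ + K₁ and no C₄ + K₁ is left.
  odd-case : ∀ {v} → Rest (v ∷ []) → Classes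
  odd-case {v} r with Fin.any? (λ x → Fin.any? λ y → Fin.any? λ z →
      ¬? (x ≟ y) ×-dec ¬? (x ≟ z) ×-dec ¬? (y ≟ z) ×-dec (G x y Bool.≟ false) ×-dec (G x z Bool.≟ false) ×-dec (G y z Bool.≟ false))
  ... | no none = inj₁ (odd r , small)
    where
    odd : Rest (v ∷ []) → OddNat n
    odd (M , _ , p) = length M , trans (sym (List.length-tabulate {n = n} (λ i → i)))
      (trans (sym (↭-length p)) (cong suc (pairs-length M)))
      where
      pairs-length : ∀ {A : Set} (m : List (A × A)) → length (pairs m) ≡ 2 * length m
      pairs-length []      = refl
      pairs-length (_ ∷ m) = cong suc (trans (cong suc (pairs-length m)) (sym (ℕ.+-suc (length m) (length m + 0))))

    small : IndepNumberAtMost G 2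
    small []                _ = z≤n
    small (_ ∷ [])          _ = s≤s z≤n
    small (_ ∷ _ ∷ [])      _ = s≤s (s≤s z≤n)
    small (x ∷ y ∷ z ∷ S) ((x≢y ∷ x≢z ∷ _) ∷ (y≢z ∷ _) ∷ _ , ind) = contradiction
      (x , y , z , x≢y , x≢z , y≢z , ind x y (here refl) (there (here refl)) ,
       ind x z (here refl) (there (there (here refl))) , ind y z (there (here refl)) (there (there (here refl)))) none
  ... | yes (x , y , z , x≢y , x≢z , y≢z , xy , xz , yz) with Base? 2K₂+K₁
  ...   | yes base₁ = inj₂ (inj₁ (TwoSides.two-sides G simple clawFree deficiency conn base₁))
  ...   | no no₁ with Base? C₄+K₁
  ...     | yes base₂ = inj₂ ([ inj₁ , [ inj₂ ∘ inj₁ ∘ inj₁ , inj₂ ∘ inj₂ ]′ ]′ (Squares.squares G simple clawFree deficiency conn (no-2K₂ no₁) base₂))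
  ...     | no no₂ = from-path path-base
    where
    avoid : Avoids 2
    avoid = no-2K₂-or-C₄ no₁ no₂

    from-path : Base P₅ → Classes
    from-path base = inj₂ (inj₂ (inj₁ (inj₂ (Paths.paths G simple clawFree deficiency conn avoid base))))

    path-base : Base P₅
    path-base with Base? P₅ | Base? K₂+P₃
    ... | yes base₄ | _         = base₄
    ... | no _      | yes base₃ = Paths.to-P₅ G simple clawFree deficiency conn avoid base₃
    ... | no no₄    | no no₃    = ⊥-elim (triple-base r x≢y x≢z y≢z ((xy ∷ xz ∷ []) ∷ (yz ∷ []) ∷ [] ∷ []) no₁ no₂ no₃ no₄)

  classify : Iso G (Cycle 4) ⊎ (∃[ p ] (1 ≤ p × Iso G (Complete (2 * p)))) ⊎ Classes
  classify with perfect-or-near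
  ... | inj₁ r       = [ inj₁ , inj₂ ∘ inj₁ ]′ (even-case r)
  ... | inj₂ (v , r) = inj₂ (inj₂ (odd-case r))

-- Converse: tools, graphs without an independent triple, and 𝒢₂₂.

module Backward {n : ℕ} (G : Graph n) (simple : IsSimple G) where

  open Matchings G simple
  open Assemble G simple

  complement : ∀ (xs ys : List (Fin n)) → Unique xs → (∀ {x} → x ∈ xs → x ∈ ys) → ∃[ U ] xs ++ U ↭ ys
  complement []       ys _        _   = ys , ↭-refl
  complement (x ∷ xs) ys (px ∷ u) sub with ∈⇒↭ (sub (here refl))
  ... | ys' , p with complement xs ys' u (λ x∈ → other x∈ (∈-resp-↭ p (sub (there x∈))))
    where
    other : ∀ {z} → z ∈ xs → z ∈ x ∷ ys' → z ∈ ys'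
    other z∈ (here refl)  = contradiction refl (All.lookup px z∈)
    other z∈ (there z∈') = z∈'
  ...   | U , q = U , ↭-trans (prep x q) (↭-sym p)

  pairs-length : ∀ {A : Set} (m : List (A × A)) → length (pairs m) ≡ 2 * length m
  pairs-length []      = refl
  pairs-length (_ ∷ m) = cong suc (trans (cong suc (pairs-length m)) (sym (ℕ.+-suc (length m) (length m + 0))))

  unmatched-set : ∀ {M} → IsMaximalMatching G M → ∃[ U ] (U ++ pairs M ↭ allFin n × Independent U)
  unmatched-set {M} ((es , u) , covers)
    with complement (pairs M) (allFin n) (subst Unique (sym (pairs≡ends M)) u) (λ {x} _ → ∈-allFin x)
  ... | U , p = U , ↭-trans (++-comm U (pairs M)) p , all-pairs U (λ x∈ y∈ → Bool.¬-not λ xy → [ uncovered x∈ , uncovered y∈ ]′ (covers _ _ xy))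
    where
    uncovered : ∀ {x} → x ∈ U → x ∉ ends M
    uncovered x∈ x∈' = Unique-apart (pairs M) (Unique-resp-↭ (↭-sym p) (allFin⁺ n)) (subst (_ ∈_) (sym (pairs≡ends M)) x∈') x∈

    all-pairs : ∀ U → (∀ {x y} → x ∈ U → y ∈ U → G x y ≡ false) → Independent U
    all-pairs []      _ = []
    all-pairs (x ∷ U) h = All.tabulate (λ y∈ → h (here refl) (there y∈)) ∷ all-pairs U (λ x∈ y∈ → h (there x∈) (there y∈))

  total : ∀ U M → U ++ pairs M ↭ allFin n → length U + 2 * length M ≡ n
  total U M p = trans (cong (length U +_) (sym (pairs-length M)))
    (trans (sym (List.length-++ U)) (trans (↭-length p) (List.length-tabulate {n = n} (λ i → i))))

  -- Any two maximal matchings miss at most one vertex each, and the numbers missed have the parity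
  -- of `n`, so they agree.
  equimatchable : DeficiencyAtMostOne → Equimatchable G
  equimatchable deficiency M M' max max' with unmatched-set max | unmatched-set max'
  ... | U , p , ind | U' , p' , ind' = ℕ.*-cancelˡ-≡ _ _ 2 (ℕ.+-cancelˡ-≡ (length U) _ _
        (trans (total U M p) (trans (sym (total U' M' p')) (cong (_+ 2 * length M') (sym same)))))
    where
    agree : ∀ k k' → k ≤ 1 → k' ≤ 1 → evenᵇ k ≡ evenᵇ k' → k ≡ k'
    agree zero       zero       _        _        _ = refl
    agree (suc zero) (suc zero) _        _        _ = refl
    agree zero       (suc zero) _        _        ()
    agree (suc zero) zero       _        _        ()
    agree (suc (suc _)) _ (s≤s ()) _ _
    agree zero (suc (suc _)) _ (s≤s ()) _
    agree (suc zero) (suc (suc _)) _ (s≤s ()) _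

    same : length U ≡ length U'
    same = agree _ _ (deficiency U M p (proj₁ (proj₁ max)) ind) (deficiency U' M' p' (proj₁ (proj₁ max')) ind')
      (trans (sym (evenᵇ-+-double (length U) (length M))) (trans (cong evenᵇ (trans (total U M p) (sym (total U' M' p'))))
        (evenᵇ-+-double (length U') (length M'))))

  -- Two of any three neighbours of c get the same colour.
  claw-free-by : (φ : Fin n → Fin n → Bool) →
                 (∀ c {x y} → G c x ≡ true → G c y ≡ true → x ≢ y → φ c x ≡ φ c y → G x y ≡ true) → ClawFree G
  claw-free-by φ adjacent c x y z (cx , cy , cz , x≢y , x≢z , y≢z , xy , xz , yz) with φ c x in p | φ c y in q | φ c z in r
  ... | true  | true  | _     = true≢false (adjacent c cx cy x≢y (trans p (sym q))) xy
  ... | true  | false | true  = true≢false (adjacent c cx cz x≢z (trans p (sym r))) xz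
  ... | true  | false | false = true≢false (adjacent c cy cz y≢z (trans q (sym r))) yz
  ... | false | true  | true  = true≢false (adjacent c cy cz y≢z (trans q (sym r))) yz
  ... | false | true  | false = true≢false (adjacent c cx cz x≢z (trans p (sym r))) xz
  ... | false | false | _     = true≢false (adjacent c cx cy x≢y (trans p (sym q))) xy

  two-alike : (κ : Fin n → Bool) → ∀ {x y z} → Unique (x ∷ y ∷ z ∷ []) →
              ∃[ u ] ∃[ w ] (u ∈ x ∷ y ∷ z ∷ [] × w ∈ x ∷ y ∷ z ∷ [] × u ≢ w × κ u ≡ κ w)
  two-alike κ {x} {y} {z} ((x≢y ∷ x≢z ∷ []) ∷ (y≢z ∷ []) ∷ _) with κ x Bool.≟ κ y | κ x Bool.≟ κ z | κ y Bool.≟ κ z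
  ... | yes e | _ | _ = x , y , here refl , there (here refl) , x≢y , e
  ... | no _ | yes e | _ = x , z , here refl , there (there (here refl)) , x≢z , e
  ... | no _ | no _ | yes e = y , z , there (here refl) , there (there (here refl)) , y≢z , e
  ... | no ¬p | no ¬q | no ¬r = ⊥-elim (¬q (trans (Bool.¬-not ¬p) (sym (Bool.¬-not (¬r ∘ sym)))))

  countIn-true : ∀ {X : VSet n} {xs} → All (λ x → X x ≡ true) xs → countIn X xs ≡ length xs
  countIn-true []                = refl
  countIn-true {X} {x ∷ xs} (e ∷ es) = cong₂ (λ b k → (if b then 1 else 0) + k) e (countIn-true es)

  countIn-false : ∀ {X : VSet n} {xs} → All (λ x → X x ≡ false) xs → countIn X xs ≡ 0
  countIn-false []                = refl
  countIn-false {X} {x ∷ xs} (e ∷ es) = cong₂ (λ b k → (if b then 1 else 0) + k) e (countIn-false es)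

  count-list : ∀ {X : VSet n} xs → Unique xs → All (λ x → X x ≡ true) xs → (∀ {x} → X x ≡ true → x ∈ xs) → count X ≡ length xs
  count-list {X} xs u all-in back with complement xs (allFin n) u (λ {x} _ → ∈-allFin x)
  ... | U , p = trans (sym (countIn-↭ X p)) (trans (countIn-++ X xs U)
      (trans (cong₂ _+_ (countIn-true all-in) (countIn-false (All.tabulate out))) (ℕ.+-identityʳ _)))
    where
    out : ∀ {x} → x ∈ U → X x ≡ false
    out x∈ = Bool.¬-not λ e → Unique-apart xs (Unique-resp-↭ (↭-sym p) (allFin⁺ n)) (back e) x∈

  iso-count : ∀ {X : VSet n} {k} {H : Graph k} → InducedIso G X H → count X ≡ k
  iso-count {X} {k} (f , inj , all-in , onto , _) = trans
    (count-list (map f (allFin k)) (Unique.map⁺ inj (allFin⁺ k)) (All.map⁺ (All.tabulate λ {i} _ → all-in i)) back)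
    (trans (List.length-map f (allFin k)) (List.length-tabulate {n = k} (λ i → i)))
    where
    back : ∀ {x} → X x ≡ true → x ∈ map f (allFin k)
    back {x} e with onto x e
    ... | i , refl = ∈-map⁺ f (∈-allFin i)

  iso-clique : ∀ {X : VSet n} {k} → InducedIso G X (Complete k) → Clique X
  iso-clique (f , inj , _ , onto , adj) {x} {y} x∈ y∈ x≢y with onto x x∈ | onto y y∈
  ... | i , refl | j , refl = trans (sym (adj i j)) (apart (toℕ i ≡ᵇ toℕ j) refl)
    where
    apart : ∀ b → (toℕ i ≡ᵇ toℕ j) ≡ b → not b ≡ true
    apart false _ = refl
    apart true  e = contradiction (cong f (Fin.toℕ-injective (≡ᵇ-sound {toℕ i} e))) x≢y

  -- A vertex outside `Y` has its partner outside `Y`, so its neighbours cannot all be listed.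
  isolated : ∀ {Y v} → Rest Y → v ∉ Y → (∀ {w} → G v w ≡ true → w ∈ Y) → ⊥
  isolated {Y} rest v∉ all-in with pull rest _ v∉
  ... | w , r , vw = Unique-apart Y (Rest-unique r) (all-in vw) (there (here refl))

  -- Matching edges outside `Y` cannot leave `X`, so `X` outside `Y` is perfectly matched within
  -- itself and only its listed vertices affect its parity.
  closed-parity : ∀ X {Y} → Rest Y → (∀ {x w} → x ∉ Y → w ∉ Y → X x ≡ true → G x w ≡ true → X w ≡ true) →
                  evenᵇ (count X) ≡ evenᵇ (countIn X Y)
  closed-parity X {Y} rest closed with count-parity X rest same
    where
    same : ∀ {x w} → Rest (Y ++ x ∷ w ∷ []) → G x w ≡ true → X x ≡ X w
    same {x} {w} r xw with X x in p | X w in q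
    ... | true  | true  = refl
    ... | false | false = refl
    ... | true  | false = trans (sym (closed (λ x∈ → Unique-apart Y (Rest-unique r) x∈ (here refl))
            (λ w∈ → Unique-apart Y (Rest-unique r) w∈ (there (here refl))) p xw)) q
    ... | false | true  = trans (sym p) (closed (λ w∈ → Unique-apart Y (Rest-unique r) w∈ (there (here refl)))
            (λ x∈ → Unique-apart Y (Rest-unique r) x∈ (here refl)) q (G-sym xw))
  ... | k , eq = trans (cong evenᵇ eq) (evenᵇ-+-double (countIn X Y) k)

  -- In an odd graph a matching cannot miss exactly two vertices, so the first case to exclude is
  -- three.
  odd-deficiency : evenᵇ n ≡ false → (∀ {x y z U} → Rest (x ∷ y ∷ z ∷ U) → Independent (x ∷ y ∷ z ∷ U) → ⊥) → DeficiencyAtMostOne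
  odd-deficiency odd none U M p es ind with U
  ... | []            = z≤n
  ... | _ ∷ []        = s≤s z≤n
  ... | _ ∷ _ ∷ _ ∷ _ = ⊥-elim (none (M , es , p) ind)
  ... | x ∷ y ∷ []    = ⊥-elim (true≢false even odd)
    where
    even : evenᵇ n ≡ true
    even = trans (cong evenᵇ (trans (sym (List.length-tabulate {n = n} (λ i → i))) (trans (sym (↭-length p)) (cong (2 +_) (pairs-length M)))))
      (evenᵇ-+-double 2 (length M))

  component : ∀ {S A B : VSet n} → TwoComponents G S A B → ∀ x → Part (S x) (A x) (B x)
  component (cover , SA , SB , AB , _) x = go (cover x) (SA x) (SB x) (AB x)
    where
    go : ∀ {s a b} → s ∨ a ∨ b ≡ true → s ∧ a ≡ false → s ∧ b ≡ false → a ∧ b ≡ false → Part s a b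
    go {true}  {false} {false} _ _ _ _ = inS
    go {false} {true}  {false} _ _ _ _ = inA
    go {false} {false} {true}  _ _ _ _ = inB

  component-count : ∀ {S A B : VSet n} → (∀ x → Part (S x) (A x) (B x)) → count S + count A + count B ≡ n
  component-count {S} {A} {B} part = trans (go (allFin n)) (List.length-tabulate {n = n} (λ i → i))
    where
    go : ∀ xs → countIn S xs + countIn A xs + countIn B xs ≡ length xs
    go []       = refl
    go (x ∷ xs) with S x | A x | B x | part x
    ... | _ | _ | _ | inS = cong suc (go xs)
    ... | _ | _ | _ | inA = trans (cong (_+ countIn B xs) (ℕ.+-suc (countIn S xs) (countIn A xs))) (cong suc (go xs))
    ... | _ | _ | _ | inB = trans (ℕ.+-suc (countIn S xs + countIn A xs) (countIn B xs)) (cong suc (go xs))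

  evenᵇ-double : ∀ k → evenᵇ (2 * k) ≡ true
  evenᵇ-double k = evenᵇ-+-double 0 k

  evenᵇ-+ : ∀ a b → evenᵇ (a + b) ≡ (if evenᵇ a then evenᵇ b else not (evenᵇ b))
  evenᵇ-+ zero    b = refl
  evenᵇ-+ (suc a) b with evenᵇ a | evenᵇ-+ a b
  ... | true  | e = cong not e
  ... | false | e = trans (cong not e) (Bool.not-involutive (evenᵇ b))

  parity-sum : ∀ {S A B : VSet n} → (∀ x → Part (S x) (A x) (B x)) → ∀ {p q r} → evenᵇ (count S) ≡ p → evenᵇ (count A) ≡ q → evenᵇ (count B) ≡ r →
               evenᵇ n ≡ (if (if p then q else not q) then r else not r)
  parity-sum {S} {A} {B} part refl refl refl = trans (cong evenᵇ (sym (component-count part)))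
    (trans (evenᵇ-+ (count S + count A) (count B)) (cong (λ b → if b then evenᵇ (count B) else not (evenᵇ (count B))) (evenᵇ-+ (count S) (count A))))

  part-S⁻ : ∀ {s a b} → Part s a b → s ≡ true → a ≡ false × b ≡ false
  part-S⁻ inS _ = refl , refl

  part-A⁻ : ∀ {s a b} → Part s a b → a ≡ true → s ≡ false × b ≡ false
  part-A⁻ inA _ = refl , refl

  part-B⁻ : ∀ {s a b} → Part s a b → b ≡ true → s ≡ false × a ≡ false
  part-B⁻ inB _ = refl , refl

  module Triple {x y z : Fin n} {U : List (Fin n)} (r : Rest (x ∷ y ∷ z ∷ U)) (ind : Independent (x ∷ y ∷ z ∷ U)) where

    Tri Y : List (Fin n)
    Tri = x ∷ y ∷ z ∷ []
    Y = x ∷ y ∷ z ∷ U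

    Tri⊆Y : ∀ {u} → u ∈ Tri → u ∈ Y
    Tri⊆Y = ∈-++⁺ˡ

    apart : ∀ {u w} → u ∈ Y → w ∈ Y → G u w ≡ true → ⊥
    apart u∈ w∈ uw = true≢false uw (independent-∈ ind u∈ w∈)

    alike : (κ : Fin n → Bool) → ∃[ u ] ∃[ w ] (u ∈ Tri × w ∈ Tri × u ≢ w × κ u ≡ κ w)
    alike κ = two-alike κ (Unique-++ˡ Tri (Rest-unique r))

    -- Pigeonhole: if the triple avoided `s`, two of its vertices would share a colour and hence be
    -- adjacent.
    contains : (κ : Fin n → Bool) (s : Fin n) →
               (∀ {u w} → u ∈ Tri → w ∈ Tri → u ≢ s → w ≢ s → u ≢ w → κ u ≡ κ w → G u w ≡ true) → s ∈ Tri
    contains κ s adjacent with Any.any? (s ≟_) Tri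
    ... | yes s∈ = s∈
    ... | no s∉ with alike κ
    ...   | u , w , u∈ , w∈ , u≢w , e = ⊥-elim (apart (Tri⊆Y u∈) (Tri⊆Y w∈)
              (adjacent u∈ w∈ (λ { refl → s∉ u∈ }) (λ { refl → s∉ w∈ }) u≢w e))

  small-independence : evenᵇ n ≡ false → IndepNumberAtMost G 2 → ClawFree G × Equimatchable G
  small-independence odd small = claw-free , equimatchable (odd-deficiency odd none)
    where
    no-triple : ∀ {x y z} → Unique (x ∷ y ∷ z ∷ []) → Independent (x ∷ y ∷ z ∷ []) → ⊥
    no-triple u ind = ℕ.<⇒≱ ℕ.≤-refl (small _ (u , λ x y x∈ y∈ → independent-∈ ind x∈ y∈))

    claw-free : ClawFree G
    claw-free c x y z (_ , _ , _ , x≢y , x≢z , y≢z , xy , xz , yz) =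
      no-triple ((x≢y ∷ x≢z ∷ []) ∷ (y≢z ∷ []) ∷ [] ∷ []) ((xy ∷ xz ∷ []) ∷ (yz ∷ []) ∷ [] ∷ [])

    none : ∀ {x y z U} → Rest (x ∷ y ∷ z ∷ U) → Independent (x ∷ y ∷ z ∷ U) → ⊥
    none {x} {y} {z} r ((xy ∷ xz ∷ _) ∷ (yz ∷ _) ∷ _) =
      no-triple (Unique-++ˡ (x ∷ y ∷ z ∷ []) (Rest-unique r)) ((xy ∷ xz ∷ []) ∷ (yz ∷ []) ∷ [] ∷ [])

  pair-cases : ∀ {s t x : Fin n} → pair s t x ≡ true → x ≡ s ⊎ x ≡ t
  pair-cases {s} {t} {x} e with ∨-split {⌊ x ≟ s ⌋} e
  ... | inj₁ e' = inj₁ (≟-sound e')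
  ... | inj₂ e' = inj₂ (≟-sound e')

  pair-left : ∀ (s t : Fin n) → pair s t s ≡ true
  pair-left s t = ∨-true (inj₁ (≟-true {x = s} refl))

  pair-right : ∀ (s t : Fin n) → pair s t t ≡ true
  pair-right s t = ∨-true {⌊ t ≟ s ⌋} (inj₂ (≟-true {x = t} refl))

  count-pair : ∀ {s t : Fin n} → s ≢ t → count (pair s t) ≡ 2
  count-pair {s} {t} s≢t = count-list (s ∷ t ∷ []) ((s≢t ∷ []) ∷ [] ∷ []) (pair-left s t ∷ pair-right s t ∷ [])
    (λ e → [ here , there ∘ here ]′ (pair-cases e))

  module TwoCut {s t : Fin n} {A B : VSet n} (s≢t : s ≢ t) (st : G s t ≡ false) (tc : TwoComponents G (pair s t) A B)
                (cliqueA : Clique A) (cliqueB : Clique B) (evenA : evenᵇ (count A) ≡ true) (oddB : evenᵇ (count B) ≡ false) where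

    part : ∀ x → Part (pair s t x) (A x) (B x)
    part = component tc

    AB : ∀ {x y} → A x ≡ true → B y ≡ true → G x y ≡ false
    AB = proj₂ (proj₂ (proj₂ (proj₂ (proj₂ (proj₂ tc))))) _ _

    data View (x : Fin n) : Set where
      at-s : x ≡ s → View x
      at-t : x ≡ t → View x
      in-A : A x ≡ true → View x
      in-B : B x ≡ true → View x

    view : ∀ x → View x
    view x with pair s t x in e | A x in e₁ | B x in e₂ | part x
    ... | _ | _ | _ | inA = in-A e₁
    ... | _ | _ | _ | inB = in-B e₂
    ... | _ | _ | _ | inS = [ at-s , at-t ]′ (pair-cases e)

    Cases : Fin n → Fin n → Fin n → Set
    Cases p q x = x ≡ p ⊎ x ≡ q ⊎ A x ≡ true ⊎ B x ≡ true

    st-cases : ∀ {x} → View x → Cases s t x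
    st-cases (at-s e) = inj₁ e
    st-cases (at-t e) = inj₂ (inj₁ e)
    st-cases (in-A e) = inj₂ (inj₂ (inj₁ e))
    st-cases (in-B e) = inj₂ (inj₂ (inj₂ e))

    ts-cases : ∀ {x} → View x → Cases t s x
    ts-cases (at-s e) = inj₂ (inj₁ e)
    ts-cases (at-t e) = inj₁ e
    ts-cases (in-A e) = inj₂ (inj₂ (inj₁ e))
    ts-cases (in-B e) = inj₂ (inj₂ (inj₂ e))

    odd : evenᵇ n ≡ false
    odd = parity-sum part (cong evenᵇ (count-pair s≢t)) evenA oddB

    A-not-s : ∀ {x} → A x ≡ true → x ≢ s
    A-not-s Ax refl = true≢false (pair-left s t) (proj₁ (part-A⁻ (part s) Ax))

    A-not-t : ∀ {x} → A x ≡ true → x ≢ t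
    A-not-t Ax refl = true≢false (pair-right s t) (proj₁ (part-A⁻ (part t) Ax))

    B-not-s : ∀ {x} → B x ≡ true → x ≢ s
    B-not-s Bx refl = true≢false (pair-left s t) (proj₁ (part-B⁻ (part s) Bx))

    B-not-t : ∀ {x} → B x ≡ true → x ≢ t
    B-not-t Bx refl = true≢false (pair-right s t) (proj₁ (part-B⁻ (part t) Bx))

  G22 : InG22 G → ClawFree G × Equimatchable G
  G22 (s , t , A , B , s≢t , st , tc , (p , _ , isoA) , (q , isoB) , toB , _ , exclusive) =
    claw-free-by φ adjacent , equimatchable (odd-deficiency odd none)
    where
    cliqueB : Clique B
    cliqueB = iso-clique isoB

    cliqueA : Clique A
    cliqueA = iso-clique isoA

    oddB : evenᵇ (count B) ≡ false
    oddB = trans (cong evenᵇ (iso-count isoB)) (cong not (evenᵇ-double q))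

    open TwoCut s≢t st tc cliqueA cliqueB (trans (cong evenᵇ (iso-count isoA)) (evenᵇ-double p)) oddB

    -- For a centre in `B` the classes are `t` alone and `B` with `s`, to which `s` is complete. For
    -- any other centre the vertices of `A` are set against the rest; a centre in `A` sees at most
    -- one of `s` and `t`.
    φ : Fin n → Fin n → Bool
    φ c x = if B c then ⌊ x ≟ t ⌋ else A x

    not-both : ∀ {c} → A c ≡ true → G s c ≡ true → G t c ≡ true → ⊥
    not-both {c} Ac sc tc' = true≢false (cong₂ _∧_ sc tc') (exclusive c Ac)

    adjacent : ∀ c {x y} → G c x ≡ true → G c y ≡ true → x ≢ y → φ c x ≡ φ c y → G x y ≡ true
    adjacent c {x} {y} cx cy x≢y e with B c in Bc
    ... | true = go (view x) (view y)
      where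
      go : View x → View y → G x y ≡ true
      go (at-s refl) (at-s refl) = contradiction refl x≢y
      go (at-s refl) (at-t refl) = ⊥-elim (true≢false (≟-true {x = t} refl) (trans (sym e) (≟-false s≢t)))
      go (at-t refl) (at-s refl) = ⊥-elim (true≢false (≟-true {x = t} refl) (trans e (≟-false s≢t)))
      go (at-t refl) (at-t refl) = contradiction refl x≢y
      go (in-A Ax) _ = ⊥-elim (true≢false (G-sym cx) (AB Ax Bc))
      go _ (in-A Ay) = ⊥-elim (true≢false (G-sym cy) (AB Ay Bc))
      go (at-s refl) (in-B By) = proj₁ (toB y By)
      go (at-t refl) (in-B By) = proj₂ (toB y By)
      go (in-B Bx) (at-s refl) = G-sym (proj₁ (toB x Bx))
      go (in-B Bx) (at-t refl) = G-sym (proj₂ (toB x Bx))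
      go (in-B Bx) (in-B By) = cliqueB Bx By x≢y
    ... | false = go (view c) (view x) (view y)
      where
      A≢ : ∀ {x y} → A x ≡ A y → A x ≡ true → A y ≡ false → ⊥
      A≢ e Ax Ay = true≢false (trans (sym e) Ax) Ay
      not-A : ∀ {x} → B x ≡ true → A x ≡ false
      not-A Bx = proj₂ (part-B⁻ (part _) Bx)
      go : View c → View x → View y → G x y ≡ true
      go (in-B Bc') _ _ = ⊥-elim (true≢false Bc' Bc)
      go _ (in-A Ax) (in-A Ay) = cliqueA Ax Ay x≢y
      go (at-s refl) (at-s refl) _ = ⊥-elim (G-irr cx refl)
      go (at-s refl) (at-t refl) _ = ⊥-elim (true≢false cx st)
      go (at-s refl) _ (at-s refl) = ⊥-elim (G-irr cy refl)
      go (at-s refl) _ (at-t refl) = ⊥-elim (true≢false cy st)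
      go (at-t refl) (at-s refl) _ = ⊥-elim (true≢false (G-sym cx) st)
      go (at-t refl) (at-t refl) _ = ⊥-elim (G-irr cx refl)
      go (at-t refl) _ (at-s refl) = ⊥-elim (true≢false (G-sym cy) st)
      go (at-t refl) _ (at-t refl) = ⊥-elim (G-irr cy refl)
      go (in-A Ac) (in-B Bx) _ = ⊥-elim (true≢false cx (AB Ac Bx))
      go (in-A Ac) _ (in-B By) = ⊥-elim (true≢false cy (AB Ac By))
      go (in-A Ac) (at-s refl) (at-s refl) = contradiction refl x≢y
      go (in-A Ac) (at-s refl) (at-t refl) = ⊥-elim (not-both Ac (G-sym cx) (G-sym cy))
      go (in-A Ac) (at-t refl) (at-s refl) = ⊥-elim (not-both Ac (G-sym cy) (G-sym cx))
      go (in-A Ac) (at-t refl) (at-t refl) = contradiction refl x≢y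
      go (in-A Ac) (at-s refl) (in-A Ay) = ⊥-elim (A≢ (sym e) Ay (proj₁ (part-S⁻ (part _) (pair-left s t))))
      go (in-A Ac) (at-t refl) (in-A Ay) = ⊥-elim (A≢ (sym e) Ay (proj₁ (part-S⁻ (part _) (pair-right s t))))
      go (in-A Ac) (in-A Ax) (at-s refl) = ⊥-elim (A≢ e Ax (proj₁ (part-S⁻ (part _) (pair-left s t))))
      go (in-A Ac) (in-A Ax) (at-t refl) = ⊥-elim (A≢ e Ax (proj₁ (part-S⁻ (part _) (pair-right s t))))
      go _ (in-A Ax) (in-B By) = ⊥-elim (A≢ e Ax (not-A By))
      go _ (in-B Bx) (in-A Ay) = ⊥-elim (A≢ (sym e) Ay (not-A Bx))
      go _ (in-B Bx) (in-B By) = cliqueB Bx By x≢y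

    -- An independent triple must contain both `s` and `t`. No vertex of `B` is then unmatched, and
    -- `B` is closed apart from `s` and `t`, so it would be even.
    none : ∀ {x y z U} → Rest (x ∷ y ∷ z ∷ U) → Independent (x ∷ y ∷ z ∷ U) → ⊥
    none r ind = true≢false (trans (closed-parity B r closed) (cong evenᵇ (countIn-false {X = B} (All.tabulate no-B)))) oddB
      where
      open Triple r ind

      clash : ∀ {u w} → View u → View w → u ≢ w → A u ≡ A w → (u ≢ s × w ≢ s) ⊎ (u ≢ t × w ≢ t) → G u w ≡ true
      clash (in-A Au) (in-A Aw) u≢w _ _ = cliqueA Au Aw u≢w
      clash (in-B Bu) (in-B Bw) u≢w _ _ = cliqueB Bu Bw u≢w
      clash (at-s refl) (in-B Bw) _ _ _ = proj₁ (toB _ Bw)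
      clash (at-t refl) (in-B Bw) _ _ _ = proj₂ (toB _ Bw)
      clash (in-B Bu) (at-s refl) _ _ _ = G-sym (proj₁ (toB _ Bu))
      clash (in-B Bu) (at-t refl) _ _ _ = G-sym (proj₂ (toB _ Bu))
      clash (at-s refl) (at-s refl) u≢w _ _ = contradiction refl u≢w
      clash (at-t refl) (at-t refl) u≢w _ _ = contradiction refl u≢w
      clash (at-s refl) (at-t refl) _ _ (inj₁ (ne , _)) = contradiction refl ne
      clash (at-s refl) (at-t refl) _ _ (inj₂ (_ , ne)) = contradiction refl ne
      clash (at-t refl) (at-s refl) _ _ (inj₁ (_ , ne)) = contradiction refl ne
      clash (at-t refl) (at-s refl) _ _ (inj₂ (ne , _)) = contradiction refl ne
      clash (in-A Au) (at-s refl) _ e _ = ⊥-elim (true≢false (trans (sym e) Au) (proj₁ (part-S⁻ (part _) (pair-left s t))))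
      clash (in-A Au) (at-t refl) _ e _ = ⊥-elim (true≢false (trans (sym e) Au) (proj₁ (part-S⁻ (part _) (pair-right s t))))
      clash (in-A Au) (in-B Bw) _ e _ = ⊥-elim (true≢false (trans (sym e) Au) (proj₂ (part-B⁻ (part _) Bw)))
      clash (at-s refl) (in-A Aw) _ e _ = ⊥-elim (true≢false (trans e Aw) (proj₁ (part-S⁻ (part _) (pair-left s t))))
      clash (at-t refl) (in-A Aw) _ e _ = ⊥-elim (true≢false (trans e Aw) (proj₁ (part-S⁻ (part _) (pair-right s t))))
      clash (in-B Bu) (in-A Aw) _ e _ = ⊥-elim (true≢false (trans e Aw) (proj₂ (part-B⁻ (part _) Bu)))

      s∈ : s ∈ Tri
      s∈ = contains A s λ _ _ u≢s w≢s u≢w e → clash (view _) (view _) u≢w e (inj₁ (u≢s , w≢s))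

      t∈ : t ∈ Tri
      t∈ = contains A t λ _ _ u≢t w≢t u≢w e → clash (view _) (view _) u≢w e (inj₂ (u≢t , w≢t))

      no-B : ∀ {u} → u ∈ Y → B u ≡ false
      no-B u∈ = Bool.¬-not λ Bu → apart (Tri⊆Y s∈) u∈ (proj₁ (toB _ Bu))

      closed : ∀ {x w} → x ∉ Y → w ∉ Y → B x ≡ true → G x w ≡ true → B w ≡ true
      closed {x} {w} x∉ w∉ Bx xw with view w
      ... | in-B Bw = Bw
      ... | in-A Aw = ⊥-elim (true≢false (G-sym xw) (AB Aw Bx))
      ... | at-s refl = contradiction (Tri⊆Y s∈) w∉
      ... | at-t refl = contradiction (Tri⊆Y t∈) w∉

-- Finite facts about C₄, P₄ and C₇, by evaluation.

opp next₄ : Fin 4 → Fin 4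
opp zero                   = suc (suc zero)
opp (suc zero)             = suc (suc (suc zero))
opp (suc (suc zero))       = zero
opp (suc (suc (suc zero))) = suc zero
next₄ zero                   = suc zero
next₄ (suc zero)             = suc (suc zero)
next₄ (suc (suc zero))       = suc (suc (suc zero))
next₄ (suc (suc (suc zero))) = zero

C₄-opposite : ∀ i j → i ≡ j ⊎ Cycle 4 i j ≡ true ⊎ j ≡ opp i
C₄-opposite = toWitness {a? = Fin.all? λ i → Fin.all? λ j → (i ≟ j) ⊎-dec (Cycle 4 i j Bool.≟ true) ⊎-dec (j ≟ opp i)} tt

C₄-next : ∀ i j → Cycle 4 (next₄ i) j ≡ false ⊎ j ≡ i ⊎ j ≡ opp i
C₄-next = toWitness {a? = Fin.all? λ i → Fin.all? λ j → (Cycle 4 (next₄ i) j Bool.≟ false) ⊎-dec (j ≟ i) ⊎-dec (j ≟ opp i)} tt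

C₄-steps : ∀ i → Cycle 4 i (next₄ i) ≡ true × Cycle 4 i (next₄ (opp i)) ≡ true × next₄ (opp i) ≢ next₄ i × next₄ (opp i) ≢ opp i × opp (opp i) ≡ i
C₄-steps = toWitness {a? = Fin.all? λ i → (Cycle 4 i (next₄ i) Bool.≟ true) ×-dec (Cycle 4 i (next₄ (opp i)) Bool.≟ true) ×-dec
  ¬? (next₄ (opp i) ≟ next₄ i) ×-dec ¬? (next₄ (opp i) ≟ opp i) ×-dec (opp (opp i) ≟ i)} tt

C₄-two-edges : ∀ k l i j → Cycle 4 k l ≡ false ⊎ i ≡ k ⊎ i ≡ l ⊎ j ≡ k ⊎ j ≡ l ⊎ i ≡ j ⊎ Cycle 4 i j ≡ true
C₄-two-edges = toWitness {a? = Fin.all? λ k → Fin.all? λ l → Fin.all? λ i → Fin.all? λ j →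
  (Cycle 4 k l Bool.≟ false) ⊎-dec (i ≟ k) ⊎-dec (i ≟ l) ⊎-dec (j ≟ k) ⊎-dec (j ≟ l) ⊎-dec (i ≟ j) ⊎-dec (Cycle 4 i j Bool.≟ true)} tt

C₄-no-triple : ∀ i j k → i ≡ j ⊎ i ≡ k ⊎ j ≡ k ⊎ Cycle 4 i j ≡ true ⊎ Cycle 4 i k ≡ true ⊎ Cycle 4 j k ≡ true
C₄-no-triple = toWitness {a? = Fin.all? λ i → Fin.all? λ j → Fin.all? λ k → (i ≟ j) ⊎-dec (i ≟ k) ⊎-dec (j ≟ k) ⊎-dec
  (Cycle 4 i j Bool.≟ true) ⊎-dec (Cycle 4 i k Bool.≟ true) ⊎-dec (Cycle 4 j k Bool.≟ true)} tt

-- A path on four vertices splits into a non-edge `ij` and an edge `kl` in one way only: its two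
-- ends and its middle edge. Each end then sees exactly one middle vertex.
P₄-middle : ∀ i j k l → PathGraph 4 i j ≡ true ⊎ PathGraph 4 k l ≡ false ⊎ i ≡ j ⊎ i ≡ k ⊎ i ≡ l ⊎ j ≡ k ⊎ j ≡ l ⊎
            (PathGraph 4 i k ≡ not (PathGraph 4 j k) × PathGraph 4 i k ≡ not (PathGraph 4 i l))
P₄-middle = toWitness {a? = Fin.all? λ i → Fin.all? λ j → Fin.all? λ k → Fin.all? λ l →
  (PathGraph 4 i j Bool.≟ true) ⊎-dec (PathGraph 4 k l Bool.≟ false) ⊎-dec (i ≟ j) ⊎-dec (i ≟ k) ⊎-dec (i ≟ l) ⊎-dec (j ≟ k) ⊎-dec (j ≟ l) ⊎-dec
  ((PathGraph 4 i k Bool.≟ not (PathGraph 4 j k)) ×-dec (PathGraph 4 i k Bool.≟ not (PathGraph 4 i l)))} tt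

-- The gaps between three independent vertices of C₇ are 2, 2 and 3, so some vertex `l` has both
-- neighbours in the triple. One of them is `i` or `j`, which later shows that `l` itself is not
-- among the unmatched.
C₇-isolated : ∀ i j k → i ≡ j ⊎ i ≡ k ⊎ j ≡ k ⊎ Cycle 7 i j ≡ true ⊎ Cycle 7 i k ≡ true ⊎ Cycle 7 j k ≡ true ⊎
              ∃[ l ] (Cycle 7 l i ∨ Cycle 7 l j ≡ true × (∀ m → Cycle 7 l m ≡ false ⊎ m ≡ i ⊎ m ≡ j ⊎ m ≡ k))
C₇-isolated = toWitness {a? = Fin.all? λ i → Fin.all? λ j → Fin.all? λ k → (i ≟ j) ⊎-dec (i ≟ k) ⊎-dec (j ≟ k) ⊎-dec
  (Cycle 7 i j Bool.≟ true) ⊎-dec (Cycle 7 i k Bool.≟ true) ⊎-dec (Cycle 7 j k Bool.≟ true) ⊎-dec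
  Fin.any? λ l → (Cycle 7 l i ∨ Cycle 7 l j Bool.≟ true) ×-dec Fin.all? λ m → (Cycle 7 l m Bool.≟ false) ⊎-dec (m ≟ i) ⊎-dec (m ≟ j) ⊎-dec (m ≟ k)} tt

degree-two : ∀ {k} → Graph k → Set
degree-two {k} H = ∀ (c x y z : Fin k) → H c x ≡ false ⊎ H c y ≡ false ⊎ H c z ≡ false ⊎ x ≡ y ⊎ x ≡ z ⊎ y ≡ z

C₄-degree : degree-two (Cycle 4)
C₄-degree = toWitness {a? = Fin.all? λ c → Fin.all? λ x → Fin.all? λ y → Fin.all? λ z → (Cycle 4 c x Bool.≟ false) ⊎-dec
  (Cycle 4 c y Bool.≟ false) ⊎-dec (Cycle 4 c z Bool.≟ false) ⊎-dec (x ≟ y) ⊎-dec (x ≟ z) ⊎-dec (y ≟ z)} tt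

C₇-degree : degree-two (Cycle 7)
C₇-degree = toWitness {a? = Fin.all? λ c → Fin.all? λ x → Fin.all? λ y → Fin.all? λ z → (Cycle 7 c x Bool.≟ false) ⊎-dec
  (Cycle 7 c y Bool.≟ false) ⊎-dec (Cycle 7 c z Bool.≟ false) ⊎-dec (x ≟ y) ⊎-dec (x ≟ z) ⊎-dec (y ≟ z)} tt

-- Converse: C₄, complete graphs, C₇ and 𝒢₂₁.

module SmallClasses {n : ℕ} (G : Graph n) (simple : IsSimple G) where

  open Matchings G simple
  open Backward G simple

  module Under {k : ℕ} (H : Graph k) (iso : Iso G H) where

    to : Fin n → Fin k
    to = Inverse.to (proj₁ iso)

    from : Fin k → Fin n
    from = Inverse.from (proj₁ iso)

    to-from : ∀ i → to (from i) ≡ i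
    to-from = Inverse.strictlyInverseˡ (proj₁ iso)

    to-injective : ∀ {x y} → to x ≡ to y → x ≡ y
    to-injective {x} {y} e = trans (sym (Inverse.strictlyInverseʳ (proj₁ iso) x)) (trans (cong from e) (Inverse.strictlyInverseʳ (proj₁ iso) y))

    edge : ∀ {x y} → H (to x) (to y) ≡ true → G x y ≡ true
    edge e = trans (proj₂ iso _ _) e

    edge⁻ : ∀ {x y} → G x y ≡ true → H (to x) (to y) ≡ true
    edge⁻ e = trans (sym (proj₂ iso _ _)) e

    claw-free : degree-two H → ClawFree G
    claw-free deg c x y z (cx , cy , cz , x≢y , x≢z , y≢z , _) with deg (to c) (to x) (to y) (to z)
    ... | inj₁ e = true≢false (edge⁻ cx) e
    ... | inj₂ (inj₁ e) = true≢false (edge⁻ cy) e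
    ... | inj₂ (inj₂ (inj₁ e)) = true≢false (edge⁻ cz) e
    ... | inj₂ (inj₂ (inj₂ (inj₁ e))) = x≢y (to-injective e)
    ... | inj₂ (inj₂ (inj₂ (inj₂ (inj₁ e)))) = x≢z (to-injective e)
    ... | inj₂ (inj₂ (inj₂ (inj₂ (inj₂ e)))) = y≢z (to-injective e)

  complete-case : ∀ {p} → Iso G (Complete p) → ClawFree G × Equimatchable G
  complete-case {p} iso = (λ { c x y z (_ , _ , _ , x≢y , _ , _ , xy , _) → true≢false (adjacent x≢y) xy }) , equimatchable deficiency
    where
    open Under (Complete p) iso

    adjacent : ∀ {x y} → x ≢ y → G x y ≡ true
    adjacent {x} {y} x≢y = edge (go (toℕ (to x) ≡ᵇ toℕ (to y)) refl)
      where
      go : ∀ b → (toℕ (to x) ≡ᵇ toℕ (to y)) ≡ b → not b ≡ true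
      go false _ = refl
      go true  e = contradiction (to-injective (Fin.toℕ-injective (≡ᵇ-sound {toℕ (to x)} e))) x≢y

    deficiency : DeficiencyAtMostOne
    deficiency []          M p es _ = z≤n
    deficiency (_ ∷ [])    M p es _ = s≤s z≤n
    deficiency (x ∷ y ∷ U) M p es ((xy ∷ _) ∷ _) = ⊥-elim (true≢false (adjacent (λ { refl →
      Unique[x∷xs]⇒x∉xs (Unique-++ˡ (x ∷ y ∷ U) (Unique-resp-↭ (↭-sym p) (allFin⁺ n))) (here refl) })) xy)

  -- Two unmatched vertices are opposite corners, and a corner between them has all its neighbours
  -- unmatched.
  C₄-case : Iso G (Cycle 4) → ClawFree G × Equimatchable G
  C₄-case iso = claw-free C₄-degree , equimatchable deficiency
    where
    open Under (Cycle 4) iso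

    deficiency : DeficiencyAtMostOne
    deficiency []          M p es _ = z≤n
    deficiency (_ ∷ [])    M p es _ = s≤s z≤n
    deficiency Y@(x ∷ y ∷ U) M p es ind@((xy ∷ _) ∷ _) with C₄-opposite (to x) (to y)
    ... | inj₁ e = contradiction (to-injective e) λ { refl →
            Unique[x∷xs]⇒x∉xs (Unique-++ˡ Y (Unique-resp-↭ (↭-sym p) (allFin⁺ n))) (here refl) }
    ... | inj₂ (inj₁ e) = ⊥-elim (true≢false (edge e) xy)
    ... | inj₂ (inj₂ e) = ⊥-elim (isolated (M , es , p) w∉ nbrs)
      where
      w : Fin n
      w = from (next₄ (to x))

      xw : G x w ≡ true
      xw = edge (trans (cong (Cycle 4 (to x)) (to-from _)) (proj₁ (C₄-steps (to x))))

      w∉ : w ∉ Y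
      w∉ w∈ = true≢false xw (independent-∈ ind (here refl) w∈)

      nbrs : ∀ {z} → G w z ≡ true → z ∈ Y
      nbrs {z} wz = [ (λ no → ⊥-elim (true≢false (edge⁻ wz) (trans (cong (λ i → Cycle 4 i (to z)) (to-from _)) no)))
        , [ (λ z≡x → here (to-injective z≡x)) , (λ z≡o → there (here (to-injective (trans z≡o (sym e))))) ]′ ]′ (C₄-next (to x) (to z))

  C₇-case : Iso G (Cycle 7) → ClawFree G × Equimatchable G
  C₇-case iso = claw-free C₇-degree , equimatchable (odd-deficiency (cong evenᵇ (↔⇒≡ (proj₁ iso))) none)
    where
    open Under (Cycle 7) iso

    none : ∀ {x y z U} → Rest (x ∷ y ∷ z ∷ U) → Independent (x ∷ y ∷ z ∷ U) → ⊥
    none {x} {y} {z} {U} r ind@((xy ∷ xz ∷ _) ∷ (yz ∷ _) ∷ _) = distinct (Rest-unique r)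
      where
      Isolated : Fin 7 → Set
      Isolated l = Cycle 7 l (to x) ∨ Cycle 7 l (to y) ≡ true × (∀ m → Cycle 7 l m ≡ false ⊎ m ≡ to x ⊎ m ≡ to y ⊎ m ≡ to z)

      lonely : ∃[ l ] Isolated l → ⊥
      lonely (l , touch , nbrs) = isolated r l∉ nbrs'
        where
        l∉ : from l ∉ x ∷ y ∷ z ∷ U
        l∉ l∈ = [ (λ e → true≢false (edge {from l} (trans (cong (λ i → Cycle 7 i (to x)) (to-from l)) e)) (independent-∈ ind l∈ (here refl)))
                , (λ e → true≢false (edge {from l} (trans (cong (λ i → Cycle 7 i (to y)) (to-from l)) e)) (independent-∈ ind l∈ (there (here refl)))) ]′
                (∨-split {Cycle 7 l (to x)} touch)

        nbrs' : ∀ {w} → G (from l) w ≡ true → w ∈ x ∷ y ∷ z ∷ U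
        nbrs' {w} e = [ (λ no → ⊥-elim (true≢false (edge⁻ e) (trans (cong (λ i → Cycle 7 i (to w)) (to-from l)) no)))
          , [ (λ p → here (to-injective p)) , [ (λ p → there (here (to-injective p))) , (λ p → there (there (here (to-injective p)))) ]′ ]′ ]′ (nbrs (to w))

      distinct : Unique (x ∷ y ∷ z ∷ U) → ⊥
      distinct ((x≢y ∷ x≢z ∷ _) ∷ (y≢z ∷ _) ∷ _) =
        [ x≢y ∘ to-injective , [ x≢z ∘ to-injective , [ y≢z ∘ to-injective
        , [ (λ e → true≢false (edge e) xy) , [ (λ e → true≢false (edge e) xz) , [ (λ e → true≢false (edge e) yz)
        , lonely ]′ ]′ ]′ ]′ ]′ ]′ (C₇-isolated (to x) (to y) (to z))

  G21 : InG21 G → ClawFree G × Equimatchable G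
  G21 (V₁ , V₂ , V₁-V₂ , (q , _ , iso₁) , (iso₂@(f , inj , all-in , onto , adj) , same , _ , _ , no₃ , no₄)) =
    claw-free-by φ adjacent , equimatchable (odd-deficiency odd none)
    where
    open Assemble G simple using (Clique)

    v₁ v₂ v₃ v₄ : Fin n
    v₁ = f zero
    v₂ = f (suc zero)
    v₃ = f (suc (suc zero))
    v₄ = f (suc (suc (suc zero)))

    clique₁ : Clique V₁
    clique₁ = iso-clique iso₁

    data View (x : Fin n) : Set where
      in-V₁ : V₁ x ≡ true → View x
      is    : ∀ i → x ≡ f i → View x

    view : ∀ x → View x
    view x with V₁ x in e | V₂ x in e' | V₁-V₂ x
    ... | true  | _    | _ = in-V₁ e
    ... | false | true | _ with onto x e'
    ...   | i , fi = is i (sym fi)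

    V₁-f : ∀ i → V₁ (f i) ≡ false
    V₁-f i = trans (V₁-V₂ (f i)) (cong not (all-in i))

    square : ∀ {i j} → Cycle 4 i j ≡ true → G (f i) (f j) ≡ true
    square e = trans (sym (adj _ _)) e

    square⁻ : ∀ {i j} → G (f i) (f j) ≡ true → Cycle 4 i j ≡ true
    square⁻ e = trans (adj _ _) e

    -- Seen from `V₁`, the clique `V₁` is set against the edge `v₁v₂`; seen from the square, the
    -- edge `v₃v₄` against `v₁`, `v₂` and their common neighbours in `V₁`.
    φ : Fin n → Fin n → Bool
    φ c x = if V₁ c then V₁ x else (⌊ x ≟ v₃ ⌋ ∨ ⌊ x ≟ v₄ ⌋)

    low : ∀ i {x} → V₁ x ≡ true → G (f i) x ≡ true → i ≡ zero ⊎ i ≡ suc zero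
    low zero                   _  _ = inj₁ refl
    low (suc zero)             _  _ = inj₂ refl
    low (suc (suc zero))       Vx e = ⊥-elim (true≢false e (no₃ _ Vx))
    low (suc (suc (suc zero))) Vx e = ⊥-elim (true≢false e (no₄ _ Vx))

    share : ∀ {i j x} → (i ≡ zero ⊎ i ≡ suc zero) → (j ≡ zero ⊎ j ≡ suc zero) → V₁ x ≡ true → G (f i) x ≡ true → G (f j) x ≡ true
    share (inj₁ refl) (inj₁ refl) _  e = e
    share (inj₁ refl) (inj₂ refl) Vx e = trans (sym (same _ Vx)) e
    share (inj₂ refl) (inj₁ refl) Vx e = trans (same _ Vx) e
    share (inj₂ refl) (inj₂ refl) _  e = e

    high : Fin n → Bool
    high x = ⌊ x ≟ v₃ ⌋ ∨ ⌊ x ≟ v₄ ⌋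

    high-f : ∀ i → high (f i) ≡ false → i ≡ zero ⊎ i ≡ suc zero
    high-f zero                   _ = inj₁ refl
    high-f (suc zero)             _ = inj₂ refl
    high-f (suc (suc zero))       e = ⊥-elim (true≢false (∨-true (inj₁ (≟-true {x = v₃} refl))) e)
    high-f (suc (suc (suc zero))) e = ⊥-elim (true≢false (∨-true {⌊ v₄ ≟ v₃ ⌋} (inj₂ (≟-true {x = v₄} refl))) e)

    high-f⁻ : ∀ i → high (f i) ≡ true → i ≡ suc (suc zero) ⊎ i ≡ suc (suc (suc zero))
    high-f⁻ i e with ∨-split {⌊ f i ≟ v₃ ⌋} e
    ... | inj₁ e' = inj₁ (inj (≟-sound e'))
    ... | inj₂ e' = inj₂ (inj (≟-sound e'))

    high-V₁ : ∀ {x} → V₁ x ≡ true → high x ≡ false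
    high-V₁ {x} Vx = ∨-false (≟-false {x = x} {v₃} λ { refl → true≢false Vx (V₁-f _) }) (≟-false {x = x} {v₄} λ { refl → true≢false Vx (V₁-f _) })

    adjacent-low : ∀ {i j} → (i ≡ zero ⊎ i ≡ suc zero) → (j ≡ zero ⊎ j ≡ suc zero) → f i ≢ f j → G (f i) (f j) ≡ true
    adjacent-low (inj₁ refl) (inj₁ refl) ne = contradiction refl ne
    adjacent-low (inj₁ refl) (inj₂ refl) _  = square refl
    adjacent-low (inj₂ refl) (inj₁ refl) _  = square refl
    adjacent-low (inj₂ refl) (inj₂ refl) ne = contradiction refl ne

    adjacent-high : ∀ {i j} → (i ≡ suc (suc zero) ⊎ i ≡ suc (suc (suc zero))) → (j ≡ suc (suc zero) ⊎ j ≡ suc (suc (suc zero))) →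
                    f i ≢ f j → G (f i) (f j) ≡ true
    adjacent-high (inj₁ refl) (inj₁ refl) ne = contradiction refl ne
    adjacent-high (inj₁ refl) (inj₂ refl) _  = square refl
    adjacent-high (inj₂ refl) (inj₁ refl) _  = square refl
    adjacent-high (inj₂ refl) (inj₂ refl) ne = contradiction refl ne

    around : ∀ i {x y} → View x → View y → G (f i) x ≡ true → G (f i) y ≡ true → x ≢ y → high x ≡ high y → G x y ≡ true
    around i (in-V₁ Vx) (in-V₁ Vy) _ _ x≢y _ = clique₁ Vx Vy x≢y
    around i (in-V₁ Vx) (is j refl) ix _ _ e = G-sym (share (low i Vx ix) (high-f j (trans (sym e) (high-V₁ Vx))) Vx ix)
    around i (is j refl) (in-V₁ Vy) _ iy _ e = share (low i Vy iy) (high-f j (trans e (high-V₁ Vy))) Vy iy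
    around i (is j refl) (is k refl) _ _ x≢y e = decide (high (f j)) refl
      where
      decide : ∀ b → high (f j) ≡ b → G (f j) (f k) ≡ true
      decide true  e' = adjacent-high (high-f⁻ j e') (high-f⁻ k (trans (sym e) e')) x≢y
      decide false e' = adjacent-low (high-f j e') (high-f k (trans (sym e) e')) x≢y

    adjacent : ∀ c {x y} → G c x ≡ true → G c y ≡ true → x ≢ y → φ c x ≡ φ c y → G x y ≡ true
    adjacent c {x} {y} cx cy x≢y e with view c
    ... | is i refl = around i (view x) (view y) cx cy x≢y (trans (sym (φ-f x)) (trans e (φ-f y)))
      where
      φ-f : ∀ x → φ (f i) x ≡ high x
      φ-f x = cong (λ b → if b then V₁ x else high x) (V₁-f i)
    ... | in-V₁ Vc = go (view x) (view y) (trans (sym (φ-V x)) (trans e (φ-V y)))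
      where
      φ-V : ∀ x → φ c x ≡ V₁ x
      φ-V x = cong (λ b → if b then V₁ x else high x) Vc
      go : View x → View y → V₁ x ≡ V₁ y → G x y ≡ true
      go (in-V₁ Vx) (in-V₁ Vy) _ = clique₁ Vx Vy x≢y
      go (in-V₁ Vx) (is j refl) e = ⊥-elim (true≢false (trans (sym e) Vx) (V₁-f j))
      go (is j refl) (in-V₁ Vy) e = ⊥-elim (true≢false (trans e Vy) (V₁-f j))
      go (is j refl) (is k refl) _ = adjacent-low (low j Vc (G-sym cx)) (low k Vc (G-sym cy)) x≢y

    odd : evenᵇ n ≡ false
    odd = parity-sum {V₂} {V₁} {λ _ → false} part (cong evenᵇ (iso-count iso₂))
      (trans (cong evenᵇ (iso-count iso₁)) (cong not (evenᵇ-double q))) (cong evenᵇ (countIn-false {X = λ _ → false} (All.tabulate {xs = allFin n} λ _ → refl)))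
      where
      part : ∀ x → Part (V₂ x) (V₁ x) false
      part x with V₁ x | V₂ x | V₁-V₂ x
      ... | _ | true  | refl = inS
      ... | _ | false | refl = inA

    none : ∀ {x y z U} → Rest (x ∷ y ∷ z ∷ U) → Independent (x ∷ y ∷ z ∷ U) → ⊥
    none r ind with Triple.alike r ind V₁
    ... | u , w , u∈ , w∈ , u≢w , e = go (view u) (view w) u∈ w∈ u≢w e
      where
      open Triple r ind

      -- Of the two corners between a pair of opposite ones, one is `v₃` or `v₄` and sees nothing of
      -- `V₁`. With both opposite corners unmatched it has no possible partner.
      top : ∀ i → f i ∈ Y → f (opp i) ∈ Y → ∀ k → (∀ x → V₁ x ≡ true → G (f k) x ≡ false) → next₄ i ≡ k → ⊥
      top i i∈ o∈ k blind refl = isolated r (λ k∈ → apart i∈ k∈ (square (proj₁ (C₄-steps i)))) (λ {w} kw → nbrs (view w) kw)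
        where
        nbrs : ∀ {w} → View w → G (f (next₄ i)) w ≡ true → w ∈ Y
        nbrs (in-V₁ Vw) e = ⊥-elim (true≢false e (blind _ Vw))
        nbrs (is j refl) e with C₄-next i j
        ... | inj₁ e≡ = ⊥-elim (true≢false (square⁻ e) e≡)
        ... | inj₂ (inj₁ refl) = i∈
        ... | inj₂ (inj₂ refl) = o∈

      tops : ∀ i → f i ∈ Y → f (opp i) ∈ Y → ⊥
      tops zero                   i∈ o∈ = top (suc (suc zero)) o∈ i∈ _ no₄ refl
      tops (suc zero)             i∈ o∈ = top (suc zero) i∈ o∈ _ no₃ refl
      tops (suc (suc zero))       i∈ o∈ = top (suc (suc zero)) i∈ o∈ _ no₄ refl
      tops (suc (suc (suc zero))) i∈ o∈ = top (suc zero) o∈ i∈ _ no₃ refl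

      go : ∀ {u w} → View u → View w → u ∈ Tri → w ∈ Tri → u ≢ w → V₁ u ≡ V₁ w → ⊥
      go (in-V₁ Vu) (in-V₁ Vw) u∈ w∈ u≢w _ = apart (Tri⊆Y u∈) (Tri⊆Y w∈) (clique₁ Vu Vw u≢w)
      go (in-V₁ Vu) (is j refl) _ _ _ e = true≢false (trans (sym e) Vu) (V₁-f j)
      go (is i refl) (in-V₁ Vw) _ _ _ e = true≢false (trans e Vw) (V₁-f i)
      go (is i refl) (is j refl) u∈ w∈ u≢w _ with C₄-opposite i j
      ... | inj₁ refl = u≢w refl
      ... | inj₂ (inj₁ e) = apart (Tri⊆Y u∈) (Tri⊆Y w∈) (square e)
      ... | inj₂ (inj₂ refl) = tops i (Tri⊆Y u∈) (Tri⊆Y w∈)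

-- Converse: 𝒢₂₃, 𝒢₃ and 𝒢₁.

module LargeClasses {n : ℕ} (G : Graph n) (simple : IsSimple G) where

  open Matchings G simple
  open Backward G simple
  open Assemble G simple using (Clique; ∉-snoc)

  record PathCut : Set where
    constructor path-cut
    field
      {s t}  : Fin n
      {A B}  : VSet n
      s≢t    : s ≢ t
      st     : G s t ≡ false
      tc     : TwoComponents G (pair s t) A B
      isoA   : InducedIso G A (Complete 2)
      h      : Fin 4 → Fin n
      h-onto : ∀ x → (pair s t ∪ˢ A) x ≡ true → ∃[ i ] h i ≡ x
      h-adj  : ∀ i j → PathGraph 4 i j ≡ G (h i) (h j)
      q      : ℕ
      isoB   : InducedIso G B (Complete (suc (2 * q)))
      cover  : ∀ x → B x ≡ true → (G s x ∨ G t x) ≡ true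

  module FromPathCut (𝒫 : PathCut) where

    open PathCut 𝒫

    private
      g      = proj₁ isoA
      g-inj  = proj₁ (proj₂ isoA)
      g-in   = proj₁ (proj₂ (proj₂ isoA))
      g-onto = proj₁ (proj₂ (proj₂ (proj₂ isoA)))

    cliqueA : Clique A
    cliqueA = iso-clique isoA

    cliqueB : Clique B
    cliqueB = iso-clique isoB

    evenA : evenᵇ (count A) ≡ true
    evenA = cong evenᵇ (iso-count isoA)

    oddB : evenᵇ (count B) ≡ false
    oddB = trans (cong evenᵇ (iso-count isoB)) (cong not (evenᵇ-double q))

    open TwoCut s≢t st tc cliqueA cliqueB evenA oddB

    other : ∀ {a} → A a ≡ true → ∃[ a' ] (A a' ≡ true × a' ≢ a × (∀ {w} → A w ≡ true → w ≡ a ⊎ w ≡ a'))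
    other {a} Aa with g-onto a Aa
    ... | zero , refl = g (suc zero) , g-in _ , (λ e → case g-inj e of λ ()) , λ {w} Aw → back (g-onto w Aw)
      where
      back : ∀ {w} → ∃[ i ] g i ≡ w → w ≡ g zero ⊎ w ≡ g (suc zero)
      back (zero , e)     = inj₁ (sym e)
      back (suc zero , e) = inj₂ (sym e)
    ... | suc zero , refl = g zero , g-in _ , (λ e → case g-inj e of λ ()) , λ {w} Aw → back (g-onto w Aw)
      where
      back : ∀ {w} → ∃[ i ] g i ≡ w → w ≡ g (suc zero) ⊎ w ≡ g zero
      back (zero , e)     = inj₂ (sym e)
      back (suc zero , e) = inj₁ (sym e)

    -- The set `A` is an edge and `s`, `t` are non-adjacent, so by `P₄-middle` the vertices of `A`
    -- are the middle of the path.
    ends-of-path : ∀ {a a'} → A a ≡ true → A a' ≡ true → a' ≢ a → G s a ≡ not (G t a) × G s a ≡ not (G s a') × G t a ≡ not (G t a')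
    ends-of-path {a} {a'} Aa Aa' a'≢a = all-three (h-onto s (∨-true (inj₁ (pair-left s t)))) (h-onto t (∨-true (inj₁ (pair-right s t))))
      (h-onto a (∨-true {pair s t a} (inj₂ Aa))) (h-onto a' (∨-true {pair s t a'} (inj₂ Aa'))) st s≢t Aa Aa' a'≢a A-not-s A-not-t
      where
      two : ∀ i j k l → G (h i) (h j) ≡ false → h i ≢ h j → A (h k) ≡ true → A (h l) ≡ true → h l ≢ h k →
            (∀ {x} → A x ≡ true → x ≢ h i) → (∀ {x} → A x ≡ true → x ≢ h j) →
            G (h i) (h k) ≡ not (G (h j) (h k)) × G (h i) (h k) ≡ not (G (h i) (h l))
      two i j k l ij i≢j Ak Al l≢k ≢i ≢j =
        [ (λ e → ⊥-elim (true≢false (trans (sym (h-adj i j)) e) ij))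
        , [ (λ e → ⊥-elim (true≢false (cliqueA Ak Al (l≢k ∘ sym)) (trans (sym (h-adj k l)) e)))
        , [ (λ e → contradiction (cong h e) i≢j)
        , [ (λ e → contradiction (cong h (sym e)) (≢i Ak))
        , [ (λ e → contradiction (cong h (sym e)) (≢i Al))
        , [ (λ e → contradiction (cong h (sym e)) (≢j Ak))
        , [ (λ e → contradiction (cong h (sym e)) (≢j Al))
        , (λ { (e , e') → trans (sym (h-adj i k)) (trans e (cong not (h-adj j k))) , trans (sym (h-adj i k)) (trans e' (cong not (h-adj i l))) })
        ]′ ]′ ]′ ]′ ]′ ]′ ]′ (P₄-middle i j k l)

      all-three : ∀ {s t a a'} → ∃[ i ] h i ≡ s → ∃[ i ] h i ≡ t → ∃[ i ] h i ≡ a → ∃[ i ] h i ≡ a' →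
                  G s t ≡ false → s ≢ t → A a ≡ true → A a' ≡ true → a' ≢ a → (∀ {x} → A x ≡ true → x ≢ s) → (∀ {x} → A x ≡ true → x ≢ t) →
                  G s a ≡ not (G t a) × G s a ≡ not (G s a') × G t a ≡ not (G t a')
      all-three (i , refl) (j , refl) (k , refl) (l , refl) st s≢t Aa Aa' a'≢a not-s not-t =
        proj₁ from-s , proj₂ from-s , proj₂ (two j i k l (G-sym st) (s≢t ∘ sym) Aa Aa' a'≢a not-t not-s)
        where from-s = two i j k l st s≢t Aa Aa' a'≢a not-s not-t

    one-end : ∀ {a} → A a ≡ true → G s a ≡ not (G t a)
    one-end Aa with other Aa
    ... | a' , Aa' , a'≢a , _ = proj₁ (ends-of-path Aa Aa' a'≢a)

    -- Splits `B` with its two ends into cliques: `s` with its neighbours in `B`, and `t` with the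
    -- others, which `t` must see by `cover`.
    σ : Fin n → Bool
    σ x = ⌊ x ≟ s ⌋ ∨ (B x ∧ G s x)

    φ : Fin n → Fin n → Bool
    φ c x = if B c then σ x else A x

    σ-s : σ s ≡ true
    σ-s = ∨-true (inj₁ (≟-true {x = s} refl))

    σ-t : σ t ≡ false
    σ-t = ∨-false (≟-false (s≢t ∘ sym)) (cong (_∧ G s t) (proj₂ (part-S⁻ (part t) (pair-right s t))))

    σ-B : ∀ {x} → B x ≡ true → σ x ≡ G s x
    σ-B {x} Bx = trans (cong (_∨ (B x ∧ G s x)) (≟-false (B-not-s Bx))) (cong (_∧ G s x) Bx)

    A-s : A s ≡ false
    A-s = proj₁ (part-S⁻ (part s) (pair-left s t))

    A-t : A t ≡ false
    A-t = proj₁ (part-S⁻ (part t) (pair-right s t))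

    t-sees : ∀ {x} → B x ≡ true → G s x ≡ false → G t x ≡ true
    t-sees {x} Bx sx = trans (sym (cong (_∨ G t x) sx)) (cover x Bx)

    adjacent : ∀ c {x y} → G c x ≡ true → G c y ≡ true → x ≢ y → φ c x ≡ φ c y → G x y ≡ true
    adjacent c {x} {y} cx cy x≢y e with B c in Bc
    ... | true = go (view x) (view y)
      where
      go : View x → View y → G x y ≡ true
      go (in-A Ax) _ = ⊥-elim (true≢false (G-sym cx) (AB Ax Bc))
      go _ (in-A Ay) = ⊥-elim (true≢false (G-sym cy) (AB Ay Bc))
      go (at-s refl) (at-s refl) = contradiction refl x≢y
      go (at-s refl) (at-t refl) = ⊥-elim (true≢false (trans (sym e) σ-s) σ-t)
      go (at-t refl) (at-s refl) = ⊥-elim (true≢false (trans e σ-s) σ-t)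
      go (at-t refl) (at-t refl) = contradiction refl x≢y
      go (at-s refl) (in-B By) = trans (sym (σ-B By)) (trans (sym e) σ-s)
      go (at-t refl) (in-B By) = t-sees By (trans (sym (σ-B By)) (trans (sym e) σ-t))
      go (in-B Bx) (at-s refl) = G-sym (trans (sym (σ-B Bx)) (trans e σ-s))
      go (in-B Bx) (at-t refl) = G-sym (t-sees Bx (trans (sym (σ-B Bx)) (trans e σ-t)))
      go (in-B Bx) (in-B By) = cliqueB Bx By x≢y
    ... | false = go (view c) (view x) (view y)
      where
      not-A : ∀ {x} → B x ≡ true → A x ≡ false
      not-A Bx = proj₂ (part-B⁻ (part _) Bx)
      go : View c → View x → View y → G x y ≡ true
      go (in-B Bc') _ _ = ⊥-elim (true≢false Bc' Bc)
      go _ (in-A Ax) (in-A Ay) = cliqueA Ax Ay x≢y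
      go _ (in-B Bx) (in-B By) = cliqueB Bx By x≢y
      go _ (in-A Ax) (at-s refl) = ⊥-elim (true≢false (trans (sym e) Ax) A-s)
      go _ (in-A Ax) (at-t refl) = ⊥-elim (true≢false (trans (sym e) Ax) A-t)
      go _ (in-A Ax) (in-B By) = ⊥-elim (true≢false (trans (sym e) Ax) (not-A By))
      go _ (at-s refl) (in-A Ay) = ⊥-elim (true≢false (trans e Ay) A-s)
      go _ (at-t refl) (in-A Ay) = ⊥-elim (true≢false (trans e Ay) A-t)
      go _ (in-B Bx) (in-A Ay) = ⊥-elim (true≢false (trans e Ay) (not-A Bx))
      go (at-s refl) (at-s refl) _ = ⊥-elim (G-irr cx refl)
      go (at-s refl) (at-t refl) _ = ⊥-elim (true≢false cx st)
      go (at-s refl) _ (at-s refl) = ⊥-elim (G-irr cy refl)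
      go (at-s refl) _ (at-t refl) = ⊥-elim (true≢false cy st)
      go (at-t refl) (at-s refl) _ = ⊥-elim (true≢false (G-sym cx) st)
      go (at-t refl) (at-t refl) _ = ⊥-elim (G-irr cx refl)
      go (at-t refl) _ (at-s refl) = ⊥-elim (true≢false (G-sym cy) st)
      go (at-t refl) _ (at-t refl) = ⊥-elim (G-irr cy refl)
      go (in-A Ac) (in-B Bx) _ = ⊥-elim (true≢false cx (AB Ac Bx))
      go (in-A Ac) _ (in-B By) = ⊥-elim (true≢false cy (AB Ac By))
      go (in-A Ac) (at-s refl) (at-s refl) = contradiction refl x≢y
      go (in-A Ac) (at-s refl) (at-t refl) = ⊥-elim (true≢false (G-sym cx) (trans (one-end Ac) (cong not (G-sym cy))))
      go (in-A Ac) (at-t refl) (at-s refl) = ⊥-elim (true≢false (G-sym cy) (trans (one-end Ac) (cong not (G-sym cx))))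
      go (in-A Ac) (at-t refl) (at-t refl) = contradiction refl x≢y

    none : ∀ {x y z U} → Rest (x ∷ y ∷ z ∷ U) → Independent (x ∷ y ∷ z ∷ U) → ⊥
    none {x} {y} {z} r ind = start
      where
      open Triple r ind

      -- A vertex `b` of the triple in `B`, seen by `p`, keeps `p` out of the triple and the
      -- pigeonhole puts `q` in. The third vertex can only be in `A`; being missed by `q` it is seen
      -- by `p`, and the other vertex of `A` is left with unmatched neighbours only. Stated for `p`,
      -- `q` in either order.
      finish : ∀ {p q b} → (∀ x → Cases p q x) → (∀ {a} → A a ≡ true → G p a ≡ not (G q a)) →
               (∀ {a a'} → A a ≡ true → A a' ≡ true → a' ≢ a → G p a ≡ not (G p a')) → (∀ {a} → A a ≡ true → a ≢ q) → (∀ {a} → B a ≡ true → a ≢ q) →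
               b ∈ Tri → B b ≡ true → G p b ≡ true → ⊥
      finish {p} {q} {b} cases one other-end A≢q B≢q b∈ Bb pb = last (alike (λ u → ⌊ u ≟ q ⌋))
        where
        p∉ : ∀ {u} → u ∈ Tri → u ≢ p
        p∉ u∈ refl = apart (Tri⊆Y u∈) (Tri⊆Y b∈) pb

        B-value : ∀ {u} → A u ≡ true → B u ≡ false
        B-value Au = proj₂ (part-A⁻ (part _) Au)

        q∈ : q ∈ Tri
        q∈ = contains B q λ u∈ w∈ u≢q w≢q u≢w e → go u∈ w∈ (cases _) (cases _) u≢q w≢q u≢w e
          where
          go : ∀ {u w} → u ∈ Tri → w ∈ Tri → Cases p q u → Cases p q w →
               u ≢ q → w ≢ q → u ≢ w → B u ≡ B w → G u w ≡ true
          go u∈ _ (inj₁ u≡p) _ _ _ _ _ = contradiction u≡p (p∉ u∈)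
          go _ w∈ _ (inj₁ w≡p) _ _ _ _ = contradiction w≡p (p∉ w∈)
          go _ _ (inj₂ (inj₁ u≡q)) _ u≢q _ _ _ = contradiction u≡q u≢q
          go _ _ _ (inj₂ (inj₁ w≡q)) _ w≢q _ _ = contradiction w≡q w≢q
          go _ _ (inj₂ (inj₂ (inj₁ Au))) (inj₂ (inj₂ (inj₁ Aw))) _ _ u≢w _ = cliqueA Au Aw u≢w
          go _ _ (inj₂ (inj₂ (inj₂ Bu))) (inj₂ (inj₂ (inj₂ Bw))) _ _ u≢w _ = cliqueB Bu Bw u≢w
          go _ _ (inj₂ (inj₂ (inj₁ Au))) (inj₂ (inj₂ (inj₂ Bw))) _ _ _ e = ⊥-elim (true≢false (trans e Bw) (B-value Au))
          go _ _ (inj₂ (inj₂ (inj₂ Bu))) (inj₂ (inj₂ (inj₁ Aw))) _ _ _ e = ⊥-elim (true≢false (trans (sym e) Bu) (B-value Aw))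

        stuck-at : ∀ {a} → a ∈ Tri → A a ≡ true → ⊥
        stuck-at {a} a∈ Aa with other Aa
        ... | a' , Aa' , a'≢a , only = isolated r (λ a'∈ → apart (Tri⊆Y a∈) a'∈ (cliqueA Aa Aa' (a'≢a ∘ sym))) (λ e → nbrs (cases _) e)
          where
          qa : G q a ≡ false
          qa = Bool.¬-not λ e → apart (Tri⊆Y q∈) (Tri⊆Y a∈) e
          pa : G p a ≡ true
          pa = trans (one Aa) (cong not qa)
          pa' : G p a' ≡ false
          pa' = trans (other-end Aa' Aa (a'≢a ∘ sym)) (cong not pa)
          nbrs : ∀ {w} → Cases p q w → G a' w ≡ true → w ∈ Y
          nbrs (inj₁ refl) e = ⊥-elim (true≢false (G-sym e) pa')
          nbrs (inj₂ (inj₁ refl)) _ = Tri⊆Y q∈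
          nbrs (inj₂ (inj₂ (inj₂ Bw))) e = ⊥-elim (true≢false e (AB Aa' Bw))
          nbrs (inj₂ (inj₂ (inj₁ Aw))) e with only Aw
          ... | inj₁ refl = Tri⊆Y a∈
          ... | inj₂ refl = ⊥-elim (G-irr e refl)

        last : ∃[ u ] ∃[ w ] (u ∈ Tri × w ∈ Tri × u ≢ w × ⌊ u ≟ q ⌋ ≡ ⌊ w ≟ q ⌋) → ⊥
        last (u , w , u∈ , w∈ , u≢w , e) = go (cases u) (cases w)
          where
          go : Cases p q u → Cases p q w → ⊥
          go (inj₁ u≡p) _ = p∉ u∈ u≡p
          go _ (inj₁ w≡p) = p∉ w∈ w≡p
          go (inj₂ (inj₂ (inj₁ Au))) _ = stuck-at u∈ Au
          go _ (inj₂ (inj₂ (inj₁ Aw))) = stuck-at w∈ Aw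
          go (inj₂ (inj₁ u≡q)) (inj₂ (inj₁ w≡q)) = u≢w (trans u≡q (sym w≡q))
          go (inj₂ (inj₁ u≡q)) (inj₂ (inj₂ (inj₂ Bw))) = true≢false (trans (sym e) (≟-true u≡q)) (≟-false (B≢q Bw))
          go (inj₂ (inj₂ (inj₂ Bu))) (inj₂ (inj₁ w≡q)) = true≢false (trans e (≟-true w≡q)) (≟-false (B≢q Bu))
          go (inj₂ (inj₂ (inj₂ Bu))) (inj₂ (inj₂ (inj₂ Bw))) = apart (Tri⊆Y u∈) (Tri⊆Y w∈) (cliqueB Bu Bw u≢w)

      -- Outside `B` only four vertices remain, and they split into two edges: `s` with its
      -- neighbour in `A`, `t` with the other vertex of `A`. Three of the four cannot be
      -- independent.
      κ : Fin n → Bool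
      κ u = ⌊ u ≟ s ⌋ ∨ (A u ∧ G s u)

      no-B : (∀ {u} → u ∈ Tri → B u ≡ true → ⊥) → ⊥
      no-B ¬B with alike κ
      ... | u , w , u∈ , w∈ , u≢w , e = apart (Tri⊆Y u∈) (Tri⊆Y w∈) (go (view u) (view w))
        where
        κ-s : κ s ≡ true
        κ-s = ∨-true (inj₁ (≟-true {x = s} refl))
        κ-t : κ t ≡ false
        κ-t = ∨-false (≟-false (s≢t ∘ sym)) (cong (_∧ G s t) A-t)
        κ-A : ∀ {x} → A x ≡ true → κ x ≡ G s x
        κ-A {x} Ax = trans (cong (_∨ (A x ∧ G s x)) (≟-false (A-not-s Ax))) (cong (_∧ G s x) Ax)
        t-A : ∀ {x} → A x ≡ true → G s x ≡ false → G t x ≡ true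
        t-A {x} Ax sx = trans (sym (Bool.not-involutive (G t x))) (cong not (trans (sym (one-end Ax)) sx))
        go : View u → View w → G u w ≡ true
        go (in-B Bu) _ = ⊥-elim (¬B u∈ Bu)
        go _ (in-B Bw) = ⊥-elim (¬B w∈ Bw)
        go (in-A Au) (in-A Aw) = cliqueA Au Aw u≢w
        go (at-s refl) (at-s refl) = contradiction refl u≢w
        go (at-t refl) (at-t refl) = contradiction refl u≢w
        go (at-s refl) (at-t refl) = ⊥-elim (true≢false (trans (sym e) κ-s) κ-t)
        go (at-t refl) (at-s refl) = ⊥-elim (true≢false (trans e κ-s) κ-t)
        go (at-s refl) (in-A Aw) = trans (sym (κ-A Aw)) (trans (sym e) κ-s)
        go (in-A Au) (at-s refl) = G-sym (trans (sym (κ-A Au)) (trans e κ-s))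
        go (at-t refl) (in-A Aw) = t-A Aw (trans (sym (κ-A Aw)) (trans (sym e) κ-t))
        go (in-A Au) (at-t refl) = G-sym (t-A Au (trans (sym (κ-A Au)) (trans e κ-t)))

      start : ⊥
      start with Any.any? (λ u → B u Bool.≟ true) Tri
      ... | no ¬B = no-B λ u∈ Bu → ¬B (lose u∈ Bu)
      ... | yes B∈ with find B∈
      ...   | b , b∈ , Bb with ∨-split {G s b} (cover b Bb)
      ...     | inj₁ sb = finish (λ x → st-cases (view x)) one-end (λ Aa Aa' ne → proj₁ (proj₂ (ends-of-path Aa Aa' ne))) A-not-t B-not-t b∈ Bb sb
      ...     | inj₂ tb = finish (λ x → ts-cases (view x)) (λ {a} Aa → trans (sym (Bool.not-involutive (G t a))) (cong not (sym (one-end Aa))))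
                  (λ Aa Aa' ne → proj₂ (proj₂ (ends-of-path Aa Aa' ne))) A-not-s B-not-s b∈ Bb tb

    solution : ClawFree G × Equimatchable G
    solution = claw-free-by φ adjacent , equimatchable (odd-deficiency odd none)

  G23 : InG23 G → ClawFree G × Equimatchable G
  G23 (_ , _ , _ , _ , s≢t , st , tc , isoA , (h , _ , _ , h-onto , h-adj) , (q , _ , isoB) , cover) =
    FromPathCut.solution (path-cut s≢t st tc isoA h h-onto h-adj q isoB cover)

  triple-cases : ∀ {s t u x : Fin n} → triple s t u x ≡ true → x ≡ s ⊎ x ≡ t ⊎ x ≡ u
  triple-cases {s} {t} {u} {x} e =
    [ (λ e → inj₁ (≟-sound e)) , (λ e → inj₂ ([ (λ e → inj₁ (≟-sound e)) , (λ e → inj₂ (≟-sound e)) ]′ (∨-split {⌊ x ≟ t ⌋} e))) ]′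
      (∨-split {⌊ x ≟ s ⌋} e)

  record Triad : Set where
    constructor triad
    field
      {s₁ s₂ s₃} : Fin n
      {A A'}     : VSet n
      {q q'}     : ℕ
      {a a'}     : Fin n
      s₁≢s₂      : s₁ ≢ s₂
      s₁≢s₃      : s₁ ≢ s₃
      s₂≢s₃      : s₂ ≢ s₃
      s₁s₂       : G s₁ s₂ ≡ false
      s₁s₃       : G s₁ s₃ ≡ false
      s₂s₃       : G s₂ s₃ ≡ false
      tc         : TwoComponents G (triple s₁ s₂ s₃) A A'
      isoA       : InducedIso G A (Complete (suc (2 * q)))
      isoA'      : InducedIso G A' (Complete (suc (2 * q')))
      Aa         : A a ≡ true
      A'a'       : A' a' ≡ true
      n₁         : ∀ x → G s₁ x ≡ (A x ∨ ⌊ x ≟ a' ⌋)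
      n₂         : ∀ x → G s₂ x ≡ (A' x ∨ ⌊ x ≟ a ⌋)
      n₃         : ∀ x → G s₃ x ≡ ((A x ∨ A' x) ∧ not (⌊ x ≟ a ⌋ ∨ ⌊ x ≟ a' ⌋))

  module FromTriad (𝒯 : Triad) where

    open Triad 𝒯

    cliqueA : Clique A
    cliqueA = iso-clique isoA

    cliqueA' : Clique A'
    cliqueA' = iso-clique isoA'

    part : ∀ x → Part (triple s₁ s₂ s₃ x) (A x) (A' x)
    part = component tc

    apart-A : ∀ {x y} → A x ≡ true → A' y ≡ true → G x y ≡ false
    apart-A = proj₂ (proj₂ (proj₂ (proj₂ (proj₂ (proj₂ tc))))) _ _

    data View (x : Fin n) : Set where
      is₁  : x ≡ s₁ → View x
      is₂  : x ≡ s₂ → View x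
      is₃  : x ≡ s₃ → View x
      in-A  : A x ≡ true → A' x ≡ false → View x
      in-A' : A x ≡ false → A' x ≡ true → View x

    view : ∀ x → View x
    view x = go (part x) refl refl refl
      where
      go : ∀ {p q r} → Part p q r → triple s₁ s₂ s₃ x ≡ p → A x ≡ q → A' x ≡ r → View x
      go inS e _ _  = [ is₁ , [ is₂ , is₃ ]′ ]′ (triple-cases e)
      go inA _ e e' = in-A e e'
      go inB _ e e' = in-A' e e'

    out₁ : A s₁ ≡ false × A' s₁ ≡ false
    out₁ = part-S⁻ (part s₁) (∨-true (inj₁ (≟-true {x = s₁} refl)))

    out₂ : A s₂ ≡ false × A' s₂ ≡ false
    out₂ = part-S⁻ (part s₂) (∨-true {⌊ s₂ ≟ s₁ ⌋} (inj₂ (∨-true (inj₁ (≟-true {x = s₂} refl)))))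

    out₃ : A s₃ ≡ false × A' s₃ ≡ false
    out₃ = part-S⁻ (part s₃) (∨-true {⌊ s₃ ≟ s₁ ⌋} (inj₂ (∨-true {⌊ s₃ ≟ s₂ ⌋} (inj₂ (≟-true {x = s₃} refl)))))

    s₁-A : ∀ {x} → A x ≡ true → G s₁ x ≡ true
    s₁-A {x} Ax = trans (n₁ x) (∨-true (inj₁ Ax))

    s₂-A' : ∀ {x} → A' x ≡ true → G s₂ x ≡ true
    s₂-A' {x} Ax = trans (n₂ x) (∨-true (inj₁ Ax))

    s₁-A' : ∀ {x} → A x ≡ false → G s₁ x ≡ true → x ≡ a'
    s₁-A' {x} Ax e = ≟-sound (trans (sym (trans (n₁ x) (cong (_∨ ⌊ x ≟ a' ⌋) Ax))) e)

    s₂-A : ∀ {x} → A' x ≡ false → G s₂ x ≡ true → x ≡ a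
    s₂-A {x} Ax e = ≟-sound (trans (sym (trans (n₂ x) (cong (_∨ ⌊ x ≟ a ⌋) Ax))) e)

    s₁-a' : G s₁ a' ≡ true
    s₁-a' = trans (n₁ a') (∨-true {A a'} (inj₂ (≟-true {x = a'} refl)))

    s₂-a : G s₂ a ≡ true
    s₂-a = trans (n₂ a) (∨-true {A' a} (inj₂ (≟-true {x = a} refl)))

    s₃-not-a : G s₃ a ≡ false
    s₃-not-a = trans (n₃ a) (trans (cong (λ b → (A a ∨ A' a) ∧ not (b ∨ ⌊ a ≟ a' ⌋)) (≟-true {x = a} refl)) (Bool.∧-zeroʳ _))

    s₃-not-a' : G s₃ a' ≡ false
    s₃-not-a' = trans (n₃ a') (trans (cong (λ b → (A a' ∨ A' a') ∧ not (⌊ a' ≟ a ⌋ ∨ b)) (≟-true {x = a'} refl))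
      (trans (cong (λ b → (A a' ∨ A' a') ∧ not b) (Bool.∨-zeroʳ ⌊ a' ≟ a ⌋)) (Bool.∧-zeroʳ _)))

    s₃-else : ∀ {x} → A x ≡ true ⊎ A' x ≡ true → x ≢ a → x ≢ a' → G s₃ x ≡ true
    s₃-else {x} Ax x≢a x≢a' = trans (n₃ x) (cong₂ (λ b b' → b ∧ not b') (∨-true {A x} Ax) (∨-false (≟-false x≢a) (≟-false x≢a')))

    -- A centre in `A` sees `A` and `s₁`, which form a clique, and at most one of `s₂`, `s₃`,
    -- because only `a` sees `s₂` and `a` misses `s₃`. A centre in `A'` is symmetric, and one among
    -- the `sᵢ` sees only the two cliques.
    φ : Fin n → Fin n → Bool
    φ c x = if A c then (⌊ x ≟ s₃ ⌋ ∨ ⌊ x ≟ s₂ ⌋) else (if A' c then (⌊ x ≟ s₃ ⌋ ∨ ⌊ x ≟ s₁ ⌋) else A x)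

    hi lo : Fin n → Bool
    hi x = ⌊ x ≟ s₃ ⌋ ∨ ⌊ x ≟ s₂ ⌋
    lo x = ⌊ x ≟ s₃ ⌋ ∨ ⌊ x ≟ s₁ ⌋

    hi-low : ∀ {x} → x ≢ s₃ → x ≢ s₂ → hi x ≡ false
    hi-low p q = ∨-false (≟-false p) (≟-false q)

    lo-low : ∀ {x} → x ≢ s₃ → x ≢ s₁ → lo x ≡ false
    lo-low p q = ∨-false (≟-false p) (≟-false q)

    hi₂ : hi s₂ ≡ true
    hi₂ = ∨-true {⌊ s₂ ≟ s₃ ⌋} (inj₂ (≟-true {x = s₂} refl))

    hi₃ : hi s₃ ≡ true
    hi₃ = ∨-true (inj₁ (≟-true {x = s₃} refl))

    lo₁ : lo s₁ ≡ true
    lo₁ = ∨-true {⌊ s₁ ≟ s₃ ⌋} (inj₂ (≟-true {x = s₁} refl))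

    lo₃ : lo s₃ ≡ true
    lo₃ = ∨-true (inj₁ (≟-true {x = s₃} refl))

    ≢₁ : ∀ {x} → A x ≡ true ⊎ A' x ≡ true → x ≢ s₁
    ≢₁ p refl = [ (λ e → true≢false e (proj₁ out₁)) , (λ e → true≢false e (proj₂ out₁)) ]′ p

    ≢₂ : ∀ {x} → A x ≡ true ⊎ A' x ≡ true → x ≢ s₂
    ≢₂ p refl = [ (λ e → true≢false e (proj₁ out₂)) , (λ e → true≢false e (proj₂ out₂)) ]′ p

    ≢₃ : ∀ {x} → A x ≡ true ⊎ A' x ≡ true → x ≢ s₃
    ≢₃ p refl = [ (λ e → true≢false e (proj₁ out₃)) , (λ e → true≢false e (proj₂ out₃)) ]′ p

    conflict₂₃ : ∀ {c} → A c ≡ true → A' c ≡ false → G c s₂ ≡ true → G c s₃ ≡ true → ⊥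
    conflict₂₃ Ac A'c e e' with s₂-A A'c (G-sym e)
    ... | refl = true≢false (G-sym e') s₃-not-a

    conflict₁₃ : ∀ {c} → A c ≡ false → G c s₁ ≡ true → G c s₃ ≡ true → ⊥
    conflict₁₃ Ac e e' with s₁-A' Ac (G-sym e)
    ... | refl = true≢false (G-sym e') s₃-not-a'

    near-A : ∀ {c x y} → A c ≡ true → A' c ≡ false → View x → View y → G c x ≡ true → G c y ≡ true → x ≢ y → hi x ≡ hi y → G x y ≡ true
    near-A Ac A'c (in-A' _ e) _ cx _ _ _ = ⊥-elim (true≢false cx (apart-A Ac e))
    near-A Ac A'c _ (in-A' _ e) _ cy _ _ = ⊥-elim (true≢false cy (apart-A Ac e))
    near-A Ac A'c (in-A Ax _) (in-A Ay _) _ _ x≢y _ = cliqueA Ax Ay x≢y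
    near-A Ac A'c (is₁ refl) (in-A Ay _) _ _ _ _ = s₁-A Ay
    near-A Ac A'c (in-A Ax _) (is₁ refl) _ _ _ _ = G-sym (s₁-A Ax)
    near-A Ac A'c (is₁ refl) (is₁ refl) _ _ x≢y _ = contradiction refl x≢y
    near-A Ac A'c (is₂ refl) (is₂ refl) _ _ x≢y _ = contradiction refl x≢y
    near-A Ac A'c (is₃ refl) (is₃ refl) _ _ x≢y _ = contradiction refl x≢y
    near-A Ac A'c (is₂ refl) (is₃ refl) cx cy _ _ = ⊥-elim (conflict₂₃ Ac A'c cx cy)
    near-A Ac A'c (is₃ refl) (is₂ refl) cx cy _ _ = ⊥-elim (conflict₂₃ Ac A'c cy cx)
    near-A Ac A'c (is₁ refl) (is₂ refl) _ _ _ e = ⊥-elim (true≢false (trans e hi₂) (hi-low s₁≢s₃ s₁≢s₂))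
    near-A Ac A'c (is₁ refl) (is₃ refl) _ _ _ e = ⊥-elim (true≢false (trans e hi₃) (hi-low s₁≢s₃ s₁≢s₂))
    near-A Ac A'c (is₂ refl) (is₁ refl) _ _ _ e = ⊥-elim (true≢false (trans (sym e) hi₂) (hi-low s₁≢s₃ s₁≢s₂))
    near-A Ac A'c (is₃ refl) (is₁ refl) _ _ _ e = ⊥-elim (true≢false (trans (sym e) hi₃) (hi-low s₁≢s₃ s₁≢s₂))
    near-A Ac A'c (in-A Ax _) (is₂ refl) _ _ _ e = ⊥-elim (true≢false (trans e hi₂) (hi-low (≢₃ (inj₁ Ax)) (≢₂ (inj₁ Ax))))
    near-A Ac A'c (in-A Ax _) (is₃ refl) _ _ _ e = ⊥-elim (true≢false (trans e hi₃) (hi-low (≢₃ (inj₁ Ax)) (≢₂ (inj₁ Ax))))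
    near-A Ac A'c (is₂ refl) (in-A Ay _) _ _ _ e = ⊥-elim (true≢false (trans (sym e) hi₂) (hi-low (≢₃ (inj₁ Ay)) (≢₂ (inj₁ Ay))))
    near-A Ac A'c (is₃ refl) (in-A Ay _) _ _ _ e = ⊥-elim (true≢false (trans (sym e) hi₃) (hi-low (≢₃ (inj₁ Ay)) (≢₂ (inj₁ Ay))))

    near-A' : ∀ {c x y} → A c ≡ false → A' c ≡ true → View x → View y → G c x ≡ true → G c y ≡ true → x ≢ y → lo x ≡ lo y → G x y ≡ true
    near-A' Ac A'c (in-A e _) _ cx _ _ _ = ⊥-elim (true≢false (G-sym cx) (apart-A e A'c))
    near-A' Ac A'c _ (in-A e _) _ cy _ _ = ⊥-elim (true≢false (G-sym cy) (apart-A e A'c))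
    near-A' Ac A'c (in-A' _ Ax) (in-A' _ Ay) _ _ x≢y _ = cliqueA' Ax Ay x≢y
    near-A' Ac A'c (is₂ refl) (in-A' _ Ay) _ _ _ _ = s₂-A' Ay
    near-A' Ac A'c (in-A' _ Ax) (is₂ refl) _ _ _ _ = G-sym (s₂-A' Ax)
    near-A' Ac A'c (is₁ refl) (is₁ refl) _ _ x≢y _ = contradiction refl x≢y
    near-A' Ac A'c (is₂ refl) (is₂ refl) _ _ x≢y _ = contradiction refl x≢y
    near-A' Ac A'c (is₃ refl) (is₃ refl) _ _ x≢y _ = contradiction refl x≢y
    near-A' Ac A'c (is₁ refl) (is₃ refl) cx cy _ _ = ⊥-elim (conflict₁₃ Ac cx cy)
    near-A' Ac A'c (is₃ refl) (is₁ refl) cx cy _ _ = ⊥-elim (conflict₁₃ Ac cy cx)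
    near-A' Ac A'c (is₂ refl) (is₁ refl) _ _ _ e = ⊥-elim (true≢false (trans e lo₁) (lo-low s₂≢s₃ (s₁≢s₂ ∘ sym)))
    near-A' Ac A'c (is₂ refl) (is₃ refl) _ _ _ e = ⊥-elim (true≢false (trans e lo₃) (lo-low s₂≢s₃ (s₁≢s₂ ∘ sym)))
    near-A' Ac A'c (is₁ refl) (is₂ refl) _ _ _ e = ⊥-elim (true≢false (trans (sym e) lo₁) (lo-low s₂≢s₃ (s₁≢s₂ ∘ sym)))
    near-A' Ac A'c (is₃ refl) (is₂ refl) _ _ _ e = ⊥-elim (true≢false (trans (sym e) lo₃) (lo-low s₂≢s₃ (s₁≢s₂ ∘ sym)))
    near-A' Ac A'c (in-A' _ Ax) (is₁ refl) _ _ _ e = ⊥-elim (true≢false (trans e lo₁) (lo-low (≢₃ (inj₂ Ax)) (≢₁ (inj₂ Ax))))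
    near-A' Ac A'c (in-A' _ Ax) (is₃ refl) _ _ _ e = ⊥-elim (true≢false (trans e lo₃) (lo-low (≢₃ (inj₂ Ax)) (≢₁ (inj₂ Ax))))
    near-A' Ac A'c (is₁ refl) (in-A' _ Ay) _ _ _ e = ⊥-elim (true≢false (trans (sym e) lo₁) (lo-low (≢₃ (inj₂ Ay)) (≢₁ (inj₂ Ay))))
    near-A' Ac A'c (is₃ refl) (in-A' _ Ay) _ _ _ e = ⊥-elim (true≢false (trans (sym e) lo₃) (lo-low (≢₃ (inj₂ Ay)) (≢₁ (inj₂ Ay))))

    S-independent : ∀ {c x} → (c ≡ s₁ ⊎ c ≡ s₂ ⊎ c ≡ s₃) → (x ≡ s₁ ⊎ x ≡ s₂ ⊎ x ≡ s₃) → G c x ≡ false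
    S-independent (inj₁ refl) (inj₁ refl) = proj₂ simple s₁
    S-independent (inj₁ refl) (inj₂ (inj₁ refl)) = s₁s₂
    S-independent (inj₁ refl) (inj₂ (inj₂ refl)) = s₁s₃
    S-independent (inj₂ (inj₁ refl)) (inj₁ refl) = G-sym s₁s₂
    S-independent (inj₂ (inj₁ refl)) (inj₂ (inj₁ refl)) = proj₂ simple s₂
    S-independent (inj₂ (inj₁ refl)) (inj₂ (inj₂ refl)) = s₂s₃
    S-independent (inj₂ (inj₂ refl)) (inj₁ refl) = G-sym s₁s₃
    S-independent (inj₂ (inj₂ refl)) (inj₂ (inj₁ refl)) = G-sym s₂s₃
    S-independent (inj₂ (inj₂ refl)) (inj₂ (inj₂ refl)) = proj₂ simple s₃

    near-S : ∀ {c x y} → (c ≡ s₁ ⊎ c ≡ s₂ ⊎ c ≡ s₃) → View x → View y → G c x ≡ true → G c y ≡ true → x ≢ y → A x ≡ A y → G x y ≡ true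
    near-S S (is₁ e) _ cx _ _ _ = ⊥-elim (true≢false cx (S-independent S (inj₁ e)))
    near-S S (is₂ e) _ cx _ _ _ = ⊥-elim (true≢false cx (S-independent S (inj₂ (inj₁ e))))
    near-S S (is₃ e) _ cx _ _ _ = ⊥-elim (true≢false cx (S-independent S (inj₂ (inj₂ e))))
    near-S S _ (is₁ e) _ cy _ _ = ⊥-elim (true≢false cy (S-independent S (inj₁ e)))
    near-S S _ (is₂ e) _ cy _ _ = ⊥-elim (true≢false cy (S-independent S (inj₂ (inj₁ e))))
    near-S S _ (is₃ e) _ cy _ _ = ⊥-elim (true≢false cy (S-independent S (inj₂ (inj₂ e))))
    near-S S (in-A Ax _) (in-A Ay _) _ _ x≢y _ = cliqueA Ax Ay x≢y
    near-S S (in-A' _ Ax) (in-A' _ Ay) _ _ x≢y _ = cliqueA' Ax Ay x≢y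
    near-S S (in-A Ax _) (in-A' Ay _) _ _ _ e = ⊥-elim (true≢false (trans (sym e) Ax) Ay)
    near-S S (in-A' Ax _) (in-A Ay _) _ _ _ e = ⊥-elim (true≢false (trans e Ay) Ax)

    adjacent : ∀ c {x y} → G c x ≡ true → G c y ≡ true → x ≢ y → φ c x ≡ φ c y → G x y ≡ true
    adjacent c {x} {y} cx cy x≢y e = go (view c)
      where
      outer : ∀ {b b'} → A c ≡ b → A' c ≡ b' → (if b then hi x else (if b' then lo x else A x)) ≡ (if b then hi y else (if b' then lo y else A y))
      outer refl refl = e
      go : View c → G x y ≡ true
      go (in-A Ac A'c)  = near-A Ac A'c (view x) (view y) cx cy x≢y (outer Ac A'c)
      go (in-A' Ac A'c) = near-A' Ac A'c (view x) (view y) cx cy x≢y (outer Ac A'c)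
      go (is₁ c≡) = near-S (inj₁ c≡) (view x) (view y) cx cy x≢y
        (outer (trans (cong A c≡) (proj₁ out₁)) (trans (cong A' c≡) (proj₂ out₁)))
      go (is₂ c≡) = near-S (inj₂ (inj₁ c≡)) (view x) (view y) cx cy x≢y
        (outer (trans (cong A c≡) (proj₁ out₂)) (trans (cong A' c≡) (proj₂ out₂)))
      go (is₃ c≡) = near-S (inj₂ (inj₂ c≡)) (view x) (view y) cx cy x≢y
        (outer (trans (cong A c≡) (proj₁ out₃)) (trans (cong A' c≡) (proj₂ out₃)))

    oddA : evenᵇ (count A) ≡ false
    oddA = trans (cong evenᵇ (iso-count isoA)) (cong not (evenᵇ-double q))

    odd : evenᵇ n ≡ false
    odd = parity-sum part (cong evenᵇ (count-list (s₁ ∷ s₂ ∷ s₃ ∷ []) ((s₁≢s₂ ∷ s₁≢s₃ ∷ []) ∷ (s₂≢s₃ ∷ []) ∷ [] ∷ [])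
        (∨-true (inj₁ (≟-true {x = s₁} refl)) ∷ ∨-true {⌊ s₂ ≟ s₁ ⌋} (inj₂ (∨-true (inj₁ (≟-true {x = s₂} refl)))) ∷
         ∨-true {⌊ s₃ ≟ s₁ ⌋} (inj₂ (∨-true {⌊ s₃ ≟ s₂ ⌋} (inj₂ (≟-true {x = s₃} refl)))) ∷ [])
        (λ e → [ here , [ (λ e → there (here e)) , (λ e → there (there (here e))) ]′ ]′ (triple-cases e))))
      oddA (trans (cong evenᵇ (iso-count isoA')) (cong not (evenᵇ-double q')))

    -- The triple contains `s₃`, so the only vertices of the cliques that can be unmatched are `a`
    -- and `a'`. If `s₁` and `s₂` are both in it, the odd clique `A` is closed; if just one is, no
    -- third vertex is possible; if neither is, the triple is `s₃`, `a`, `a'`.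
    none : ∀ {x y z U} → Rest (x ∷ y ∷ z ∷ U) → Independent (x ∷ y ∷ z ∷ U) → ⊥
    none r ind = cases (Any.any? (s₁ ≟_) Tri) (Any.any? (s₂ ≟_) Tri)
      where
      open Triple r ind

      κ : Fin n → Bool
      κ u = A u ∨ ⌊ u ≟ s₁ ⌋

      κ-false : ∀ {u} → A u ≡ false → u ≢ s₁ → κ u ≡ false
      κ-false Au u≢ = ∨-false Au (≟-false u≢)

      κ-true : κ s₁ ≡ true
      κ-true = ∨-true {A s₁} (inj₂ (≟-true {x = s₁} refl))

      s₃∈ : s₃ ∈ Tri
      s₃∈ = contains κ s₃ λ _ _ u≢ w≢ u≢w e → go (view _) (view _) u≢ w≢ u≢w e
        where
        go : ∀ {u w} → View u → View w → u ≢ s₃ → w ≢ s₃ → u ≢ w → κ u ≡ κ w → G u w ≡ true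
        go (is₃ e) _ u≢ _ _ _ = contradiction e u≢
        go _ (is₃ e) _ w≢ _ _ = contradiction e w≢
        go (is₁ refl) (is₁ refl) _ _ u≢w _ = contradiction refl u≢w
        go (is₂ refl) (is₂ refl) _ _ u≢w _ = contradiction refl u≢w
        go (in-A Au _) (in-A Aw _) _ _ u≢w _ = cliqueA Au Aw u≢w
        go (in-A' _ Au) (in-A' _ Aw) _ _ u≢w _ = cliqueA' Au Aw u≢w
        go (is₁ refl) (in-A Aw _) _ _ _ _ = s₁-A Aw
        go (in-A Au _) (is₁ refl) _ _ _ _ = G-sym (s₁-A Au)
        go (is₂ refl) (in-A' _ Aw) _ _ _ _ = s₂-A' Aw
        go (in-A' _ Au) (is₂ refl) _ _ _ _ = G-sym (s₂-A' Au)
        go (is₁ refl) (is₂ refl) _ _ _ e = ⊥-elim (true≢false (trans (sym e) κ-true) (κ-false (proj₁ out₂) (s₁≢s₂ ∘ sym)))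
        go (is₂ refl) (is₁ refl) _ _ _ e = ⊥-elim (true≢false (trans e κ-true) (κ-false (proj₁ out₂) (s₁≢s₂ ∘ sym)))
        go (is₁ refl) (in-A' Aw A'w) _ _ _ e = ⊥-elim (true≢false (trans (sym e) κ-true) (κ-false Aw (≢₁ (inj₂ A'w))))
        go (in-A' Au A'u) (is₁ refl) _ _ _ e = ⊥-elim (true≢false (trans e κ-true) (κ-false Au (≢₁ (inj₂ A'u))))
        go (in-A Au _) (is₂ refl) _ _ _ e = ⊥-elim (true≢false (trans (sym e) (∨-true (inj₁ Au))) (κ-false (proj₁ out₂) (s₁≢s₂ ∘ sym)))
        go (is₂ refl) (in-A Aw _) _ _ _ e = ⊥-elim (true≢false (trans e (∨-true (inj₁ Aw))) (κ-false (proj₁ out₂) (s₁≢s₂ ∘ sym)))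
        go (in-A Au _) (in-A' Aw A'w) _ _ _ e = ⊥-elim (true≢false (trans (sym e) (∨-true (inj₁ Au))) (κ-false Aw (≢₁ (inj₂ A'w))))
        go (in-A' Au A'u) (in-A Aw _) _ _ _ e = ⊥-elim (true≢false (trans e (∨-true (inj₁ Aw))) (κ-false Au (≢₁ (inj₂ A'u))))

      not-in-Y : ∀ {s u} → s ∈ Tri → G s u ≡ true → u ∉ Y
      not-in-Y s∈ su u∈ = apart (Tri⊆Y s∈) u∈ su

      only-a : ∀ {u} → u ∈ Y → A u ≡ true → A' u ≡ false → u ≡ a
      only-a {u} u∈ Au A'u with u ≟ a
      ... | yes e = e
      ... | no ne = contradiction u∈ (not-in-Y s₃∈ (s₃-else (inj₁ Au) ne λ { refl → true≢false A'a' A'u }))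

      only-a' : ∀ {u} → u ∈ Y → A u ≡ false → A' u ≡ true → u ≡ a'
      only-a' {u} u∈ Au A'u with u ≟ a'
      ... | yes e = e
      ... | no ne = contradiction u∈ (not-in-Y s₃∈ (s₃-else (inj₂ A'u) (λ { refl → true≢false Aa Au }) ne))

      off : ∀ {s} → (u w : Fin n) → u ≢ w → ⌊ u ≟ s ⌋ ≡ ⌊ w ≟ s ⌋ → u ≢ s × w ≢ s
      off {s} u w u≢w e = (λ u≡s → u≢w (trans u≡s (sym (≟-sound (trans (sym e) (≟-true u≡s)))))) ,
                          (λ w≡s → u≢w (trans (≟-sound (trans e (≟-true w≡s))) (sym w≡s)))

      all-S : s₁ ∈ Tri → s₂ ∈ Tri → ⊥
      all-S s₁∈ s₂∈ = true≢false (trans (closed-parity A r closed) (cong evenᵇ (countIn-false {X = A} (All.tabulate no-A)))) oddA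
        where
        no-A : ∀ {u} → u ∈ Y → A u ≡ false
        no-A u∈ = Bool.¬-not λ Au → not-in-Y s₁∈ (s₁-A Au) u∈
        closed : ∀ {x w} → x ∉ Y → w ∉ Y → A x ≡ true → G x w ≡ true → A w ≡ true
        closed {x} {w} _ w∉ Ax xw = go (view w)
          where
          go : View w → A w ≡ true
          go (in-A Aw _) = Aw
          go (in-A' _ A'w) = ⊥-elim (true≢false xw (apart-A Ax A'w))
          go (is₁ refl) = contradiction (Tri⊆Y s₁∈) w∉
          go (is₂ refl) = contradiction (Tri⊆Y s₂∈) w∉
          go (is₃ refl) = contradiction (Tri⊆Y s₃∈) w∉

      one-S₁ : s₁ ∈ Tri → s₂ ∉ Tri → ⊥
      one-S₁ s₁∈ s₂∉ with alike (λ u → ⌊ u ≟ s₁ ⌋)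
      ... | u , w , u∈ , w∈ , u≢w , e = u≢w (trans (must u∈ (proj₁ (off u w u≢w e)) (view u)) (sym (must w∈ (proj₂ (off u w u≢w e)) (view w))))
        where
        must : ∀ {u} → u ∈ Tri → u ≢ s₁ → View u → u ≡ s₃
        must _ u≢ (is₁ e) = contradiction e u≢
        must u∈ _ (is₂ refl) = contradiction u∈ s₂∉
        must _ _ (is₃ e) = e
        must u∈ _ (in-A Au _) = contradiction (Tri⊆Y u∈) (not-in-Y s₁∈ (s₁-A Au))
        must u∈ _ (in-A' Au A'u) with only-a' (Tri⊆Y u∈) Au A'u
        ... | refl = contradiction (Tri⊆Y u∈) (not-in-Y s₁∈ s₁-a')

      one-S₂ : s₂ ∈ Tri → s₁ ∉ Tri → ⊥
      one-S₂ s₂∈ s₁∉ with alike (λ u → ⌊ u ≟ s₂ ⌋)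
      ... | u , w , u∈ , w∈ , u≢w , e = u≢w (trans (must u∈ (proj₁ (off u w u≢w e)) (view u)) (sym (must w∈ (proj₂ (off u w u≢w e)) (view w))))
        where
        must : ∀ {u} → u ∈ Tri → u ≢ s₂ → View u → u ≡ s₃
        must u∈ _ (is₁ refl) = contradiction u∈ s₁∉
        must _ u≢ (is₂ e) = contradiction e u≢
        must _ _ (is₃ e) = e
        must u∈ _ (in-A' _ A'u) = contradiction (Tri⊆Y u∈) (not-in-Y s₂∈ (s₂-A' A'u))
        must u∈ _ (in-A Au A'u) with only-a (Tri⊆Y u∈) Au A'u
        ... | refl = contradiction (Tri⊆Y u∈) (not-in-Y s₂∈ s₂-a)

      both-a : a ∈ Tri → a' ∈ Tri → ⊥
      both-a a∈ a'∈ = true≢false (trans (closed-parity X r closed) (cong evenᵇ (countIn-false {X = X} (All.tabulate no-X)))) oddX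
        where
        -- `X` replaces `a` by `s₁` in `A` and so stays odd. Its edges lead out only to `a`, `a'`
        -- and `s₃`, all unmatched: `s₂` sees no vertex of `A` except `a`. A closed set of odd size
        -- without unmatched vertices is impossible.
        K X : VSet n
        K x = A x ∧ not ⌊ x ≟ a ⌋
        X x = K x ∨ ⌊ x ≟ s₁ ⌋

        K-true : ∀ {x} → A x ≡ true → x ≢ a → K x ≡ true
        K-true Ax x≢a = cong₂ (λ b b' → b ∧ not b') Ax (≟-false x≢a)

        K-s₁ : K s₁ ≡ false
        K-s₁ = cong (_∧ not ⌊ s₁ ≟ a ⌋) (proj₁ out₁)

        in-K : ∀ {x} → K x ≡ true → A x ≡ true × x ≢ a
        in-K {x} e with ∧-true {A x} e
        ... | Ax , ne = Ax , λ x≡a → true≢false ne (cong not (≟-true x≡a))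

        oddX : evenᵇ (count X) ≡ false
        oddX = trans (cong evenᵇ (trans (count-remove X s₁ (∨-true {K s₁} (inj₂ (≟-true {x = s₁} refl))))
          (trans (cong suc (countIn-cong (λ x → same x (x ≟ s₁)) (allFin n))) (sym (count-remove A a Aa))))) oddA
          where
          countIn-cong : ∀ {P Q : VSet n} → (∀ x → P x ≡ Q x) → ∀ xs → countIn P xs ≡ countIn Q xs
          countIn-cong h []       = refl
          countIn-cong h (x ∷ xs) = cong₂ (λ b k → (if b then 1 else 0) + k) (h x) (countIn-cong h xs)
          same : ∀ x → Dec (x ≡ s₁) → X x ∧ not ⌊ x ≟ s₁ ⌋ ≡ K x
          same x (yes refl) = trans (cong (λ b → X s₁ ∧ not b) (≟-true {x = s₁} refl)) (trans (Bool.∧-zeroʳ _) (sym K-s₁))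
          same x (no x≢s₁)  = trans (cong (λ b → (K x ∨ b) ∧ not b) (≟-false x≢s₁)) (trans (Bool.∧-identityʳ _) (Bool.∨-identityʳ _))

        no-X : ∀ {u} → u ∈ Y → X u ≡ false
        no-X {u} u∈ = Bool.¬-not λ e → [ (λ Ku → proj₂ (in-K Ku) (a-only (proj₁ (in-K Ku)))) , (λ u≡ → s₁-out (≟-sound u≡)) ]′ (∨-split {K u} e)
          where
          a-only : A u ≡ true → u ≡ a
          a-only Au = only-a u∈ Au (proj₂ (part-A⁻ (part u) Au))
          s₁-out : u ≢ s₁
          s₁-out refl = not-in-Y a∈ (G-sym (s₁-A Aa)) u∈

        closed : ∀ {x w} → x ∉ Y → w ∉ Y → X x ≡ true → G x w ≡ true → X w ≡ true
        closed {x} {w} x∉ w∉ Xx xw = [ (λ Kx → from-K (in-K Kx) (view w)) , (λ x≡ → from-s₁ (≟-sound x≡) (view w)) ]′ (∨-split {K x} Xx)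
          where
          to-K : A w ≡ true → X w ≡ true
          to-K Aw = ∨-true (inj₁ (K-true Aw λ { refl → w∉ (Tri⊆Y a∈) }))
          from-K : A x ≡ true × x ≢ a → View w → X w ≡ true
          from-K _ (is₁ refl) = ∨-true {K s₁} (inj₂ (≟-true {x = s₁} refl))
          from-K (Ax , x≢a) (is₂ refl) = contradiction (s₂-A (proj₂ (part-A⁻ (part x) Ax)) (G-sym xw)) x≢a
          from-K _ (is₃ refl) = contradiction (Tri⊆Y s₃∈) w∉
          from-K _ (in-A Aw _) = to-K Aw
          from-K (Ax , _) (in-A' _ A'w) = ⊥-elim (true≢false xw (apart-A Ax A'w))
          from-s₁ : x ≡ s₁ → View w → X w ≡ true
          from-s₁ refl (is₁ refl) = ⊥-elim (G-irr xw refl)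
          from-s₁ refl (is₂ refl) = ⊥-elim (true≢false xw s₁s₂)
          from-s₁ refl (is₃ refl) = contradiction (Tri⊆Y s₃∈) w∉
          from-s₁ refl (in-A Aw _) = to-K Aw
          from-s₁ refl (in-A' Aw _) with s₁-A' Aw xw
          ... | refl = contradiction (Tri⊆Y a'∈) w∉

      no-S : s₁ ∉ Tri → s₂ ∉ Tri → ⊥
      no-S s₁∉ s₂∉ with alike (λ u → ⌊ u ≟ s₃ ⌋)
      ... | u , w , u∈ , w∈ , u≢w , e = go (which u∈ (proj₁ (off u w u≢w e)) (view u)) (which w∈ (proj₂ (off u w u≢w e)) (view w))
        where
        which : ∀ {u} → u ∈ Tri → u ≢ s₃ → View u → u ≡ a ⊎ u ≡ a'
        which u∈ _ (is₁ refl) = contradiction u∈ s₁∉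
        which u∈ _ (is₂ refl) = contradiction u∈ s₂∉
        which _ u≢ (is₃ e) = contradiction e u≢
        which u∈ _ (in-A Au A'u) = inj₁ (only-a (Tri⊆Y u∈) Au A'u)
        which u∈ _ (in-A' Au A'u) = inj₂ (only-a' (Tri⊆Y u∈) Au A'u)
        go : u ≡ a ⊎ u ≡ a' → w ≡ a ⊎ w ≡ a' → ⊥
        go (inj₁ p) (inj₁ q) = u≢w (trans p (sym q))
        go (inj₂ p) (inj₂ q) = u≢w (trans p (sym q))
        go (inj₁ refl) (inj₂ refl) = both-a u∈ w∈
        go (inj₂ refl) (inj₁ refl) = both-a w∈ u∈

      cases : Dec (s₁ ∈ Tri) → Dec (s₂ ∈ Tri) → ⊥
      cases (yes p) (yes q) = all-S p q
      cases (yes p) (no q)  = one-S₁ p q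
      cases (no p)  (yes q) = one-S₂ q p
      cases (no p)  (no q)  = no-S p q

    solution : ClawFree G × Equimatchable G
    solution = claw-free-by φ adjacent , equimatchable (odd-deficiency odd none)

  G3 : InG3 G → ClawFree G × Equimatchable G
  G3 (_ , _ , _ , _ , _ , s₁≢s₂ , s₁≢s₃ , s₂≢s₃ , s₁s₂ , s₁s₃ , s₂s₃ , tc , (q , _ , isoA) , (q' , _ , isoA') , _ , _ , Aa , A'a' , n₁ , n₂ , n₃) =
    FromTriad.solution (triad {q = q} {q'} s₁≢s₂ s₁≢s₃ s₂≢s₃ s₁s₂ s₁s₃ s₂s₃ tc isoA isoA' Aa A'a' n₁ n₂ n₃)

  module CutSide {v : Fin n} {X : VSet n} (Xv : X v ≡ false)
                 (near : ∀ {x w} → X x ≡ true → G x w ≡ true → w ≡ v ⊎ X w ≡ true) where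

    X≢v : ∀ {x} → X x ≡ true → x ≢ v
    X≢v Xx refl = true≢false Xx Xv

    even : G1Part G v X → evenᵇ (count X) ≡ true
    even (inj₁ (p , iso)) = trans (cong evenᵇ (iso-count iso)) (evenᵇ-double p)
    even (inj₂ (iso , _)) = cong evenᵇ (iso-count iso)

    hub : G1Part G v X → ∀ {x y} → X x ≡ true → X y ≡ true → G v x ≡ true → G v y ≡ true → x ≢ y → G x y ≡ true
    hub (inj₁ (_ , iso)) Xx Xy _ _ x≢y = iso-clique iso Xx Xy x≢y
    hub (inj₂ (_ , a , b , _ , _ , _ , ab , only , _)) Xx Xy vx vy x≢y = go (only _ Xx vx) (only _ Xy vy)
      where
      go : _ → _ → _
      go (inj₁ refl) (inj₁ refl) = contradiction refl x≢y
      go (inj₁ refl) (inj₂ refl) = ab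
      go (inj₂ refl) (inj₁ refl) = G-sym ab
      go (inj₂ refl) (inj₂ refl) = contradiction refl x≢y

    -- The colouring for a centre inside the side: `v` against a complete side, or the triangle of
    -- `v`, `a`, `b` against the opposite edge of a C₄.
    ψ : G1Part G v X → Fin n → Bool
    ψ (inj₁ _)               x = ⌊ x ≟ v ⌋
    ψ (inj₂ (_ , a , b , _)) x = ⌊ x ≟ v ⌋ ∨ (⌊ x ≟ a ⌋ ∨ ⌊ x ≟ b ⌋)

    local : (P : G1Part G v X) → ∀ {c x y} → X c ≡ true → G c x ≡ true → G c y ≡ true → x ≢ y → ψ P x ≡ ψ P y → G x y ≡ true
    local (inj₁ (_ , iso)) Xc cx cy x≢y e = go (near Xc cx) (near Xc cy)
      where
      go : _ → _ → _
      go (inj₁ refl) (inj₁ refl) = contradiction refl x≢y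
      go (inj₁ refl) (inj₂ Xy)   = ⊥-elim (true≢false (trans (sym e) (≟-true {x = v} refl)) (≟-false (X≢v Xy)))
      go (inj₂ Xx)   (inj₁ refl) = ⊥-elim (true≢false (trans e (≟-true {x = v} refl)) (≟-false (X≢v Xx)))
      go (inj₂ Xx)   (inj₂ Xy)   = iso-clique iso Xx Xy x≢y
    local P@(inj₂ ((f , f-inj , f-in , f-onto , f-adj) , a , b , a≢b , Xa , Xb , ab , only , va , vb)) Xc cx cy x≢y e =
      go (place (near Xc cx)) (place (near Xc cy)) x≢y e
      where
      data Place (x : Fin n) : Set where
        is-v : x ≡ v → Place x
        is-a : x ≡ a → Place x
        is-b : x ≡ b → Place x
        rest : X x ≡ true → x ≢ a → x ≢ b → Place x

      place : ∀ {x} → x ≡ v ⊎ X x ≡ true → Place x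
      place (inj₁ x≡v) = is-v x≡v
      place {x} (inj₂ Xx) with x ≟ a | x ≟ b
      ... | yes x≡a | _       = is-a x≡a
      ... | no _    | yes x≡b = is-b x≡b
      ... | no x≢a  | no x≢b  = rest Xx x≢a x≢b

      ψ-v : ψ P v ≡ true
      ψ-v = ∨-true (inj₁ (≟-true {x = v} refl))

      ψ-a : ψ P a ≡ true
      ψ-a = ∨-true {⌊ a ≟ v ⌋} (inj₂ (∨-true (inj₁ (≟-true {x = a} refl))))

      ψ-b : ψ P b ≡ true
      ψ-b = ∨-true {⌊ b ≟ v ⌋} (inj₂ (∨-true {⌊ b ≟ a ⌋} (inj₂ (≟-true {x = b} refl))))

      ψ-rest : ∀ {x} → X x ≡ true → x ≢ a → x ≢ b → ψ P x ≡ false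
      ψ-rest Xx x≢a x≢b = ∨-false (≟-false (X≢v Xx)) (∨-false (≟-false x≢a) (≟-false x≢b))

      opposite-edge : ∀ {x y} → X x ≡ true → x ≢ a → x ≢ b → X y ≡ true → y ≢ a → y ≢ b → x ≢ y → G x y ≡ true
      opposite-edge Xx x≢a x≢b Xy y≢a y≢b x≢y with f-onto _ Xx | f-onto _ Xy | f-onto a Xa | f-onto b Xb
      ... | i , refl | j , refl | k , refl | l , refl =
        [ (λ e → ⊥-elim (true≢false ab (trans (sym (f-adj k l)) e))) , [ (λ e → contradiction (cong f e) x≢a)
        , [ (λ e → contradiction (cong f e) x≢b) , [ (λ e → contradiction (cong f e) y≢a) , [ (λ e → contradiction (cong f e) y≢b)
        , [ (λ e → contradiction (cong f e) x≢y) , (λ e → trans (sym (f-adj i j)) e) ]′ ]′ ]′ ]′ ]′ ]′ (C₄-two-edges k l i j)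

      differ : ∀ {p q : Bool} → p ≡ true → q ≡ false → p ≡ q → ⊥
      differ p q e = true≢false (trans (sym e) p) q

      go : ∀ {x y} → Place x → Place y → x ≢ y → ψ P x ≡ ψ P y → G x y ≡ true
      go (is-v refl) (is-v refl) x≢y _ = contradiction refl x≢y
      go (is-v refl) (is-a refl) _ _ = va
      go (is-v refl) (is-b refl) _ _ = vb
      go (is-a refl) (is-v refl) _ _ = G-sym va
      go (is-a refl) (is-a refl) x≢y _ = contradiction refl x≢y
      go (is-a refl) (is-b refl) _ _ = ab
      go (is-b refl) (is-v refl) _ _ = G-sym vb
      go (is-b refl) (is-a refl) _ _ = G-sym ab
      go (is-b refl) (is-b refl) x≢y _ = contradiction refl x≢y
      go (rest Xx x≢a x≢b) (rest Xy y≢a y≢b) x≢y _ = opposite-edge Xx x≢a x≢b Xy y≢a y≢b x≢y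
      go (is-v refl) (rest Xy y≢a y≢b) _ e = ⊥-elim (differ ψ-v (ψ-rest Xy y≢a y≢b) e)
      go (is-a refl) (rest Xy y≢a y≢b) _ e = ⊥-elim (differ ψ-a (ψ-rest Xy y≢a y≢b) e)
      go (is-b refl) (rest Xy y≢a y≢b) _ e = ⊥-elim (differ ψ-b (ψ-rest Xy y≢a y≢b) e)
      go (rest Xx x≢a x≢b) (is-v refl) _ e = ⊥-elim (differ ψ-v (ψ-rest Xx x≢a x≢b) (sym e))
      go (rest Xx x≢a x≢b) (is-a refl) _ e = ⊥-elim (differ ψ-a (ψ-rest Xx x≢a x≢b) (sym e))
      go (rest Xx x≢a x≢b) (is-b refl) _ e = ⊥-elim (differ ψ-b (ψ-rest Xx x≢a x≢b) (sym e))

    no-triple : G1Part G v X → ∀ {x y z} → X x ≡ true → X y ≡ true → X z ≡ true → x ≢ y → x ≢ z → y ≢ z →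
                (G x y ≡ true → ⊥) → (G x z ≡ true → ⊥) → (G y z ≡ true → ⊥) → ⊥
    no-triple (inj₁ (_ , iso)) Xx Xy _ x≢y _ _ xy _ _ = xy (iso-clique iso Xx Xy x≢y)
    no-triple (inj₂ ((f , _ , _ , f-onto , f-adj) , _)) Xx Xy Xz x≢y x≢z y≢z xy xz yz with f-onto _ Xx | f-onto _ Xy | f-onto _ Xz
    ... | i , refl | j , refl | k , refl = [ x≢y ∘ cong f , [ x≢z ∘ cong f , [ y≢z ∘ cong f
      , [ (λ e → xy (trans (sym (f-adj i j)) e)) , [ (λ e → xz (trans (sym (f-adj i k)) e)) , (λ e → yz (trans (sym (f-adj j k)) e)) ]′ ]′ ]′ ]′ ]′ (C₄-no-triple i j k)

    -- With `v` listed, the side has to be matched within itself. A complete even side with exactly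
    -- one listed vertex has the wrong parity. In a C₄ a neighbouring corner must take the opposite
    -- corner as partner, or finds it listed already, and then some corner has no partner left.
    perfect : (P : G1Part G v X) → ∀ {Y} → Rest Y → v ∈ Y →
              (∀ {p q} → p ∈ Y → q ∈ Y → X p ≡ true → X q ≡ true → G p q ≡ true → ⊥) → ∀ {u} → u ∈ Y → X u ≡ true → ⊥
    perfect P@(inj₁ (_ , iso)) {Y} r v∈ apart {u} u∈ Xu with ∈⇒↭ u∈
    ... | Y' , p = true≢false (even P) (trans (closed-parity X r closed) (cong evenᵇ one))
      where
      closed : ∀ {x w} → x ∉ Y → w ∉ Y → X x ≡ true → G x w ≡ true → X w ≡ true
      closed _ w∉ Xx xw = [ (λ { refl → contradiction v∈ w∉ }) , id ]′ (near Xx xw)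
      one : countIn X Y ≡ 1
      one = trans (countIn-↭ X p) (cong₂ (λ b k → (if b then 1 else 0) + k) Xu (countIn-false (All.tabulate λ q∈ → Bool.¬-not λ Xq →
        apart u∈ (∈-resp-↭ (↭-sym p) (there q∈)) Xu Xq (iso-clique iso Xu Xq
          (λ { refl → Unique[x∷xs]⇒x∉xs (Unique-resp-↭ p (Rest-unique r)) q∈ })))))
    perfect (inj₂ ((f , f-inj , f-in , f-onto , f-adj) , _)) {Y} r v∈ apart u∈ Xu with f-onto _ Xu
    ... | i , refl = go (Any.any? (f (opp i) ≟_) Y)
      where
      side : ∀ {j} → Cycle 4 i j ≡ true → f j ∉ Y
      side {j} e j∈ = apart u∈ j∈ Xu (f-in j) (trans (sym (f-adj i j)) e)

      neighbours : ∀ k {w} → G (f (next₄ k)) w ≡ true → w ≡ v ⊎ w ≡ f k ⊎ w ≡ f (opp k)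
      neighbours k {w} e = [ inj₁ , (λ Xw → inj₂ (from-X (f-onto w Xw))) ]′ (near (f-in _) e)
        where
        from-X : ∃[ m ] f m ≡ w → w ≡ f k ⊎ w ≡ f (opp k)
        from-X (m , refl) = [ (λ no → ⊥-elim (true≢false (trans (f-adj _ m) e) no)) , [ inj₁ ∘ cong f , inj₂ ∘ cong f ]′ ]′ (C₄-next k m)

      go : Dec (f (opp i) ∈ Y) → ⊥
      go (yes o∈) = isolated r (side (proj₁ (C₄-steps i))) λ e → [ (λ { refl → v∈ }) , [ (λ { refl → u∈ }) , (λ { refl → o∈ }) ]′ ]′ (neighbours i e)
      go (no o∉) with pull r (f (next₄ i)) (side (proj₁ (C₄-steps i)))
      ... | w , r' , e = isolated r' l∉ λ e' → [ (λ { refl → ∈-++⁺ˡ v∈ }) , [ (λ { refl → o∈' }) , (λ { refl → back∈ }) ]′ ]′ (neighbours (opp i) e')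
        where
        w∉ : w ∉ Y
        w∉ w∈ = Unique-apart Y (Rest-unique r') w∈ (there (here refl))

        w≡ : w ≡ f (opp i)
        w≡ = [ (λ { refl → contradiction v∈ w∉ }) , [ (λ { refl → contradiction u∈ w∉ }) , id ]′ ]′ (neighbours i e)

        o∈' : f (opp i) ∈ Y ++ f (next₄ i) ∷ w ∷ []
        o∈' = ∈-++⁺ʳ Y (there (here (sym w≡)))

        back∈ : f (opp (opp i)) ∈ Y ++ f (next₄ i) ∷ w ∷ []
        back∈ = ∈-++⁺ˡ (subst (λ k → f k ∈ Y) (sym (proj₂ (proj₂ (proj₂ (proj₂ (C₄-steps i)))))) u∈)

        l∉ : f (next₄ (opp i)) ∉ Y ++ f (next₄ i) ∷ w ∷ []
        l∉ = ∉-snoc (side (proj₁ (proj₂ (C₄-steps i)))) (proj₁ (proj₂ (proj₂ (C₄-steps i))) ∘ f-inj)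
          (λ e → proj₁ (proj₂ (proj₂ (proj₂ (C₄-steps i)))) (f-inj (trans e w≡)))

  G1 : InG1 G → ClawFree G × Equimatchable G
  G1 (v , X , X' , tc , P , P' , _) = claw-free-by φ adjacent , equimatchable (odd-deficiency odd none)
    where
    part : ∀ x → Part (singleton v x) (X x) (X' x)
    part = component tc

    X-X' : ∀ {x y} → X x ≡ true → X' y ≡ true → G x y ≡ false
    X-X' = proj₂ (proj₂ (proj₂ (proj₂ (proj₂ (proj₂ tc))))) _ _

    out : X v ≡ false × X' v ≡ false
    out = part-S⁻ (part v) (≟-true {x = v} refl)

    data View (x : Fin n) : Set where
      is-v : x ≡ v → View x
      left : X x ≡ true → X' x ≡ false → View x
      right : X x ≡ false → X' x ≡ true → View x

    view : ∀ x → View x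
    view x = go (part x) refl refl refl
      where
      go : ∀ {p q r} → Part p q r → singleton v x ≡ p → X x ≡ q → X' x ≡ r → View x
      go inS e _ _  = is-v (≟-sound e)
      go inA _ e e' = left e e'
      go inB _ e e' = right e e'

    near : ∀ {x w} → X x ≡ true → G x w ≡ true → w ≡ v ⊎ X w ≡ true
    near {x} {w} Xx xw = go (view w)
      where
      go : View w → w ≡ v ⊎ X w ≡ true
      go (is-v e)    = inj₁ e
      go (left e _)  = inj₂ e
      go (right _ e) = ⊥-elim (true≢false xw (X-X' Xx e))

    near' : ∀ {x w} → X' x ≡ true → G x w ≡ true → w ≡ v ⊎ X' w ≡ true
    near' {x} {w} Xx xw = go (view w)
      where
      go : View w → w ≡ v ⊎ X' w ≡ true
      go (is-v e)    = inj₁ e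
      go (left e _)  = ⊥-elim (true≢false (G-sym xw) (X-X' e Xx))
      go (right _ e) = inj₂ e

    -- At the cut vertex the two sides are the colours, since the neighbours of `v` in either side
    -- form a clique; elsewhere each side uses its own `ψ`.
    φ : Fin n → Fin n → Bool
    φ c x = if ⌊ c ≟ v ⌋ then X x else (if X c then CutSide.ψ (proj₁ out) near P x else CutSide.ψ (proj₂ out) near' P' x)

    adjacent : ∀ c {x y} → G c x ≡ true → G c y ≡ true → x ≢ y → φ c x ≡ φ c y → G x y ≡ true
    adjacent c {x} {y} cx cy x≢y e = go (view c)
      where
      outer : ∀ {b b'} → ⌊ c ≟ v ⌋ ≡ b → X c ≡ b' →
              (if b then X x else (if b' then CutSide.ψ (proj₁ out) near P x else CutSide.ψ (proj₂ out) near' P' x)) ≡ (if b then X y else (if b' then CutSide.ψ (proj₁ out) near P y else CutSide.ψ (proj₂ out) near' P' y))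
      outer refl refl = e
      centre : c ≡ v → X x ≡ X y → View x → View y → G x y ≡ true
      centre refl _ (is-v refl) _ = ⊥-elim (G-irr cx refl)
      centre refl _ _ (is-v refl) = ⊥-elim (G-irr cy refl)
      centre refl _ (left Xx _) (left Xy _) = CutSide.hub (proj₁ out) near P Xx Xy cx cy x≢y
      centre refl _ (right _ Xx) (right _ Xy) = CutSide.hub (proj₂ out) near' P' Xx Xy cx cy x≢y
      centre refl e (left Xx _) (right Xy _) = ⊥-elim (true≢false (trans (sym e) Xx) Xy)
      centre refl e (right Xx _) (left Xy _) = ⊥-elim (true≢false (trans e Xy) Xx)
      go : View c → G x y ≡ true
      go (is-v c≡v)   = centre c≡v (outer (≟-true c≡v) refl) (view x) (view y)
      go (left Xc _)  = CutSide.local (proj₁ out) near P Xc cx cy x≢y (outer (≟-false (CutSide.X≢v (proj₁ out) near Xc)) Xc)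
      go (right Xc X'c) = CutSide.local (proj₂ out) near' P' X'c cx cy x≢y (outer (≟-false (CutSide.X≢v (proj₂ out) near' X'c)) Xc)

    odd : evenᵇ n ≡ false
    odd = parity-sum part (cong evenᵇ (count-list (v ∷ []) ([] ∷ []) (≟-true {x = v} refl ∷ []) (λ e → here (≟-sound e)))) (CutSide.even (proj₁ out) near P) (CutSide.even (proj₂ out) near' P')

    -- If `v` is unmatched, `perfect` excludes any further unmatched vertex. Otherwise `v` is
    -- matched into one side, `perfect` for the other side forces the whole triple into that same
    -- side, and a clique or a C₄ has no independent triple.
    none : ∀ {x y z U} → Rest (x ∷ y ∷ z ∷ U) → Independent (x ∷ y ∷ z ∷ U) → ⊥
    none {x} {y} {z} r ind = go (Any.any? (v ≟_) Y)
      where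
      open Triple r ind

      free : v ∈ Y → ⊥
      free v∈ with alike (λ u → ⌊ u ≟ v ⌋)
      ... | u , w , u∈ , w∈ , u≢w , e = stuck-at u∈ (λ u≡v → u≢w (trans u≡v (sym (≟-sound (trans (sym e) (≟-true u≡v)))))) (view u)
        where
        stuck-at : ∀ {u} → u ∈ Tri → u ≢ v → View u → ⊥
        stuck-at _ u≢v (is-v e) = u≢v e
        stuck-at u∈ _ (left Xu _) = CutSide.perfect (proj₁ out) near P r v∈ (λ p∈ q∈ _ _ → apart p∈ q∈) (Tri⊆Y u∈) Xu
        stuck-at u∈ _ (right _ Xu) = CutSide.perfect (proj₂ out) near' P' r v∈ (λ p∈ q∈ _ _ → apart p∈ q∈) (Tri⊆Y u∈) Xu

      used : v ∉ Y → ∃[ w ] (Rest (Y ++ v ∷ w ∷ []) × G v w ≡ true) → ⊥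
      used v∉ (w , r' , vw) = side (view w)
        where
        v∈' : v ∈ Y ++ v ∷ w ∷ []
        v∈' = ∈-++⁺ʳ Y (here refl)

        back : ∀ {p} → p ∈ Y ++ v ∷ w ∷ [] → p ≢ v → p ≢ w → p ∈ Y
        back p∈ p≢v p≢w with ∈-++⁻ Y p∈
        ... | inj₁ p∈Y               = p∈Y
        ... | inj₂ (here e)          = contradiction e p≢v
        ... | inj₂ (there (here e))  = contradiction e p≢w

        distinct : Unique (x ∷ y ∷ z ∷ []) → (∀ {u} → u ∈ Tri → X u ≡ true) ⊎ (∀ {u} → u ∈ Tri → X' u ≡ true) → ⊥
        distinct ((x≢y ∷ x≢z ∷ []) ∷ (y≢z ∷ []) ∷ _) (inj₁ in-X) = CutSide.no-triple (proj₁ out) near P (in-X (here refl)) (in-X (there (here refl)))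
          (in-X (there (there (here refl)))) x≢y x≢z y≢z (apart (here refl) (there (here refl))) (apart (here refl) (there (there (here refl))))
          (apart (there (here refl)) (there (there (here refl))))
        distinct ((x≢y ∷ x≢z ∷ []) ∷ (y≢z ∷ []) ∷ _) (inj₂ in-X) = CutSide.no-triple (proj₂ out) near' P' (in-X (here refl)) (in-X (there (here refl)))
          (in-X (there (there (here refl)))) x≢y x≢z y≢z (apart (here refl) (there (here refl))) (apart (here refl) (there (there (here refl))))
          (apart (there (here refl)) (there (there (here refl))))

        side : View w → ⊥
        side (is-v refl) = G-irr vw refl
        side (left Xw _) = distinct (Unique-++ˡ Tri (Rest-unique r)) (inj₁ λ u∈ → lies u∈ (view _))
          where
          lies : ∀ {u} → u ∈ Tri → View u → X u ≡ true
          lies u∈ (is-v refl) = contradiction (Tri⊆Y u∈) v∉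
          lies _ (left Xu _) = Xu
          lies u∈ (right _ X'u) = ⊥-elim (CutSide.perfect (proj₂ out) near' P' r' v∈' (λ p∈ q∈ Xp Xq → apart (inside p∈ Xp) (inside q∈ Xq)) (∈-++⁺ˡ (Tri⊆Y u∈)) X'u)
            where
            inside : ∀ {p} → p ∈ Y ++ v ∷ w ∷ [] → X' p ≡ true → p ∈ Y
            inside p∈ X'p = back p∈ (CutSide.X≢v (proj₂ out) near' X'p) (λ { refl → true≢false X'p (proj₂ (part-A⁻ (part _) Xw)) })
        side (right _ X'w) = distinct (Unique-++ˡ Tri (Rest-unique r)) (inj₂ λ u∈ → lies u∈ (view _))
          where
          lies : ∀ {u} → u ∈ Tri → View u → X' u ≡ true
          lies u∈ (is-v refl) = contradiction (Tri⊆Y u∈) v∉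
          lies _ (right _ Xu) = Xu
          lies u∈ (left Xu _) = ⊥-elim (CutSide.perfect (proj₁ out) near P r' v∈' (λ p∈ q∈ Xp Xq → apart (inside p∈ Xp) (inside q∈ Xq)) (∈-++⁺ˡ (Tri⊆Y u∈)) Xu)
            where
            inside : ∀ {p} → p ∈ Y ++ v ∷ w ∷ [] → X p ≡ true → p ∈ Y
            inside p∈ Xp = back p∈ (CutSide.X≢v (proj₁ out) near Xp) (λ { refl → true≢false Xp (proj₂ (part-B⁻ (part _) X'w)) })

      go : Dec (v ∈ Y) → ⊥
      go (yes v∈) = free v∈
      go (no v∉)  = used v∉ (pull r v v∉)

theorem1 : ∀ (n : ℕ) (G : Graph n) → IsSimple G → Connected G →
    ((ClawFree G × Equimatchable G) ⇔
    (Iso G (Cycle 4)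
    ⊎ (∃[ p ] (1 ≤ p × Iso G (Complete (2 * p))))
    ⊎ (OddNat n × IndepNumberAtMost G 2)
    ⊎ InG1 G
    ⊎ (InG21 G ⊎ InG22 G ⊎ InG23 G ⊎ Iso G (Cycle 7))
    ⊎ InG3 G))
theorem1 n G simple conn = mk⇔
  (λ (clawFree , eq) → Forward.classify G simple clawFree (Augment.deficiency≤1 G simple clawFree conn eq) conn)
  ([ C₄-case , [ (λ (_ , _ , iso) → complete-case iso)
  , [ (λ ((k , odd) , small) → small-independence (trans (cong evenᵇ odd) (cong not (evenᵇ-double k))) small)
  , [ G1 , [ [ G21 , [ G22 , [ G23 , C₇-case ]′ ]′ ]′ , G3 ]′ ]′ ]′ ]′ ]′)
  where
  open Backward G simple using (evenᵇ-double; small-independence; G22)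
  open SmallClasses G simple using (C₄-case; C₇-case; complete-case; G21)
  open LargeClasses G simple using (G1; G23; G3)
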